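{- \textsc{Symmetric Directed Multiway Vertex Cut} can be solved in time $2^{O(k^3)} n^{O(1)}$, where, for an input instance $(D,T,k)$, $k$ is the bound on the solution size and $n=|V(D)|$.
   Context: \textsc{Symmetric Directed Multiway Vertex Cut} is the following problem. Input: a digraph $D$, a set of terminals $T\subseteq V(D)$, and $k\in\mathbb{N}$. Output: find, if there exists one, a set $X\subseteq V(D)$ with $|X|\le k$ such that there is no pair of distinct terminals $t,t'\in T\setminus X$ that are strongly connected in $D-X$ (i.e. lie in the same strongly connected component of $D-X$); otherwise report that no such set exists. Terminals may belong to $X$. -}

module Defs where

open import Data.Bool using (Bool; true; false; if_then_else_)
open import Data.Fin using (Fin; toℕ)
open import Data.Fin.Subset using (Subset; _∈_; _∉_; _─_; ∣_∣)
open import Data.List using (List; []; _∷_; _++_; map; concatMap; tabulate; allFin)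
open import Data.Nat using (ℕ; zero; suc; _+_; _*_; _∸_; _^_; _≤_; _≡ᵇ_)
open import Data.Product using (∃; ∃-syntax; _×_; _,_)
open import Data.Sum using (_⊎_)
open import Data.Vec using (toList; lookup)
open import Relation.Binary.Core using (Rel)
open import Relation.Binary.Construct.Closure.ReflexiveTransitive using (Star)
open import Relation.Binary.PropositionalEquality using (_≡_; _≢_)
open import Relation.Nullary using (¬_)
open import Level using (0ℓ)

Digraph : ℕ → Set
Digraph n = Fin n → Fin n → Bool

-- The arcs of D − X.  The vertices of X are kept as isolated points, so
-- connectivity in D − X is meaningful only between vertices outside X.
ArcAvoiding : ∀ {n} → Digraph n → Subset n → Rel (Fin n) 0ℓ
ArcAvoiding D X u v = D u v ≡ true × u ∉ X × v ∉ X

StronglyConnectedAvoiding : ∀ {n} → Digraph n → Subset n → Rel (Fin n) 0ℓ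
StronglyConnectedAvoiding D X u v =
  Star (ArcAvoiding D X) u v × Star (ArcAvoiding D X) v u

record Instance : Set where
  field
    order     : ℕ
    digraph   : Digraph order
    terminals : Subset order
    budget    : ℕ

open Instance public

IsSolution : (I : Instance) → Subset (order I) → Set
IsSolution I X =
  ∣ X ∣ ≤ budget I ×
  (∀ t t′ → t ∈ terminals I ─ X → t′ ∈ terminals I ─ X → t ≢ t′ →
     ¬ StronglyConnectedAvoiding (digraph I) X t t′)

-- The model of computation is a structured random-access machine with unit
-- cost.  A program names finitely many registers; memory is reached only
-- through `load` and `store`.  Addition and truncated subtraction are the
-- only arithmetic: with unit-cost multiplication the model would no longer
-- be polynomially equivalent to Turing machines.

Register : Set
Register = ℕ

infixr 4 _⨾_
infix  5 _≔_ _≔const_ _≔_⊕_ _≔_⊖_ _≔load_ store_≔_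

data Program : Set where
  skip               : Program
  _≔const_           : Register → ℕ → Program
  _≔_                : Register → Register → Program
  _≔_⊕_ _≔_⊖_        : Register → Register → Register → Program
  _≔load_            : Register → Register → Program
  store_≔_           : Register → Register → Program
  _⨾_                : Program → Program → Program
  ifzero_then_else_  : Register → Program → Program → Program
  whilenonzero_run_  : Register → Program → Program

record State : Set where
  constructor ⟨_,_⟩
  field
    reg : ℕ → ℕ
    mem : ℕ → ℕ

open State public

_[_↦_] : (ℕ → ℕ) → ℕ → ℕ → (ℕ → ℕ)
(f [ x ↦ a ]) y = if x ≡ᵇ y then a else f y

infix 3 _,_⇓[_]_

-- p , s ⇓[ t ] s′ : started in s, the program p halts in s′ after exactly
-- t steps, each primitive instruction and each test of a register being
-- one step.
data _,_⇓[_]_ : Program → State → ℕ → State → Set where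

  ⇓skip  : ∀ {r m} → skip , ⟨ r , m ⟩ ⇓[ 1 ] ⟨ r , m ⟩

  ⇓const : ∀ {r m x a} →
           x ≔const a , ⟨ r , m ⟩ ⇓[ 1 ] ⟨ r [ x ↦ a ] , m ⟩

  ⇓copy  : ∀ {r m x y} →
           x ≔ y , ⟨ r , m ⟩ ⇓[ 1 ] ⟨ r [ x ↦ r y ] , m ⟩

  ⇓add   : ∀ {r m x y z} →
           x ≔ y ⊕ z , ⟨ r , m ⟩ ⇓[ 1 ] ⟨ r [ x ↦ r y + r z ] , m ⟩

  ⇓sub   : ∀ {r m x y z} →
           x ≔ y ⊖ z , ⟨ r , m ⟩ ⇓[ 1 ] ⟨ r [ x ↦ r y ∸ r z ] , m ⟩

  ⇓load  : ∀ {r m x y} →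
           x ≔load y , ⟨ r , m ⟩ ⇓[ 1 ] ⟨ r [ x ↦ m (r y) ] , m ⟩

  ⇓store : ∀ {r m x y} →
           store x ≔ y , ⟨ r , m ⟩ ⇓[ 1 ] ⟨ r , m [ r x ↦ r y ] ⟩

  ⇓seq   : ∀ {p q s s′ s″ t t′} →
           p , s ⇓[ t ] s′ → q , s′ ⇓[ t′ ] s″ →
           p ⨾ q , s ⇓[ t + t′ ] s″

  ⇓then  : ∀ {p q s s′ x t} → reg s x ≡ 0 → p , s ⇓[ t ] s′ →
           ifzero x then p else q , s ⇓[ suc t ] s′

  ⇓else  : ∀ {p q s s′ x t} → reg s x ≢ 0 → q , s ⇓[ t ] s′ →
           ifzero x then p else q , s ⇓[ suc t ] s′

  ⇓exit  : ∀ {p s x} → reg s x ≡ 0 →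
           whilenonzero x run p , s ⇓[ 1 ] s

  ⇓loop  : ∀ {p s s′ s″ x t t′} → reg s x ≢ 0 →
           p , s ⇓[ t ] s′ → whilenonzero x run p , s′ ⇓[ t′ ] s″ →
           whilenonzero x run p , s ⇓[ suc (t + t′) ] s″

bit : Bool → ℕ
bit false = 0
bit true  = 1

contents : List ℕ → (ℕ → ℕ)
contents []       _       = 0
contents (a ∷ as) zero    = a
contents (a ∷ as) (suc i) = contents as i

-- Registers 0 and 1 hold n and k.  Memory holds the characteristic vector
-- of T in cells 0 … n − 1, then the adjacency matrix of D row by row.
-- Everything else is 0.
input : Instance → State
input I = ⟨ contents (order I ∷ budget I ∷ [])
          , contents (map bit (toList (terminals I) ++ adjacency)) ⟩
  where
  adjacency : List Bool
  adjacency = concatMap (λ u → tabulate (digraph I u)) (allFin (order I))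

-- Register 0 tells whether a solution exists; if so, cells 0 … n − 1 of
-- memory hold the characteristic vector of one.
CorrectOutput : Instance → State → Set
CorrectOutput I s =
  (reg s 0 ≡ 1 ×
   ∃[ X ] IsSolution I X × (∀ v → mem s (toℕ v) ≡ bit (lookup X v)))
  ⊎
  (reg s 0 ≡ 0 × ¬ ∃ (IsSolution I))

SolvesWithin : Program → (Instance → ℕ) → Set
SolvesWithin p bound =
  ∀ I → ∃[ s ] ∃[ t ] (p , input I ⇓[ t ] s) × t ≤ bound I × CorrectOutput I s

infix 4 _∈O_

_∈O_ : (ℕ → ℕ) → (ℕ → ℕ) → Set
f ∈O g = ∃[ c ] ∃[ N ] (∀ x → N ≤ x → f x ≤ c * g x)

-- Iterative compression over the terminals: solutions W for the first i
-- terminals are improved, so a set W of k + 1 vertices meeting all bad closed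
-- walks is always at hand.  It is disposed of in rounds, each of which cuts the
-- sink strong component among those meeting W off from the rest of W.  The cut
-- is a furthest minimum cut found by augmenting paths, where a guided search
-- branches on whether the next vertex is deleted or added to the source side;
-- the branches are bits of an advice number.  Shadows are removed by guessing
-- sets of residues: since lcm(1, …, M) is exponentially large, some modulus
-- below a polynomial in k and log n separates a solution of k vertices from any
-- small set.  All digits of the advice together stay below
-- B = 2^(162 (k + 1)³) (n + 1)², because l^E ≤ E^E 2^l absorbs the powers of
-- log n, so all loops may run up to B.  The algorithm is written in a small
-- loop language over arrays, which is compiled to the machine.

module Submission where

open import Defs
open import Data.Bool using (Bool; T; _∧_; _∨_; false; if_then_else_; not; true)
open import Data.Empty using (⊥; ⊥-elim)
open import Data.Fin using (Fin; fromℕ<; toℕ) renaming (suc to fsuc; zero to fzero)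
open import Data.Fin.Properties using (toℕ-fromℕ<; toℕ-injective; toℕ<n)
open import Data.Fin.Subset using (Subset; _─_; ∣_∣) renaming (_∈_ to _∈ˢ_; _∉_ to _∉ˢ_)
open import Data.Fin.Subset.Properties using (p─q⊆p; x∈p∧x∉q⇒x∈p─q)
open import Data.List using (List; []; _++_; _∷_; allFin; concatMap; foldr; length; map; tabulate)
open import Data.List.Membership.Propositional using () renaming (_∈_ to _∈ᴸ_)
open import Data.List.Membership.Propositional.Properties using (∈-++⁺ʳ; ∈-++⁺ˡ; ∈-++⁻; ∈-map⁺; ∈-map⁻)
open import Data.List.Properties using (length-++; length-map; length-tabulate; map-++)
open import Data.List.Relation.Unary.Any using () renaming (here to hereᴸ; there to thereᴸ)
open import Data.Maybe using (Maybe; _>>=_; just; nothing)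
open import Data.Nat using (>-nonZero; >-nonZero⁻¹; NonZero; _%_; _*_; _+_; _/_; _<?_; _<_; _<ᵇ_; _^_; _∸_; _≟_; _≡ᵇ_; _≤?_; _≤_; suc; s≤s; s≤s⁻¹; zero; z≤n; ℕ; ∣_-_∣)
open import Data.Nat.DivMod using (m%n<n; m/n≤m; m≡m%n+[m/n]*n)
open import Data.Nat.Divisibility
open import Data.Nat.Induction using (<-wellFounded)
open import Data.Nat.Properties
open import Data.Nat.Solver using (module +-*-Solver)
open import Data.Product using (_,_; _×_; proj₁; proj₂; Σ; ∃; ∃-syntax)
open import Data.Sum using ([_,_]′; _⊎_; inj₁; inj₂)
open import Data.Unit using (tt; ⊤)
open import Data.Vec using (Vec; lookup; toList) renaming ([] to []ᵛ; _∷_ to _∷ᵛ_; here to hereᵛ; tabulate to tabulateᵛ; there to thereᵛ)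
open import Data.Vec.Properties using ([]=⇒lookup; length-toList; lookup⇒[]=; lookup∘tabulate)
open import Function using (_∘_; case_of_; id)
open import Induction.WellFounded using (Acc; acc)
open import Relation.Binary.Construct.Closure.ReflexiveTransitive using (Star; _◅_; ε)
open import Relation.Binary.PropositionalEquality using (_≡_; _≢_; cong; cong₂; module ≡-Reasoning; refl; subst; subst₂; sym; trans)
open import Relation.Nullary using (Dec; contradiction; does; no; yes; ¬_)
open import Relation.Nullary.Decidable using (_×-dec_; _⊎-dec_; map′; toSum; ¬?)
open import Relation.Unary using (Decidable)
open +-*-Solver using (_:*_; _:+_; _:=_; con; solve)

sum : ℕ → (ℕ → ℕ) → ℕ
sum zero f = 0
sum (suc b) f = sum b f + f b

iter : {A : Set} → ℕ → (ℕ → A → A) → A → A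
iter zero f s = s
iter (suc b) f s = f b (iter b f s)

sum-cong : ∀ b {f g : ℕ → ℕ} → (∀ i → i < b → f i ≡ g i) → sum b f ≡ sum b g
sum-cong zero h = refl
sum-cong (suc b) h = cong₂ _+_ (sum-cong b (λ i i<b → h i (m<n⇒m<1+n i<b))) (h b ≤-refl)

sum-≤ : ∀ b {f g : ℕ → ℕ} → (∀ i → i < b → f i ≤ g i) → sum b f ≤ sum b g
sum-≤ zero h = z≤n
sum-≤ (suc b) h = +-mono-≤ (sum-≤ b (λ i i<b → h i (m<n⇒m<1+n i<b))) (h b ≤-refl)

sum-const : ∀ b c → sum b (λ _ → c) ≡ b * c
sum-const zero c = refl
sum-const (suc b) c = trans (cong (_+ c) (sum-const b c)) (+-comm (b * c) c)

term≤sum : ∀ b (f : ℕ → ℕ) i → i < b → f i ≤ sum b f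
term≤sum (suc b) f i i<1+b with m<1+n⇒m<n∨m≡n i<1+b
... | inj₁ i<b = ≤-trans (term≤sum b f i i<b) (m≤m+n _ _)
... | inj₂ refl = m≤n+m _ _

sum≢0 : ∀ b (f : ℕ → ℕ) → sum b f ≢ 0 → ∃[ i ] i < b × f i ≢ 0
sum≢0 zero f ≢0 = contradiction refl ≢0
sum≢0 (suc b) f ≢0 with f b ≟ 0
... | no fb≢0 = b , ≤-refl , fb≢0
... | yes fb≡0 with sum≢0 b f (λ e → ≢0 (cong₂ _+_ e fb≡0))
... | i , i<b , fi≢0 = i , m<n⇒m<1+n i<b , fi≢0

ind : {P : Set} → Dec P → ℕ
ind (yes _) = 1
ind (no _) = 0

# : ℕ → {P : ℕ → Set} → Decidable P → ℕ
# b P? = sum b (λ i → ind (P? i))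

ind-≤ : {P Q : Set} (p : Dec P) (q : Dec Q) → (P → Q) → ind p ≤ ind q
ind-≤ (yes p) (yes q) f = ≤-refl
ind-≤ (yes p) (no ¬q) f = contradiction (f p) ¬q
ind-≤ (no _) q f = z≤n

#-mono : ∀ b {P Q : ℕ → Set} (P? : Decidable P) (Q? : Decidable Q) →
  (∀ i → i < b → P i → Q i) → # b P? ≤ # b Q?
#-mono b P? Q? h = sum-≤ b (λ i i<b → ind-≤ (P? i) (Q? i) (h i i<b))

#-≤ : ∀ b {P : ℕ → Set} (P? : Decidable P) → # b P? ≤ b
#-≤ zero P? = z≤n
#-≤ (suc b) P? = ≤-trans (+-mono-≤ (#-≤ b P?) (ind≤1 (P? b))) (≤-reflexive (+-comm b 1))
  where
  ind≤1 : {P : Set} (p : Dec P) → ind p ≤ 1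
  ind≤1 (yes _) = ≤-refl
  ind≤1 (no _) = z≤n

+-swap : ∀ w x y z → (w + x) + (y + z) ≡ (w + y) + (x + z)
+-swap = solve 4 (λ w x y z → (w :+ x) :+ (y :+ z) := (w :+ y) :+ (x :+ z)) refl

#-∪ : ∀ b {P Q R : ℕ → Set} (P? : Decidable P) (Q? : Decidable Q) (R? : Decidable R) →
  (∀ i → i < b → R i → P i ⊎ Q i) → # b R? ≤ # b P? + # b Q?
#-∪ zero P? Q? R? h = z≤n
#-∪ (suc b) P? Q? R? h = begin
  # b R? + ind (R? b) ≤⟨ +-mono-≤ (#-∪ b P? Q? R? (λ i i<b → h i (m<n⇒m<1+n i<b))) (last (R? b) (P? b) (Q? b) (h b ≤-refl)) ⟩
  (# b P? + # b Q?) + (ind (P? b) + ind (Q? b)) ≡⟨ +-swap (# b P?) (# b Q?) _ _ ⟩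
  (# b P? + ind (P? b)) + (# b Q? + ind (Q? b)) ∎
  where
  open ≤-Reasoning
  last : {P Q R : Set} (r : Dec R) (p : Dec P) (q : Dec Q) → (R → P ⊎ Q) → ind r ≤ ind p + ind q
  last (no _) p q f = z≤n
  last (yes r) (yes p) q f = s≤s z≤n
  last (yes r) (no ¬p) (yes q) f = s≤s z≤n
  last (yes r) (no ¬p) (no ¬q) f = ⊥-elim ([ ¬p , ¬q ]′ (f r))

#-⊎ : ∀ b {P Q R : ℕ → Set} (P? : Decidable P) (Q? : Decidable Q) (R? : Decidable R) →
  (∀ i → i < b → P i → R i) → (∀ i → i < b → Q i → R i) →
  (∀ i → i < b → P i → Q i → ⊥) → # b P? + # b Q? ≤ # b R?
#-⊎ zero P? Q? R? f g d = z≤n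
#-⊎ (suc b) P? Q? R? f g d = begin
  (# b P? + ind (P? b)) + (# b Q? + ind (Q? b)) ≡⟨ +-swap (# b P?) (ind (P? b)) _ _ ⟩
  (# b P? + # b Q?) + (ind (P? b) + ind (Q? b)) ≤⟨ +-mono-≤ (#-⊎ b P? Q? R? (λ i l → f i (m<n⇒m<1+n l)) (λ i l → g i (m<n⇒m<1+n l)) (λ i l → d i (m<n⇒m<1+n l))) (last (R? b) (P? b) (Q? b) (f b ≤-refl) (g b ≤-refl) (d b ≤-refl)) ⟩
  # b R? + ind (R? b) ∎
  where
  open ≤-Reasoning
  last : {P Q R : Set} (r : Dec R) (p : Dec P) (q : Dec Q) → (P → R) → (Q → R) → (P → Q → ⊥) → ind p + ind q ≤ ind r
  last r (yes p) (yes q) f g d = ⊥-elim (d p q)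
  last r (yes p) (no ¬q) f g d = ≤-trans (≤-reflexive (+-identityʳ 1)) (ind-≤ (yes p) r f)
  last r (no ¬p) q f g d = ind-≤ q r g

#-0 : ∀ b {P : ℕ → Set} (P? : Decidable P) → (∀ i → i < b → ¬ P i) → # b P? ≡ 0
#-0 zero P? h = refl
#-0 (suc b) P? h with P? b
... | yes p = contradiction p (h b ≤-refl)
... | no _ = trans (+-identityʳ _) (#-0 b P? (λ i l → h i (m<n⇒m<1+n l)))

#-pos : ∀ b {P : ℕ → Set} (P? : Decidable P) i → i < b → P i → 1 ≤ # b P?
#-pos b P? i i<b p = ≤-trans (ind-≤ (yes p) (P? i) id) (term≤sum b _ i i<b)

0-# : ∀ b {P : ℕ → Set} (P? : Decidable P) → # b P? ≡ 0 → ∀ i → i < b → ¬ P i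
0-# b P? e i i<b p = contradiction (≤-trans (#-pos b P? i i<b p) (≤-reflexive e)) λ ()

#-one : ∀ b a → # b (λ i → i ≟ a) ≤ 1
#-one zero a = z≤n
#-one (suc b) a with b ≟ a
... | no _ = ≤-trans (≤-reflexive (+-identityʳ _)) (#-one b a)
... | yes refl = ≤-reflexive (cong (_+ 1) (#-0 b (λ i → i ≟ b) (λ i i<b e → <⇒≢ i<b e)))

#-< : ∀ b {P Q : ℕ → Set} (P? : Decidable P) (Q? : Decidable Q) →
  (∀ i → i < b → P i → Q i) → ∀ a → a < b → Q a → ¬ P a → # b P? < # b Q?
#-< b P? Q? h a a<b qa ¬pa = begin
  suc (# b P?) ≡⟨ +-comm 1 _ ⟩
  # b P? + 1 ≤⟨ +-monoʳ-≤ _ (#-pos b (λ i → i ≟ a) a a<b refl) ⟩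
  # b P? + # b (λ i → i ≟ a) ≤⟨ #-⊎ b P? (λ i → i ≟ a) Q? h (λ { i l refl → qa }) (λ { i l p refl → ¬pa p }) ⟩
  # b Q? ∎
  where open ≤-Reasoning

#-inj : ∀ b c {P Q : ℕ → Set} (P? : Decidable P) (Q? : Decidable Q) (f : ℕ → ℕ) →
  (∀ i → i < b → P i → f i < c × Q (f i)) →
  (∀ i j → i < b → j < b → P i → P j → f i ≡ f j → i ≡ j) → # b P? ≤ # c Q?
#-inj zero c P? Q? f h inj = z≤n
#-inj (suc b) c {P} {Q} P? Q? f h inj with P? b
... | no ¬p = ≤-trans (≤-reflexive (+-identityʳ _))
  (#-inj b c P? Q? f (λ i l → h i (m<n⇒m<1+n l)) (λ i j l l′ → inj i j (m<n⇒m<1+n l) (m<n⇒m<1+n l′)))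
... | yes p = begin
  # b P? + 1 ≤⟨ +-mono-≤ (#-inj b c {Q = λ i → Q i × i ≢ f b} P? (λ i → Q? i ×-dec ¬? (i ≟ f b)) f
    (λ i l pi → proj₁ (h i (m<n⇒m<1+n l) pi) , proj₂ (h i (m<n⇒m<1+n l) pi) ,
      λ e → <⇒≢ l (inj i b (m<n⇒m<1+n l) ≤-refl pi p e))
    (λ i j l l′ → inj i j (m<n⇒m<1+n l) (m<n⇒m<1+n l′)))
      (#-pos c (λ i → i ≟ f b) (f b) (proj₁ (h b ≤-refl p)) refl) ⟩
  # c (λ i → Q? i ×-dec ¬? (i ≟ f b)) + # c (λ i → i ≟ f b)
    ≤⟨ #-⊎ c (λ i → Q? i ×-dec ¬? (i ≟ f b)) (λ i → i ≟ f b) Q? (λ _ _ → proj₁)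
      (λ { i l refl → proj₂ (h b ≤-refl p) }) (λ i l q e → proj₂ q e) ⟩
  # c Q? ∎
  where open ≤-Reasoning

abstract

  any<? : ∀ b {P : ℕ → Set} → Decidable P → Dec (∃[ i ] i < b × P i)
  any<? b P? with # b P? ≟ 0
  ... | yes e = no λ (i , l , p) → 0-# b P? e i l p
  ... | no ≢0 with sum≢0 b _ ≢0
  ... | i , l , q with P? i
  ... | yes p = yes (i , l , p)
  ... | no _ = contradiction refl q

  all<? : ∀ b {P : ℕ → Set} → Decidable P → Dec (∀ i → i < b → P i)
  all<? b P? with any<? b (λ i → ¬? (P? i))
  ... | yes (i , l , ¬p) = no λ h → ¬p (h i l)
  ... | no none = yes λ i l → case P? i of λ { (yes p) → p ; (no ¬p) → contradiction (i , l , ¬p) none }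

#-unique : ∀ b {P : ℕ → Set} (P? : Decidable P) → (∀ {i j} → P i → P j → i ≡ j) → # b P? ≤ 1
#-unique b P? h with any<? b P?
... | yes (i , _ , p) = ≤-trans (#-mono b P? (λ j → j ≟ i) (λ j _ q → h q p)) (#-one b i)
... | no none = ≤-trans (≤-reflexive (#-0 b P? (λ i l p → none (i , l , p)))) z≤n

upd : {A : Set} → (ℕ → A) → ℕ → A → (ℕ → A)
upd f x a y = if x ≡ᵇ y then a else f y

upd-≡ : {A : Set} (f : ℕ → A) (x : ℕ) (a : A) → upd f x a x ≡ a
upd-≡ f x a with x ≡ᵇ x | ≡⇒≡ᵇ x x refl
... | true | _ = refl

upd-≢ : {A : Set} (f : ℕ → A) {x y : ℕ} (a : A) → x ≢ y → upd f x a y ≡ f y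
upd-≢ f {x} {y} a x≢y with x ≡ᵇ y | ≡ᵇ⇒≡ x y
... | true | h = contradiction (h tt) x≢y
... | false | _ = refl

infixl 6 _⊞_ _⊟_
infix 7 _!_

-- `var` refers to registers that are read-only for the term, `a ! t` reads
-- array a (as 0 beyond the bound B), and Σ[ x ] t sums over x < B.
data Tm : Set where
  var : ℕ → Tm
  lit : ℕ → Tm
  _⊞_ _⊟_ : Tm → Tm → Tm
  ifz : Tm → Tm → Tm → Tm
  _!_ : ℕ → Tm → Tm
  Σ[_]_ : ℕ → Tm → Tm

infixr 1 _﹔_
infix 4 _[_]:=_

data Cm : Set where
  _[_]:=_ : ℕ → ℕ → Tm → Cm
  _﹔_ : Cm → Cm → Cm
  for : ℕ → Cm → Cm

Env : Set
Env = ℕ → ℕ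

Mem : Set
Mem = ℕ → ℕ → ℕ

cond : {A : Set} → ℕ → A → A → A
cond zero a b = a
cond (suc _) a b = b

at : ℕ → (ℕ → ℕ) → ℕ → ℕ
at B f i = cond (B ∸ i) 0 (f i)

eval : ℕ → Env → Mem → Tm → ℕ
eval B ρ σ (var x) = ρ x
eval B ρ σ (lit c) = c
eval B ρ σ (s ⊞ t) = eval B ρ σ s + eval B ρ σ t
eval B ρ σ (s ⊟ t) = eval B ρ σ s ∸ eval B ρ σ t
eval B ρ σ (ifz c s t) = cond (eval B ρ σ c) (eval B ρ σ s) (eval B ρ σ t)
eval B ρ σ (a ! t) = at B (σ a) (eval B ρ σ t)
eval B ρ σ (Σ[ x ] t) = sum B (λ i → eval B (upd ρ x i) σ t)

exec : ℕ → Env → Cm → Mem → Mem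
exec B ρ (a [ x ]:= t) σ = upd σ a (λ i → eval B (upd ρ x i) σ t)
exec B ρ (c ﹔ d) σ = exec B ρ d (exec B ρ c σ)
exec B ρ (for x c) σ = iter B (λ i → exec B (upd ρ x i) c) σ

-- Compilation: name x lives in register 2x, the scratch registers are odd,
-- and register 4 (name 2) holds the bound of all loops.  Array a < 32 has
-- its cell i at address 32 i + a; array 0 buffers the parallel assignments.

ν τ : ℕ → ℕ
ν x = x + x
τ j = suc (j + j)

dbl : ℕ → ℕ
dbl i = i + i

addr : ℕ → ℕ → ℕ
addr a i = dbl (dbl (dbl (dbl (dbl i)))) + a

shiftP : ℕ → ℕ → Program
shiftP j a = τ j ≔ τ j ⊕ τ j ⨾ τ j ≔ τ j ⊕ τ j ⨾ τ j ≔ τ j ⊕ τ j ⨾ τ j ≔ τ j ⊕ τ j ⨾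
  τ j ≔ τ j ⊕ τ j ⨾ τ (suc j) ≔const a ⨾ τ j ≔ τ j ⊕ τ (suc j)

forP : ℕ → ℕ → Program → Program
forP x j p = ν x ≔const 0 ⨾ τ j ≔ ν 2 ⊖ ν x ⨾
  whilenonzero τ j run (p ⨾ τ j ≔const 1 ⨾ ν x ≔ ν x ⊕ τ j ⨾ τ j ≔ ν 2 ⊖ ν x)

comp : Tm → ℕ → Program
comp (var x) j = τ j ≔ ν x
comp (lit c) j = τ j ≔const c
comp (s ⊞ t) j = comp s j ⨾ comp t (suc j) ⨾ τ j ≔ τ j ⊕ τ (suc j)
comp (s ⊟ t) j = comp s j ⨾ comp t (suc j) ⨾ τ j ≔ τ j ⊖ τ (suc j)
comp (ifz c s t) j = comp c j ⨾ ifzero τ j then comp s j else comp t j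
comp (a ! t) j = comp t j ⨾ τ (suc j) ≔ ν 2 ⊖ τ j ⨾
  ifzero τ (suc j) then τ j ≔const 0 else (shiftP j a ⨾ τ j ≔load τ j)
comp (Σ[ x ] t) j = τ j ≔const 0 ⨾ forP x (suc j) (comp t (suc j) ⨾ τ j ≔ τ j ⊕ τ (suc j))

compC : Cm → Program
compC (a [ x ]:= t) =
  forP x 0 (comp t 1 ⨾ τ 2 ≔ ν x ⨾ shiftP 2 0 ⨾ store τ 2 ≔ τ 1) ⨾
  forP x 0 (τ 1 ≔ ν x ⨾ shiftP 1 0 ⨾ τ 1 ≔load τ 1 ⨾ τ 2 ≔ ν x ⨾ shiftP 2 a ⨾ store τ 2 ≔ τ 1)
compC (c ﹔ d) = compC c ⨾ compC d
compC (for x c) = forP x 0 (compC c)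

-- The static condition for compilation: only live names are read, a binder
-- never shadows a live name, and arrays are numbered 1 … 31.

okTm : (ℕ → Bool) → Tm → Bool
okTm Γ (var x) = Γ x
okTm Γ (lit c) = true
okTm Γ (s ⊞ t) = okTm Γ s ∧ okTm Γ t
okTm Γ (s ⊟ t) = okTm Γ s ∧ okTm Γ t
okTm Γ (ifz c s t) = okTm Γ c ∧ okTm Γ s ∧ okTm Γ t
okTm Γ (a ! t) = ((0 <ᵇ a) ∧ (a <ᵇ 32)) ∧ okTm Γ t
okTm Γ (Σ[ x ] t) = not (Γ x) ∧ okTm (upd Γ x true) t

okCm : (ℕ → Bool) → Cm → Bool
okCm Γ (a [ x ]:= t) = ((0 <ᵇ a) ∧ (a <ᵇ 32)) ∧ not (Γ x) ∧ okTm (upd Γ x true) t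
okCm Γ (c ﹔ d) = okCm Γ c ∧ okCm Γ d
okCm Γ (for x c) = not (Γ x) ∧ okCm (upd Γ x true) c

forT : ℕ → ℕ → ℕ
forT B c = 3 + B * (c + 4)

timeTm : ℕ → Tm → ℕ
timeTm B (var x) = 1
timeTm B (lit c) = 1
timeTm B (s ⊞ t) = timeTm B s + (timeTm B t + 1)
timeTm B (s ⊟ t) = timeTm B s + (timeTm B t + 1)
timeTm B (ifz c s t) = timeTm B c + suc (timeTm B s + timeTm B t)
timeTm B (a ! t) = timeTm B t + 10
timeTm B (Σ[ x ] t) = 1 + forT B (timeTm B t + 1)

timeCm : ℕ → Cm → ℕ
timeCm B (a [ x ]:= t) = forT B (timeTm B t + 9) + forT B 18
timeCm B (c ﹔ d) = timeCm B c + timeCm B d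
timeCm B (for x c) = forT B (timeCm B c)

-- Correctness of the compilation

Within : Program → State → State → ℕ → Set
Within p s s′ b = ∃[ t ] (p , s ⇓[ t ] s′) × t ≤ b

seqW : ∀ {p q s s′ s″ b c} → Within p s s′ b → Within q s′ s″ c → Within (p ⨾ q) s s″ (b + c)
seqW (t , e , l) (t′ , e′ , l′) = t + t′ , ⇓seq e e′ , +-mono-≤ l l′

oneW : ∀ {p s s′} → p , s ⇓[ 1 ] s′ → Within p s s′ 1
oneW e = 1 , e , ≤-refl

weakenW : ∀ {p s s′ b c} → b ≤ c → Within p s s′ b → Within p s s′ c
weakenW b≤c (t , e , l) = t , e , ≤-trans l b≤c

ν≢τ : ∀ x j → ν x ≢ τ j
ν≢τ x j e = even≢odd x j (trans (cong (x +_) (+-identityʳ x)) (trans e (cong (λ y → suc (j + y)) (sym (+-identityʳ j)))))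

dbl-inj : ∀ {x y} → x + x ≡ y + y → x ≡ y
dbl-inj {zero} {zero} e = refl
dbl-inj {suc x} {suc y} e = cong suc (dbl-inj (suc-injective (trans (sym (+-suc x x)) (trans (suc-injective e) (+-suc y y)))))

pair-inj : ∀ n {u u′ v v′} → v < n → v′ < n → u * n + v ≡ u′ * n + v′ → u ≡ u′ × v ≡ v′
pair-inj n {zero} {zero} l l′ e = refl , e
pair-inj n {zero} {suc u′} {v′ = v′} l l′ e =
  contradiction (≤-<-trans (≤-trans (m≤m+n n (u′ * n + v′)) (≤-reflexive (trans (sym (+-assoc n (u′ * n) v′)) (sym e)))) l) (<-irrefl refl)
pair-inj n {suc u} {zero} {v = v} l l′ e =
  contradiction (≤-<-trans (≤-trans (m≤m+n n (u * n + v)) (≤-reflexive (trans (sym (+-assoc n (u * n) v)) e))) l′) (<-irrefl refl)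
pair-inj n {suc u} {suc u′} {v} {v′} l l′ e
  with pair-inj n {u} {u′} l l′ (+-cancelˡ-≡ n _ _ (trans (sym (+-assoc n (u * n) v)) (trans e (+-assoc n (u′ * n) v′))))
... | refl , refl = refl , refl

addr-inj : ∀ {a b i j} → a < 32 → b < 32 → addr a i ≡ addr b j → a ≡ b × i ≡ j
addr-inj {a} {b} {i} {j} a< b< e with pair-inj 32 {i} {j} a< b< (trans (sym (eq i a)) (trans e (eq j b)))
  where
  dbl≡ : ∀ i c → dbl i * c ≡ i * (2 * c)
  dbl≡ i c = trans (*-distribʳ-+ c i i) (trans (cong (i * c +_) (sym (+-identityʳ _))) (trans (*-comm 2 (i * c)) (trans (*-assoc i c 2) (cong (i *_) (*-comm c 2)))))
  eq : ∀ i a → addr a i ≡ i * 32 + a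
  eq i a = cong (_+ a) (trans (sym (*-identityʳ _)) (trans (dbl≡ (dbl (dbl (dbl (dbl i)))) 1)
    (trans (dbl≡ (dbl (dbl (dbl i))) 2) (trans (dbl≡ (dbl (dbl i)) 4) (trans (dbl≡ (dbl i) 8) (dbl≡ i 16))))))
... | refl , refl = refl , refl

Agrees : (ℕ → Bool) → Env → (ℕ → ℕ) → Set
Agrees Γ ρ r = ∀ x → Γ x ≡ true → r (ν x) ≡ ρ x

Holds : ℕ → Mem → (ℕ → ℕ) → Set
Holds B σ m = ∀ a → 0 < a → a < 32 → ∀ i → i < B → m (addr a i) ≡ σ a i

∧-trueˡ : ∀ {a b} → a ∧ b ≡ true → a ≡ true
∧-trueˡ {true} e = refl

∧-trueʳ : ∀ {a b} → a ∧ b ≡ true → b ≡ true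
∧-trueʳ {true} e = e

not-true : ∀ {a} → not a ≡ true → a ≡ true → ⊥
not-true {false} e ()

<ᵇ-true : ∀ {m n} → (m <ᵇ n) ≡ true → m < n
<ᵇ-true {m} {n} e = <ᵇ⇒< m n (subst T (sym e) tt)

upd-name : ∀ (r : ℕ → ℕ) j a y → upd r (τ j) a (ν y) ≡ r (ν y)
upd-name r j a y = upd-≢ r a (λ e → ν≢τ y j (sym e))

upd-τ : ∀ (r : ℕ → ℕ) {i j} a → i < j → upd r (τ j) a (τ i) ≡ r (τ i)
upd-τ r a i<j = upd-≢ r a (λ e → <⇒≢ i<j (sym (dbl-inj (suc-injective e))))

upd-νν : ∀ (r : ℕ → ℕ) {x y} a → x ≢ y → upd r (ν x) a (ν y) ≡ r (ν y)
upd-νν r a x≢y = upd-≢ r a (λ e → x≢y (dbl-inj e))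

upd-ντ : ∀ (r : ℕ → ℕ) x j a → upd r (ν x) a (τ j) ≡ r (τ j)
upd-ντ r x j a = upd-≢ r a (ν≢τ x j)

record Keeps (Γ : ℕ → Bool) (j : ℕ) (r r′ : ℕ → ℕ) : Set where
  constructor keeps
  field
    names : ∀ x → Γ x ≡ true → r′ (ν x) ≡ r (ν x)
    temps : ∀ i → i < j → r′ (τ i) ≡ r (τ i)
open Keeps

keeps-refl : ∀ {Γ j r} → Keeps Γ j r r
keeps-refl = keeps (λ _ _ → refl) (λ _ _ → refl)

keeps-trans : ∀ {Γ j r r′ r″} → Keeps Γ j r r′ → Keeps Γ j r′ r″ → Keeps Γ j r r″
keeps-trans k l = keeps (λ x g → trans (names l x g) (names k x g)) (λ i h → trans (temps l i h) (temps k i h))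

keeps-τ : ∀ {Γ j} r {i} a → j ≤ i → Keeps Γ j r (upd r (τ i) a)
keeps-τ r {i} a j≤i = keeps (λ x _ → upd-name r i a x) (λ h h<j → upd-τ r a (<-≤-trans h<j j≤i))

keeps-ν : ∀ {Γ j} r {x} a → Γ x ≡ false → Keeps Γ j r (upd r (ν x) a)
keeps-ν {Γ} r {x} a fx = keeps
  (λ y gy → upd-νν r a (λ e → case trans (sym gy) (trans (cong Γ (sym e)) fx) of λ ()))
  (λ h _ → upd-ντ r x h a)

keeps-weaken : ∀ {Γ i j r r′} → j ≤ i → Keeps Γ i r r′ → Keeps Γ j r r′
keeps-weaken j≤i k = keeps (names k) (λ h l → temps k h (<-≤-trans l j≤i))

keeps-⊆ : ∀ {Γ x j r r′} → Keeps (upd Γ x true) j r r′ → Keeps Γ j r r′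
keeps-⊆ {Γ} {x} k = keeps (λ y gy → names k y (lem y gy)) (temps k)
  where
  lem : ∀ y → Γ y ≡ true → upd Γ x true y ≡ true
  lem y gy with x ≡ᵇ y
  ... | true = refl
  ... | false = gy

agrees-keeps : ∀ {Γ ρ j r r′} → Agrees Γ ρ r → Keeps Γ j r r′ → Agrees Γ ρ r′
agrees-keeps A k x g = trans (names k x g) (A x g)

not-false : ∀ {a} → not a ≡ true → a ≡ false
not-false {false} e = refl

module _ (B : ℕ) where

  shift-ok₀ : ∀ {Γ j₀} r m j a → j₀ ≤ j →
    ∃[ r′ ] Within (shiftP j a) ⟨ r , m ⟩ ⟨ r′ , m ⟩ 7 × r′ (τ j) ≡ addr a (r (τ j)) ×
      Keeps Γ j₀ r r′ × (∀ i → i < j → r′ (τ i) ≡ r (τ i))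
  shift-ok₀ {Γ} {j₀} r m j a j₀≤j = _ , (7 , ⇓seq ⇓add (⇓seq ⇓add (⇓seq ⇓add (⇓seq ⇓add (⇓seq ⇓add (⇓seq ⇓const ⇓add))))) , ≤-refl) ,
    trans (upd-≡ r₆ (τ j) _) (cong₂ _+_ (trans (upd-τ r₅ {j} {suc j} a ≤-refl) val) (upd-≡ r₅ (τ (suc j)) a)) , K , λ i i<j → temps K′ i i<j
    where
    D : (ℕ → ℕ) → (ℕ → ℕ)
    D r = upd r (τ j) (r (τ j) + r (τ j))
    dv : ∀ r → D r (τ j) ≡ dbl (r (τ j))
    dv r = upd-≡ r (τ j) _
    r₅ = D (D (D (D (D r))))
    r₆ = upd r₅ (τ (suc j)) a
    val : r₅ (τ j) ≡ dbl (dbl (dbl (dbl (dbl (r (τ j))))))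
    val = trans (dv (D (D (D (D r))))) (cong dbl (trans (dv (D (D (D r)))) (cong dbl (trans (dv (D (D r))) (cong dbl (trans (dv (D r)) (cong dbl (dv r))))))))
    kD : ∀ r → Keeps Γ j r (D r)
    kD r = keeps-τ r _ ≤-refl
    K′ : Keeps Γ j r _
    K′ = keeps-trans (kD r) (keeps-trans (kD (D r)) (keeps-trans (kD (D (D r))) (keeps-trans (kD (D (D (D r)))) (keeps-trans (kD (D (D (D (D r))))) (keeps-trans (keeps-τ r₅ a (n≤1+n j)) (keeps-τ r₆ _ ≤-refl))))))
    K : Keeps Γ j₀ r _
    K = keeps-weaken j₀≤j K′

  abstract
    shift-ok : ∀ {Γ j₀} r m j a → j₀ ≤ j →
      ∃[ r′ ] Within (shiftP j a) ⟨ r , m ⟩ ⟨ r′ , m ⟩ 7 × r′ (τ j) ≡ addr a (r (τ j)) ×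
        Keeps Γ j₀ r r′ × (∀ i → i < j → r′ (τ i) ≡ r (τ i))
    shift-ok = shift-ok₀

  for-ok : ∀ {Γ j₀ j} x p c → j₀ ≤ j → (Inv : ℕ → State → Set) → Γ 2 ≡ true → Γ x ≡ false →
    (∀ i s → i < B → reg s (ν 2) ≡ B → reg s (ν x) ≡ i → Inv i s →
      ∃[ s′ ] Within p s s′ c × Keeps (upd Γ x true) j₀ (reg s) (reg s′) × Inv (suc i) s′) →
    (∀ i r r′ m → Keeps Γ j r r′ → Inv i ⟨ r , m ⟩ → Inv i ⟨ r′ , m ⟩) →
    ∀ s → reg s (ν 2) ≡ B → Inv 0 s →
    ∃[ s′ ] Within (forP x j p) s s′ (forT B c) × Keeps Γ j₀ (reg s) (reg s′) × Inv B s′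
  for-ok {Γ} {j₀} {j} x p c j₀≤j Inv Γ2 Γx body stable s@(⟨ r , m ⟩) rB inv₀ =
    let (s′ , (t , e , l) , k , inv) = loop B s₁ 0 (+-identityʳ B) r₁x r₁B r₁j (stable 0 r (reg s₁) m k₁ inv₀)
    in s′ , (_ , ⇓seq ⇓const (⇓seq ⇓sub e) , s≤s (s≤s (≤-trans l (≤-reflexive (+-comm _ 1))))) , keeps-trans (keeps-weaken j₀≤j k₁) k , inv
    where
    x≢2 : x ≢ 2
    x≢2 refl = case trans (sym Γ2) Γx of λ ()
    ra = upd r (ν x) 0
    s₁ = ⟨ upd ra (τ j) (ra (ν 2) ∸ ra (ν x)) , m ⟩
    k₁ : Keeps Γ j r (reg s₁)
    k₁ = keeps-trans (keeps-ν r 0 Γx) (keeps-τ ra _ ≤-refl)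
    raB : ra (ν 2) ≡ B
    raB = trans (upd-νν r 0 x≢2) rB
    r₁x : reg s₁ (ν x) ≡ 0
    r₁x = trans (upd-name ra j _ x) (upd-≡ r (ν x) 0)
    r₁B : reg s₁ (ν 2) ≡ B
    r₁B = trans (upd-name ra j _ 2) raB
    r₁j : reg s₁ (τ j) ≡ B ∸ 0
    r₁j = trans (upd-≡ ra (τ j) _) (cong₂ _∸_ raB (upd-≡ r (ν x) 0))
    P = p ⨾ τ j ≔const 1 ⨾ ν x ≔ ν x ⊕ τ j ⨾ τ j ≔ ν 2 ⊖ ν x
    loop : ∀ g s i → g + i ≡ B → reg s (ν x) ≡ i → reg s (ν 2) ≡ B → reg s (τ j) ≡ B ∸ i → Inv i s →
      ∃[ s′ ] Within (whilenonzero τ j run P) s s′ (g * (c + 4) + 1) × Keeps Γ j₀ (reg s) (reg s′) × Inv B s′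
    loop zero s i refl rx rB rj inv =
      s , oneW (⇓exit (trans rj (n∸n≡0 i))) , keeps-refl , inv
    loop (suc g) s i refl rx rB rj inv
      with body i s (s≤s (m≤n+m i g)) rB rx inv
    ... | s₂@(⟨ r₂ , m₂ ⟩) , (t₂ , e₂ , l₂) , k₂ , inv₂ =
      let (s′ , (t , e , l) , k , inv′) = loop g s₅ (suc i) (+-suc g i) r₅x r₅B r₅j (stable (suc i) r₂ (reg s₅) m₂ k₅ inv₂)
      in s′ , (_ , ⇓loop (λ z → case trans (sym z) (trans rj (m+n∸n≡m (suc g) i)) of λ ()) (⇓seq e₂ (⇓seq ⇓const (⇓seq ⇓add ⇓sub))) e , arith l₂ l) ,
         keeps-trans (keeps-⊆ {Γ} {x} k₂) (keeps-trans (keeps-weaken j₀≤j k₅) k) , inv′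
      where
      r₃ = upd r₂ (τ j) 1
      r₄ = upd r₃ (ν x) (r₃ (ν x) + r₃ (τ j))
      s₅ = ⟨ upd r₄ (τ j) (r₄ (ν 2) ∸ r₄ (ν x)) , m₂ ⟩
      k₅ : Keeps Γ j r₂ (reg s₅)
      k₅ = keeps-trans (keeps-τ r₂ 1 ≤-refl) (keeps-trans (keeps-ν r₃ _ Γx) (keeps-τ r₄ _ ≤-refl))
      r₄x : r₄ (ν x) ≡ suc i
      r₄x = trans (upd-≡ r₃ (ν x) _) (trans (cong₂ _+_ (trans (upd-name r₂ j 1 x) (trans (names k₂ x (upd-≡ Γ x true)) rx)) (upd-≡ r₂ (τ j) 1)) (+-comm i 1))
      r₄B : r₄ (ν 2) ≡ suc g + i
      r₄B = trans (upd-νν r₃ _ x≢2) (trans (upd-name r₂ j 1 2) (trans (names k₂ 2 (trans (upd-≢ Γ true x≢2) Γ2)) rB))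
      r₅x : reg s₅ (ν x) ≡ suc i
      r₅x = trans (upd-name r₄ j _ x) r₄x
      r₅B : reg s₅ (ν 2) ≡ suc g + i
      r₅B = trans (upd-name r₄ j _ 2) r₄B
      r₅j : reg s₅ (τ j) ≡ (suc g + i) ∸ suc i
      r₅j = trans (upd-≡ r₄ (τ j) _) (cong₂ _∸_ r₄B r₄x)
      arith : ∀ {t₂ t} → t₂ ≤ c → t ≤ g * (c + 4) + 1 → suc ((t₂ + 3) + t) ≤ (c + 4) + g * (c + 4) + 1
      arith {t₂} {t} l₂ l = begin
        suc ((t₂ + 3) + t) ≤⟨ s≤s (+-mono-≤ (+-monoˡ-≤ 3 l₂) l) ⟩
        suc ((c + 3) + (g * (c + 4) + 1)) ≡⟨ eq c (g * (c + 4)) ⟩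
        (c + 4) + g * (c + 4) + 1 ∎
        where
        open ≤-Reasoning
        eq = solve 2 (λ c y → con 1 :+ ((c :+ con 3) :+ (y :+ con 1)) := (c :+ con 4) :+ y :+ con 1) refl

  Live : (ℕ → Bool) → Env → Set
  Live Γ ρ = Γ 2 ≡ true × ρ 2 ≡ B

  agrees-upd : ∀ {Γ ρ x i r} → Agrees Γ ρ r → r (ν x) ≡ i → Agrees (upd Γ x true) (upd ρ x i) r
  agrees-upd {Γ} {ρ} {x} {i} A e y gy with x ≡ᵇ y | ≡ᵇ⇒≡ x y
  ... | true | h with h tt
  ... | refl = e
  agrees-upd A e y gy | false | _ = A y gy

  live-upd : ∀ {Γ ρ x i} → Γ x ≡ false → Live Γ ρ → Live (upd Γ x true) (upd ρ x i)
  live-upd {Γ} {ρ} {x} {i} fx (g , e) = trans (upd-≢ Γ true x≢2) g , trans (upd-≢ ρ i x≢2) e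
    where
    x≢2 : x ≢ 2
    x≢2 refl = case trans (sym g) fx of λ ()

  comp-ok : ∀ t {Γ ρ σ} j r m → okTm Γ t ≡ true → Live Γ ρ → Agrees Γ ρ r → Holds B σ m →
    ∃[ r′ ] Within (comp t j) ⟨ r , m ⟩ ⟨ r′ , m ⟩ (timeTm B t) × r′ (τ j) ≡ eval B ρ σ t × Keeps Γ j r r′
  comp-ok (var x) j r m ok L A H = _ , oneW ⇓copy , trans (upd-≡ r (τ j) _) (A x ok) , keeps-τ r _ ≤-refl
  comp-ok (lit c) j r m ok L A H = _ , oneW ⇓const , upd-≡ r (τ j) c , keeps-τ r c ≤-refl
  comp-ok (s ⊞ t) j r m ok L A H
    with comp-ok s j r m (∧-trueˡ ok) L A H
  ... | r₁ , w₁ , v₁ , k₁ with comp-ok t (suc j) r₁ m (∧-trueʳ ok) L (agrees-keeps A k₁) H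
  ... | r₂ , w₂ , v₂ , k₂ = _ , seqW w₁ (seqW w₂ (oneW ⇓add)) ,
    trans (upd-≡ r₂ (τ j) _) (cong₂ _+_ (trans (temps k₂ j ≤-refl) v₁) v₂) ,
    keeps-trans k₁ (keeps-trans (keeps-weaken (n≤1+n j) k₂) (keeps-τ r₂ _ ≤-refl))
  comp-ok (s ⊟ t) j r m ok L A H
    with comp-ok s j r m (∧-trueˡ ok) L A H
  ... | r₁ , w₁ , v₁ , k₁ with comp-ok t (suc j) r₁ m (∧-trueʳ ok) L (agrees-keeps A k₁) H
  ... | r₂ , w₂ , v₂ , k₂ = _ , seqW w₁ (seqW w₂ (oneW ⇓sub)) ,
    trans (upd-≡ r₂ (τ j) _) (cong₂ _∸_ (trans (temps k₂ j ≤-refl) v₁) v₂) ,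
    keeps-trans k₁ (keeps-trans (keeps-weaken (n≤1+n j) k₂) (keeps-τ r₂ _ ≤-refl))
  comp-ok (ifz c s t) {Γ} {ρ} {σ} j r m ok L A H
    with comp-ok c j r m (∧-trueˡ ok) L A H
  ... | r₁ , w₁ , v₁ , k₁ with eval B ρ σ c | v₁
  ... | zero | e =
    let (r₂ , (t₂ , e₂ , l₂) , v₂ , k₂) = comp-ok s j r₁ m (∧-trueˡ {okTm Γ s} (∧-trueʳ {okTm Γ c} ok)) L (agrees-keeps A k₁) H
    in r₂ , seqW w₁ (suc t₂ , ⇓then e e₂ , s≤s (≤-trans l₂ (m≤m+n _ _))) , v₂ , keeps-trans k₁ k₂
  ... | suc h | e =
    let (r₂ , (t₂ , e₂ , l₂) , v₂ , k₂) = comp-ok t j r₁ m (∧-trueʳ {okTm Γ s} (∧-trueʳ {okTm Γ c} ok)) L (agrees-keeps A k₁) H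
    in r₂ , seqW w₁ (suc t₂ , ⇓else (λ z → case trans (sym z) e of λ ()) e₂ , s≤s (≤-trans l₂ (m≤n+m _ _))) , v₂ , keeps-trans k₁ k₂
  comp-ok (a ! t) {Γ} {ρ} {σ} j r m ok L A H
    with comp-ok t j r m (∧-trueʳ ok) L A H
  ... | r₁ , w₁ , v₁ , k₁ = main (B ∸ eval B ρ σ t) refl
    where
    i = eval B ρ σ t
    r₂ = upd r₁ (τ (suc j)) (r₁ (ν 2) ∸ r₁ (τ j))
    k₂ : Keeps Γ j r₁ r₂
    k₂ = keeps-τ r₁ _ (n≤1+n j)
    v₂ : r₂ (τ (suc j)) ≡ B ∸ i
    v₂ = trans (upd-≡ r₁ (τ (suc j)) _) (cong₂ _∸_ (trans (agrees-keeps A k₁ 2 (proj₁ L)) (proj₂ L)) v₁)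
    v₂j : r₂ (τ j) ≡ i
    v₂j = trans (upd-τ r₁ {j} {suc j} _ ≤-refl) v₁
    main : ∀ d → B ∸ i ≡ d →
      ∃[ r′ ] Within (comp (a ! t) j) ⟨ r , m ⟩ ⟨ r′ , m ⟩ (timeTm B t + 10) × r′ (τ j) ≡ cond d 0 (σ a i) × Keeps Γ j r r′
    main zero d≡ = _ , seqW w₁ (weakenW (s≤s (s≤s (s≤s z≤n))) (seqW (oneW ⇓sub) (2 , ⇓then (trans v₂ d≡) ⇓const , ≤-refl))) ,
      upd-≡ r₂ (τ j) 0 , keeps-trans k₁ (keeps-trans k₂ (keeps-τ r₂ 0 ≤-refl))
    main (suc d) d≡ with shift-ok {Γ} {j} r₂ m j a ≤-refl
    ... | r₃ , (t₃ , e₃ , l₃) , v₃ , k₃ , _ = _ ,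
      seqW w₁ (seqW (oneW ⇓sub) (_ , ⇓else (λ z → case trans (sym z) (trans v₂ d≡) of λ ()) (⇓seq e₃ ⇓load) , s≤s (+-monoˡ-≤ 1 l₃))) ,
      trans (upd-≡ r₃ (τ j) _) (trans (cong m (trans v₃ (cong (addr a) v₂j)))
        (H a (<ᵇ-true {0} {a} (∧-trueˡ {0 <ᵇ a} (∧-trueˡ ok))) (<ᵇ-true {a} {32} (∧-trueʳ {0 <ᵇ a} (∧-trueˡ ok))) i (m<n⇒m≤1+n∸ d d≡))) ,
      keeps-trans k₁ (keeps-trans k₂ (keeps-trans k₃ (keeps-τ r₃ _ ≤-refl)))
      where
      m<n⇒m≤1+n∸ : ∀ d → B ∸ i ≡ suc d → i < B
      m<n⇒m≤1+n∸ d e = m<n⇒0<n∸m⁻¹ (subst (0 <_) (sym e) (s≤s z≤n))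
        where
        m<n⇒0<n∸m⁻¹ : 0 < B ∸ i → i < B
        m<n⇒0<n∸m⁻¹ h with i <? B
        ... | yes l = l
        ... | no ¬l = contradiction (subst (0 <_) (m≤n⇒m∸n≡0 (≮⇒≥ ¬l)) h) λ ()
  comp-ok (Σ[ x ] t) {Γ} {ρ} {σ} j r m ok L A H =
    let (s′ , w , k , (meq , v , _)) = for-ok {Γ} {j} {suc j} x _ (timeTm B t + 1) (n≤1+n j) Inv (proj₁ L) fx body stable ⟨ r₁ , m ⟩ rB (refl , upd-≡ r (τ j) 0 , A₁)
    in reg s′ , subst (λ z → Within _ _ ⟨ reg s′ , z ⟩ _) meq (seqW (oneW ⇓const) w) , v , keeps-trans k₁ k
    where
    fx = not-false {Γ x} (∧-trueˡ ok)
    r₁ = upd r (τ j) 0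
    k₁ : Keeps Γ j r r₁
    k₁ = keeps-τ r 0 ≤-refl
    A₁ = agrees-keeps A k₁
    rB = trans (A₁ 2 (proj₁ L)) (proj₂ L)
    Inv : ℕ → State → Set
    Inv i s = mem s ≡ m × reg s (τ j) ≡ sum i (λ i → eval B (upd ρ x i) σ t) × Agrees Γ ρ (reg s)
    body : ∀ i s → i < B → reg s (ν 2) ≡ B → reg s (ν x) ≡ i → Inv i s →
      ∃[ s′ ] Within _ s s′ (timeTm B t + 1) × Keeps (upd Γ x true) j (reg s) (reg s′) × Inv (suc i) s′
    body i s i<B sB sx (refl , v , A′)
      with comp-ok t (suc j) (reg s) (mem s) (∧-trueʳ {not (Γ x)} ok) (live-upd {Γ} {ρ} {x} {i} fx L) (agrees-upd {Γ} {ρ} {x} {i} {reg s} A′ sx) H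
    ... | r₂ , w₂ , v₂ , k₂ = _ , seqW w₂ (oneW ⇓add) , k₃ , refl ,
      trans (upd-≡ r₂ (τ j) _) (cong₂ _+_ (trans (temps k₂ j ≤-refl) v) v₂) , agrees-keeps A′ (keeps-⊆ {Γ} {x} k₃)
      where
      k₃ = keeps-trans (keeps-weaken (n≤1+n j) k₂) (keeps-τ r₂ _ ≤-refl)
    stable : ∀ i r r′ m → Keeps Γ (suc j) r r′ → Inv i ⟨ r , m ⟩ → Inv i ⟨ r′ , m ⟩
    stable i r r′ m k (e , v , A′) = e , trans (temps k j ≤-refl) v , agrees-keeps A′ k

addr-other : ∀ (m : ℕ → ℕ) {a b i j : ℕ} v → a < 32 → b < 32 → a ≢ b ⊎ i ≢ j → upd m (addr a i) v (addr b j) ≡ m (addr b j)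
addr-other m {a} {b} {i} {j} v a< b< d = upd-≢ m v (λ e → case addr-inj {a} {b} {i} {j} a< b< e of
  λ { (p , q) → [ (λ ¬p → ¬p p) , (λ ¬q → ¬q q) ]′ d })

upd-cong : ∀ (m : ℕ → ℕ) {x y} v z → x ≡ y → upd m x v z ≡ upd m y v z
upd-cong m v z refl = refl

module _ (B : ℕ) where

  compC-ok : ∀ c {Γ ρ σ} r m → okCm Γ c ≡ true → Live B Γ ρ → Agrees Γ ρ r → Holds B σ m →
    ∃[ s ] Within (compC c) ⟨ r , m ⟩ s (timeCm B c) × Keeps Γ 0 r (reg s) × Holds B (exec B ρ c σ) (mem s)
  compC-ok (a [ x ]:= t) {Γ} {ρ} {σ} r m ok L A H =
    let (s₁ , w₁ , k₁ , (H₁ , b₁ , A₁)) =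
          for-ok B {Γ} {0} {0} x _ (timeTm B t + 9) z≤n Inv₁ (proj₁ L) fx body₁ stable₁ ⟨ r , m ⟩ (trans (A 2 (proj₁ L)) (proj₂ L)) (H , (λ h ()) , A)
        (s₂ , w₂ , k₂ , (H₂ , c₂ , _ , _)) =
          for-ok B {Γ} {0} {0} x _ 18 z≤n Inv₂ (proj₁ L) fx body₂ stable₂ s₁ (trans (A₁ 2 (proj₁ L)) (proj₂ L)) ((λ b 0<b b<32 _ → H₁ b 0<b b<32) , (λ h ()) , b₁ , A₁)
    in s₂ , seqW w₁ w₂ , keeps-trans k₁ k₂ , λ b 0<b b<32 i i<B → final (mem s₂) H₂ c₂ b 0<b b<32 i i<B (a ≟ b)
    where
    fx = not-false {Γ x} (∧-trueˡ (∧-trueʳ {(0 <ᵇ a) ∧ (a <ᵇ 32)} ok))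
    0<a = <ᵇ-true {0} {a} (∧-trueˡ {0 <ᵇ a} (∧-trueˡ ok))
    a<32 = <ᵇ-true {a} {32} (∧-trueʳ {0 <ᵇ a} (∧-trueˡ ok))
    okt = ∧-trueʳ {not (Γ x)} (∧-trueʳ {(0 <ᵇ a) ∧ (a <ᵇ 32)} ok)
    f : ℕ → ℕ
    f i = eval B (upd ρ x i) σ t
    Inv₁ Inv₂ : ℕ → State → Set
    Inv₁ i s = Holds B σ (mem s) × (∀ h → h < i → mem s (addr 0 h) ≡ f h) × Agrees Γ ρ (reg s)
    Inv₂ i s = (∀ b → 0 < b → b < 32 → a ≢ b → ∀ i → i < B → mem s (addr b i) ≡ σ b i) ×
      (∀ h → h < i → mem s (addr a h) ≡ f h) × (∀ h → h < B → mem s (addr 0 h) ≡ f h) × Agrees Γ ρ (reg s)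
    stable₁ : ∀ i r r′ m → Keeps Γ 0 r r′ → Inv₁ i ⟨ r , m ⟩ → Inv₁ i ⟨ r′ , m ⟩
    stable₁ i r r′ m k (h , b , A) = h , b , agrees-keeps A k
    stable₂ : ∀ i r r′ m → Keeps Γ 0 r r′ → Inv₂ i ⟨ r , m ⟩ → Inv₂ i ⟨ r′ , m ⟩
    stable₂ i r r′ m k (h , c , b , A) = h , c , b , agrees-keeps A k
    extend : ∀ (m : ℕ → ℕ) a i v → a < 32 → (∀ h → h < i → m (addr a h) ≡ f h) → v ≡ f i →
      ∀ h → h < suc i → upd m (addr a i) v (addr a h) ≡ f h
    extend m a i v a<32 old e h h<1+i with m<1+n⇒m<n∨m≡n h<1+i
    ... | inj₁ h<i = trans (addr-other m {a} {a} {i} {h} v a<32 a<32 (inj₂ (λ e → <⇒≢ h<i (sym e)))) (old h h<i)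
    ... | inj₂ refl = trans (upd-≡ m (addr a i) v) e
    body₁ : ∀ i s → i < B → reg s (ν 2) ≡ B → reg s (ν x) ≡ i → Inv₁ i s →
      ∃[ s′ ] Within _ s s′ (timeTm B t + 9) × Keeps (upd Γ x true) 0 (reg s) (reg s′) × Inv₁ (suc i) s′
    body₁ i ⟨ r , m ⟩ i<B rB rx (H , b , A)
      with comp-ok B t 1 r m okt (live-upd B {Γ} {ρ} {x} {i} fx L) (agrees-upd B {Γ} {ρ} {x} {i} {r} A rx) H
    ... | r₁ , w₁ , v₁ , k₁ with shift-ok B {upd Γ x true} {0} (upd r₁ (τ 2) (r₁ (ν x))) m 2 0 z≤n
    ... | r₂ , w₂ , v₂ , k₂ , t₂ = _ , seqW w₁ (seqW (oneW ⇓copy) (seqW w₂ (oneW ⇓store))) , K , H′ , b′ , agrees-keeps A (keeps-⊆ {Γ} {x} K)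
      where
      K = keeps-trans (keeps-weaken z≤n k₁) (keeps-trans (keeps-τ {upd Γ x true} {0} r₁ {2} _ z≤n) k₂)
      v≡ : r₂ (τ 1) ≡ f i
      v≡ = trans (t₂ 1 ≤-refl) v₁
      a≡ : r₂ (τ 2) ≡ addr 0 i
      a≡ = trans v₂ (cong (addr 0) (trans (upd-≡ r₁ (τ 2) _) (trans (names k₁ x (upd-≡ Γ x true)) rx)))
      H′ : Holds B σ (upd m (r₂ (τ 2)) (r₂ (τ 1)))
      H′ b 0<b b<32 j j<B = trans (upd-cong m (r₂ (τ 1)) (addr b j) a≡)
        (trans (addr-other m {0} {b} {i} {j} _ (s≤s z≤n) b<32 (inj₁ (<⇒≢ 0<b))) (H b 0<b b<32 j j<B))
      b′ : ∀ h → h < suc i → upd m (r₂ (τ 2)) (r₂ (τ 1)) (addr 0 h) ≡ f h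
      b′ h l = trans (upd-cong m (r₂ (τ 1)) (addr 0 h) a≡) (extend m 0 i _ (s≤s z≤n) b v≡ h l)
    body₂ : ∀ i s → i < B → reg s (ν 2) ≡ B → reg s (ν x) ≡ i → Inv₂ i s →
      ∃[ s′ ] Within _ s s′ 18 × Keeps (upd Γ x true) 0 (reg s) (reg s′) × Inv₂ (suc i) s′
    body₂ i ⟨ r , m ⟩ i<B rB rx (H , c , b , A)
      with shift-ok B {upd Γ x true} {0} (upd r (τ 1) (r (ν x))) m 1 0 z≤n
    ... | r₁ , w₁ , v₁ , k₁ , t₁
      with shift-ok B {upd Γ x true} {0} (upd (upd r₁ (τ 1) (m (r₁ (τ 1)))) (τ 2) (upd r₁ (τ 1) (m (r₁ (τ 1))) (ν x))) m 2 a z≤n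
    ... | r₄ , w₄ , v₄ , k₄ , t₄ =
      _ , weakenW ≤-refl (seqW (oneW ⇓copy) (seqW w₁ (seqW (oneW ⇓load) (seqW (oneW ⇓copy) (seqW w₄ (oneW ⇓store)))))) , K , H′ , c′ , b′ , agrees-keeps A (keeps-⊆ {Γ} {x} K)
      where
      r₂ = upd r₁ (τ 1) (m (r₁ (τ 1)))
      r₃ = upd r₂ (τ 2) (r₂ (ν x))
      k₂ = keeps-trans (keeps-τ {upd Γ x true} {0} r {1} _ z≤n) (keeps-trans k₁ (keeps-τ r₁ {1} _ z≤n))
      K = keeps-trans k₂ (keeps-trans (keeps-τ {_} {0} r₂ {2} _ z≤n) k₄)
      v≡ : r₄ (τ 1) ≡ f i
      v≡ = trans (t₄ 1 ≤-refl) (trans (upd-≡ r₁ (τ 1) _)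
        (trans (cong m (trans v₁ (cong (addr 0) (trans (upd-≡ r (τ 1) _) rx)))) (b i i<B)))
      a≡ : r₄ (τ 2) ≡ addr a i
      a≡ = trans v₄ (cong (addr a) (trans (upd-≡ r₂ (τ 2) _) (trans (names k₂ x (upd-≡ Γ x true)) rx)))
      H′ : ∀ b → 0 < b → b < 32 → a ≢ b → ∀ j → j < B → upd m (r₄ (τ 2)) (r₄ (τ 1)) (addr b j) ≡ σ b j
      H′ b 0<b b<32 a≢b j j<B = trans (upd-cong m (r₄ (τ 1)) (addr b j) a≡)
        (trans (addr-other m {a} {b} {i} {j} _ a<32 b<32 (inj₁ a≢b)) (H b 0<b b<32 a≢b j j<B))
      c′ : ∀ h → h < suc i → upd m (r₄ (τ 2)) (r₄ (τ 1)) (addr a h) ≡ f h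
      c′ h l = trans (upd-cong m (r₄ (τ 1)) (addr a h) a≡) (extend m a i _ a<32 c v≡ h l)
      b′ : ∀ h → h < B → upd m (r₄ (τ 2)) (r₄ (τ 1)) (addr 0 h) ≡ f h
      b′ h l = trans (upd-cong m (r₄ (τ 1)) (addr 0 h) a≡)
        (trans (addr-other m {a} {0} {i} {h} _ a<32 (s≤s z≤n) (inj₁ (λ e → <⇒≢ 0<a (sym e)))) (b h l))
    final : ∀ m → (∀ b → 0 < b → b < 32 → a ≢ b → ∀ i → i < B → m (addr b i) ≡ σ b i) →
      (∀ h → h < B → m (addr a h) ≡ f h) → ∀ b → 0 < b → b < 32 → ∀ i → i < B → Dec (a ≡ b) → m (addr b i) ≡ upd σ a f b i
    final m H c b 0<b b<32 i i<B (yes refl) = trans (c i i<B) (cong (λ g → g i) (sym (upd-≡ σ a f)))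
    final m H c b 0<b b<32 i i<B (no a≢b) = trans (H b 0<b b<32 a≢b i i<B) (cong (λ g → g i) (sym (upd-≢ σ f a≢b)))
  compC-ok (c ﹔ d) {Γ} r m ok L A H
    with compC-ok c r m (∧-trueˡ ok) L A H
  ... | ⟨ r₁ , m₁ ⟩ , w₁ , k₁ , H₁ with compC-ok d r₁ m₁ (∧-trueʳ {okCm Γ c} ok) L (agrees-keeps A k₁) H₁
  ... | s₂ , w₂ , k₂ , H₂ = s₂ , seqW w₁ w₂ , keeps-trans k₁ k₂ , H₂
  compC-ok (for x c) {Γ} {ρ} {σ} r m ok L A H =
    let (s , w , k , (H′ , _)) = for-ok B {Γ} {0} {0} x _ (timeCm B c) z≤n Inv (proj₁ L) fx body stable ⟨ r , m ⟩ (trans (A 2 (proj₁ L)) (proj₂ L)) (H , A)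
    in s , w , k , H′
    where
    fx = not-false {Γ x} (∧-trueˡ ok)
    Inv : ℕ → State → Set
    Inv i s = Holds B (iter i (λ i → exec B (upd ρ x i) c) σ) (mem s) × Agrees Γ ρ (reg s)
    stable : ∀ i r r′ m → Keeps Γ 0 r r′ → Inv i ⟨ r , m ⟩ → Inv i ⟨ r′ , m ⟩
    stable i r r′ m k (h , A) = h , agrees-keeps A k
    body : ∀ i s → i < B → reg s (ν 2) ≡ B → reg s (ν x) ≡ i → Inv i s →
      ∃[ s′ ] Within (compC c) s s′ (timeCm B c) × Keeps (upd Γ x true) 0 (reg s) (reg s′) × Inv (suc i) s′
    body i ⟨ r , m ⟩ i<B rB rx (H , A)
      with compC-ok c r m (∧-trueʳ {not (Γ x)} ok) (live-upd B {Γ} {ρ} {x} {i} fx L) (agrees-upd B {Γ} {ρ} {x} {i} {r} A rx) H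
    ... | s , w , k , H′ = s , w , k , H′ , agrees-keeps A (keeps-⊆ {Γ} {x} k)

-- Polynomially bounded running times

Poly : (ℕ → ℕ) → Set
Poly f = ∃[ e ] (∀ B → f B ≤ (2 + B) ^ e)

pow-mono : ∀ B {d e} → d ≤ e → (2 + B) ^ d ≤ (2 + B) ^ e
pow-mono B = ^-monoʳ-≤ (2 + B)

poly-const : ∀ c → Poly (λ _ → c)
poly-const c = c , λ B → ≤-trans (n≤2^n c) (^-monoˡ-≤ c (s≤s (s≤s z≤n)))
  where
  n≤2^n : ∀ n → n ≤ 2 ^ n
  n≤2^n zero = z≤n
  n≤2^n (suc n) = ≤-trans (+-mono-≤ (>-nonZero⁻¹ (2 ^ n) {{m^n≢0 2 n}}) (n≤2^n n)) (≤-reflexive (cong (2 ^ n +_) (sym (+-identityʳ _))))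

poly-id : Poly (λ B → B)
poly-id = 1 , λ B → ≤-trans (m≤n+m B 2) (≤-reflexive (sym (*-identityʳ (2 + B))))

poly-+ : ∀ {f g} → Poly f → Poly g → Poly (λ B → f B + g B)
poly-+ {f} {g} (d , p) (e , q) = suc (d + e) , λ B → begin
  f B + g B ≤⟨ +-mono-≤ (p B) (q B) ⟩
  (2 + B) ^ d + (2 + B) ^ e ≤⟨ +-mono-≤ (pow-mono B (m≤m+n d e)) (pow-mono B (m≤n+m e d)) ⟩
  (2 + B) ^ (d + e) + (2 + B) ^ (d + e) ≡⟨ cong ((2 + B) ^ (d + e) +_) (sym (+-identityʳ ((2 + B) ^ (d + e)))) ⟩
  2 * (2 + B) ^ (d + e) ≤⟨ *-monoˡ-≤ ((2 + B) ^ (d + e)) (m≤m+n 2 B) ⟩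
  (2 + B) ^ suc (d + e) ∎
  where open ≤-Reasoning

poly-* : ∀ {f g} → Poly f → Poly g → Poly (λ B → f B * g B)
poly-* {f} {g} (d , p) (e , q) = d + e , λ B →
  ≤-trans (*-mono-≤ (p B) (q B)) (≤-reflexive (sym (^-distribˡ-+-* (2 + B) d e)))

poly-for : ∀ {f} → Poly f → Poly (λ B → forT B (f B))
poly-for p = poly-+ (poly-const 3) (poly-* poly-id (poly-+ p (poly-const 4)))

poly-timeTm : ∀ t → Poly (λ B → timeTm B t)
poly-timeTm (var x) = poly-const 1
poly-timeTm (lit c) = poly-const 1
poly-timeTm (s ⊞ t) = poly-+ (poly-timeTm s) (poly-+ (poly-timeTm t) (poly-const 1))
poly-timeTm (s ⊟ t) = poly-+ (poly-timeTm s) (poly-+ (poly-timeTm t) (poly-const 1))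
poly-timeTm (ifz c s t) = poly-+ (poly-timeTm c) (poly-+ (poly-const 1) (poly-+ (poly-timeTm s) (poly-timeTm t)))
poly-timeTm (a ! t) = poly-+ (poly-timeTm t) (poly-const 10)
poly-timeTm (Σ[ x ] t) = poly-+ (poly-const 1) (poly-for (poly-+ (poly-timeTm t) (poly-const 1)))

poly-timeCm : ∀ c → Poly (λ B → timeCm B c)
poly-timeCm (a [ x ]:= t) = poly-+ (poly-for (poly-+ (poly-timeTm t) (poly-const 9))) (poly-for (poly-const 18))
poly-timeCm (c ﹔ d) = poly-+ (poly-timeCm c) (poly-timeCm d)
poly-timeCm (for x c) = poly-for (poly-timeCm c)

-- Non-interference: flow K c computes the arrays that are determined by the
-- arrays in K after c, or fails if c reads an undetermined array.


Names : Set
Names = ℕ → Bool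

reads : Names → Tm → Bool
reads K (var x) = true
reads K (lit c) = true
reads K (s ⊞ t) = reads K s ∧ reads K t
reads K (s ⊟ t) = reads K s ∧ reads K t
reads K (ifz c s t) = reads K c ∧ reads K s ∧ reads K t
reads K (a ! t) = K a ∧ reads K t
reads K (Σ[ x ] t) = reads K t

flow : Names → Cm → Maybe Names
flow K (a [ x ]:= t) = if reads K t then just (upd K a true) else nothing
flow K (c ﹔ d) = flow K c >>= λ K′ → flow K′ d
flow K (for x c) = flow K c >>= λ _ → just K

module _ (B : ℕ) where

  Same : Names → Mem → Mem → Set
  Same K σ σ′ = ∀ a → K a ≡ true → ∀ i → i < B → σ a i ≡ σ′ a i

  Agree : (ℕ → Bool) → Env → Env → Set
  Agree Γ ρ ρ′ = ∀ x → Γ x ≡ true → ρ x ≡ ρ′ x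

  agree-upd : ∀ x i {Γ ρ ρ′} → Agree Γ ρ ρ′ → Agree (upd Γ x true) (upd ρ x i) (upd ρ′ x i)
  agree-upd x i E y g with x ≡ᵇ y
  ... | true = refl
  ... | false = E y g

  at-cong : ∀ {f g : ℕ → ℕ} i → (i < B → f i ≡ g i) → at B f i ≡ at B g i
  at-cong i h with i <? B
  ... | yes l = cong (cond (B ∸ i) 0) (h l)
  ... | no ¬l rewrite m≤n⇒m∸n≡0 (≮⇒≥ ¬l) = refl

  eval-same : ∀ t {Γ K ρ ρ′ σ σ′} → okTm Γ t ≡ true → reads K t ≡ true → Agree Γ ρ ρ′ → Same K σ σ′ → eval B ρ σ t ≡ eval B ρ′ σ′ t
  eval-same (var x) g ok E S = E x g
  eval-same (lit c) g ok E S = refl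
  eval-same (s ⊞ t) {Γ} {K} g ok E S = cong₂ _+_ (eval-same s (∧-trueˡ g) (∧-trueˡ ok) E S) (eval-same t (∧-trueʳ {okTm Γ s} g) (∧-trueʳ {reads K s} ok) E S)
  eval-same (s ⊟ t) {Γ} {K} g ok E S = cong₂ _∸_ (eval-same s (∧-trueˡ g) (∧-trueˡ ok) E S) (eval-same t (∧-trueʳ {okTm Γ s} g) (∧-trueʳ {reads K s} ok) E S)
  eval-same (ifz c s t) {Γ} {K} g ok E S
    rewrite sym (eval-same c (∧-trueˡ g) (∧-trueˡ ok) E S)
      | sym (eval-same s (∧-trueˡ {okTm Γ s} (∧-trueʳ {okTm Γ c} g)) (∧-trueˡ {reads K s} (∧-trueʳ {reads K c} ok)) E S)
      | sym (eval-same t (∧-trueʳ {okTm Γ s} (∧-trueʳ {okTm Γ c} g)) (∧-trueʳ {reads K s} (∧-trueʳ {reads K c} ok)) E S) = refl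
  eval-same (a ! t) {Γ} {K} {ρ} {ρ′} {σ} {σ′} g ok E S
    rewrite sym (eval-same t {Γ} {K} {ρ} {ρ′} {σ} {σ′} (∧-trueʳ {(0 <ᵇ a) ∧ (a <ᵇ 32)} g) (∧-trueʳ {K a} ok) E S) =
    at-cong {σ a} {σ′ a} (eval B ρ σ t) (S a (∧-trueˡ ok) (eval B ρ σ t))
  eval-same (Σ[ x ] t) {Γ} g ok E S = sum-cong B (λ i _ → eval-same t (∧-trueʳ {not (Γ x)} g) ok (agree-upd x i E) S)

  flow-⊇ : ∀ {K K′} c → flow K c ≡ just K′ → ∀ a → K a ≡ true → K′ a ≡ true
  flow-⊇ {K} (a [ x ]:= t) e b kb with reads K t | e
  ... | true | refl with a ≡ᵇ b
  ... | true = refl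
  ... | false = kb
  flow-⊇ {K} (c ﹔ d) e b kb with flow K c in eq
  ... | just K₁ = flow-⊇ d e b (flow-⊇ c eq b kb)
  flow-⊇ {K} (for x c) e b kb with flow K c | e
  ... | just _ | refl = kb

  exec-same : ∀ c {Γ K K′ ρ ρ′ σ σ′} → okCm Γ c ≡ true → flow K c ≡ just K′ → Agree Γ ρ ρ′ → Same K σ σ′ → Same K′ (exec B ρ c σ) (exec B ρ′ c σ′)
  exec-same (a [ x ]:= t) {Γ} {K} g e E S b kb i i<B with reads K t in ok | e
  ... | true | refl with a ≡ᵇ b
  ... | true = eval-same t (∧-trueʳ {not (Γ x)} (∧-trueʳ {(0 <ᵇ a) ∧ (a <ᵇ 32)} g)) ok (agree-upd x i E) S
  ... | false = S b kb i i<B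
  exec-same (c ﹔ d) {Γ} {K} g e E S with flow K c in eq
  ... | just K₁ = exec-same d (∧-trueʳ {okCm Γ c} g) e E (exec-same c (∧-trueˡ g) eq E S)
  exec-same (for x c) {Γ} {K} {ρ = ρ} {ρ′} {σ} {σ′} g e E S with flow K c in eq | e
  ... | just K₁ | refl = go B
    where
    go : ∀ b → Same K (iter b (λ i → exec B (upd ρ x i) c) σ) (iter b (λ i → exec B (upd ρ′ x i) c) σ′)
    go zero = S
    go (suc b) a ka = exec-same c (∧-trueʳ {not (Γ x)} g) eq (agree-upd x b E) (go b) a (flow-⊇ c eq a ka)

writes : Cm → Names
writes (a [ x ]:= t) b = a ≡ᵇ b
writes (c ﹔ d) b = writes c b ∨ writes d b
writes (for x c) b = writes c b

frame : ∀ B ρ c σ a → writes c a ≡ false → exec B ρ c σ a ≡ σ a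
frame B ρ (b [ x ]:= t) σ a e rewrite e = refl
frame B ρ (c ﹔ d) σ a e with writes c a in eq
... | false = trans (frame B ρ d _ a e) (frame B ρ c σ a eq)
frame B ρ (for x c) σ a e = go B
  where
  go : ∀ b → iter b (λ i → exec B (upd ρ x i) c) σ a ≡ σ a
  go zero = refl
  go (suc b) = trans (frame B (upd ρ x b) c _ a e) (go b)

record DSet : Set₁ where
  constructor dset
  field
    El : ℕ → Set
    dec : Decidable El
open DSet

infix 4 _∈_ _∉_ _⊆_
_∈_ _∉_ : ℕ → DSet → Set
v ∈ P = El P v
v ∉ P = ¬ El P v

Outside : ℕ → DSet → ℕ → Set
Outside n X v = v < n × v ∉ X

_⊆_ : DSet → DSet → Set
P ⊆ Q = ∀ v → v ∈ P → v ∈ Q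

infixl 6 _∪_ _∖_
_∪_ _∖_ : DSet → DSet → DSet
El (P ∪ Q) v = v ∈ P ⊎ v ∈ Q
dec (P ∪ Q) v = dec P v ⊎-dec dec Q v
El (P ∖ Q) v = v ∈ P × v ∉ Q
dec (P ∖ Q) v = dec P v ×-dec ¬? (dec Q v)

｛_｝ : ℕ → DSet
El ｛ x ｝ v = v ≡ x
dec ｛ x ｝ v = v ≟ x

-- A vertex-cut problem: choose a set R of vertices of V, disjoint from F,
-- whose frontier (the vertices outside R that lie in S or are entered by an
-- arc from R) is small.

record Net : Set₁ where
  field
    B : ℕ
    V S F : DSet
    A : ℕ → ℕ → Set
    A? : ∀ u v → Dec (A u v)
    V<B : ∀ v → v ∈ V → v < B

module Cut (N : Net) where
  open Net N public

  infix 8 ♯_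
  ♯_ : DSet → ℕ
  ♯ P = # B (dec P)

  Entered : DSet → DSet
  El (Entered R) r = r ∈ S ⊎ ∃[ u ] u < B × u ∈ R × A u r
  dec (Entered R) r = dec S r ⊎-dec any<? B (λ u → dec R u ×-dec A? u r)

  right : DSet → DSet → DSet
  right Q D = V ∖ D ∖ Q

  frontier : DSet → DSet → DSet
  El (frontier R D) r = r ∈ right R D × r ∈ Entered R
  dec (frontier R D) r = dec (right R D) r ×-dec dec (Entered R) r

  Valid : DSet → DSet → Set
  Valid R D = ∀ v → v ∈ R → v ∈ V × v ∉ F × v ∉ D

  Adj : ℕ → ℕ → Set
  Adj u r = A u r ⊎ u ≡ r

  -- A partial assignment of right vertices to owners: 0 is nobody, 1 the
  -- source, 2 + u the vertex u. Every left vertex but the pending one owns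
  -- exactly one right vertex among its successors and itself.
  record Matching (Q D : DSet) (own : ℕ → ℕ) (p : ℕ) : Set where
    left : ℕ → Set
    left u = u ∈ right Q D × u ∉ F
    field
      total : ∀ u → left u → 2 + u ≢ p → ∃[ r ] r ∈ right Q D × own r ≡ 2 + u
      source : ∀ r → r ∈ right Q D → own r ≡ 1 → r ∈ Entered Q
      owner : ∀ r u → r ∈ right Q D → own r ≡ 2 + u → left u × Adj u r
      unique : ∀ r r′ u → r ∈ right Q D → r′ ∈ right Q D → own r ≡ 2 + u → own r′ ≡ 2 + u → r ≡ r′
      pends : ∀ r u → r ∈ right Q D → own r ≡ 2 + u → p ≢ 2 + u

  -- lev marks the right vertices from which an alternating path leads to an
  -- unowned vertex, with decreasing positive levels along such paths.
  record Levels (Q D : DSet) (own lev : ℕ → ℕ) : Set where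
    field
      free : ∀ r → r ∈ right Q D → own r ≡ 0 → lev r ≢ 0
      back : ∀ r u r′ → r ∈ right Q D → own r ≡ 2 + u → Adj u r′ → r′ ∈ right Q D → lev r′ ≢ 0 → lev r ≢ 0
      sound : ∀ r → r ∈ right Q D → lev r ≢ 0 → own r ≡ 0 ⊎ ∃[ u ] ∃[ r′ ] own r ≡ 2 + u × Adj u r′ × r′ ∈ right Q D × lev r′ ≢ 0 × lev r′ < lev r

  assign : ∀ {Q D own own′ p} c → Matching Q D own p → c ∈ right Q D →
    (p ≡ 1 × c ∈ Entered Q) ⊎ (∃[ u ] p ≡ 2 + u × (u ∈ right Q D × u ∉ F) × Adj u c) →
    own′ c ≡ p → (∀ r → r < B → r ≢ c → own′ r ≡ own r) → Matching Q D own′ (own c)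
  assign {Q} {D} {own} {own′} {p} c M c∈ pc e≡ e≢ = record
    { total = tot
    ; source = λ r r∈ e → case r ≟ c of λ
        { (yes refl) → case pc of λ { (inj₁ (_ , c∈S)) → c∈S ; (inj₂ (u , p≡ , _)) → contradiction (trans (sym e) (trans e≡ p≡)) λ () }
        ; (no r≢c) → source r r∈ (trans (sym (e≢ r (bd r∈) r≢c)) e) }
    ; owner = λ r u r∈ e → case r ≟ c of λ
        { (yes refl) → case pc of λ
            { (inj₁ (p≡1 , _)) → contradiction (trans (sym p≡1) (trans (sym e≡) e)) λ ()
            ; (inj₂ (u′ , p≡ , l , a)) → subst (λ z → left z × Adj z c) (suc-injective (suc-injective (trans (sym p≡) (trans (sym e≡) e)))) (l , a) }
        ; (no r≢c) → owner r u r∈ (trans (sym (e≢ r (bd r∈) r≢c)) e) }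
    ; unique = uni
    ; pends = λ r u r∈ e q → case r ≟ c of λ
        { (yes refl) → pends c u c∈ q (trans (sym e≡) e)
        ; (no r≢c) → r≢c (unique r c u r∈ c∈ (trans (sym (e≢ r (bd r∈) r≢c)) e) q) }
    }
    where
    open Matching M
    bd : ∀ {r} → r ∈ right Q D → r < B
    bd ((r∈V , _) , _) = V<B _ r∈V
    tot : ∀ u → left u → 2 + u ≢ own c → ∃[ r ] r ∈ right Q D × own′ r ≡ 2 + u
    tot u l ne with 2 + u ≟ p
    ... | yes e = c , c∈ , trans e≡ (sym e)
    ... | no ¬e with total u l ¬e
    ... | r , r∈ , e = r , r∈ , trans (e≢ r (bd r∈) (λ { refl → ne (sym e) })) e
    uni : ∀ r r′ u → r ∈ right Q D → r′ ∈ right Q D → own′ r ≡ 2 + u → own′ r′ ≡ 2 + u → r ≡ r′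
    uni r r′ u r∈ r′∈ e e′ with r ≟ c | r′ ≟ c
    ... | yes refl | yes refl = refl
    ... | yes refl | no r′≢c = contradiction (trans (sym e≡) e) (pends r′ u r′∈ (trans (sym (e≢ r′ (bd r′∈) r′≢c)) e′))
    ... | no r≢c | yes refl = contradiction (trans (sym e≡) e′) (pends r u r∈ (trans (sym (e≢ r (bd r∈) r≢c)) e))
    ... | no r≢c | no r′≢c = unique r r′ u r∈ r′∈ (trans (sym (e≢ r (bd r∈) r≢c)) e) (trans (sym (e≢ r′ (bd r′∈) r′≢c)) e′)

  levels-agree : ∀ {Q D own lev lev′} → Levels Q D own lev → Levels Q D own lev′ →
    ∀ r → Acc _<_ (lev r) → r ∈ right Q D → lev r ≢ 0 → lev′ r ≢ 0
  levels-agree L L′ r (acc rec) r∈ ne with Levels.sound L r r∈ ne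
  ... | inj₁ e = Levels.free L′ r r∈ e
  ... | inj₂ (u , r′ , e , a , r′∈ , ne′ , l<) = Levels.back L′ r u r′ r∈ e a r′∈ (levels-agree L L′ r′ (rec l<) r′∈ ne′)

  module _ {Q D : DSet} {own own′ : ℕ → ℕ} (eq : ∀ r → r < B → own′ r ≡ own r) where

    private
      tr : ∀ {r} → r ∈ right Q D → own′ r ≡ own r
      tr ((r∈V , _) , _) = eq _ (V<B _ r∈V)

    levels-cong : ∀ {lev} → Levels Q D own lev → Levels Q D own′ lev
    levels-cong L = record
      { free = λ r r∈ e → free r r∈ (trans (sym (tr r∈)) e)
      ; back = λ r u r′ r∈ e → back r u r′ r∈ (trans (sym (tr r∈)) e)
      ; sound = λ r r∈ ne → [ (λ e → inj₁ (trans (tr r∈) e)) , (λ { (u , r′ , e , h) → inj₂ (u , r′ , trans (tr r∈) e , h) }) ]′ (sound r r∈ ne) }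
      where open Levels L

    matching-cong : ∀ {p} → Matching Q D own p → Matching Q D own′ p
    matching-cong M = record
      { total  = λ u l ne → let (r , r∈ , e) = total u l ne in r , r∈ , trans (tr r∈) e
      ; source = λ r r∈ e → source r r∈ (trans (sym (tr r∈)) e)
      ; owner = λ r u r∈ e → owner r u r∈ (trans (sym (tr r∈)) e)
      ; unique = λ r r′ u r∈ r′∈ e e′ → unique r r′ u r∈ r′∈ (trans (sym (tr r∈)) e) (trans (sym (tr r′∈)) e′)
      ; pends = λ r u r∈ e → pends r u r∈ (trans (sym (tr r∈)) e) }
      where open Matching M

  matching-≤1 : ∀ {Q D own p p′} → p ≤ 1 → p′ ≤ 1 → Matching Q D own p → Matching Q D own p′
  matching-≤1 {Q} {D} {own} {p} {p′} p≤1 p′≤1 M = record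
    { total = λ u l _ → total u l (λ { refl → contradiction p≤1 λ { (s≤s ()) } }) ; source = source ; owner = owner ; unique = unique
    ; pends = λ { r u r∈ e refl → contradiction p′≤1 λ { (s≤s ()) } } }
    where open Matching M

  -- When no alternating path starts in the frontier of Q, the unmarked
  -- vertices form the furthest minimum cut beyond Q.
  module Furthest {Q D : DSet} {own lev : ℕ → ℕ} {p} (M : Matching Q D own p) (p≤1 : p ≤ 1) (L : Levels Q D own lev)
    (valid : Valid Q D) (maximal : ∀ r → r ∈ right Q D → r ∈ Entered Q → lev r ≡ 0) where
    open Matching M
    open Levels L

    Left : DSet
    El Left u = left u
    dec Left u = dec (right Q D) u ×-dec ¬? (dec F u)

    R* : DSet
    El R* u = left u × (∀ r → r < B → ¬ (r ∈ right Q D × Adj u r × lev r ≢ 0))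
    dec R* u = dec Left u ×-dec all<? B (λ r → ¬? (dec (right Q D) r ×-dec (A? u r ⊎-dec (u ≟ r)) ×-dec ¬? (lev r ≟ 0)))

    Q′ : DSet
    Q′ = Q ∪ R*

    bd : ∀ {r} → r ∈ right Q D → r < B
    bd ((r∈V , _) , _) = V<B _ r∈V

    valid′ : Valid Q′ D
    valid′ v (inj₁ q) = valid v q
    valid′ v (inj₂ ((((v∈V , v∉D) , _) , v∉F) , _)) = v∈V , v∉F , v∉D

    Δ : DSet → DSet
    Δ R = (R ∖ Q) ∪ frontier R D

    Owned : DSet → DSet
    El (Owned R) r = r ∈ right Q D × ∃[ u ] u < B × u ∈ R × own r ≡ 2 + u
    dec (Owned R) r = dec (right Q D) r ×-dec any<? B (λ u → dec R u ×-dec (own r ≟ 2 + u))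

    Sourced : DSet
    El Sourced r = r ∈ right Q D × own r ≡ 1
    dec Sourced r = dec (right Q D) r ×-dec (own r ≟ 1)

    owned≤ : ∀ R → ♯ Owned R ≤ ♯ R
    owned≤ R = #-inj B B (dec (Owned R)) (dec R) (λ r → own r ∸ 2)
      (λ { r _ (_ , u , u<B , u∈R , e) → subst (λ z → (z ∸ 2) < B × (z ∸ 2) ∈ R) (sym e) (u<B , u∈R) })
      (λ { r r′ _ _ (r∈ , u , _ , _ , e) (r′∈ , u′ , _ , _ , e′) q → unique r r′ u r∈ r′∈ e (trans e′ (cong (2 +_) (sym (trans (sym (cong (_∸ 2) e)) (trans q (cong (_∸ 2) e′)))))) })

    ≤owned : ∀ R → R ⊆ Left → ♯ R ≤ ♯ Owned R
    ≤owned R R⊆L = #-inj B B (dec R) (dec (Owned R)) f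
      (λ u u<B u∈R → let (r∈ , e) = f-ok u (R⊆L u u∈R) in bd r∈ , r∈ , u , u<B , u∈R , e)
      (λ u u′ _ _ a a′ q → suc-injective (suc-injective (trans (sym (proj₂ (f-ok u (R⊆L u a)))) (trans (cong own q) (proj₂ (f-ok u′ (R⊆L u′ a′)))))))
      where
      no-p : ∀ u → 2 + u ≢ p
      no-p u refl = contradiction p≤1 λ { (s≤s ()) }
      f : ℕ → ℕ
      f u with dec Left u
      ... | yes l = proj₁ (total u l (no-p u))
      ... | no _ = 0
      f-ok : ∀ u → left u → f u ∈ right Q D × own (f u) ≡ 2 + u
      f-ok u l with dec Left u
      ... | yes l′ = proj₂ (total u l′ (no-p u))
      ... | no ¬l = contradiction l ¬l

    enter : ∀ R {u r} → Q ⊆ R → u < B → u ∈ R → r ∈ right Q D → Adj u r → r ∈ Δ R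
    enter R {u} {r} Q⊆R u<B u∈R ((r∈V , r∉D) , r∉Q) a with dec R r
    ... | yes r∈R = inj₁ (r∈R , r∉Q)
    enter R Q⊆R u<B u∈R ((r∈V , r∉D) , r∉Q) (inj₁ a) | no r∉R = inj₂ (((r∈V , r∉D) , r∉R) , inj₂ (_ , u<B , u∈R , a))
    enter R Q⊆R u<B u∈R ((r∈V , r∉D) , r∉Q) (inj₂ refl) | no r∉R = contradiction u∈R r∉R

    enterQ : ∀ R {r} → Q ⊆ R → r ∈ right Q D → r ∈ Entered Q → r ∈ Δ R
    enterQ R {r} Q⊆R ((r∈V , r∉D) , r∉Q) e with dec R r
    ... | yes r∈R = inj₁ (r∈R , r∉Q)
    ... | no r∉R = inj₂ (((r∈V , r∉D) , r∉R) , [ inj₁ , (λ { (u , l , q , a) → inj₂ (u , l , Q⊆R u q , a) }) ]′ e)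

    owned⊆Δ : ∀ R → Q ⊆ R → ∀ r → r ∈ Owned R ⊎ r ∈ Sourced → r ∈ Δ R
    owned⊆Δ R Q⊆R r (inj₁ (r∈ , u , u<B , u∈R , e)) = enter R Q⊆R u<B u∈R r∈ (proj₂ (owner r u r∈ e))
    owned⊆Δ R Q⊆R r (inj₂ (r∈ , e)) = enterQ R Q⊆R r∈ (source r r∈ e)

    unmarked : ∀ r → r ∈ right Q D → lev r ≡ 0 → r ∈ Sourced ⊎ r ∈ Owned R*
    unmarked r r∈ l≡0 with own r in eq
    ... | 0 = contradiction l≡0 (free r r∈ eq)
    ... | 1 = inj₁ (r∈ , refl)
    ... | suc (suc u) = let (l , a) = owner r u r∈ eq in
      inj₂ (r∈ , u , bd (proj₁ l) , (l , λ { r′ _ (r′∈ , a′ , ne) → back r u r′ r∈ eq a′ r′∈ ne l≡0 }) , refl)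

    R*-unmarked : ∀ {u r} → u ∈ R* → r ∈ right Q D → Adj u r → lev r ≡ 0
    R*-unmarked {u} {r} (_ , h) r∈ a with lev r ≟ 0
    ... | yes e = e
    ... | no ne = contradiction (r∈ , a , ne) (h r (bd r∈))

    Δ-size : ∀ R → Q ⊆ R → Valid R D → ♯ (R ∖ Q) + ♯ frontier R D ≤ ♯ Δ R
    Δ-size R Q⊆R v = #-⊎ B (dec (R ∖ Q)) (dec (frontier R D)) (dec (Δ R)) (λ _ _ → inj₁) (λ _ _ → inj₂)
      (λ { i _ (i∈R , _) ((_ , i∉R) , _) → i∉R i∈R })

    size-Δ : ∀ R → ♯ Δ R ≤ ♯ (R ∖ Q) + ♯ frontier R D
    size-Δ R = #-∪ B (dec (R ∖ Q)) (dec (frontier R D)) (dec (Δ R)) (λ _ _ → id)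

    absorb-≤ : ∀ R → Q ⊆ R → Valid R D → ♯ frontier (R ∪ R*) D ≤ ♯ frontier R D
    absorb-≤ R Q⊆R v = +-cancelˡ-≤ (♯ ((R ∪ R*) ∖ Q)) _ _ (begin
      ♯ ((R ∪ R*) ∖ Q) + ♯ frontier (R ∪ R*) D ≤⟨ Δ-size (R ∪ R*) (λ u q → inj₁ (Q⊆R u q)) (λ { u (inj₁ a) → v u a ; u (inj₂ a) → valid′ u (inj₂ a) }) ⟩
      ♯ Δ (R ∪ R*) ≤⟨ #-∪ B (dec (Δ R)) (dec (Owned (R* ∖ R))) (dec (Δ (R ∪ R*))) (λ r _ → new r) ⟩
      ♯ Δ R + ♯ Owned (R* ∖ R) ≤⟨ +-mono-≤ (size-Δ R) (owned≤ (R* ∖ R)) ⟩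
      (♯ (R ∖ Q) + ♯ frontier R D) + ♯ (R* ∖ R) ≡⟨ +-comm (♯ (R ∖ Q) + ♯ frontier R D) (♯ (R* ∖ R)) ⟩
      ♯ (R* ∖ R) + (♯ (R ∖ Q) + ♯ frontier R D) ≡⟨ sym (+-assoc (♯ (R* ∖ R)) _ _) ⟩
      (♯ (R* ∖ R) + ♯ (R ∖ Q)) + ♯ frontier R D ≤⟨ +-monoˡ-≤ _ (#-⊎ B (dec (R* ∖ R)) (dec (R ∖ Q)) (dec ((R ∪ R*) ∖ Q))
        (λ { i _ (a , b) → inj₂ a , proj₂ (proj₁ (proj₁ a)) }) (λ { i _ (a , b) → inj₁ a , b }) (λ { i _ (_ , b) (a , _) → b a })) ⟩
      ♯ ((R ∪ R*) ∖ Q) + ♯ frontier R D ∎)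
      where
      open ≤-Reasoning
      split : ∀ r → r ∈ right Q D → lev r ≡ 0 → r ∈ Δ R ⊎ r ∈ Owned (R* ∖ R)
      split r r∈ l≡0 with unmarked r r∈ l≡0
      ... | inj₁ s = inj₁ (owned⊆Δ R Q⊆R r (inj₂ s))
      ... | inj₂ (_ , u , u<B , u∈* , e) with dec R u
      ... | yes u∈R = inj₁ (owned⊆Δ R Q⊆R r (inj₁ (r∈ , u , u<B , u∈R , e)))
      ... | no u∉R = inj₂ (r∈ , u , u<B , (u∈* , u∉R) , e)
      new : ∀ r → r ∈ Δ (R ∪ R*) → r ∈ Δ R ⊎ r ∈ Owned (R* ∖ R)
      new r (inj₁ (inj₁ a , b)) = inj₁ (inj₁ (a , b))
      new r (inj₁ (inj₂ a , b)) = split r (proj₁ (proj₁ a)) (R*-unmarked a (proj₁ (proj₁ a)) (inj₂ refl))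
      new r (inj₂ ((rV , r∉) , inj₁ s)) = inj₁ (inj₂ ((rV , r∉ ∘ inj₁) , inj₁ s))
      new r (inj₂ ((rV , r∉) , inj₂ (u , l , inj₁ a , b))) = inj₁ (inj₂ ((rV , r∉ ∘ inj₁) , inj₂ (u , l , a , b)))
      new r (inj₂ ((rV , r∉) , inj₂ (u , l , inj₂ a , b))) = split r r∈ (R*-unmarked a r∈ (inj₁ b))
        where r∈ = rV , λ q → r∉ (inj₁ (Q⊆R r q))

    cut≤sources : ♯ frontier Q′ D ≤ ♯ Sourced
    cut≤sources = +-cancelˡ-≤ (♯ (Q′ ∖ Q)) _ _ (begin
      ♯ (Q′ ∖ Q) + ♯ frontier Q′ D ≤⟨ Δ-size Q′ (λ _ → inj₁) valid′ ⟩
      ♯ Δ Q′ ≤⟨ #-∪ B (dec (Owned R*)) (dec Sourced) (dec (Δ Q′)) (λ r _ → cover r) ⟩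
      ♯ Owned R* + ♯ Sourced ≤⟨ +-monoˡ-≤ _ (≤-trans (owned≤ R*) (#-mono B (dec R*) (dec (Q′ ∖ Q)) (λ { i _ a → inj₂ a , proj₂ (proj₁ (proj₁ a)) }))) ⟩
      ♯ (Q′ ∖ Q) + ♯ Sourced ∎)
      where
      open ≤-Reasoning
      flip : ∀ r → r ∈ right Q D → lev r ≡ 0 → r ∈ Owned R* ⊎ r ∈ Sourced
      flip r r∈ l = [ inj₂ , inj₁ ]′ (unmarked r r∈ l)
      cover : ∀ r → r ∈ Δ Q′ → r ∈ Owned R* ⊎ r ∈ Sourced
      cover r (inj₁ (inj₁ q , nq)) = contradiction q nq
      cover r (inj₁ (inj₂ a , _)) = flip r (proj₁ (proj₁ a)) (R*-unmarked a (proj₁ (proj₁ a)) (inj₂ refl))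
      cover r (inj₂ ((rV , r∉) , e)) = flip r r∈ (reach e)
        where
        r∈ : r ∈ right Q D
        r∈ = rV , r∉ ∘ inj₁
        reach : r ∈ Entered Q′ → lev r ≡ 0
        reach (inj₁ s) = maximal r r∈ (inj₁ s)
        reach (inj₂ (u , l , inj₁ q , a)) = maximal r r∈ (inj₂ (u , l , q , a))
        reach (inj₂ (u , l , inj₂ q , a)) = R*-unmarked q r∈ (inj₁ a)

    beyond : ∀ R → Q ⊆ R → ∀ r → Acc _<_ (lev r) → r ∈ right Q D → lev r ≢ 0 → r ∈ Δ R →
      ∃[ r′ ] r′ ∈ right Q D × r′ ∈ Δ R × ¬ (r′ ∈ Owned R ⊎ r′ ∈ Sourced)
    beyond R Q⊆R r (acc rec) r∈ ne r∈Δ with sound r r∈ ne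
    ... | inj₁ own0 = r , r∈ , r∈Δ , λ
      { (inj₁ (_ , u , _ , _ , e)) → contradiction (trans (sym own0) e) λ ()
      ; (inj₂ (_ , e)) → contradiction (trans (sym own0) e) λ () }
    ... | inj₂ (u , r′ , e , a , r′∈ , ne′ , l<) with dec R u
    ... | yes u∈R = beyond R Q⊆R r′ (rec l<) r′∈ ne′ (enter R Q⊆R (bd (proj₁ (proj₁ (owner r u r∈ e)))) u∈R r′∈ a)
    ... | no u∉R = r , r∈ , r∈Δ , λ
      { (inj₁ (_ , u′ , _ , u′∈R , e′)) → u∉R (subst (_∈ R) (suc-injective (suc-injective (trans (sym e′) e))) u′∈R)
      ; (inj₂ (_ , e′)) → contradiction (trans (sym e′) e) λ () }

    beyond-< : ∀ R → Q ⊆ R → Valid R D → ∀ x → x ∈ R → x ∉ Q′ → ♯ frontier Q′ D < ♯ frontier R D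
    beyond-< R Q⊆R v x x∈R x∉Q′ with any<? B (λ r → dec (right Q D) r ×-dec (A? x r ⊎-dec (x ≟ r)) ×-dec ¬? (lev r ≟ 0))
    ... | no none = contradiction (inj₂ ((x∈ , proj₁ (proj₂ (v x x∈R))) , λ r l h → none (r , l , h))) x∉Q′
      where
      x∈ : x ∈ right Q D
      x∈ = (proj₁ (v x x∈R) , proj₂ (proj₂ (v x x∈R))) , x∉Q′ ∘ inj₁
    ... | yes (r , r<B , r∈ , a , ne) = ≤-<-trans cut≤sources (+-cancelˡ-≤ (♯ (R ∖ Q)) _ _ (begin
      ♯ (R ∖ Q) + suc (♯ Sourced) ≡⟨ +-suc _ _ ⟩
      suc (♯ (R ∖ Q) + ♯ Sourced) ≤⟨ s≤s (+-monoˡ-≤ _ (≤-trans (≤owned (R ∖ Q) (λ u a → ((proj₁ (v u (proj₁ a)) , proj₂ (proj₂ (v u (proj₁ a)))) , proj₂ a) , proj₁ (proj₂ (v u (proj₁ a)))))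
        (#-mono B (dec (Owned (R ∖ Q))) (dec (Owned R)) (λ { i _ (i∈ , u , l , a , e) → i∈ , u , l , proj₁ a , e })))) ⟩
      suc (♯ Owned R + ♯ Sourced) ≤⟨ s≤s (#-⊎ B (dec (Owned R)) (dec Sourced) (dec (Owned R ∪ Sourced)) (λ _ _ → inj₁) (λ _ _ → inj₂)
        (λ { i _ (_ , u , _ , _ , e) (_ , e′) → contradiction (trans (sym e′) e) λ () })) ⟩
      suc (♯ (Owned R ∪ Sourced)) ≤⟨ (let (r′ , r′∈ , r′∈Δ , new) = beyond R Q⊆R r (<-wellFounded _) r∈ ne (enter R Q⊆R (V<B x (proj₁ (v x x∈R))) x∈R r∈ a)
                                      in #-< B (dec (Owned R ∪ Sourced)) (dec (Δ R)) (λ i _ → owned⊆Δ R Q⊆R i) r′ (bd r′∈) r′∈Δ new) ⟩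
      ♯ Δ R ≤⟨ size-Δ R ⟩
      ♯ (R ∖ Q) + ♯ frontier R D ∎))
      where open ≤-Reasoning

module Guide (N : Net) where
  open Cut N

  frontier-mono : ∀ R R′ D D′ → R ⊆ R′ → R′ ⊆ R → D′ ⊆ D → ♯ frontier R D ≤ ♯ frontier R′ D′
  frontier-mono R R′ D D′ f g h = #-mono B (dec (frontier R D)) (dec (frontier R′ D′))
    λ { i _ (((v , nd) , nr) , e) → ((v , nd ∘ h i) , nr ∘ g i) , [ inj₁ , (λ { (u , l , r , a) → inj₂ (u , l , f u r , a) }) ]′ e }

  record Furth (Q D Q₁ : DSet) : Set₁ where
    field
      grows : Q ⊆ Q₁
      valid₁ : Valid Q₁ D
      absorb : ∀ R → Q ⊆ R → Valid R D → ♯ frontier (R ∪ Q₁) D ≤ ♯ frontier R D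
      beyond : ∀ R → Q₁ ⊆ R → Valid R D → ∀ x → x ∈ R → x ∉ Q₁ → ♯ frontier Q₁ D < ♯ frontier R D

  record Active (R₀ : DSet) (c p : ℕ) (Q D : DSet) : Set₁ where
    field
      R : DSet
      l : ℕ
      target : R₀ ⊆ R
      below : Q ⊆ R
      valid : Valid R D
      size : ♯ D + ♯ frontier R D ≤ c
      lower : ∀ R′ → Q ⊆ R′ → Valid R′ D → l ≤ ♯ frontier R′ D
      potential : 2 * ♯ frontier R D ≤ p + l

  record Done (R₀ : DSet) (c : ℕ) (Q D : DSet) : Set where
    field
      closed : ∀ r → r ∉ frontier Q D
      disjoint : ∀ v → v ∈ R₀ → v ∉ D
      size : ♯ D ≤ c

  initial : ∀ R₀ c Q D → Valid R₀ D → (∀ v → v ∉ Q) → (∀ v → v ∉ D) → ♯ frontier R₀ D ≤ c → Active R₀ c (2 * c) Q D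
  initial R₀ c Q D v noQ noD h = record
    { R = R₀ ; l = 0 ; target = λ _ → id ; below = λ u q → contradiction q (noQ u) ; valid = v
    ; size = ≤-trans (≤-reflexive (cong (_+ ♯ frontier R₀ D) (#-0 B (dec D) (λ i _ → noD i)))) h
    ; lower = λ _ _ _ → z≤n ; potential = ≤-trans (*-monoʳ-≤ 2 h) (m≤m+n (2 * c) 0) }

  module _ {R₀ c p Q D Q₁} (act : Active R₀ c p Q D) (fu : Furth Q D Q₁) where
    open Active act
    open Furth fu

    R₁ : DSet
    R₁ = R ∪ Q₁

    validR₁ : Valid R₁ D
    validR₁ v (inj₁ a) = valid v a
    validR₁ v (inj₂ a) = valid₁ v a

    frR₁ : ♯ frontier R₁ D ≤ ♯ frontier R D
    frR₁ = absorb R below valid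

    tight : ∀ R′ → Q₁ ⊆ R′ → Valid R′ D → ♯ frontier Q₁ D ≤ ♯ frontier R′ D
    tight R′ h v with any<? B (λ x → dec R′ x ×-dec ¬? (dec Q₁ x))
    ... | yes (x , _ , x∈ , x∉) = <⇒≤ (beyond R′ h v x x∈ x∉)
    ... | no none = frontier-mono Q₁ R′ D D h (λ u u∈ → case dec Q₁ u of λ
            { (yes q) → q ; (no ¬q) → contradiction (u , V<B u (proj₁ (v u u∈)) , u∈ , ¬q) none }) (λ _ → id)

    potential₁ : 2 * ♯ frontier R₁ D ≤ p + ♯ frontier Q₁ D
    potential₁ = ≤-trans (*-monoʳ-≤ 2 frR₁) (≤-trans potential (+-monoʳ-≤ p (lower Q₁ grows valid₁)))

    size₁ : ♯ D + ♯ frontier R₁ D ≤ c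
    size₁ = ≤-trans (+-monoʳ-≤ (♯ D) frR₁) size

    finish : (∀ r → r ∉ frontier Q₁ D) → Done R₀ c Q₁ D
    finish h = record { closed = h ; disjoint = λ v v∈ → proj₂ (proj₂ (valid v (target v v∈))) ; size = ≤-trans (m≤m+n _ _) size }

    advance : ∀ x → x ∈ frontier Q₁ D → ∃[ p′ ] p ≡ suc p′ ×
      ((x ∉ F × (∀ Q₂ → Q₂ ⊆ Q₁ ∪ ｛ x ｝ → Q₁ ∪ ｛ x ｝ ⊆ Q₂ → Active R₀ c p′ Q₂ D)) ⊎
       (∀ D₂ → D₂ ⊆ D ∪ ｛ x ｝ → D ∪ ｛ x ｝ ⊆ D₂ → Active R₀ c p′ Q₁ D₂))
    advance x x∈@(((x∈V , x∉D) , x∉Q₁) , ent) = go p refl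
      where
      l₁ = ♯ frontier Q₁ D
      f₁ = ♯ frontier R₁ D
      l₁≥1 : 1 ≤ l₁
      l₁≥1 = #-pos B (dec (frontier Q₁ D)) x (V<B x x∈V) x∈
      l₁≤f₁ : l₁ ≤ f₁
      l₁≤f₁ = tight R₁ (λ _ → inj₂) validR₁
      go : ∀ q → p ≡ q → ∃[ p′ ] q ≡ suc p′ × _
      go zero p≡0 = contradiction (≤-trans l₁≥1 (≤-trans l₁≤f₁ f₁≤0)) λ ()
        where
        f₁≤0 : f₁ ≤ 0
        f₁≤0 = +-cancelˡ-≤ f₁ f₁ 0 (≤-trans (≤-reflexive (cong (f₁ +_) (sym (+-identityʳ f₁))))
          (≤-trans potential₁ (≤-trans (≤-reflexive (cong (_+ l₁) p≡0)) (≤-trans l₁≤f₁ (≤-reflexive (sym (+-identityʳ f₁)))))))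
      go (suc p′) p≡ with dec R₁ x
      ... | yes x∈R₁ = p′ , refl , inj₁ (proj₁ (proj₂ (validR₁ x x∈R₁)) , λ Q₂ h g → record
        { R = R₁ ; l = suc l₁ ; target = λ v v∈ → inj₁ (target v v∈)
        ; below = λ u u∈ → [ inj₂ , (λ e → subst (_∈ R₁) (sym e) x∈R₁) ]′ (h u u∈)
        ; valid = validR₁ ; size = size₁
        ; lower = λ R′ h′ v → beyond R′ (λ u u∈ → h′ u (g u (inj₁ u∈))) v x (h′ x (g x (inj₂ refl))) x∉Q₁
        ; potential = ≤-trans potential₁ (≤-reflexive (trans (cong (_+ l₁) p≡) (sym (+-suc p′ l₁)))) })
      ... | no x∉R₁ = p′ , refl , inj₂ λ D₂ h g → record
        { R = R₁ ; l = l₁ ∸ 1 ; target = λ v v∈ → inj₁ (target v v∈) ; below = λ u u∈ → inj₂ u∈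
        ; valid = λ v v∈ → let (a , b , d) = validR₁ v v∈ in a , b , λ d₂ → [ d , (λ { refl → x∉R₁ v∈ }) ]′ (h v d₂)
        ; size = ≤-trans (+-monoˡ-≤ _ (≤-trans (#-∪ B (dec D) (dec ｛ x ｝) (dec D₂) (λ i _ → h i)) (+-monoʳ-≤ (♯ D) (#-one B x))))
          (≤-trans (≤-reflexive (+-assoc (♯ D) 1 _)) (≤-trans (+-monoʳ-≤ (♯ D) (less D₂ h g)) size₁))
        ; lower = λ R′ h′ v → ≤-trans (∸-monoˡ-≤ 1 (≤-trans (tight R′ h′ (λ u u∈ → let (a , b , d) = v u u∈ in a , b , λ e → d (g u (inj₁ e))))
                    (#-∪ B (dec (frontier R′ D₂)) (dec ｛ x ｝) (dec (frontier R′ D)) (λ i _ → part D₂ h R′ i)))) (dec-one D₂ R′)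
        ; potential = pot D₂ h g }
        where
        x∈fr : x ∈ frontier R₁ D
        x∈fr = ((x∈V , x∉D) , x∉R₁) , [ inj₁ , (λ { (u , l , r , a) → inj₂ (u , l , inj₂ r , a) }) ]′ ent
        less : ∀ D₂ → D₂ ⊆ D ∪ ｛ x ｝ → D ∪ ｛ x ｝ ⊆ D₂ → 1 + ♯ frontier R₁ D₂ ≤ f₁
        less D₂ h g = #-< B (dec (frontier R₁ D₂)) (dec (frontier R₁ D))
          (λ { i _ (((a , nd) , nr) , e) → ((a , λ d → nd (g i (inj₁ d))) , nr) , e }) x (V<B x x∈V) x∈fr
          (λ { (((_ , nd) , _) , _) → nd (g x (inj₂ refl)) })
        part : ∀ D₂ → D₂ ⊆ D ∪ ｛ x ｝ → ∀ R′ i → i ∈ frontier R′ D → i ∈ frontier R′ D₂ ⊎ i ≡ x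
        part D₂ h R′ i (((a , nd) , nr) , e) with i ≟ x
        ... | yes p = inj₂ p
        ... | no ¬p = inj₁ (((a , λ d₂ → [ nd , ¬p ]′ (h i d₂)) , nr) , e)
        dec-one : ∀ D₂ R′ → (♯ frontier R′ D₂ + ♯ ｛ x ｝) ∸ 1 ≤ ♯ frontier R′ D₂
        dec-one D₂ R′ = ≤-trans (∸-monoˡ-≤ 1 (+-monoʳ-≤ (♯ frontier R′ D₂) (#-one B x))) (≤-reflexive (m+n∸n≡m _ 1))
        pot : ∀ D₂ → D₂ ⊆ D ∪ ｛ x ｝ → D ∪ ｛ x ｝ ⊆ D₂ → 2 * ♯ frontier R₁ D₂ ≤ p′ + (l₁ ∸ 1)
        pot D₂ h g = +-cancelˡ-≤ 2 _ _ (begin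
          2 + 2 * ♯ frontier R₁ D₂ ≡⟨ eq₁ (♯ frontier R₁ D₂) ⟩
          2 * (1 + ♯ frontier R₁ D₂) ≤⟨ *-monoʳ-≤ 2 (less D₂ h g) ⟩
          2 * f₁ ≤⟨ potential₁ ⟩
          p + l₁ ≡⟨ cong₂ _+_ p≡ (sym (m+[n∸m]≡n l₁≥1)) ⟩
          suc p′ + (1 + (l₁ ∸ 1)) ≡⟨ cong suc (+-suc p′ (l₁ ∸ 1)) ⟩
          2 + (p′ + (l₁ ∸ 1)) ∎)
          where
          open ≤-Reasoning
          eq₁ : ∀ a → 2 + 2 * a ≡ 2 * (1 + a)
          eq₁ a = sym (*-distribˡ-+ 2 1 a)

  active-≈ : ∀ {R₀ c p} Q Q′ D D′ → Q ⊆ Q′ → Q′ ⊆ Q → D ⊆ D′ → D′ ⊆ D → Active R₀ c p Q D → Active R₀ c p Q′ D′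
  active-≈ {p = p} Q Q′ D D′ q q′ d d′ act = record
    { R = R ; l = l ; target = target ; below = λ v v∈ → below v (q′ v v∈)
    ; valid = λ v v∈ → let (a , b , e) = valid v v∈ in a , b , e ∘ d′ v
    ; size = ≤-trans (+-mono-≤ (#-mono B (dec D′) (dec D) (λ i _ → d′ i)) (frontier-mono R R D′ D (λ _ → id) (λ _ → id) d)) size
    ; lower = λ R′ h v → ≤-trans (lower R′ (λ u u∈ → h u (q u u∈)) (λ u u∈ → let (a , b , e) = v u u∈ in a , b , e ∘ d u))
                                  (frontier-mono R′ R′ D D′ (λ _ → id) (λ _ → id) d′)
    ; potential = ≤-trans (*-monoʳ-≤ 2 (frontier-mono R R D′ D (λ _ → id) (λ _ → id) d)) potential }
    where open Active act

  done-step : ∀ {R₀ c Q D Q₁} → Valid Q D → Done R₀ c Q D → Furth Q D Q₁ → Done R₀ c Q₁ D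
  done-step {Q = Q} {D} {Q₁} v d fu = record { closed = no-fr ; disjoint = Done.disjoint d ; size = Done.size d }
    where
    open Furth fu
    no-fr : ∀ r → r ∉ frontier Q₁ D
    no-fr r r∈ = 0-# B (dec (frontier Q₁ D)) (n≤0⇒n≡0 (begin
      ♯ frontier Q₁ D ≤⟨ frontier-mono Q₁ (Q ∪ Q₁) D D (λ _ → inj₂) (λ u → [ grows u , id ]′) (λ _ → id) ⟩
      ♯ frontier (Q ∪ Q₁) D ≤⟨ absorb Q (λ _ → id) v ⟩
      ♯ frontier Q D ≡⟨ #-0 B (dec (frontier Q D)) (λ i _ → Done.closed d i) ⟩
      0 ∎)) r (V<B r (proj₁ (proj₁ (proj₁ r∈)))) r∈
      where open ≤-Reasoning

  furth : ∀ {Q D own lev p Q₁} (M : Matching Q D own p) (p≤1 : p ≤ 1) (L : Levels Q D own lev) (valid : Valid Q D)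
    (maximal : ∀ r → r ∈ right Q D → r ∈ Entered Q → lev r ≡ 0) →
    Q₁ ⊆ Furthest.Q′ M p≤1 L valid maximal → Furthest.Q′ M p≤1 L valid maximal ⊆ Q₁ → Furth Q D Q₁
  furth {Q} {D} {Q₁ = Q₁} M p≤1 L valid maximal h g = record
    { grows = λ v q → g v (inj₁ q)
    ; valid₁ = λ v q → valid′ v (h v q)
    ; absorb = λ R Q⊆R vR → ≤-trans (frontier-mono (R ∪ Q₁) (R ∪ R*) D D
      (λ v → [ inj₁ , (λ q → [ inj₁ ∘ Q⊆R v , inj₂ ]′ (h v q)) ]′) (λ v → [ inj₁ , inj₂ ∘ g v ∘ inj₂ ]′) (λ _ → id)) (absorb-≤ R Q⊆R vR)
    ; beyond = λ R Q₁⊆R vR x x∈ x∉ → ≤-<-trans (frontier-mono Q₁ Q′ D D h g (λ _ → id))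
      (beyond-< R (λ v q → Q₁⊆R v (g v (inj₁ q))) vR x x∈ (x∉ ∘ g x)) }
    where open Furthest M p≤1 L valid maximal

disjoint : Names → Cm → Bool
disjoint K (a [ x ]:= t) = not (K a)
disjoint K (c ﹔ d) = disjoint K c ∧ disjoint K d
disjoint K (for x c) = disjoint K c

-- Formulas, their translation to terms (nonzero for true) and their meaning

infix 5 _≺_ _≐_ _∋_
infixr 4 _&_
infixr 3 _∥_

data Fm : Set where
  _≺_ _≐_ : Tm → Tm → Fm
  _∋_ : ℕ → Tm → Fm
  _&_ _∥_ : Fm → Fm → Fm
  ~_ : Fm → Fm
  ∃̇[_]_ : ℕ → Fm → Fm

tm : Fm → Tm
tm (s ≺ t) = t ⊟ s
tm (s ≐ t) = ifz (s ⊟ t) (ifz (t ⊟ s) (lit 1) (lit 0)) (lit 0)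
tm (a ∋ t) = a ! t
tm (φ & ψ) = ifz (tm φ) (lit 0) (tm ψ)
tm (φ ∥ ψ) = ifz (tm φ) (tm ψ) (lit 1)
tm (~ φ) = ifz (tm φ) (lit 1) (lit 0)
tm (∃̇[ x ] φ) = Σ[ x ] tm φ

find : ℕ → ℕ → (ℕ → Fm) → Tm
find x y φ = Σ[ x ] ifz (Σ[ y ] tm ((var y ≺ var x ⊞ lit 1) & φ y)) (lit 1) (lit 0)

module _ (B : ℕ) where

  ⟦_⟧ : Fm → Env → Mem → Set
  ⟦ s ≺ t ⟧ ρ σ = eval B ρ σ s < eval B ρ σ t
  ⟦ s ≐ t ⟧ ρ σ = eval B ρ σ s ≡ eval B ρ σ t
  ⟦ a ∋ t ⟧ ρ σ = eval B ρ σ t < B × σ a (eval B ρ σ t) ≢ 0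
  ⟦ φ & ψ ⟧ ρ σ = ⟦ φ ⟧ ρ σ × ⟦ ψ ⟧ ρ σ
  ⟦ φ ∥ ψ ⟧ ρ σ = ⟦ φ ⟧ ρ σ ⊎ ⟦ ψ ⟧ ρ σ
  ⟦ ~ φ ⟧ ρ σ = ¬ ⟦ φ ⟧ ρ σ
  ⟦ ∃̇[ x ] φ ⟧ ρ σ = ∃[ i ] i < B × ⟦ φ ⟧ (upd ρ x i) σ

  at-< : ∀ (f : ℕ → ℕ) {i} → i < B → at B f i ≡ f i
  at-< f {i} i<B with B ∸ i in eq
  ... | zero = contradiction (m<n⇒0<n∸m i<B) (λ h → contradiction (subst (0 <_) eq h) λ ())
  ... | suc _ = refl

  at-≢0 : ∀ (f : ℕ → ℕ) i → at B f i ≢ 0 → i < B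
  at-≢0 f i ne with i <? B
  ... | yes l = l
  ... | no ¬l = contradiction (cong (λ d → cond d 0 (f i)) (m≤n⇒m∸n≡0 (≮⇒≥ ¬l))) ne

  holds fails : Fm → Env → Mem → Set
  holds φ ρ σ = eval B ρ σ (tm φ) ≢ 0
  fails φ ρ σ = eval B ρ σ (tm φ) ≡ 0

  sound : ∀ φ {ρ σ} → holds φ ρ σ → ⟦ φ ⟧ ρ σ
  complete : ∀ φ {ρ σ} → ⟦ φ ⟧ ρ σ → holds φ ρ σ

  sound (s ≺ t) {ρ} {σ} h with eval B ρ σ s <? eval B ρ σ t
  ... | yes l = l
  ... | no ¬l = contradiction (m≤n⇒m∸n≡0 (≮⇒≥ ¬l)) h
  sound (s ≐ t) {ρ} {σ} h with eval B ρ σ s ∸ eval B ρ σ t in e₁ | eval B ρ σ t ∸ eval B ρ σ s in e₂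
  ... | zero | zero = ≤-antisym (m∸n≡0⇒m≤n e₁) (m∸n≡0⇒m≤n e₂)
  ... | zero | suc _ = contradiction refl h
  ... | suc _ | _ = contradiction refl h
  sound (a ∋ t) {ρ} {σ} h = i<B , λ e → h (trans (at-< (σ a) i<B) e)
    where i<B = at-≢0 (σ a) (eval B ρ σ t) h
  sound (φ & ψ) {ρ} {σ} h with eval B ρ σ (tm φ) in e
  ... | zero = contradiction refl h
  ... | suc _ = sound φ (λ z → contradiction (trans (sym e) z) λ ()) , sound ψ h
  sound (φ ∥ ψ) {ρ} {σ} h with eval B ρ σ (tm φ) in e
  ... | zero = inj₂ (sound ψ h)
  ... | suc _ = inj₁ (sound φ (λ z → contradiction (trans (sym e) z) λ ()))
  sound (~ φ) {ρ} {σ} h p with eval B ρ σ (tm φ) | complete φ p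
  ... | zero | q = q refl
  ... | suc _ | q = h refl
  sound (∃̇[ x ] φ) {ρ} {σ} h = let (i , i<B , q) = sum≢0 B _ h in i , i<B , sound φ q

  complete (s ≺ t) l e = <⇒≱ l (m∸n≡0⇒m≤n e)
  complete (s ≐ t) {ρ} {σ} p e with eval B ρ σ s | p
  ... | v | refl rewrite n∸n≡0 (eval B ρ σ t) = contradiction e λ ()
  complete (a ∋ t) {ρ} {σ} (l , ne) e = ne (trans (sym (at-< (σ a) l)) e)
  complete (φ & ψ) {ρ} {σ} (p , q) e with eval B ρ σ (tm φ) | complete φ p
  ... | zero | ne = ne refl
  ... | suc _ | _ = complete ψ q e
  complete (φ ∥ ψ) {ρ} {σ} p e with eval B ρ σ (tm φ) in eq
  ... | suc _ = contradiction e λ ()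
  ... | zero = [ (λ q → complete φ q eq) , (λ q → complete ψ q e) ]′ p
  complete (~ φ) {ρ} {σ} p e with eval B ρ σ (tm φ) in eq
  ... | zero = contradiction e λ ()
  ... | suc _ = p (sound φ (λ z → contradiction (trans (sym eq) z) λ ()))
  complete (∃̇[ x ] φ) {ρ} {σ} (i , i<B , p) e =
    complete φ p (n≤0⇒n≡0 (≤-trans (term≤sum B _ i i<B) (≤-reflexive e)))

  decide : ∀ φ ρ σ → Dec (⟦ φ ⟧ ρ σ)
  decide φ ρ σ = map′ (sound φ) (complete φ) (¬? (eval B ρ σ (tm φ) ≟ 0))

  if-true : ∀ φ {ρ σ} (a b : ℕ) → ⟦ φ ⟧ ρ σ → cond (eval B ρ σ (tm φ)) a b ≡ b
  if-true φ {ρ} {σ} a b p with eval B ρ σ (tm φ) | complete φ p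
  ... | zero | ne = contradiction refl ne
  ... | suc _ | _ = refl

  if-false : ∀ φ {ρ σ} (a b : ℕ) → ¬ ⟦ φ ⟧ ρ σ → cond (eval B ρ σ (tm φ)) a b ≡ a
  if-false φ {ρ} {σ} a b ¬p with eval B ρ σ (tm φ) in e
  ... | zero = refl
  ... | suc _ = contradiction (sound φ (λ z → contradiction (trans (sym e) z) λ ())) ¬p

  transfer : ∀ φ {Γ K ρ ρ′ σ σ′} → okTm Γ (tm φ) ≡ true → reads K (tm φ) ≡ true → Agree B Γ ρ ρ′ → Same B K σ σ′ → ⟦ φ ⟧ ρ σ → ⟦ φ ⟧ ρ′ σ′
  transfer φ g ok E S p = sound φ λ z → complete φ p (trans (eval-same B (tm φ) g ok E S) z)

  least : (P : ℕ → Set) (h : ℕ → ℕ) → (∀ i → i < B → (∃[ j ] j ≤ i × P j) → h i ≡ 0) →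
    (∀ i → i < B → ¬ (∃[ j ] j ≤ i × P j) → h i ≡ 1) → (∀ i → Dec (P i)) →
    (sum B h ≡ B × (∀ j → j < B → ¬ P j)) ⊎ (sum B h < B × P (sum B h))
  least P h h0 h1 P? = [ inj₁ , (λ { (m , m<B , e , p) → inj₂ (subst (_< B) (sym e) m<B , subst P (sym e) p) }) ]′ (go B ≤-refl)
    where
    go : ∀ c → c ≤ B → (sum c h ≡ c × (∀ j → j < c → ¬ P j)) ⊎ (∃[ m ] m < c × sum c h ≡ m × P m)
    go zero _ = inj₁ (refl , λ j ())
    go (suc c) c<B with go c (<⇒≤ c<B)
    ... | inj₂ (m , m<c , e , p) = inj₂ (m , m<n⇒m<1+n m<c , trans (cong₂ _+_ e (h0 c c<B (m , <⇒≤ m<c , p))) (+-identityʳ m) , p)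
    ... | inj₁ (e , none) with P? c
    ... | yes p = inj₂ (c , ≤-refl , trans (cong₂ _+_ e (h0 c c<B (c , ≤-refl , p))) (+-identityʳ c) , p)
    ... | no ¬p = inj₁ (trans (cong₂ _+_ e (h1 c c<B λ { (j , j≤c , p) → none′ j (s≤s j≤c) p })) (+-comm c 1) , none′)
      where
      none′ : ∀ j → j < suc c → ¬ P j
      none′ j l p with m<1+n⇒m<n∨m≡n l
      ... | inj₁ j<c = none j j<c p
      ... | inj₂ refl = ¬p p

  find-ok : ∀ x y φ {ρ σ} → x ≢ y → (P : ℕ → Set) →
    (∀ i j → j < B → ⟦ φ y ⟧ (upd (upd ρ x i) y j) σ → P j) →
    (∀ i j → j < B → P j → ⟦ φ y ⟧ (upd (upd ρ x i) y j) σ) → (∀ i → Dec (P i)) →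
    (let m = eval B ρ σ (find x y φ) in (m ≡ B × (∀ j → j < B → ¬ P j)) ⊎ (m < B × P m))
  find-ok x y φ {ρ} {σ} x≢y P to from P? = least P _
    (λ i i<B (j , j≤i , p) → if-true (∃̇[ y ] ((var y ≺ var x ⊞ lit 1) & φ y)) {upd ρ x i} {σ} 1 0 (j , ≤-<-trans j≤i i<B , less i j j≤i , from i j (≤-<-trans j≤i i<B) p))
    (λ i i<B none → if-false (∃̇[ y ] ((var y ≺ var x ⊞ lit 1) & φ y)) {upd ρ x i} {σ} 1 0 λ { (j , j<B , l , q) → none (j , unless i j l , to i j j<B q) })
    P?
    where
    ex : ∀ i j → upd (upd ρ x i) y j x ≡ i
    ex i j = trans (upd-≢ (upd ρ x i) {y} {x} j (λ e → x≢y (sym e))) (upd-≡ ρ x i)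
    less : ∀ i j → j ≤ i → upd (upd ρ x i) y j y < upd (upd ρ x i) y j x + 1
    less i j l = subst (_< upd (upd ρ x i) y j x + 1) (sym (upd-≡ (upd ρ x i) y j))
      (≤-trans (s≤s l) (≤-reflexive (trans (+-comm 1 i) (cong (_+ 1) (sym (ex i j))))))
    unless : ∀ i j → upd (upd ρ x i) y j y < upd (upd ρ x i) y j x + 1 → j ≤ i
    unless i j l = s≤s⁻¹ (≤-trans (≤-reflexive (cong suc (sym (upd-≡ (upd ρ x i) y j)))) (≤-trans l (≤-reflexive (trans (+-comm _ 1) (cong suc (ex i j))))))

  ⟪_⟫ : (ℕ → ℕ) → DSet
  El ⟪ f ⟫ v = v < B × f v ≢ 0
  dec ⟪ f ⟫ v = (v <? B) ×-dec ¬? (f v ≟ 0)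

  fixpoint : (N C : ℕ → ℕ → Set) → (∀ j v → Dec (N j v)) → (∀ j v → Dec (C j v)) →
    (∀ j v → v < B → N j v ⊎ C j v → N (suc j) v) →
    (∀ j v → v < B → N (suc j) v → N j v ⊎ C j v) →
    (∀ j → (∀ v → v < B → N (suc j) v → N j v) → ∀ v → v < B → C (suc j) v → C j v) →
    ∀ v → v < B → C B v → N B v
  fixpoint N C N? C? grow only back v v<B c = case go B of λ
      { (inj₂ cl) → cl v v<B c
      ; (inj₁ full) → case N? B v of λ
          { (yes n) → n
          ; (no ¬n) → contradiction (≤-<-trans full (<-≤-trans (#-< B (N? B) (λ i → i <? B) (λ i l _ → l) v v<B v<B ¬n) (#-≤ B (λ i → i <? B)))) (<-irrefl refl) } }
    where
    go : ∀ j → j ≤ # B (N? j) ⊎ (∀ v → v < B → C j v → N j v)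
    go zero = inj₁ z≤n
    go (suc j) with any<? B (λ v → C? j v ×-dec ¬? (N? j v))
    ... | no none = inj₂ λ v v<B c → grow j v v<B (inj₂ (back j (λ v v<B n → [ id , closed v v<B ]′ (only j v v<B n)) v v<B c))
      where
      closed : ∀ v → v < B → C j v → N j v
      closed v v<B c = case N? j v of λ { (yes n) → n ; (no ¬n) → contradiction (v , v<B , c , ¬n) none }
    ... | yes (v , v<B , c , ¬n) with go j
    ... | inj₁ h = inj₁ (≤-<-trans h (#-< B (N? j) (N? (suc j)) (λ i l n → grow j i l (inj₁ n)) v v<B (grow j v v<B (inj₂ c)) ¬n))
    ... | inj₂ cl = contradiction (cl v v<B c) ¬n

contains : Names → List ℕ → Bool
contains K [] = true
contains K (a ∷ as) = K a ∧ contains K as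

among : List ℕ → Names
among = foldr (λ a K → upd K a true) (λ _ → false)

module _ (B : ℕ) where

  same-nil : ∀ {σ σ′} → Same B (among []) σ σ′
  same-nil a ()

  same-cons : ∀ {a as σ σ′} → (∀ i → i < B → σ a i ≡ σ′ a i) → Same B (among as) σ σ′ → Same B (among (a ∷ as)) σ σ′
  same-cons {a} h S b kb with a ≡ᵇ b | ≡ᵇ⇒≡ a b
  ... | true | e with e tt
  ... | refl = h
  same-cons {a} h S b kb | false | _ = S b kb

  same-sym : ∀ {K σ σ′} → Same B K σ σ′ → Same B K σ′ σ
  same-sym S a k i l = sym (S a k i l)

  same-trans : ∀ {K σ σ′ σ″} → Same B K σ σ′ → Same B K σ′ σ″ → Same B K σ σ″
  same-trans S S′ a k i l = trans (S a k i l) (S′ a k i l)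

  same-⊆ : ∀ {as : List ℕ} {K σ σ′} → contains K as ≡ true → Same B K σ σ′ → Same B (among as) σ σ′
  same-⊆ {[]} e S a ()
  same-⊆ {a ∷ as} {K} e S = same-cons {a} {as} (S a (∧-trueˡ e)) (same-⊆ {as} (∧-trueʳ {K a} e) S)

  keepSame : ∀ {K} ρ c σ → disjoint K c ≡ true → Same B K σ (exec B ρ c σ)
  keepSame {K} ρ (a [ x ]:= t) σ d b kb i l with a ≡ᵇ b | ≡ᵇ⇒≡ a b
  ... | true  | e = case trans (sym (not-false d)) (trans (cong K (e tt)) kb) of λ ()
  ... | false | _ = refl
  keepSame {K} ρ (c ﹔ c′) σ d = same-trans (keepSame ρ c σ (∧-trueˡ d)) (keepSame ρ c′ _ (∧-trueʳ {disjoint K c} d))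
  keepSame {K} ρ (for x c) σ d = go B
    where
    go : ∀ b → Same B K σ (iter b (λ i → exec B (upd ρ x i) c) σ)
    go zero a k i l = refl
    go (suc b) = same-trans (go b) (keepSame (upd ρ x b) c _ d)

INP gV gS gF gQ gD gB gbit own lev cur pend tmp gx MM TT : ℕ
INP = 1 ; gV = 2 ; gS = 3 ; gF = 4 ; gQ = 5 ; gD = 6 ; gB = 7 ; gbit = 8
own = 9 ; lev = 10 ; cur = 11 ; pend = 12 ; tmp = 13 ; gx = 14 ; MM = 15 ; TT = 16

mulT : ℕ → Tm → Tm → Tm
mulT x s t = Σ[ x ] ifz (s ⊟ var x) (lit 0) t

mulN : Tm → Tm
mulN t = mulT 40 t (var 0)

-- Vertices are 0 … n − 1; the ghost of v is n + v.  There is an arc from a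
-- terminal u to the ghost of v if the matrix MM says so.
edgeF arcF : ℕ → ℕ → Fm
edgeF u v = INP ∋ (var 0 ⊞ mulN (var u) ⊞ var v)
arcF u v = var u ≺ var 0 &
  ((var v ≺ var 0 & edgeF u v) ∥
   (~ (var v ≺ var 0) & var v ≺ var 0 ⊞ var 0 & TT ∋ var u & MM ∋ (mulN (var u) ⊞ (var v ⊟ var 0))))

rightF leftF enteredF : ℕ → Fm
rightF r = (gV ∋ var r & ~ (gD ∋ var r)) & ~ (gQ ∋ var r)
leftF u = rightF u & ~ (gF ∋ var u)
enteredF r = gS ∋ var r ∥ ∃̇[ 41 ] (gQ ∋ var 41 & arcF 41 r)

adjF : ℕ → ℕ → Fm
adjF u r = arcF u r ∥ var u ≐ var r

initC levC startC walkC augC furthC : Cm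
initC = own [ 21 ]:= ifz (tm (leftF 21)) (lit 0) (lit 2 ⊞ var 21)

levF : Fm
levF = rightF 21 & (own ! var 21 ≐ lit 0 ∥
  ∃̇[ 23 ] (own ! var 21 ≐ lit 2 ⊞ var 23 & ∃̇[ 24 ] (adjF 23 24 & rightF 24 & lev ∋ var 24)))

levC = lev [ 21 ]:= lit 0 ﹔
  for 22 (lev [ 21 ]:= ifz (lev ! var 21) (ifz (tm levF) (lit 0) (var 22 ⊞ lit 1)) (lev ! var 21))

startF nextF : ℕ → Fm
startF r = rightF r & enteredF r & lev ∋ var r
nextF r = rightF r & ∃̇[ 23 ] (tmp ! lit 0 ≐ lit 2 ⊞ var 23 & adjF 23 r) & lev ∋ var r & lev ! var r ≺ lev ! (cur ! lit 0)

startC = pend [ 21 ]:= lit 1 ﹔ cur [ 21 ]:= find 25 24 startF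

-- Reassigns the current vertex cur to pend, makes its former owner tmp the
-- pending one and steps to a vertex of lower level; cur ≥ B means stop.
walkC = tmp [ 21 ]:= own ! (cur ! lit 0) ﹔
  own [ 21 ]:= ifz (tm (var 21 ≐ cur ! lit 0)) (own ! var 21) (pend ! lit 0) ﹔
  pend [ 21 ]:= ifz (var 2 ⊟ cur ! lit 0) (pend ! lit 0) (tmp ! lit 0) ﹔
  cur [ 21 ]:= find 25 24 nextF

augC = levC ﹔ startC ﹔ for 27 walkC

furthC = initC ﹔ for 26 augC ﹔ levC ﹔
  gQ [ 21 ]:= tm (gQ ∋ var 21 ∥ leftF 21 & ~ (∃̇[ 24 ] (rightF 24 & adjF 21 24 & lev ∋ var 24)))

record View : Set where
  constructor view
  field vV vS vF vQ vD vI vT vM : ℕ → ℕ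
open View

viewOf : Mem → View
viewOf s = view (s gV) (s gS) (s gF) (s gQ) (s gD) (s INP) (s TT) (s MM)

view≡ : ∀ (s s′ : Mem) → s′ gV ≡ s gV → s′ gS ≡ s gS → s′ gF ≡ s gF → s′ gQ ≡ s gQ → s′ gD ≡ s gD →
  s′ INP ≡ s INP → s′ TT ≡ s TT → s′ MM ≡ s MM → viewOf s′ ≡ viewOf s
view≡ s s′ a b c d e f g h rewrite a | b | c | d | e | f | g | h = refl

keepsView : Cm → Bool
keepsView c = not (writes c gV ∨ writes c gS ∨ writes c gF ∨ writes c gQ ∨ writes c gD ∨ writes c INP ∨ writes c TT ∨ writes c MM)

view-frame : ∀ B ρ c s → keepsView c ≡ true → viewOf (exec B ρ c s) ≡ viewOf s
view-frame B ρ c s h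
  with writes c gV in e₁ | writes c gS in e₂ | writes c gF in e₃ | writes c gQ in e₄ | writes c gD in e₅ | writes c INP in e₆ | writes c TT in e₇ | writes c MM in e₈
... | false | false | false | false | false | false | false | false =
  view≡ s (exec B ρ c s) (frame B ρ c s gV e₁) (frame B ρ c s gS e₂) (frame B ρ c s gF e₃) (frame B ρ c s gQ e₄) (frame B ρ c s gD e₅) (frame B ρ c s INP e₆) (frame B ρ c s TT e₇) (frame B ρ c s MM e₈)

module Guided (B n : ℕ) where

  mul : ℕ → ℕ
  mul u = sum B (λ i → cond (u ∸ i) 0 n)

  Cell : (ℕ → ℕ) → ℕ → Set
  Cell f i = i < B × f i ≢ 0

  Arc : (I T M : ℕ → ℕ) → ℕ → ℕ → Set
  Arc I T M u v = u < n × ((v < n × Cell I (n + mul u + v)) ⊎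
    (¬ (v < n) × v < n + n × Cell T u × Cell M (mul u + (v ∸ n))))

  Cell? : ∀ f i → Dec (Cell f i)
  Cell? f i = (i <? B) ×-dec ¬? (f i ≟ 0)

  Arc? : ∀ I T M u v → Dec (Arc I T M u v)
  Arc? I T M u v = (u <? n) ×-dec (((v <? n) ×-dec Cell? I _) ⊎-dec (¬? (v <? n) ×-dec ((v <? n + n) ×-dec Cell? T _ ×-dec Cell? M _)))

  net : View → Net
  net w = record { B = B ; V = ⟪ B ⟫ (vV w) ; S = ⟪ B ⟫ (vS w) ; F = ⟪ B ⟫ (vF w) ; A = Arc (vI w) (vT w) (vM w)
    ; A? = Arc? (vI w) (vT w) (vM w) ; V<B = λ v → proj₁ }

  Qof Dof : View → DSet
  Qof w = ⟪ B ⟫ (vQ w)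
  Dof w = ⟪ B ⟫ (vD w)

  module C (w : View) = Cut (net w)
  module G (w : View) = Guide (net w)

  Right : View → DSet
  Right w = C.right w (Qof w) (Dof w)

  Levels : View → (ℕ → ℕ) → (ℕ → ℕ) → Set
  Levels w = C.Levels w (Qof w) (Dof w)

  Matching : View → (ℕ → ℕ) → ℕ → Set
  Matching w = C.Matching w (Qof w) (Dof w)

  Cond : View → (ℕ → ℕ) → (ℕ → ℕ) → ℕ → Set
  Cond w o l r = r ∈ Right w × (at B o r ≡ 0 ⊎
    ∃[ u ] u < B × at B o r ≡ 2 + u × ∃[ r′ ] r′ < B × C.Adj w u r′ × r′ ∈ Right w × Cell l r′)

  levBody : Cm
  levBody = lev [ 21 ]:= ifz (lev ! var 21) (ifz (tm levF) (lit 0) (var 22 ⊞ lit 1)) (lev ! var 21)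


  Cond? : ∀ w o l r → Dec (Cond w o l r)
  Cond? w o l r = dec (Right w) r ×-dec ((at B o r ≟ 0) ⊎-dec any<? B (λ u → (at B o r ≟ 2 + u) ×-dec
    any<? B (λ r′ → (Arc? (vI w) (vT w) (vM w) u r′ ⊎-dec (u ≟ r′)) ×-dec dec (Right w) r′ ×-dec Cell? l r′)))

  Cond-mono : ∀ w o l l′ r → (∀ v → v < B → Cell l v → Cell l′ v) → Cond w o l r → Cond w o l′ r
  Cond-mono w o l l′ r h (r∈ , inj₁ e) = r∈ , inj₁ e
  Cond-mono w o l l′ r h (r∈ , inj₂ (u , u<B , e , r′ , r′<B , a , r′∈ , c)) = r∈ , inj₂ (u , u<B , e , r′ , r′<B , a , r′∈ , h r′ r′<B c)

  record LevSeq (w : View) (o : ℕ → ℕ) (L : ℕ → ℕ → ℕ) : Set where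
    field
      start : ∀ r → L 0 r ≡ 0
      old : ∀ j r → r < B → L j r ≢ 0 → L (suc j) r ≡ L j r
      new : ∀ j r → r < B → L j r ≡ 0 → Cond w o (L j) r → L (suc j) r ≡ suc j
      stay : ∀ j r → r < B → L j r ≡ 0 → ¬ Cond w o (L j) r → L (suc j) r ≡ 0

    bounded : ∀ j r → r < B → L j r ≤ j
    bounded zero r r<B = ≤-reflexive (start r)
    bounded (suc j) r r<B with L j r ≟ 0
    ... | no ne = ≤-trans (≤-reflexive (old j r r<B ne)) (≤-trans (bounded j r r<B) (n≤1+n j))
    ... | yes e with Cond? w o (L j) r
    ... | yes c = ≤-reflexive (new j r r<B e c)
    ... | no ¬c = ≤-trans (≤-reflexive (stay j r r<B e ¬c)) z≤n

    descends : ∀ j r → r ∈ Right w → L j r ≢ 0 →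
      at B o r ≡ 0 ⊎ ∃[ u ] ∃[ r′ ] at B o r ≡ 2 + u × C.Adj w u r′ × r′ ∈ Right w × L j r′ ≢ 0 × L j r′ < L j r
    descends zero r r∈ ne = contradiction (start r) ne
    descends (suc j) r r∈@(((r<B , _) , _) , _) ne with L j r ≟ 0
    ... | no ne₀ = [ inj₁ , (λ { (u , r′ , e , a , r′∈ , ne′ , l<) → inj₂ (u , r′ , e , a , r′∈ ,
      (λ z → ne′ (trans (sym (old j r′ (proj₁ (proj₁ (proj₁ r′∈))) ne′)) z)) ,
      subst (_< L (suc j) r) (sym (old j r′ (proj₁ (proj₁ (proj₁ r′∈))) ne′)) (subst (L j r′ <_) (sym (old j r r<B ne₀)) l<)) }) ]′ (descends j r r∈ ne₀)
    ... | yes e₀ with Cond? w o (L j) r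
    ... | no ¬c = contradiction (stay j r r<B e₀ ¬c) ne
    ... | yes c@(_ , inj₁ e) = inj₁ e
    ... | yes c@(_ , inj₂ (u , _ , e , r′ , r′<B , a , r′∈ , (_ , ne′))) = inj₂ (u , r′ , e , a , r′∈ ,
      (λ z → ne′ (trans (sym (old j r′ r′<B ne′)) z)) ,
      subst (_< L (suc j) r) (sym (old j r′ r′<B ne′)) (≤-<-trans (bounded j r′ r′<B) (≤-reflexive (sym (new j r r<B e₀ c)))))

    saturated : ∀ r → r < B → Cond w o (L B) r → Cell (L B) r
    saturated = fixpoint B (λ j r → Cell (L j) r) (λ j r → Cond w o (L j) r) (λ j → Cell? (L j)) (λ j → Cond? w o (L j))
      (λ { j r r<B (inj₁ (l , ne)) → l , λ z → ne (trans (sym (old j r r<B ne)) z)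
        ; j r r<B (inj₂ c) → r<B , (case L j r ≟ 0 of λ
            { (no ne) → λ z → ne (trans (sym (old j r r<B ne)) z)
            ; (yes e) → λ z → contradiction (trans (sym z) (new j r r<B e c)) λ () }) })
      (λ j r r<B (_ , ne) → case L j r ≟ 0 of λ
         { (no ne₀) → inj₁ (r<B , ne₀)
         ; (yes e) → case Cond? w o (L j) r of λ { (yes c) → inj₂ c ; (no ¬c) → contradiction (stay j r r<B e ¬c) ne } })
      (λ j h r r<B c → Cond-mono w o (L (suc j)) (L j) r h c)

    levels : ∀ {p} → Matching w o p → Levels w o (L B)
    levels M = record
      { free = λ r r∈ e → proj₂ (saturated r (bd r∈) (r∈ , inj₁ (trans (at-< B o (bd r∈)) e)))
      ; back = λ r u r′ r∈ e a r′∈ ne → proj₂ (saturated r (bd r∈) (r∈ , inj₂ (u , bd (proj₁ (proj₁ (C.Matching.owner {w} M r u r∈ e))) ,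
        trans (at-< B o (bd r∈)) e , r′ , bd r′∈ , a , r′∈ , (bd r′∈ , ne))))
      ; sound = λ r r∈ ne → [ (λ e → inj₁ (trans (sym (at-< B o (bd r∈))) e)) ,
        (λ { (u , r′ , e , h) → inj₂ (u , r′ , trans (sym (at-< B o (bd r∈))) e , h) }) ]′ (descends B r r∈ ne) }
      where
      bd : ∀ {r} → r ∈ Right w → r < B
      bd (((r<B , _) , _) , _) = r<B

  Sourced : View → (ℕ → ℕ) → DSet
  El (Sourced w o) r = r ∈ Right w × o r ≡ 1
  dec (Sourced w o) r = dec (Right w) r ×-dec (o r ≟ 1)

  Maximal : View → (ℕ → ℕ) → Set
  Maximal w l = ∀ r → r ∈ Right w → r ∈ C.Entered w (Qof w) → l r ≡ 0

  Start : View → (ℕ → ℕ) → ℕ → Set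
  Start w l r = r ∈ Right w × r ∈ C.Entered w (Qof w) × Cell l r

  Next : View → (ℕ → ℕ) → (q lc : ℕ) → ℕ → Set
  Next w l q lc r = r ∈ Right w × (∃[ u ] u < B × q ≡ 2 + u × C.Adj w u r) × Cell l r × at B l r < lc

  record WalkStep (w : View) (l : ℕ → ℕ) (o : ℕ → ℕ) (c p : ℕ) (o′ : ℕ → ℕ) (c′ p′ : ℕ) : Set where
    field
      idle-o : B ≤ c → ∀ r → r < B → o′ r ≡ o r
      idle-p : B ≤ c → p′ ≡ p
      idle-c : B ≤ c → B ≤ c′
      moves-c : c < B → o′ c ≡ p
      moves-o : c < B → ∀ r → r < B → r ≢ c → o′ r ≡ o r
      moves-p : c < B → p′ ≡ o c
      moves-to : c < B → (B ≤ c′ × (∀ r → r < B → ¬ Next w l (o c) (l c) r)) ⊎ (c′ < B × Next w l (o c) (l c) c′)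

  pred : ℕ → ℕ
  pred p = ind (p ≟ 1)

  data Walk (w : View) (o₀ l : ℕ → ℕ) (i : ℕ) (o : ℕ → ℕ) (c p : ℕ) : Set where
    walking : c < B → c ∈ Right w → l c ≢ 0 → l c + i ≤ B →
      (p ≡ 1 × c ∈ C.Entered w (Qof w)) ⊎ (∃[ u ] p ≡ 2 + u × (u ∈ Right w × u ∉ ⟪ B ⟫ (vF w)) × C.Adj w u c) →
      Matching w o p → (∀ r → r ∈ Right w → l r ≢ 0 → l r ≤ l c → o r ≡ o₀ r) →
      suc (# B (dec (Sourced w o₀))) ≤ # B (dec (Sourced w o)) + pred p → Walk w o₀ l i o c p
    stopped : B ≤ c → p ≤ 1 → Matching w o p → suc (# B (dec (Sourced w o₀))) ≤ # B (dec (Sourced w o)) → Walk w o₀ l i o c p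

  walk-step : ∀ {w o₀ l p₀ i o c p o′ c′ p′} → Matching w o₀ p₀ → Levels w o₀ l → WalkStep w l o c p o′ c′ p′ →
    Walk w o₀ l i o c p → Walk w o₀ l (suc i) o′ c′ p′
  walk-step {w} {o₀} {l} M₀ L st (stopped B≤c p≤1 M h) = stopped (idle-c B≤c) (subst (_≤ 1) (sym (idle-p B≤c)) p≤1)
    (subst (Matching w _) (sym (idle-p B≤c)) (C.matching-cong w (idle-o B≤c) M))
    (≤-trans h (#-mono B (dec (Sourced w _)) (dec (Sourced w _)) (λ r l → λ { (r∈ , e) → r∈ , trans (idle-o B≤c r l) e })))
    where open WalkStep st
  walk-step {w} {o₀} {l} {i = i} {o} {c} {p} {o′} {c′} {p′} M₀ L st (walking c<B c∈ ne b pc M low h) = go (C.Levels.sound {w} L c c∈ ne)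
    where
    open WalkStep st
    M′ : Matching w o′ (o c)
    M′ = C.assign w c M c∈ pc (moves-c c<B) (moves-o c<B)
    oc : o c ≡ o₀ c
    oc = low c c∈ ne ≤-refl
    src : ∀ q → p ≡ q → o c ≢ 1 → suc (# B (dec (Sourced w o₀))) ≤ # B (dec (Sourced w o′))
    src q p≡q oc≢1 with q ≟ 1
    ... | yes refl = ≤-trans h (≤-trans (≤-reflexive (trans (cong (λ z → # B (dec (Sourced w o)) + pred z) p≡q) (+-comm _ 1)))
      (#-< B (dec (Sourced w o)) (dec (Sourced w o′))
        (λ { r r<B (r∈ , e) → r∈ , trans (moves-o c<B r r<B (λ { refl → oc≢1 e })) e }) c c<B (c∈ , trans (moves-c c<B) p≡q) (λ { (_ , e) → oc≢1 e })))
    ... | no q≢1 = ≤-trans h (≤-trans (+-monoʳ-≤ _ zero-pred) (≤-trans (≤-reflexive (+-identityʳ _))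
      (#-mono B (dec (Sourced w o)) (dec (Sourced w o′)) (λ { r r<B (r∈ , e) → r∈ , trans (moves-o c<B r r<B (λ { refl → oc≢1 e })) e }))))
      where
      zero-pred : pred p ≤ 0
      zero-pred with p ≟ 1
      ... | yes e = contradiction (trans (sym p≡q) e) q≢1
      ... | no _ = z≤n
    go : o₀ c ≡ 0 ⊎ ∃[ u ] ∃[ r′ ] o₀ c ≡ 2 + u × C.Adj w u r′ × r′ ∈ Right w × l r′ ≢ 0 × l r′ < l c → Walk w o₀ l (suc i) o′ c′ p′
    go (inj₁ e₀) with moves-to c<B
    ... | inj₂ (_ , (_ , (u , _ , e , _) , _)) = contradiction (trans (sym (trans oc e₀)) e) λ ()
    ... | inj₁ (B≤c′ , _) = stopped B≤c′ (≤-trans (≤-reflexive (trans (moves-p c<B) (trans oc e₀))) z≤n) (subst (Matching w o′) (sym (moves-p c<B)) M′)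
      (src p refl (λ e → contradiction (trans (sym (trans oc e₀)) e) λ ()))
    go (inj₂ (u , r′ , e , a , r′∈ , ne′ , l<)) with moves-to c<B
    ... | inj₁ (_ , none) = contradiction (r′∈ , (u , proj₁ (proj₁ (proj₁ u∈)) , trans oc e , a) , (r′<B , ne′) , subst (_< l c) (sym (at-< B l r′<B)) l<) (none r′ r′<B)
      where
      u∈ = proj₁ (proj₁ (C.Matching.owner {w} M₀ c u c∈ e))
      r′<B = proj₁ (proj₁ (proj₁ r′∈))
    ... | inj₂ (c′<B , (c′∈ , (v , v<B , e′ , a′) , (_ , nec′) , l<c)) = walking c′<B c′∈ nec′
      (≤-trans (≤-reflexive (+-suc (l c′) i)) (≤-trans (+-monoˡ-≤ i lc′<) b))
      (inj₂ (v , trans (moves-p c<B) e′ , proj₁ (C.Matching.owner {w} M c v c∈ e′) , a′))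
      (subst (Matching w o′) (sym (moves-p c<B)) M′)
      (λ r r∈ ner l≤ → trans (moves-o c<B r (proj₁ (proj₁ (proj₁ r∈))) (λ { refl → <-irrefl refl (≤-<-trans l≤ lc′<) })) (low r r∈ ner (≤-trans l≤ (<⇒≤ lc′<))))
      (≤-trans (src p refl (λ z → contradiction (trans (sym z) e′) λ ())) (m≤m+n _ _))
      where
      lc′< : l c′ < l c
      lc′< = subst (_< l c) (at-< B l c′<B) l<c

  Progress : View → (ℕ → ℕ) → (ℕ → ℕ) → Set
  Progress w o o′ = ((∃[ l ] Levels w o l × Maximal w l) × (∀ r → r < B → o′ r ≡ o r)) ⊎
    ((∃[ l ] ∃[ r ] Levels w o l × Start w l r) × suc (# B (dec (Sourced w o))) ≤ # B (dec (Sourced w o′)))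

  walk-done : ∀ {w l o} (os : ℕ → ℕ → ℕ) (cs ps : ℕ → ℕ) {p₀} → p₀ ≤ 1 → Matching w o p₀ → Levels w o l → (∀ r → r < B → l r ≤ B) →
    (∀ r → r < B → os 0 r ≡ o r) → ps 0 ≡ 1 → (B ≤ cs 0 × (∀ r → r < B → ¬ Start w l r)) ⊎ (cs 0 < B × Start w l (cs 0)) →
    (∀ i → WalkStep w l (os i) (cs i) (ps i) (os (suc i)) (cs (suc i)) (ps (suc i))) →
    Progress w o (os B) × (∃[ p ] p ≤ 1 × Matching w (os B) p)
  walk-done {w} {l} {o} os cs ps p₀≤1 M L bound o≡ p≡ (inj₁ (B≤c , none)) st =
    inj₁ ((l , L , λ r r∈ e → case l r ≟ 0 of λ { (yes z) → z ; (no ne) → contradiction (r∈ , e , (proj₁ (proj₁ (proj₁ r∈)) , ne)) (none r (proj₁ (proj₁ (proj₁ r∈)))) })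
         , λ r r<B → trans (eqs B r r<B) (o≡ r r<B)) ,
    _ , p₀≤1 , C.matching-cong w (λ r r<B → trans (eqs B r r<B) (o≡ r r<B)) M
    where
    cs≥ : ∀ i → B ≤ cs i
    cs≥ zero = B≤c
    cs≥ (suc i) = WalkStep.idle-c (st i) (cs≥ i)
    eqs : ∀ i r → r < B → os i r ≡ os 0 r
    eqs zero r r<B = refl
    eqs (suc i) r r<B = trans (WalkStep.idle-o (st i) (cs≥ i) r r<B) (eqs i r r<B)
  walk-done {w} {l} {o} os cs ps p₀≤1 M L bound o≡ p≡ (inj₂ (c<B , (c∈ , ent , (_ , ne)))) st = final (walks B)
    where
    walks : ∀ i → Walk w o l i (os i) (cs i) (ps i)
    walks zero = walking c<B c∈ ne (≤-trans (≤-reflexive (+-identityʳ _)) (bound _ c<B)) (inj₁ (p≡ , ent))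
      (subst (Matching w _) (sym p≡) (C.matching-cong w o≡ (C.matching-≤1 w p₀≤1 (s≤s z≤n) M))) (λ r r∈ _ _ → o≡ r (proj₁ (proj₁ (proj₁ r∈))))
      (≤-trans (≤-reflexive (+-comm 1 _)) (+-mono-≤ (#-mono B (dec (Sourced w o)) (dec (Sourced w (os 0))) (λ { r r<B (r∈ , e) → r∈ , trans (o≡ r r<B) e }))
        (≤-reflexive (sym (cong pred p≡)))))
    walks (suc i) = walk-step M L (st i) (walks i)
    final : Walk w o l B (os B) (cs B) (ps B) → _
    final (walking _ _ ne b _ _ _ _) = contradiction (≤-trans (+-monoˡ-≤ B (n≢0⇒n>0 ne)) b) (<-irrefl refl)
    final (stopped _ p≤1 M h) = inj₂ ((l , cs 0 , L , (c∈ , ent , (c<B , ne))) , h) , _ , p≤1 , M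

  rounds : ∀ {w} (os : ℕ → ℕ → ℕ) → Matching w (os 0) 0 →
    (∀ i p → p ≤ 1 → Matching w (os i) p → Progress w (os i) (os (suc i)) × (∃[ p ] p ≤ 1 × Matching w (os (suc i)) p)) →
    (∃[ p ] p ≤ 1 × Matching w (os B) p) × (∀ l → Levels w (os B) l → Maximal w l)
  rounds {w} os M₀ step = proj₁ (inv B) , λ l L → [ full l L , best l L ]′ (proj₂ (inv B))
    where
    inv : ∀ i → (∃[ p ] p ≤ 1 × Matching w (os i) p) × (i ≤ # B (dec (Sourced w (os i))) ⊎ ∃[ l ] Levels w (os i) l × Maximal w l)
    inv zero = (0 , z≤n , M₀) , inj₁ z≤n
    inv (suc i) with inv i
    ... | (p , p≤1 , M) , q with step i p p≤1 M
    ... | inj₁ ((l , L , m) , eq) , M′ = M′ , inj₂ (l , C.levels-cong w eq L , m)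
    ... | inj₂ ((l , r , L , (r∈ , e , (_ , ne))) , more) , M′ = M′ , inj₁ ([ (λ h → ≤-trans (s≤s h) more)
      , (λ { (l′ , L′ , m) → contradiction (m r r∈ e) (C.levels-agree w L L′ r (<-wellFounded _) r∈ ne) }) ]′ q)
    best : ∀ l → Levels w (os B) l → (∃[ l ] Levels w (os B) l × Maximal w l) → Maximal w l
    best l L (l′ , L′ , m) r r∈ e with l r ≟ 0
    ... | yes z = z
    ... | no ne = contradiction (m r r∈ e) (C.levels-agree w L L′ r (<-wellFounded _) r∈ ne)
    full : ∀ l → Levels w (os B) l → B ≤ # B (dec (Sourced w (os B))) → Maximal w l
    full l L h r r∈ e with os B r ≟ 1
    ... | yes o1 = case l r ≟ 0 of λ
          { (yes z) → z
          ; (no ne) → [ (λ z → contradiction (trans (sym o1) z) λ ()) , (λ { (u , _ , z , _) → contradiction (trans (sym o1) z) λ () }) ]′ (C.Levels.sound {w} L r r∈ ne) }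
    ... | no o≢1 = contradiction (≤-<-trans h (<-≤-trans (#-< B (dec (Sourced w (os B))) (λ i → i <? B) (λ i l _ → l) r r<B r<B (λ { (_ , z) → o≢1 z })) (#-≤ B (λ i → i <? B)))) (<-irrefl refl)
      where r<B = proj₁ (proj₁ (proj₁ r∈))

module Run (ρ : Env) (0<B : 0 < ρ 2) where
  B = ρ 2
  open Guided B (ρ 0)

  levStep : ℕ → Mem → Mem
  levStep i = exec B (upd ρ 22 i) levBody

  levStep-old : ∀ i s r → r < B → s lev r ≢ 0 → levStep i s lev r ≡ s lev r
  levStep-old i s r r<B ne rewrite at-< B (s lev) r<B with s lev r
  ... | zero = contradiction refl ne
  ... | suc _ = refl

  levStep-new : ∀ i s r → r < B → s lev r ≡ 0 → Cond (viewOf s) (s own) (s lev) r → levStep i s lev r ≡ suc i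
  levStep-new i s r r<B e c rewrite at-< B (s lev) r<B | e = trans (if-true B levF {upd (upd ρ 22 i) 21 r} {s} 0 (i + 1) c) (+-comm i 1)

  levStep-none : ∀ i s r → r < B → s lev r ≡ 0 → ¬ Cond (viewOf s) (s own) (s lev) r → levStep i s lev r ≡ 0
  levStep-none i s r r<B e c rewrite at-< B (s lev) r<B | e = if-false B levF {upd (upd ρ 22 i) 21 r} {s} 0 (i + 1) c

  levSeq : (f : ℕ → Mem → Mem) (s : Mem) → (∀ i s → viewOf (f i s) ≡ viewOf s × f i s own ≡ s own) →
    (∀ r → s lev r ≡ 0) →
    (∀ i s r → r < B → s lev r ≢ 0 → f i s lev r ≡ s lev r) →
    (∀ i s r → r < B → s lev r ≡ 0 → Cond (viewOf s) (s own) (s lev) r → f i s lev r ≡ suc i) →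
    (∀ i s r → r < B → s lev r ≡ 0 → ¬ Cond (viewOf s) (s own) (s lev) r → f i s lev r ≡ 0) →
    LevSeq (viewOf s) (s own) (λ j → iter j f s lev)
  levSeq f s keep s0 old new none = record
    { start = s0 ; old = λ j → old j (iter j f s)
    ; new = λ j r l e c → new j (iter j f s) r l e (subst₂ (λ w o → Cond w o (iter j f s lev) r) (sym (proj₁ (kept j))) (sym (proj₂ (kept j))) c)
    ; stay = λ j r l e ¬c → none j (iter j f s) r l e λ c → ¬c (subst₂ (λ w o → Cond w o (iter j f s lev) r) (proj₁ (kept j)) (proj₂ (kept j)) c) }
    where
    kept : ∀ j → viewOf (iter j f s) ≡ viewOf s × iter j f s own ≡ s own
    kept zero = refl , refl
    kept (suc j) = trans (proj₁ (keep j _)) (proj₁ (kept j)) , trans (proj₂ (keep j _)) (proj₂ (kept j))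

  levC-seq : ∀ s → ∃[ L ] LevSeq (viewOf s) (s own) L × exec B ρ levC s lev ≡ L B
  levC-seq s = _ , levSeq levStep (exec B ρ (lev [ 21 ]:= lit 0) s) (λ _ _ → refl , refl) (λ _ → refl) levStep-old levStep-new levStep-none , refl

  keepL : ∀ j s → viewOf (iter j levStep s) ≡ viewOf s × iter j levStep s own ≡ s own
  keepL zero s = refl , refl
  keepL (suc j) s = keepL j s

  levC-ok : ∀ s → viewOf (exec B ρ levC s) ≡ viewOf s × exec B ρ levC s own ≡ s own
  levC-ok s = keepL B (exec B ρ (lev [ 21 ]:= lit 0) s)

  at0 : ∀ f → at B f 0 ≡ f 0
  at0 f = at-< B f 0<B

  at-≥ : ∀ f i → B ≤ i → at B f i ≡ 0
  at-≥ f i h rewrite m≤n⇒m∸n≡0 h = refl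

  walk-ok : ∀ i s → (let s′ = exec B (upd ρ 27 i) walkC s in
    WalkStep (viewOf s) (s lev) (s own) (s cur 0) (s pend 0) (s′ own) (s′ cur 0) (s′ pend 0))
  walk-ok i s = record
    { idle-o = λ h r r<B → trans (if-false B here {ρ₁ r} {s₁} (at B (s own) r) (at B (s pend) 0) (λ e → <⇒≢ (<-≤-trans r<B h) (trans e c≡))) (at-< B (s own) r<B)
    ; idle-p = λ h → trans (cond0 (m≤n⇒m∸n≡0 (subst (B ≤_) (sym c≡) h))) (at0 (s pend))
    ; idle-c = λ h → [ (λ { (e , _) → ≤-reflexive (sym e) })
      , (λ { (_ , (_ , (u , _ , e , _) , _)) → contradiction (trans (sym (trans tmp≡ (at-≥ (s own) (s cur 0) h))) e) λ () }) ]′ found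
    ; moves-c = λ h → trans (if-true B here {ρ₁ (s cur 0)} {s₁} (at B (s own) (s cur 0)) (at B (s pend) 0) (sym c≡)) (at0 (s pend))
    ; moves-o = λ h r r<B ne → trans (if-false B here {ρ₁ r} {s₁} (at B (s own) r) (at B (s pend) 0) (λ e → ne (trans e c≡))) (at-< B (s own) r<B)
    ; moves-p = λ h → trans (cond1 (subst (λ z → 0 < B ∸ z) (sym c≡) (m<n⇒0<n∸m h))) (trans tmp≡ (at-< B (s own) h))
    ; moves-to = λ h → [ (λ { (e , nil) → inj₁ (≤-reflexive (sym e) , λ r r<B nx → nil r r<B (subst₂ (λ q lc → Next (viewOf s) (s lev) q lc r) (sym (trans tmp≡ (at-< B (s own) h))) (sym (lc≡ h)) nx)) })
      , (λ { (l , nx) → inj₂ (l , subst₂ (λ q lc → Next (viewOf s) (s lev) q lc (s′ cur 0)) (trans tmp≡ (at-< B (s own) h)) (lc≡ h) nx) }) ]′ found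
    }
    where
    ρ₁ : ℕ → Env
    ρ₁ r = upd (upd ρ 27 i) 21 r
    here = var 21 ≐ cur ! lit 0
    s₁ s′ : Mem
    s₁ = exec B (upd ρ 27 i) (tmp [ 21 ]:= own ! (cur ! lit 0)) s
    s′ = exec B (upd ρ 27 i) walkC s
    c≡ : at B (s cur) 0 ≡ s cur 0
    c≡ = at0 (s cur)
    tmp≡ : at B (λ _ → at B (s own) (at B (s cur) 0)) 0 ≡ at B (s own) (s cur 0)
    tmp≡ = trans (at0 (λ _ → at B (s own) (at B (s cur) 0))) (cong (at B (s own)) c≡)
    lc≡ : s cur 0 < B → at B (s lev) (at B (s cur) 0) ≡ s lev (s cur 0)
    lc≡ h = trans (cong (at B (s lev)) c≡) (at-< B (s lev) h)
    cond0 : ∀ {d a b : ℕ} → d ≡ 0 → cond d a b ≡ a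
    cond0 refl = refl
    cond1 : ∀ {d a b : ℕ} → 0 < d → cond d a b ≡ b
    cond1 (s≤s _) = refl
    s₃ = exec B (upd ρ 27 i) (pend [ 21 ]:= ifz (var 2 ⊟ cur ! lit 0) (pend ! lit 0) (tmp ! lit 0))
      (exec B (upd ρ 27 i) (own [ 21 ]:= ifz (tm (var 21 ≐ cur ! lit 0)) (own ! var 21) (pend ! lit 0)) s₁)
    found : (s′ cur 0 ≡ B × (∀ j → j < B → ¬ Next (viewOf s) (s lev) (at B (s₃ tmp) 0) (at B (s lev) (at B (s cur) 0)) j)) ⊎
      (s′ cur 0 < B × Next (viewOf s) (s lev) (at B (s₃ tmp) 0) (at B (s lev) (at B (s cur) 0)) (s′ cur 0))
    found = find-ok B 25 24 nextF {ρ₁ 0} {s₃} (λ ()) (Next (viewOf s) (s lev) (at B (s₃ tmp) 0) (at B (s lev) (at B (s cur) 0)))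
      (λ _ _ _ h → h) (λ _ _ _ h → h) (λ j → decide B (nextF 24) (upd (upd (ρ₁ 0) 25 0) 24 j) s₃)

module AugRun (ρ : Env) (0<B : 0 < ρ 2) where
  open Run ρ 0<B public
  open Guided B (ρ 0) public

  start-ok : ∀ s → (let s′ = exec B ρ startC s in
    (s′ cur 0 ≡ B × (∀ j → j < B → ¬ Start (viewOf s) (s lev) j)) ⊎ (s′ cur 0 < B × Start (viewOf s) (s lev) (s′ cur 0)))
  start-ok s = find-ok B 25 24 startF {upd ρ 21 0} {exec B ρ (pend [ 21 ]:= lit 1) s} (λ ()) (Start (viewOf s) (s lev))
    (λ _ _ _ h → h) (λ _ _ _ h → h) (λ j → decide B (startF 24) (upd (upd (upd ρ 21 0) 25 0) 24 j) (exec B ρ (pend [ 21 ]:= lit 1) s))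

  walks : (f : ℕ → Mem → Mem) (s : Mem) → (∀ i s → viewOf (f i s) ≡ viewOf s × f i s lev ≡ s lev) →
    (∀ i s → WalkStep (viewOf s) (s lev) (s own) (s cur 0) (s pend 0) (f i s own) (f i s cur 0) (f i s pend 0)) →
    ∀ i → WalkStep (viewOf s) (s lev) (iter i f s own) (iter i f s cur 0) (iter i f s pend 0)
      (iter (suc i) f s own) (iter (suc i) f s cur 0) (iter (suc i) f s pend 0)
  walks f s keep st i = subst₂ (λ w l → WalkStep w l (iter i f s own) (iter i f s cur 0) (iter i f s pend 0)
    (iter (suc i) f s own) (iter (suc i) f s cur 0) (iter (suc i) f s pend 0)) (proj₁ (kept i)) (proj₂ (kept i)) (st i (iter i f s))
    where
    kept : ∀ j → viewOf (iter j f s) ≡ viewOf s × iter j f s lev ≡ s lev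
    kept zero = refl , refl
    kept (suc j) = trans (proj₁ (keep j _)) (proj₁ (kept j)) , trans (proj₂ (keep j _)) (proj₂ (kept j))

  aug-view : ∀ s → viewOf (exec B ρ augC s) ≡ viewOf s
  aug-view s = view-frame B ρ augC s refl

  aug-ok : ∀ s {p} → p ≤ 1 → Matching (viewOf s) (s own) p →
    Progress (viewOf s) (s own) (exec B ρ augC s own) × (∃[ p ] p ≤ 1 × Matching (viewOf s) (exec B ρ augC s own) p)
  aug-ok s p≤1 M = walk-done (λ i → iter i f s₂ own) (λ i → iter i f s₂ cur 0) (λ i → iter i f s₂ pend 0) p≤1 M L bd
    (λ r _ → cong (λ o → o r) (proj₂ (levC-ok s))) refl
    ([ (λ { (e , h) → inj₁ (≤-reflexive (sym e) , λ r l z → h r l (subst (λ w → Start w (s₁ lev) r) (sym (proj₁ (levC-ok s))) z)) })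
     , (λ { (l , z) → inj₂ (l , subst (λ w → Start w (s₁ lev) (s₂ cur 0)) (proj₁ (levC-ok s)) z) }) ]′ (start-ok s₁))
    λ i → subst (λ w → WalkStep w (s₁ lev) (iter i f s₂ own) (iter i f s₂ cur 0) (iter i f s₂ pend 0)
      (iter (suc i) f s₂ own) (iter (suc i) f s₂ cur 0) (iter (suc i) f s₂ pend 0)) (proj₁ (levC-ok s)) (walks f s₂ (λ _ _ → refl , refl) walk-ok i)
    where
    s₁ = exec B ρ levC s
    s₂ = exec B ρ startC s₁
    f = λ i → exec B (upd ρ 27 i) walkC
    L : Levels (viewOf s) (s own) (s₁ lev)
    L = let (l , q , e) = levC-seq s in subst (Levels (viewOf s) (s own)) (sym e) (LevSeq.levels {w = viewOf s} q M)
    bd : ∀ r → r < B → s₁ lev r ≤ B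
    bd r r<B = let (l , q , e) = levC-seq s in subst (λ z → z r ≤ B) (sym e) (LevSeq.bounded {w = viewOf s} q B r r<B)

module FurthRun (ρ : Env) (0<B : 0 < ρ 2) where
  open AugRun ρ 0<B public

  init-ok : ∀ s → Matching (viewOf s) (exec B ρ initC s own) 0
  init-ok s = record
    { total = λ u l _ → u , proj₁ l , yes-left u l
    ; source = λ r r∈ e → case split r of λ { (inj₁ (_ , z)) → contradiction (trans (sym e) z) λ () ; (inj₂ z) → contradiction (trans (sym e) z) λ () }
    ; owner = λ r u r∈ e → own-ok r u e (split r)
    ; unique = λ r r′ u _ _ e e′ → trans (self r u e) (sym (self r′ u e′))
    ; pends = λ _ _ _ _ () }
    where
    ρ₁ : ℕ → Env
    ρ₁ r = upd ρ 21 r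
    o = exec B ρ initC s own
    yes-left : ∀ u → u ∈ Right (viewOf s) × u ∉ ⟪ B ⟫ (s gF) → o u ≡ 2 + u
    yes-left u l = if-true B (leftF 21) {ρ₁ u} {s} 0 (2 + u) l
    split : ∀ r → ((r ∈ Right (viewOf s) × r ∉ ⟪ B ⟫ (s gF)) × o r ≡ 2 + r) ⊎ o r ≡ 0
    split r with decide B (leftF 21) (ρ₁ r) s
    ... | yes l = inj₁ (l , yes-left r l)
    ... | no ¬l = inj₂ (if-false B (leftF 21) {ρ₁ r} {s} 0 (2 + r) ¬l)
    own-ok : ∀ r u → o r ≡ 2 + u → ((r ∈ Right (viewOf s) × r ∉ ⟪ B ⟫ (s gF)) × o r ≡ 2 + r) ⊎ o r ≡ 0 →
      (u ∈ Right (viewOf s) × u ∉ ⟪ B ⟫ (s gF)) × C.Adj (viewOf s) u r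
    own-ok r u e (inj₂ z) = contradiction (trans (sym e) z) λ ()
    own-ok r u e (inj₁ (l , z)) with suc-injective (suc-injective (trans (sym z) e))
    ... | refl = l , inj₂ refl
    self : ∀ r u → o r ≡ 2 + u → r ≡ u
    self r u e with split r
    ... | inj₁ (_ , z) = suc-injective (suc-injective (trans (sym z) e))
    ... | inj₂ z = contradiction (trans (sym e) z) λ ()

  lastF : Fm
  lastF = gQ ∋ var 21 ∥ leftF 21 & ~ (∃̇[ 24 ] (rightF 24 & adjF 21 24 & lev ∋ var 24))

  furth-abs : (f : ℕ → Mem → Mem) (s : Mem) → (∀ i s → viewOf (f i s) ≡ viewOf s) →
    (∀ i s {p} → p ≤ 1 → Matching (viewOf s) (s own) p → Progress (viewOf s) (s own) (f i s own) × (∃[ p ] p ≤ 1 × Matching (viewOf s) (f i s own) p)) →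
    Matching (viewOf s) (s own) 0 →
    let s₂ = iter B f s in viewOf s₂ ≡ viewOf s × (∃[ p ] p ≤ 1 × Matching (viewOf s) (s₂ own) p) × (∀ l → Levels (viewOf s) (s₂ own) l → Maximal (viewOf s) l)
  furth-abs f s keep st M = kept B , rounds {viewOf s} (λ i → iter i f s own) M
    λ i p p≤1 M → let (a , q , q≤1 , b) = st i (iter i f s) p≤1 (subst (λ w → Matching w (iter i f s own) p) (sym (kept i)) M)
                  in subst (λ w → Progress w (iter i f s own) (iter (suc i) f s own)) (kept i) a , q , q≤1 , subst (λ w → Matching w (iter (suc i) f s own) q) (kept i) b
    where
    kept : ∀ j → viewOf (iter j f s) ≡ viewOf s
    kept zero = refl
    kept (suc j) = trans (keep j _) (kept j)

  furth-ok : ∀ s → C.Valid (viewOf s) (Qof (viewOf s)) (Dof (viewOf s)) →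
    G.Furth (viewOf s) (Qof (viewOf s)) (Dof (viewOf s)) (⟪ B ⟫ (exec B ρ furthC s gQ))
  furth-ok s valid = G.furth (viewOf s) M p≤1 L valid (mx (s₃ lev) L) to from
    where
    w = viewOf s
    s₁ = exec B ρ initC s
    f = λ i → exec B (upd ρ 26 i) augC
    s₂ = iter B f s₁
    s₃ = exec B ρ levC s₂
    main = furth-abs f s₁ (λ i → AugRun.aug-view (upd ρ 26 i) 0<B) (λ i → AugRun.aug-ok (upd ρ 26 i) 0<B) (init-ok s)
    v₂ : viewOf s₂ ≡ w
    v₂ = proj₁ main
    p = proj₁ (proj₁ (proj₂ main))
    p≤1 = proj₁ (proj₂ (proj₁ (proj₂ main)))
    M : Matching w (s₂ own) p
    M = proj₂ (proj₂ (proj₁ (proj₂ main)))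
    mx = proj₂ (proj₂ main)
    L : Levels w (s₂ own) (s₃ lev)
    L = let (l , q , e) = levC-seq s₂ in subst₂ (λ w l → Levels w (s₂ own) l) v₂ (sym e) (LevSeq.levels {w = viewOf s₂} q (subst (λ w → Matching w (s₂ own) p) (sym v₂) M))
    v₃ : viewOf s₃ ≡ w
    v₃ = trans (proj₁ (levC-ok s₂)) v₂
    Meaning : View → ℕ → Set
    Meaning w i = i ∈ Qof w ⊎ ((i ∈ Right w × i ∉ ⟪ B ⟫ (vF w)) × ¬ (∃[ r ] r < B × r ∈ Right w × C.Adj w i r × Cell (s₃ lev) r))
    module Fu = C.Furthest w M p≤1 L valid (mx (s₃ lev) L)
    to : ⟪ B ⟫ (exec B ρ furthC s gQ) ⊆ Fu.Q′
    to i (i<B , h) = conv (subst (λ w → Meaning w i) v₃ (sound B lastF {upd ρ 21 i} {s₃} h))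
      where
      conv : Meaning w i → i ∈ Fu.Q′
      conv (inj₁ q) = inj₁ q
      conv (inj₂ (l , no-r)) = inj₂ (l , λ { r r<B (r∈ , a , ne) → no-r (r , r<B , r∈ , a , (r<B , ne)) })
    from : Fu.Q′ ⊆ ⟪ B ⟫ (exec B ρ furthC s gQ)
    from i q = bd q , complete B lastF {upd ρ 21 i} {s₃} (subst (λ w → Meaning w i) (sym v₃) (conv q))
      where
      bd : i ∈ Fu.Q′ → i < B
      bd (inj₁ q) = proj₁ q
      bd (inj₂ (l , _)) = proj₁ (proj₁ (proj₁ (proj₁ l)))
      conv : i ∈ Fu.Q′ → Meaning w i
      conv (inj₁ q) = inj₁ q
      conv (inj₂ (l , h)) = inj₂ (l , λ { (r , r<B , r∈ , a , (_ , ne)) → h r r<B (r∈ , a , ne) })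

frontF : ℕ → Fm
frontF r = rightF r & enteredF r

halfT : Tm → Tm
halfT t = Σ[ 28 ] ifz ((lit 2 ⊞ var 28 ⊞ var 28) ⊟ t) (lit 1) (lit 0)

absorbF : Fm
absorbF = gbit ∋ lit 0 & ~ (gF ∋ var 21)

bitC frontC moveC guideStepC guideC : Cm
bitC = gbit [ 21 ]:= gB ! lit 0 ⊟ (halfT (gB ! lit 0) ⊞ halfT (gB ! lit 0)) ﹔ gB [ 21 ]:= halfT (gB ! lit 0)
frontC = furthC ﹔ gx [ 21 ]:= find 25 24 frontF
moveC = gQ [ 21 ]:= tm (gQ ∋ var 21 ∥ var 21 ≐ gx ! lit 0 & absorbF) ﹔
  gD [ 21 ]:= tm (gD ∋ var 21 ∥ var 21 ≐ gx ! lit 0 & ~ absorbF)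
guideStepC = bitC ﹔ frontC ﹔ moveC
guideC = gQ [ 21 ]:= lit 0 ﹔ gD [ 21 ]:= lit 0 ﹔ for 29 guideStepC

module GuideSpec (B n : ℕ) where
  open Guided B n public

  netOf : Mem → Net
  netOf s = net (viewOf s)

  QQ DD VV FF : Mem → DSet
  QQ s = ⟪ B ⟫ (s gQ)
  DD s = ⟪ B ⟫ (s gD)
  VV s = ⟪ B ⟫ (s gV)
  FF s = ⟪ B ⟫ (s gF)

  record FrontSpec (s s₁ : Mem) : Set₁ where
    field
      net≡ : netOf s₁ ≡ netOf s
      D≡ : s₁ gD ≡ s gD
      isFurth : Guide.Furth (netOf s) (QQ s) (DD s) (QQ s₁)
      pick : (s₁ gx 0 ≡ B × (∀ r → r ∉ Cut.frontier (netOf s) (QQ s₁) (DD s))) ⊎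
        (s₁ gx 0 < B × s₁ gx 0 ∈ Cut.frontier (netOf s) (QQ s₁) (DD s))

  netOf≡ : ∀ s s′ → s′ gV ≡ s gV → s′ gS ≡ s gS → s′ gF ≡ s gF → s′ INP ≡ s INP → s′ TT ≡ s TT → s′ MM ≡ s MM → netOf s′ ≡ netOf s
  netOf≡ s s′ a b c d e f = go (s′ gV) (s′ gS) (s′ gF) (s′ INP) (s′ TT) (s′ MM) a b c d e f
    where
    go : ∀ V S F I T M → V ≡ s gV → S ≡ s gS → F ≡ s gF → I ≡ s INP → T ≡ s TT → M ≡ s MM → net (view V S F (s′ gQ) (s′ gD) I T M) ≡ netOf s
    go _ _ _ _ _ _ refl refl refl refl refl refl = refl

  front-abs : ∀ s s₁ s₂ → s₁ gV ≡ s gV → s₁ gS ≡ s gS → s₁ gF ≡ s gF → s₁ INP ≡ s INP → s₁ TT ≡ s TT → s₁ MM ≡ s MM → s₁ gD ≡ s gD →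
    Guide.Furth (netOf s) (QQ s) (DD s) (QQ s₁) →
    viewOf s₂ ≡ viewOf s₁ →
    (s₂ gx 0 ≡ B × (∀ j → j < B → j ∉ C.frontier (viewOf s₁) (QQ s₁) (DD s₁))) ⊎ (s₂ gx 0 < B × s₂ gx 0 ∈ C.frontier (viewOf s₁) (QQ s₁) (DD s₁)) →
    FrontSpec s s₂
  front-abs s s₁ s₂ v b f i t m d fu e pk = record
    { net≡ = trans (cong net e) ne
    ; D≡ = trans (cong vD e) d
    ; isFurth = subst (λ q → Guide.Furth (netOf s) (QQ s) (DD s) (⟪ B ⟫ q)) (sym (cong vQ e)) fu
    ; pick = subst₂ P (sym (cong vQ e)) d (subst (λ N → (s₂ gx 0 ≡ B × (∀ r → r ∉ Cut.frontier N (QQ s₁) (DD s₁))) ⊎ (s₂ gx 0 < B × s₂ gx 0 ∈ Cut.frontier N (QQ s₁) (DD s₁))) ne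
      ([ (λ { (a , h) → inj₁ (a , λ r r∈ → h r (proj₁ (proj₁ (proj₁ (proj₁ r∈)))) r∈) }) , inj₂ ]′ pk)) }
    where
    ne : netOf s₁ ≡ netOf s
    ne = netOf≡ s s₁ v b f i t m
    P : (ℕ → ℕ) → (ℕ → ℕ) → Set
    P q d = (s₂ gx 0 ≡ B × (∀ r → r ∉ Cut.frontier (netOf s) (⟪ B ⟫ q) (⟪ B ⟫ d))) ⊎ (s₂ gx 0 < B × s₂ gx 0 ∈ Cut.frontier (netOf s) (⟪ B ⟫ q) (⟪ B ⟫ d))

  record MoveSpec (s s′ : Mem) : Set where
    x = s gx 0
    field
      frames : viewOf (upd (upd s′ gQ (s gQ)) gD (s gD)) ≡ viewOf s
      Q→ : ∀ v → v ∈ QQ s′ → v ∈ QQ s ⊎ (v ≡ x × s gbit 0 ≢ 0 × x ∉ FF s)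
      Q← : ∀ v → v < B → v ∈ QQ s ⊎ (v ≡ x × s gbit 0 ≢ 0 × x ∉ FF s) → v ∈ QQ s′
      D→ : ∀ v → v ∈ DD s′ → v ∈ DD s ⊎ (v ≡ x × ¬ (s gbit 0 ≢ 0 × x ∉ FF s))
      D← : ∀ v → v < B → v ∈ DD s ⊎ (v ≡ x × ¬ (s gbit 0 ≢ 0 × x ∉ FF s)) → v ∈ DD s′

  infix 4 _≈_
  _≈_ : DSet → DSet → Set
  P ≈ P′ = P ⊆ P′ × P′ ⊆ P

  record StepSpec (s s′ : Mem) : Set₁ where
    N = netOf s
    field
      net≡ : netOf s′ ≡ netOf s
      Q₁ : DSet
      isFurth : Guide.Furth N (QQ s) (DD s) Q₁
      outcome : ((∀ r → r ∉ Cut.frontier N Q₁ (DD s)) × QQ s′ ≈ Q₁ × DD s′ ≈ DD s) ⊎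
        (∃[ x ] x ∈ Cut.frontier N Q₁ (DD s) ×
          ((x ∉ FF s × QQ s′ ≈ Q₁ ∪ ｛ x ｝ × DD s′ ≈ DD s) ⊎ (QQ s′ ≈ Q₁ × DD s′ ≈ DD s ∪ ｛ x ｝)))

  module Moved (s s₁ s₂ : Mem) (fs : FrontSpec s s₁) (ms : MoveSpec s₁ s₂) where
    open MoveSpec ms

    net-moved : netOf s₂ ≡ netOf s
    net-moved = trans (cong (λ w → net (view (vV w) (vS w) (vF w) (s₂ gQ) (s₂ gD) (vI w) (vT w) (vM w))) frames) (FrontSpec.net≡ fs)

    D→′ : ∀ v → v ∈ DD s₁ → v ∈ DD s
    D→′ v (l , h) = l , subst (λ f → f v ≢ 0) (FrontSpec.D≡ fs) h

    D←′ : ∀ v → v ∈ DD s → v ∈ DD s₁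
    D←′ v (l , h) = l , subst (λ f → f v ≢ 0) (sym (FrontSpec.D≡ fs)) h

    move-none : s₁ gx 0 ≡ B → QQ s₂ ≈ QQ s₁ × DD s₂ ≈ DD s
    move-none x≡B =
      ((λ v v∈ → [ id , (λ { (e , _) → contradiction (subst (_< B) (trans e x≡B) (proj₁ v∈)) (<-irrefl refl) }) ]′ (Q→ v v∈)) , (λ v v∈ → Q← v (proj₁ v∈) (inj₁ v∈))) ,
      ((λ v v∈ → [ D→′ v , (λ { (e , _) → contradiction (subst (_< B) (trans e x≡B) (proj₁ v∈)) (<-irrefl refl) }) ]′ (D→ v v∈)) , (λ v v∈ → D← v (proj₁ v∈) (inj₁ (D←′ v v∈))))

    move-absorb : s₁ gx 0 < B → s₁ gbit 0 ≢ 0 × s₁ gx 0 ∉ FF s₁ → QQ s₂ ≈ QQ s₁ ∪ ｛ s₁ gx 0 ｝ × DD s₂ ≈ DD s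
    move-absorb x<B ab =
      ((λ v v∈ → [ inj₁ , (λ { (e , _) → inj₂ e }) ]′ (Q→ v v∈)) ,
       (λ v → [ (λ v∈ → Q← v (proj₁ v∈) (inj₁ v∈)) , (λ e → Q← v (subst (_< B) (sym e) x<B) (inj₂ (e , ab))) ]′)) ,
      ((λ v v∈ → [ D→′ v , (λ { (_ , nab) → contradiction ab nab }) ]′ (D→ v v∈)) , (λ v v∈ → D← v (proj₁ v∈) (inj₁ (D←′ v v∈))))

    move-delete : s₁ gx 0 < B → ¬ (s₁ gbit 0 ≢ 0 × s₁ gx 0 ∉ FF s₁) → QQ s₂ ≈ QQ s₁ × DD s₂ ≈ DD s ∪ ｛ s₁ gx 0 ｝
    move-delete x<B nab =
      ((λ v v∈ → [ id , (λ { (_ , b) → contradiction b nab }) ]′ (Q→ v v∈)) , (λ v v∈ → Q← v (proj₁ v∈) (inj₁ v∈))) ,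
      ((λ v v∈ → [ inj₁ ∘ D→′ v , (λ { (e , _) → inj₂ e }) ]′ (D→ v v∈)) ,
       (λ v → [ (λ v∈ → D← v (proj₁ v∈) (inj₁ (D←′ v v∈))) , (λ e → D← v (subst (_< B) (sym e) x<B) (inj₂ (e , nab))) ]′))

  step-abs : ∀ s s₁ s₂ → FrontSpec s s₁ → MoveSpec s₁ s₂ → FF s₁ ≡ FF s → StepSpec s s₂
  step-abs s s₁ s₂ fs ms ff = record { net≡ = net-moved ; Q₁ = QQ s₁ ; isFurth = FrontSpec.isFurth fs ; outcome = go (FrontSpec.pick fs) }
    where
    open Moved s s₁ s₂ fs ms
    go : _ → _
    go (inj₁ (x≡B , h)) = inj₁ (h , move-none x≡B)
    go (inj₂ (x<B , x∈)) with ¬? (s₁ gbit 0 ≟ 0) ×-dec ¬? (dec (FF s₁) (s₁ gx 0))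
    ... | yes ab = inj₂ (s₁ gx 0 , x∈ , inj₁ (subst (s₁ gx 0 ∉_) ff (proj₂ ab) , move-absorb x<B ab))
    ... | no nab = inj₂ (s₁ gx 0 , x∈ , inj₂ (move-delete x<B nab))

  module _ (N : Net) where

    valid-≈ : ∀ Q Q′ D D′ → Q′ ≈ Q → D′ ≈ D → Cut.Valid N Q D → Cut.Valid N Q′ D′
    valid-≈ _ _ _ _ (q , _) (d , _) v u u∈ = let (a , b , c) = v u (q u u∈) in a , b , c ∘ d u

    closed-≈ : ∀ Q Q′ D D′ → Q′ ≈ Q → D′ ≈ D → (∀ r → r ∉ Cut.frontier N Q D) → ∀ r → r ∉ Cut.frontier N Q′ D′
    closed-≈ _ _ _ _ (q , q′) (d , d′) h r (((v , nd) , nq) , e) = h r (((v , nd ∘ d′ r) , nq ∘ q′ r) , [ inj₁ , (λ { (u , l , u∈ , a) → inj₂ (u , l , q u u∈ , a) }) ]′ e)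

  record Sound (N : Net) (j : ℕ) (s : Mem) : Set₁ where
    field
      net≡ : netOf s ≡ N
      valid : Cut.Valid N (QQ s) (DD s)
      D⊆V : ∀ v → v ∈ DD s → v ∈ Net.V N
      count : j ≤ # B (dec (QQ s ∪ DD s)) ⊎ (∀ r → r ∉ Cut.frontier N (QQ s) (DD s))

  sound-step : ∀ {N j s s′} → Sound N j s → StepSpec s s′ → Sound N (suc j) s′
  sound-step {_} {j} {s} {s′} record { net≡ = refl ; valid = valid ; D⊆V = D⊆V ; count = count } st = go outcome
    where
    open StepSpec st
    open Guide.Furth isFurth
    stay : (∀ r → r ∉ Cut.frontier N (QQ s) (DD s)) → ∀ r → r ∉ Cut.frontier N Q₁ (DD s)
    stay cl = Guide.Done.closed (Guide.done-step N {R₀ = dset (λ _ → ⊥) (λ _ → no λ ())} {c = B} valid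
      (record { closed = cl ; disjoint = λ _ () ; size = #-≤ B (dec (DD s)) }) isFurth)
    grow : ∀ {x} → x ∈ Cut.frontier N Q₁ (DD s) → x ∈ QQ s′ ∪ DD s′ → (∀ v → v < B → v ∈ QQ s ∪ DD s → v ∈ QQ s′ ∪ DD s′) →
      suc j ≤ # B (dec (QQ s′ ∪ DD s′)) ⊎ (∀ r → r ∉ Cut.frontier N (QQ s′) (DD s′))
    grow {x} x∈ x∈′ sub = inj₁ ([ (λ h → ≤-<-trans h (#-< B (dec (QQ s ∪ DD s)) (dec (QQ s′ ∪ DD s′)) sub x (proj₁ (proj₁ (proj₁ (proj₁ x∈)))) x∈′
      [ (λ q → proj₂ (proj₁ x∈) (grows x q)) , proj₂ (proj₁ (proj₁ x∈)) ]′))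
      , (λ cl → contradiction x∈ (stay cl x)) ]′ count)
    go : _ → Sound N (suc j) s′
    go (inj₁ (cl , q≈ , d≈)) = record { net≡ = net≡ ; valid = valid-≈ N Q₁ (QQ s′) (DD s) (DD s′) q≈ d≈ valid₁ ; D⊆V = λ v → D⊆V v ∘ proj₁ d≈ v ; count = inj₂ (closed-≈ N Q₁ (QQ s′) (DD s) (DD s′) q≈ d≈ cl) }
    go (inj₂ (x , x∈ , inj₁ (x∉F , q≈ , d≈))) = record
      { net≡ = net≡
      ; valid = valid-≈ N (Q₁ ∪ ｛ x ｝) (QQ s′) (DD s) (DD s′) q≈ d≈ (λ { v (inj₁ q) → valid₁ v q ; v (inj₂ refl) → proj₁ (proj₁ (proj₁ x∈)) , x∉F , proj₂ (proj₁ (proj₁ x∈)) })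
      ; D⊆V = λ v → D⊆V v ∘ proj₁ d≈ v
      ; count = grow x∈ (inj₁ (proj₂ q≈ x (inj₂ refl))) (λ v _ → [ (λ q → inj₁ (proj₂ q≈ v (inj₁ (grows v q)))) , (λ d → inj₂ (proj₂ d≈ v d)) ]′) }
    go (inj₂ (x , x∈ , inj₂ (q≈ , d≈))) = record
      { net≡ = net≡
      ; valid = valid-≈ N Q₁ (QQ s′) (DD s ∪ ｛ x ｝) (DD s′) q≈ d≈ (λ v q → let (a , b , c) = valid₁ v q in a , b , [ c , (λ { refl → proj₂ (proj₁ x∈) q }) ]′)
      ; D⊆V = λ v v∈ → [ D⊆V v , (λ { refl → proj₁ (proj₁ (proj₁ x∈)) }) ]′ (proj₁ d≈ v v∈)
      ; count = grow x∈ (inj₂ (proj₂ d≈ x (inj₂ refl))) (λ v _ → [ (λ q → inj₁ (proj₂ q≈ v (grows v q))) , (λ d → inj₂ (proj₂ d≈ v (inj₁ d))) ]′) }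

  sound-end : ∀ {N s} → Sound N B s → ∀ r → r ∉ Cut.frontier N (QQ s) (DD s)
  sound-end {_} {s} record { net≡ = refl ; count = inj₂ cl } = cl
  sound-end {_} {s} record { net≡ = refl ; count = inj₁ h } r r∈@(((r∈V , r∉D) , r∉Q) , _) =
    contradiction (≤-<-trans h (<-≤-trans (#-< B (dec (QQ s ∪ DD s)) (λ i → i <? B) (λ i l _ → l) r (proj₁ r∈V) (proj₁ r∈V) [ r∉Q , r∉D ]′) (#-≤ B (λ i → i <? B)))) (<-irrefl refl)

module StepRun (ρ : Env) (0<B : 0 < ρ 2) where
  open FurthRun ρ 0<B using (B; furth-ok; at0)
  open GuideSpec B (ρ 0) public

  front-ok : ∀ s → C.Valid (viewOf s) (QQ s) (DD s) → FrontSpec s (exec B ρ frontC s)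
  front-ok s valid = front-abs s s₁ (exec B ρ frontC s)
    (frame B ρ furthC s gV refl) (frame B ρ furthC s gS refl) (frame B ρ furthC s gF refl) (frame B ρ furthC s INP refl)
    (frame B ρ furthC s TT refl) (frame B ρ furthC s MM refl) (frame B ρ furthC s gD refl) (furth-ok s valid)
    (view-frame B ρ (gx [ 21 ]:= find 25 24 frontF) s₁ refl) (pick s₁)
    where
    s₁ = exec B ρ furthC s
    pick : ∀ s₁ → (exec B ρ (gx [ 21 ]:= find 25 24 frontF) s₁ gx 0 ≡ B × (∀ j → j < B → j ∉ C.frontier (viewOf s₁) (QQ s₁) (DD s₁))) ⊎
      (exec B ρ (gx [ 21 ]:= find 25 24 frontF) s₁ gx 0 < B × exec B ρ (gx [ 21 ]:= find 25 24 frontF) s₁ gx 0 ∈ C.frontier (viewOf s₁) (QQ s₁) (DD s₁))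
    pick s₁ = find-ok B 25 24 frontF {upd ρ 21 0} {s₁} (λ ()) (λ j → j ∈ C.frontier (viewOf s₁) (QQ s₁) (DD s₁))
      (λ _ _ _ h → h) (λ _ _ _ h → h) (λ j → dec (C.frontier (viewOf s₁) (QQ s₁) (DD s₁)) j)

  move-ok : ∀ s → MoveSpec s (exec B ρ moveC s)
  move-ok s = record
    { frames = refl
    ; Q→ = λ v (v<B , h) → [ inj₁ , (λ { (e , (_ , b) , f) → inj₂ (trans e x≡ , b , subst (_∉ FF s) (trans e x≡) f) }) ]′ (sound B qF {upd ρ 21 v} {s} h)
    ; Q← = λ v v<B h → v<B , complete B qF {upd ρ 21 v} {s} ([ inj₁ , (λ { (e , b , f) → inj₂ (trans e (sym x≡) , (0<B , b) , subst (_∉ FF s) (sym e) f) }) ]′ h)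
    ; D→ = λ v (v<B , h) → [ inj₁ , (λ { (e , nb) → inj₂ (trans e x≡ , λ { (b , f) → nb ((0<B , b) , subst (_∉ FF s) (sym (trans e x≡)) f) }) }) ]′ (sound B dF {upd ρ 21 v} {s₁} h)
    ; D← = λ v v<B h → v<B , complete B dF {upd ρ 21 v} {s₁} ([ inj₁ , (λ { (e , nb) → inj₂ (trans e (sym x≡) , λ { ((_ , b) , f) → nb (b , subst (_∉ FF s) e f) }) }) ]′ h)
    }
    where
    qF dF : Fm
    qF = gQ ∋ var 21 ∥ var 21 ≐ gx ! lit 0 & absorbF
    dF = gD ∋ var 21 ∥ var 21 ≐ gx ! lit 0 & ~ absorbF
    s₁ = exec B ρ (gQ [ 21 ]:= tm qF) s
    x≡ : at B (s gx) 0 ≡ s gx 0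
    x≡ = at0 (s gx)

  step-ok : ∀ s → C.Valid (viewOf s) (QQ s) (DD s) → StepSpec s (exec B ρ guideStepC s)
  step-ok s valid = record { net≡ = net≡ ; Q₁ = Q₁ ; isFurth = isFurth ; outcome = outcome }
    where
    s₀ = exec B ρ bitC s
    s₁ = exec B ρ frontC s₀
    open StepSpec (step-abs s₀ s₁ (exec B ρ moveC s₁) (front-ok s₀ valid) (move-ok s₁) (cong (⟪ B ⟫) (frame B ρ frontC s₀ gF refl)))

iterFrom : {A : Set} → ℕ → ℕ → (ℕ → A → A) → A → A
iterFrom j zero f s = s
iterFrom j (suc m) f s = iterFrom (suc j) m f (f j s)

iterFrom-last : ∀ {A : Set} j m (f : ℕ → A → A) s → iterFrom j (suc m) f s ≡ f (j + m) (iterFrom j m f s)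
iterFrom-last j zero f s = cong (λ i → f i s) (sym (+-identityʳ j))
iterFrom-last j (suc m) f s = trans (iterFrom-last (suc j) m f (f j s)) (cong (λ i → f i (iterFrom (suc j) m f (f j s))) (sym (+-suc j m)))

iter≡iterFrom : ∀ {A : Set} m (f : ℕ → A → A) s → iter m f s ≡ iterFrom 0 m f s
iter≡iterFrom zero f s = refl
iter≡iterFrom (suc m) f s = trans (cong (f m) (iter≡iterFrom m f s)) (sym (iterFrom-last 0 m f s))

half-sum : ∀ B b → b ≤ B → ∀ q → q + q ≤ b → b < 2 + (q + q) → sum B (λ i → cond ((2 + i + i) ∸ b) 1 0) ≡ q
half-sum B b b≤B q lo hi = go B (≤-trans (≤-trans (m≤m+n q q) lo) b≤B)
  where
  low : ∀ i → i < q → (2 + i + i) ∸ b ≡ 0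
  low i i<q = m≤n⇒m∸n≡0 (≤-trans (≤-trans (≤-reflexive (cong suc (sym (+-suc i i)))) (+-mono-≤ i<q i<q)) lo)
  high : ∀ i → q ≤ i → 0 < (2 + i + i) ∸ b
  high i q≤i = m<n⇒0<n∸m (<-≤-trans hi (s≤s (s≤s (+-mono-≤ q≤i q≤i))))
  go : ∀ c → q ≤ c → sum c (λ i → cond ((2 + i + i) ∸ b) 1 0) ≡ q
  go zero q≤0 = sym (n≤0⇒n≡0 q≤0)
  go (suc c) q≤ with q ≟ suc c
  ... | yes refl = trans (sum-cong (suc c) (λ i l → cong (λ d → cond d 1 0) (low i l))) (trans (sum-const (suc c) 1) (*-identityʳ (suc c)))
  ... | no ne = trans (cong₂ _+_ (go c q≤c) (zer (high c q≤c))) (+-identityʳ q)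
    where
    q≤c = ≤-pred (≤∧≢⇒< q≤ ne)
    zer : ∀ {d} → 0 < d → cond d 1 0 ≡ 0
    zer (s≤s _) = refl

module GuideRun (ρ : Env) (0<B : 0 < ρ 2) where
  open FurthRun ρ 0<B using (B; at0) public
  open GuideSpec B (ρ 0) public

  Γ₀ : Names
  Γ₀ = among (0 ∷ 2 ∷ [])

  statics statics′ : List ℕ
  statics = gV ∷ gS ∷ gF ∷ INP ∷ TT ∷ MM ∷ []
  statics′ = gQ ∷ gD ∷ statics

  SameS : Mem → Mem → Set
  SameS = Same B (among statics′)

  DoneAt : DSet → ℕ → Mem → Set
  DoneAt R₀ c s = C.Valid (viewOf s) (QQ s) (DD s) × Guide.Done (netOf s) R₀ c (QQ s) (DD s)

  cell-same : ∀ (a : ℕ) {s s′ : Mem} (v : ℕ) → (∀ i → i < B → s a i ≡ s′ a i) → v ∈ ⟪ B ⟫ (s a) → v ∈ ⟪ B ⟫ (s′ a)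
  cell-same a v h (l , ne) = l , λ e → ne (trans (h v l) e)

  done-same : ∀ {R₀ c s s′} → SameS s s′ → DoneAt R₀ c s → DoneAt R₀ c s′
  done-same {R₀} {c} {s} {s′} S (valid , d) =
    (λ v v∈ → let (a , b , e) = valid v (cell-same gQ {s′} {s} v (S′ gQ refl) v∈)
              in cell-same gV {s} {s′} v (S gV refl) a , b ∘ cell-same gF {s′} {s} v (S′ gF refl) , e ∘ cell-same gD {s′} {s} v (S′ gD refl)) ,
    record
      { closed = λ r r∈ → Guide.Done.closed d r (transfer B (frontF 24) {among (24 ∷ 0 ∷ 2 ∷ [])} {among statics′} {upd ρ 24 r} {upd ρ 24 r} {s′} {s} refl refl (λ _ _ → refl) S′ r∈)
      ; disjoint = λ v v∈ → Guide.Done.disjoint d v v∈ ∘ cell-same gD {s′} {s} v (S′ gD refl)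
      ; size = ≤-trans (#-mono B (dec (DD s′)) (dec (DD s)) (λ v _ → cell-same gD {s′} {s} v (S′ gD refl))) (Guide.Done.size d) }
    where S′ = same-sym B {among statics′} {s} {s′} S

  stepF : ℕ → Mem → Mem
  stepF i = exec B (upd ρ 29 i) guideStepC

  done-next : ∀ {R₀ c} i s → DoneAt R₀ c s → DoneAt R₀ c (stepF i s)
  done-next {R₀} {c} i s (valid , d) = go (StepRun.step-ok (upd ρ 29 i) 0<B s valid)
    where
    go : StepSpec s (stepF i s) → DoneAt R₀ c (stepF i s)
    go st = subst (λ N → Cut.Valid N (QQ s′) (DD s′) × Guide.Done N R₀ c (QQ s′) (DD s′)) (sym net≡) (out outcome)
      where
      open StepSpec st
      open Guide.Furth isFurth
      s′ = stepF i s
      d₁ : Guide.Done N R₀ c Q₁ (DD s)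
      d₁ = Guide.done-step N valid d isFurth
      out : _ → Cut.Valid N (QQ s′) (DD s′) × Guide.Done N R₀ c (QQ s′) (DD s′)
      out (inj₁ (cl , q≈ , d≈)) = valid-≈ N Q₁ (QQ s′) (DD s) (DD s′) q≈ d≈ valid₁ , record
        { closed = closed-≈ N Q₁ (QQ s′) (DD s) (DD s′) q≈ d≈ cl
        ; disjoint = λ v v∈ → Guide.Done.disjoint d v v∈ ∘ proj₁ d≈ v
        ; size = ≤-trans (#-mono B (dec (DD s′)) (dec (DD s)) (λ v _ → proj₁ d≈ v)) (Guide.Done.size d) }
      out (inj₂ (x , x∈ , _)) = contradiction x∈ (Guide.Done.closed d₁ x)

  half : ℕ → ℕ
  half b = sum B (λ i → cond ((2 + i + i) ∸ b) 1 0)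

  bit-half : ∀ c β → β ≤ 1 → β + (c + c) ≤ B → half (β + (c + c)) ≡ c
  bit-half c β β≤1 h = half-sum B _ h c (m≤n+m (c + c) β) (s≤s (+-monoˡ-≤ (c + c) β≤1))

  bits-ok : ∀ i s c β → β ≤ 1 → β + (c + c) ≤ B → s gB 0 ≡ β + (c + c) →
    (let s′ = exec B (upd ρ 29 i) bitC s in s′ gbit 0 ≡ β × s′ gB 0 ≡ c)
  bits-ok i s c β β≤1 h e = trans (cong (λ b → b ∸ (half b + half b)) b≡) (trans (cong (λ z → (β + (c + c)) ∸ (z + z)) (bit-half c β β≤1 h)) (m+n∸n≡m β (c + c))) ,
    trans (cong half b≡) (bit-half c β β≤1 h)
    where
    b≡ : at B (s gB) 0 ≡ β + (c + c)
    b≡ = trans (at0 (s gB)) e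

  actual-abs : ∀ ρ cb cf cm {K₁ K₂} s s′ c β →
    disjoint (among statics′) cb ≡ true →
    okCm Γ₀ cf ≡ true → flow (among statics′) cf ≡ just K₁ → contains K₁ (gx ∷ statics′) ≡ true →
    okCm Γ₀ cm ≡ true → flow (among (gbit ∷ gx ∷ statics′)) cm ≡ just K₂ → contains K₂ statics′ ≡ true →
    writes cf gbit ≡ false → writes cf gB ≡ false → writes cm gB ≡ false →
    exec B ρ cb s′ gbit 0 ≡ β × exec B ρ cb s′ gB 0 ≡ c → (∀ i → exec B ρ cb s′ gbit i ≡ exec B ρ cb s′ gbit 0) → SameS s s′ →
    SameS (exec B ρ cm (upd (exec B ρ cf s) gbit (λ _ → β))) (exec B ρ (cb ﹔ cf ﹔ cm) s′) × exec B ρ (cb ﹔ cf ﹔ cm) s′ gB 0 ≡ c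
  actual-abs ρ cb cf cm {K₁} {K₂} s s′ c β d okf ff fc okm fm mc wb wB wB′ bits const S =
    same-⊆ B {statics′} {K₂} {exec B ρ cm sβ} {exec B ρ cm s₁′} mc
      (exec-same B cm {Γ₀} {among (gbit ∷ gx ∷ statics′)} {K₂} {ρ} {ρ} {sβ} {s₁′} okm fm (λ _ _ → refl) S₁) ,
    trans (cong (λ f → f 0) (trans (frame B ρ cm s₁′ gB wB′) (frame B ρ cf s₀′ gB wB))) (proj₂ bits)
    where
    s₀′ = exec B ρ cb s′
    s₁ = exec B ρ cf s
    s₁′ = exec B ρ cf s₀′
    sβ = upd s₁ gbit (λ _ → β)
    S₀ : SameS s s₀′
    S₀ = same-trans B {among statics′} {s} {s′} {s₀′} S (keepSame B {among statics′} ρ cb s′ d)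
    S₁ : Same B (among (gbit ∷ gx ∷ statics′)) sβ s₁′
    S₁ = same-cons B {gbit} {gx ∷ statics′} {sβ} {s₁′}
      (λ i _ → sym (trans (cong (λ f → f i) (frame B ρ cf s₀′ gbit wb)) (trans (const i) (proj₁ bits))))
      (same-⊆ B {gx ∷ statics′} {among (gx ∷ statics′)} {sβ} {s₁′} refl
        (same-trans B {among (gx ∷ statics′)} {sβ} {s₁} {s₁′}
          (same-sym B {among (gx ∷ statics′)} {s₁} {sβ} (keepSame B {among (gx ∷ statics′)} ρ (gbit [ 21 ]:= lit β) s₁ refl))
          (same-⊆ B {gx ∷ statics′} {K₁} {s₁} {s₁′} fc
            (exec-same B cf {Γ₀} {among statics′} {K₁} {ρ} {ρ} {s} {s₀′} okf ff (λ _ _ → refl) S₀))))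

  actual : ∀ j s s′ c β → β ≤ 1 → β + (c + c) ≤ B → SameS s s′ → s′ gB 0 ≡ β + (c + c) →
    SameS (exec B (upd ρ 29 j) moveC (upd (exec B (upd ρ 29 j) frontC s) gbit (λ _ → β))) (stepF j s′) × stepF j s′ gB 0 ≡ c
  actual j s s′ c β β≤1 h S e = actual-abs (upd ρ 29 j) bitC frontC moveC s s′ c β refl refl refl refl refl refl refl refl refl refl
    (bits-ok j s′ c β β≤1 h e) (λ _ → refl) S

  module Loop (stepf frontf movef : ℕ → Mem → Mem)
    (front-ok : ∀ i s → C.Valid (viewOf s) (QQ s) (DD s) → FrontSpec s (frontf i s))
    (front-gF : ∀ i s → frontf i s gF ≡ s gF)
    (move-ok : ∀ i s → MoveSpec s (movef i s))
    (done-next : ∀ {R₀ c} i s → DoneAt R₀ c s → DoneAt R₀ c (stepf i s))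
    (actual : ∀ j s s′ c β → β ≤ 1 → β + (c + c) ≤ B → SameS s s′ → s′ gB 0 ≡ β + (c + c) →
      SameS (movef j (upd (frontf j s) gbit (λ _ → β))) (stepf j s′) × stepf j s′ gB 0 ≡ c) where

    σ-after : ℕ → ℕ → Mem → Mem
    σ-after j β s = movef j (upd (frontf j s) gbit (λ _ → β))

    done-iter : ∀ {R₀ c} m j s → DoneAt R₀ c s → DoneAt R₀ c (iterFrom j m stepf s)
    done-iter zero j s d = d
    done-iter (suc m) j s d = done-iter m (suc j) (stepf j s) (done-next j s d)

    Run : ℕ → DSet → ℕ → ℕ → ℕ → Mem → Set
    Run p R₀ c m j s = ∃[ b ] b < 2 ^ p × (∀ s′ → SameS s s′ → s′ gB 0 ≡ b → DoneAt R₀ c (iterFrom j m stepf s′))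

    guided : ∀ p m j s {R₀ c} → p < m → 2 ^ p ≤ B → C.Valid (viewOf s) (QQ s) (DD s) →
      Guide.Active (netOf s) R₀ c p (QQ s) (DD s) → Run p R₀ c m j s
    guided p (suc m) j s {R₀} {c} (s≤s p≤m) 2^p≤B valid act = go (FrontSpec.pick fs)
      where
      N = netOf s
      fs = front-ok j s valid
      s₁ = frontf j s
      open FrontSpec fs using (net≡; D≡; isFurth)
      module Mv (β : ℕ) where
        sβ = upd s₁ gbit (λ _ → β)
        fsβ : FrontSpec s sβ
        fsβ = record { net≡ = net≡ ; D≡ = D≡ ; isFurth = isFurth ; pick = FrontSpec.pick fs }
        open Moved s sβ (σ-after j β s) fsβ (move-ok j sβ) public
      doneσ : ∀ {β Q D} → QQ (σ-after j β s) ≈ Q → DD (σ-after j β s) ≈ D → Cut.Valid N Q D → Guide.Done N R₀ c Q D → DoneAt R₀ c (σ-after j β s)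
      doneσ {β} {Q} {D} q≈ d≈ v d = subst (λ N → Cut.Valid N (QQ σ) (DD σ) × Guide.Done N R₀ c (QQ σ) (DD σ)) (sym (Mv.net-moved β))
        (valid-≈ N Q (QQ σ) D (DD σ) q≈ d≈ v , record
          { closed = closed-≈ N Q (QQ σ) D (DD σ) q≈ d≈ (Guide.Done.closed d)
          ; disjoint = λ v v∈ → Guide.Done.disjoint d v v∈ ∘ proj₁ d≈ v
          ; size = ≤-trans (#-mono B (dec (DD σ)) (dec D) (λ v _ → proj₁ d≈ v)) (Guide.Done.size d) })
        where σ = σ-after j β s
      next : ∀ {p′} β {Q D} → β ≤ 1 → p ≡ suc p′ → QQ (σ-after j β s) ≈ Q → DD (σ-after j β s) ≈ D → Cut.Valid N Q D → Guide.Active N R₀ c p′ Q D →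
        Run p R₀ c (suc m) j s
      next {p′} β {Q} {D} β≤1 refl q≈ d≈ v a = β + (b + b) , b<′ , λ s′ S e →
        let (S₂ , e₂) = actual j s s′ b β β≤1 (<⇒≤ (<-≤-trans b<′ 2^p≤B)) S e in fin (stepf j s′) S₂ e₂
        where
        σ = σ-after j β s
        rec : Run p′ R₀ c m (suc j) σ
        rec = guided p′ m (suc j) σ p≤m (≤-trans (^-monoʳ-≤ 2 (n≤1+n p′)) 2^p≤B)
          (subst (λ N → Cut.Valid N (QQ σ) (DD σ)) (sym (Mv.net-moved β)) (valid-≈ N Q (QQ σ) D (DD σ) q≈ d≈ v))
          (subst (λ N → Guide.Active N R₀ c p′ (QQ σ) (DD σ)) (sym (Mv.net-moved β))
            (Guide.active-≈ N Q (QQ σ) D (DD σ) (proj₂ q≈) (proj₁ q≈) (proj₂ d≈) (proj₁ d≈) a))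
        b = proj₁ rec
        b<′ : β + (b + b) < 2 ^ suc p′
        b<′ = ≤-<-trans (+-monoˡ-≤ (b + b) β≤1) (≤-trans (≤-reflexive (cong suc (sym (+-suc b b)))) (≤-trans (+-mono-≤ (proj₁ (proj₂ rec)) (proj₁ (proj₂ rec))) (≤-reflexive (cong (2 ^ p′ +_) (sym (+-identityʳ (2 ^ p′)))))))
        fin : ∀ s₂ → SameS σ s₂ → s₂ gB 0 ≡ b → DoneAt R₀ c (iterFrom (suc j) m stepf s₂)
        fin s₂ = proj₂ (proj₂ rec) s₂
      valid₁ = Guide.Furth.valid₁ isFurth
      go : _ → Run p R₀ c (suc m) j s
      go (inj₁ (x≡B , h)) = 0 , >-nonZero⁻¹ (2 ^ p) {{m^n≢0 2 p}} , λ s′ S e →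
        let (S₂ , _) = actual j s s′ 0 0 z≤n z≤n S e
        in done-iter m (suc j) (stepf j s′) (done-same {s = σ-after j 0 s} {stepf j s′} S₂ (doneσ {0} {QQ s₁} {DD s} (proj₁ (Mv.move-none 0 x≡B)) (proj₂ (Mv.move-none 0 x≡B)) valid₁ (Guide.finish N act isFurth h)))
      go (inj₂ (x<B , x∈)) with Guide.advance N act isFurth (s₁ gx 0) x∈
      ... | p′ , p≡ , inj₁ (x∉F , absorb) = next 1 {Q = QQ s₁ ∪ ｛ s₁ gx 0 ｝} {DD s} ≤-refl p≡ (proj₁ moved) (proj₂ moved)
        (λ { v (inj₁ q) → valid₁ v q ; v (inj₂ refl) → proj₁ (proj₁ (proj₁ x∈)) , x∉F , proj₂ (proj₁ (proj₁ x∈)) })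
        (absorb _ (λ _ → id) (λ _ → id))
        where
        moved = Mv.move-absorb 1 x<B ((λ ()) , subst (λ f → s₁ gx 0 ∉ ⟪ B ⟫ f) (sym (front-gF j s)) x∉F)
      ... | p′ , p≡ , inj₂ delete = next 0 {Q = QQ s₁} {DD s ∪ ｛ s₁ gx 0 ｝} z≤n p≡ (proj₁ moved) (proj₂ moved)
        (λ v q → let (a , b , e) = valid₁ v q in a , b , [ e , (λ { refl → proj₂ (proj₁ x∈) q }) ]′)
        (delete _ (λ _ → id) (λ _ → id))
        where
        moved = Mv.move-delete 0 x<B (λ h → proj₁ h refl)

  open Loop stepF (λ i → exec B (upd ρ 29 i) frontC) (λ i → exec B (upd ρ 29 i) moveC)
    (λ i → StepRun.front-ok (upd ρ 29 i) 0<B) (λ i s → frame B (upd ρ 29 i) frontC s gF refl) (λ i → StepRun.move-ok (upd ρ 29 i) 0<B) done-next actual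
    using (guided)

  startG : Mem → Mem
  startG s = exec B ρ (gQ [ 21 ]:= lit 0 ﹔ gD [ 21 ]:= lit 0) s

  guide≡ : ∀ s → exec B ρ guideC s ≡ iterFrom 0 B stepF (startG s)
  guide≡ s = iter≡iterFrom B stepF (startG s)

  empty : ∀ {v} → v ∉ ⟪ B ⟫ (λ _ → 0)
  empty (_ , ne) = ne refl

  guide-sound : ∀ s → Sound (netOf s) B (exec B ρ guideC s)
  guide-sound s = go B
    where
    go : ∀ j → Sound (netOf s) j (iter j stepF (startG s))
    go zero = record { net≡ = refl ; valid = λ v v∈ → contradiction v∈ empty ; D⊆V = λ v v∈ → contradiction v∈ empty ; count = inj₁ z≤n }
    go (suc j) = sound-step (go j) (step (iter j stepF (startG s)) (go j))
      where
      step : ∀ s₁ → Sound (netOf s) j s₁ → StepSpec s₁ (stepF j s₁)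
      step s₁ so = StepRun.step-ok (upd ρ 29 j) 0<B s₁ (subst (λ N → Cut.Valid N (QQ s₁) (DD s₁)) (sym (Sound.net≡ so)) (Sound.valid so))

  guide-complete : ∀ s R₀ c → Cut.Valid (netOf s) R₀ (⟪ B ⟫ (λ _ → 0)) → # B (dec (Cut.frontier (netOf s) R₀ (⟪ B ⟫ (λ _ → 0)))) ≤ c →
    2 ^ (2 * c) ≤ B → 2 * c < B →
    ∃[ b ] b < 2 ^ (2 * c) × (∀ s′ → Same B (among statics) s s′ → s′ gB 0 ≡ b →
      let t = exec B ρ guideC s′ in (∀ v → v ∈ R₀ → v ∉ DD t) × # B (dec (DD t)) ≤ c)
  guide-complete s R₀ c valid h pB lB =
    let (b , b< , r) = guided (2 * c) B 0 (startG s) {R₀} {c} lB pB (λ v v∈ → contradiction v∈ empty)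
          (Guide.initial (netOf s) R₀ c (⟪ B ⟫ (λ _ → 0)) (⟪ B ⟫ (λ _ → 0)) valid (λ v → empty) (λ v → empty) h)
    in b , b< , λ s′ S e → subst (λ t → (∀ v → v ∈ R₀ → v ∉ DD t) × # B (dec (DD t)) ≤ c) (sym (guide≡ s′))
      (out (iterFrom 0 B stepF (startG s′)) (r (startG s′)
        (same-cons B {gQ} {gD ∷ statics} {startG s} {startG s′} (λ _ _ → refl) (same-cons B {gD} {statics} {startG s} {startG s′} (λ _ _ → refl)
          (same-trans B {among statics} {startG s} {s} {startG s′} (same-sym B {among statics} {s} {startG s} (keepSame B {among statics} ρ (gQ [ 21 ]:= lit 0 ﹔ gD [ 21 ]:= lit 0) s refl))
            (same-trans B {among statics} {s} {s′} {startG s′} S (keepSame B {among statics} ρ (gQ [ 21 ]:= lit 0 ﹔ gD [ 21 ]:= lit 0) s′ refl))))) e))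
    where
    out : ∀ t → DoneAt R₀ c t → (∀ v → v ∈ R₀ → v ∉ DD t) × # B (dec (DD t)) ≤ c
    out t (_ , d) = Guide.Done.disjoint d , Guide.Done.size d

bin : ℕ → ℕ → ℕ
bin n zero = 1
bin zero (suc k) = 0
bin (suc n) (suc k) = bin n k + bin n (suc k)

bin-0 : ∀ n d → bin n (suc (n + d)) ≡ 0
bin-0 zero d = refl
bin-0 (suc n) d = cong₂ _+_ (bin-0 n d) (trans (cong (λ z → bin n (suc z)) (sym (+-suc n d))) (bin-0 n (suc d)))

sum-+ : ∀ b (f g : ℕ → ℕ) → sum b (λ i → f i + g i) ≡ sum b f + sum b g
sum-+ zero f g = refl
sum-+ (suc b) f g = trans (cong (_+ (f b + g b)) (sum-+ b f g)) (+-swap (sum b f) (sum b g) (f b) (g b))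

sum-first : ∀ b (f : ℕ → ℕ) → sum (suc b) f ≡ f 0 + sum b (λ i → f (suc i))
sum-first zero f = +-comm 0 (f 0)
sum-first (suc b) f = trans (cong (_+ f (suc b)) (sum-first b f)) (+-assoc (f 0) _ _)

sum-bin : ∀ n → sum (suc n) (bin n) ≡ 2 ^ n
sum-bin zero = refl
sum-bin (suc n) = begin
  sum (suc (suc n)) (bin (suc n)) ≡⟨ sum-first (suc n) (bin (suc n)) ⟩
  1 + sum (suc n) (λ k → bin n k + bin n (suc k)) ≡⟨ cong (1 +_) (sum-+ (suc n) (bin n) (λ k → bin n (suc k))) ⟩
  1 + (sum (suc n) (bin n) + sum (suc n) (λ k → bin n (suc k))) ≡⟨ eq (sum (suc n) (bin n)) _ ⟩
  sum (suc n) (bin n) + (1 + sum (suc n) (λ k → bin n (suc k))) ≡⟨ cong (sum (suc n) (bin n) +_) (sym (sum-first (suc n) (bin n))) ⟩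
  sum (suc n) (bin n) + (sum (suc n) (bin n) + bin n (suc n)) ≡⟨ cong (λ z → sum (suc n) (bin n) + (sum (suc n) (bin n) + z)) (trans (cong (λ z → bin n (suc z)) (sym (+-identityʳ n))) (bin-0 n 0)) ⟩
  sum (suc n) (bin n) + (sum (suc n) (bin n) + 0) ≡⟨ cong (λ z → z + (z + 0)) (sum-bin n) ⟩
  2 ^ suc n ∎
  where
  open ≡-Reasoning
  eq : ∀ a b → 1 + (a + b) ≡ a + (1 + b)
  eq a b = sym (+-suc a b)

bin-absorb : ∀ n k → suc k * bin (suc n) (suc k) ≡ suc n * bin n k
bin-absorb zero zero = refl
bin-absorb zero (suc k) = *-zeroʳ (suc (suc k))
bin-absorb (suc n) zero = trans (+-identityʳ _) (trans (cong suc (trans (sym (+-identityʳ _)) (bin-absorb n zero))) (cong suc (*-identityʳ (suc n))) ▹ sym (*-identityʳ (suc (suc n))))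
  where
  _▹_ : ∀ {a b c : ℕ} → a ≡ b → b ≡ c → a ≡ c
  _▹_ = trans
bin-absorb (suc n) (suc k) = begin
  suc (suc k) * (bin (suc n) (suc k) + bin (suc n) (suc (suc k))) ≡⟨ eq₁ k (bin (suc n) (suc k)) (bin (suc n) (suc (suc k))) ⟩
  bin (suc n) (suc k) + (suc k * bin (suc n) (suc k) + suc (suc k) * bin (suc n) (suc (suc k))) ≡⟨ cong₂ (λ y z → bin (suc n) (suc k) + (y + z)) (bin-absorb n k) (bin-absorb n (suc k)) ⟩
  (bin n k + bin n (suc k)) + (suc n * bin n k + suc n * bin n (suc k)) ≡⟨ eq₂ n (bin n k) (bin n (suc k)) ⟩
  suc (suc n) * (bin n k + bin n (suc k)) ∎
  where
  open ≡-Reasoning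
  eq₁ = solve 3 (λ k x y → (con 1 :+ (con 1 :+ k)) :* (x :+ y) := x :+ ((con 1 :+ k) :* x :+ (con 1 :+ (con 1 :+ k)) :* y)) refl
  eq₂ = solve 3 (λ n x y → (x :+ y) :+ ((con 1 :+ n) :* x :+ (con 1 :+ n) :* y) := (con 1 :+ (con 1 :+ n)) :* (x :+ y)) refl

bin-pos : ∀ n k → k ≤ n → 0 < bin n k
bin-pos n zero _ = s≤s z≤n
bin-pos (suc n) (suc k) (s≤s l) = <-≤-trans (bin-pos n k l) (m≤m+n _ _)

-- Leibniz' harmonic triangle: with a = j C(m−1, j), b = j C(m, j) and
-- c = (j+1) C(m, j+1) one has 1/c = 1/a − 1/b, so a common multiple of a and
-- b is a multiple of c.
leibniz : ∀ M L → 0 < L → (∀ m → 0 < m → m ≤ M → m ∣ L) → ∀ j m → j < m → m ≤ M → suc j * bin m (suc j) ∣ L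
leibniz M L 0<L div zero m j<m m≤M = subst (_∣ L) (sym (trans (*-identityˡ _) (bin-1 m))) (div m j<m m≤M)
  where
  bin-1 : ∀ m → bin m 1 ≡ m
  bin-1 zero = refl
  bin-1 (suc m) = cong suc (bin-1 m)
leibniz M L 0<L div (suc j) (suc m) (s≤s j<m) m≤M
  with leibniz M L 0<L div j m j<m (<⇒≤ m≤M) | leibniz M L 0<L div j (suc m) (m<n⇒m<1+n j<m) m≤M
... | divides x ex | divides y ey = ∣m+n∣m⇒∣n (subst (c ∣_) key (n∣m*n x)) (n∣m*n y)
  where
  p = bin m (suc j)
  q = bin m j
  a = suc j * p
  b = suc j * (q + p)
  c = suc (suc j) * bin (suc m) (suc (suc j))
  ab≢0 : NonZero (a * b)
  ab≢0 = m*n≢0 a b {{>-nonZero (*-mono-≤ {1} {suc j} (s≤s z≤n) (bin-pos m (suc j) j<m))}}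
    {{>-nonZero (*-mono-≤ {1} {suc j} (s≤s z≤n) (<-≤-trans (bin-pos m (suc j) j<m) (m≤n+m p q)))}}
  c≡ : c ≡ suc m * p
  c≡ = bin-absorb m (suc j)
  b≡ : b ≡ suc m * q
  b≡ = bin-absorb m j
  id₁ : a * b + c * a ≡ c * b
  id₁ = begin
    a * b + c * a ≡⟨ cong₂ (λ u v → a * u + v * a) b≡ c≡ ⟩
    a * (suc m * q) + suc m * p * a ≡⟨ eq (suc j) (suc m) p q ⟩
    suc m * p * b ≡⟨ cong (_* b) (sym c≡) ⟩
    c * b ∎
    where
    open ≡-Reasoning
    eq = solve 4 (λ j m p q → j :* p :* (m :* q) :+ m :* p :* (j :* p) := m :* p :* (j :* (q :+ p))) refl
  key : x * c ≡ y * c + L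
  key = *-cancelʳ-≡ (x * c) (y * c + L) (a * b) {{ab≢0}} (begin
    x * c * (a * b) ≡⟨ eq₁ x c a b ⟩
    (x * a) * (c * b) ≡⟨ cong (_* (c * b)) (sym ex) ⟩
    L * (c * b) ≡⟨ cong (L *_) (sym id₁) ⟩
    L * (a * b + c * a) ≡⟨ eq₂ L a b c ⟩
    L * (c * a) + L * (a * b) ≡⟨ cong (λ z → z * (c * a) + L * (a * b)) ey ⟩
    (y * b) * (c * a) + L * (a * b) ≡⟨ eq₃ y c a b L ⟩
    (y * c + L) * (a * b) ∎)
    where
    open ≡-Reasoning
    eq₁ = solve 4 (λ x c a b → x :* c :* (a :* b) := (x :* a) :* (c :* b)) refl
    eq₂ = solve 4 (λ L a b c → L :* (a :* b :+ c :* a) := L :* (c :* a) :+ L :* (a :* b)) refl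
    eq₃ = solve 5 (λ y c a b L → (y :* b) :* (c :* a) :+ L :* (a :* b) := (y :* c :+ L) :* (a :* b)) refl

common-multiple : ∀ M L → 0 < L → (∀ m → 0 < m → m ≤ M → m ∣ L) → 2 ^ M ≤ suc M * L
common-multiple M L 0<L div = begin
  2 ^ M ≡⟨ sym (sum-bin M) ⟩
  sum (suc M) (bin M) ≤⟨ sum-≤ (suc M) small ⟩
  sum (suc M) (λ _ → L) ≡⟨ sum-const (suc M) L ⟩
  suc M * L ∎
  where
  open ≤-Reasoning
  small : ∀ j → j < suc M → bin M j ≤ L
  small zero _ = 0<L
  small (suc j) (s≤s j<M) = ≤-trans (m≤n*m (bin M (suc j)) (suc j)) (∣⇒≤ {{>-nonZero 0<L}} (leibniz M L 0<L div j M j<M ≤-refl))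

gaps : ℕ → List ℕ → ℕ
gaps x [] = 1
gaps x (q ∷ qs) = ∣ x - q ∣ * gaps x qs

allGaps : List ℕ → List ℕ → ℕ
allGaps [] qs = 1
allGaps (x ∷ xs) qs = gaps x qs * allGaps xs qs

gaps-∣ : ∀ x {q qs} → q ∈ᴸ qs → ∣ x - q ∣ ∣ gaps x qs
gaps-∣ x (hereᴸ refl) = m∣m*n _
gaps-∣ x {qs = q′ ∷ _} (thereᴸ q∈) = ∣-trans (gaps-∣ x q∈) (n∣m*n ∣ x - q′ ∣)

allGaps-∣ : ∀ {x xs q qs} → x ∈ᴸ xs → q ∈ᴸ qs → ∣ x - q ∣ ∣ allGaps xs qs
allGaps-∣ {x} (hereᴸ refl) q∈ = ∣-trans (gaps-∣ x q∈) (m∣m*n _)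
allGaps-∣ {xs = x′ ∷ _} {qs = qs} (thereᴸ x∈) q∈ = ∣-trans (allGaps-∣ x∈ q∈) (n∣m*n (gaps x′ qs))

gaps-pos : ∀ x qs → (∀ q → q ∈ᴸ qs → x ≢ q) → 0 < gaps x qs
gaps-pos x [] h = s≤s z≤n
gaps-pos x (q ∷ qs) h = *-mono-≤ {1} {∣ x - q ∣} (n≢0⇒n>0 (λ e → h q (hereᴸ refl) (∣m-n∣≡0⇒m≡n e))) (gaps-pos x qs (λ q q∈ → h q (thereᴸ q∈)))

Below : ℕ → List ℕ → Set
Below b xs = ∀ x → x ∈ᴸ xs → x < b

Apart : List ℕ → List ℕ → Set
Apart xs qs = ∀ x q → x ∈ᴸ xs → q ∈ᴸ qs → x ≢ q

allGaps-pos : ∀ xs qs → Apart xs qs → 0 < allGaps xs qs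
allGaps-pos [] qs h = s≤s z≤n
allGaps-pos (x ∷ xs) qs h = *-mono-≤ {1} {gaps x qs} (gaps-pos x qs (λ q → h x q (hereᴸ refl))) (allGaps-pos xs qs (λ x q x∈ → h x q (thereᴸ x∈)))

gaps-≤ : ∀ l x qs → x < 2 ^ l → Below (2 ^ l) qs → gaps x qs ≤ 2 ^ (l * length qs)
gaps-≤ l x [] x< h = ≤-reflexive (cong (2 ^_) (sym (*-zeroʳ l)))
gaps-≤ l x (q ∷ qs) x< h = ≤-trans (*-mono-≤ (≤-trans (∣m-n∣≤m⊔n x q) (<⇒≤ (⊔-lub x< (h q (hereᴸ refl))))) (gaps-≤ l x qs x< (λ q q∈ → h q (thereᴸ q∈))))
  (≤-reflexive (trans (sym (^-distribˡ-+-* 2 l (l * length qs))) (cong (2 ^_) (sym (*-suc l (length qs))))))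

allGaps-≤ : ∀ l xs qs → Below (2 ^ l) xs → Below (2 ^ l) qs → allGaps xs qs ≤ 2 ^ (length xs * (l * length qs))
allGaps-≤ l [] qs h g = s≤s z≤n
allGaps-≤ l (x ∷ xs) qs h g = ≤-trans (*-mono-≤ (gaps-≤ l x qs (h x (hereᴸ refl)) g) (allGaps-≤ l xs qs (λ x x∈ → h x (thereᴸ x∈)) g))
  (≤-reflexive (sym (^-distribˡ-+-* 2 (l * length qs) (length xs * (l * length qs)))))

anyᴸ? : ∀ (xs : List ℕ) {P : ℕ → Set} → (∀ x → Dec (P x)) → Dec (∃[ x ] x ∈ᴸ xs × P x)
anyᴸ? [] P? = no λ ()
anyᴸ? (x ∷ xs) P? with P? x | anyᴸ? xs P?
... | yes p | _ = yes (x , hereᴸ refl , p)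
... | no _ | yes (y , y∈ , p) = yes (y , thereᴸ y∈ , p)
... | no ¬p | no none = no λ { (y , hereᴸ refl , p) → ¬p p ; (y , thereᴸ y∈ , p) → none (y , y∈ , p) }

separate : ∀ l s xs qs → Below (2 ^ l) xs → Below (2 ^ l) qs →
  Apart xs qs → length xs * (l * length qs) ≤ s →
  ∃[ m ] 0 < m × m ≤ 2 * s + 4 × (∀ x q → x ∈ᴸ xs → q ∈ᴸ qs → ¬ (m ∣ ∣ x - q ∣))
separate l s xs qs xs< qs< dis N≤s
  with any<? (suc (2 * s + 4)) (λ m → (0 <? m) ×-dec ¬? (anyᴸ? xs (λ x → anyᴸ? qs (λ q → m ∣? ∣ x - q ∣))))
... | yes (m , m< , 0<m , none) = m , 0<m , ≤-pred m< , λ x q x∈ q∈ d → none (x , x∈ , q , q∈ , d)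
... | no nope = contradiction (common-multiple M L (allGaps-pos xs qs dis) div) (<⇒≱ big)
  where
  M = 2 * s + 4
  L = allGaps xs qs
  div : ∀ m → 0 < m → m ≤ M → m ∣ L
  div m 0<m m≤M with anyᴸ? xs (λ x → anyᴸ? qs (λ q → m ∣? ∣ x - q ∣))
  ... | yes (x , x∈ , q , q∈ , d) = ∣-trans d (allGaps-∣ x∈ q∈)
  ... | no none = contradiction (m , s≤s m≤M , 0<m , none) nope
  lin : ∀ s → suc (2 * s + 4) < 2 ^ (s + 4)
  lin zero = s≤s (s≤s (s≤s (s≤s (s≤s (s≤s z≤n)))))
  lin (suc s) = begin-strict
    suc (2 * suc s + 4) ≡⟨ eq s ⟩
    suc (2 * s + 4) + 2 ≤⟨ +-monoʳ-≤ (suc (2 * s + 4)) (≤-trans (s≤s (s≤s z≤n)) (m≤n+m 5 (2 * s)) ▹ ≤-reflexive (+-suc (2 * s) 4)) ⟩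
    suc (2 * s + 4) + suc (2 * s + 4) <⟨ +-mono-< (lin s) (lin s) ⟩
    2 ^ (s + 4) + 2 ^ (s + 4) ≡⟨ cong (2 ^ (s + 4) +_) (sym (+-identityʳ (2 ^ (s + 4)))) ⟩
    2 ^ (suc s + 4) ∎
    where
    open ≤-Reasoning
    _▹_ : ∀ {a b c : ℕ} → a ≤ b → b ≤ c → a ≤ c
    _▹_ = ≤-trans
    eq = solve 1 (λ s → con 1 :+ (con 2 :* (con 1 :+ s) :+ con 4) := con 1 :+ (con 2 :* s :+ con 4) :+ con 2) refl
  big : suc M * L < 2 ^ M
  big = begin-strict
    suc M * L ≤⟨ *-monoʳ-≤ (suc M) (≤-trans (allGaps-≤ l xs qs xs< qs<) (^-monoʳ-≤ 2 N≤s)) ⟩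
    suc M * 2 ^ s <⟨ *-monoˡ-< (2 ^ s) {{m^n≢0 2 s}} (lin s) ⟩
    2 ^ (s + 4) * 2 ^ s ≡⟨ sym (^-distribˡ-+-* 2 (s + 4) s) ⟩
    2 ^ (s + 4 + s) ≡⟨ cong (2 ^_) (eq s) ⟩
    2 ^ M ∎
    where
    open ≤-Reasoning
    eq = solve 1 (λ s → s :+ con 4 :+ s := con 2 :* s :+ con 4) refl

UU WW PP ZZ XX adv hC hm hd HH BC sol nsol found fail : ℕ
UU = 17 ; WW = 18 ; PP = 19 ; ZZ = 20 ; XX = 21 ; adv = 22 ; hC = 23 ; hm = 24 ; hd = 25
HH = 26 ; BC = 27 ; sol = 28 ; nsol = 29 ; found = 30 ; fail = 31

divT modT : Tm → Tm → Tm
divT s t = Σ[ 42 ] ifz (mulT 43 (var 42 ⊞ lit 1) t ⊟ s) (lit 1) (lit 0)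
modT s t = s ⊟ mulT 39 (divT s t) t

threshold : ∀ B (h : ℕ → ℕ) q v → q ≤ B → (∀ i → i < q → h i ≡ v) → (∀ i → q ≤ i → h i ≡ 0) → sum B h ≡ q * v
threshold zero h q v q≤ lo hi rewrite n≤0⇒n≡0 q≤ = refl
threshold (suc B) h q v q≤ lo hi with q ≟ suc B
... | yes refl = trans (sum-cong (suc B) lo) (sum-const (suc B) v)
... | no ne = trans (cong₂ _+_ (threshold B h q v (≤-pred (≤∧≢⇒< q≤ ne)) lo hi) (hi B (≤-pred (≤∧≢⇒< q≤ ne)))) (+-identityʳ (q * v))

cond-0 : ∀ {d a b : ℕ} → d ≡ 0 → cond d a b ≡ a
cond-0 refl = refl

cond-+ : ∀ {d a b : ℕ} → 0 < d → cond d a b ≡ b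
cond-+ (s≤s _) = refl

mul-val : ∀ B u t → u ≤ B → sum B (λ i → cond (u ∸ i) 0 t) ≡ u * t
mul-val B u t u≤B = threshold B _ u t u≤B (λ i l → cond-+ (m<n⇒0<n∸m l)) (λ i l → cond-0 (m≤n⇒m∸n≡0 l))

floorDiv : ℕ → ℕ → ℕ → ℕ
floorDiv B b a = sum B (λ i → cond (sum B (λ j → cond ((i + 1) ∸ j) 0 b) ∸ a) 1 0)

div-val : ∀ B a b q → q ≤ B → q * b ≤ a → a < suc q * b → floorDiv B b a ≡ q
div-val B a b q q≤B lo hi = trans (sum-cong B {g = λ i → cond (suc i * b ∸ a) 1 0} (λ i l → cong (λ z → cond (z ∸ a) 1 0)
  (trans (mul-val B (i + 1) b (≤-trans (≤-reflexive (+-comm i 1)) l)) (cong (_* b) (+-comm i 1)))))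
  (trans (threshold B _ q 1 q≤B (λ i l → cond-0 (m≤n⇒m∸n≡0 (≤-trans (*-monoˡ-≤ b l) lo))) (λ i l → cond-+ (m<n⇒0<n∸m (<-≤-trans hi (*-monoˡ-≤ b (s≤s l)))))) (*-identityʳ q))

encode : ℕ → List ℕ → ℕ
encode M [] = 0
encode M (d ∷ ds) = d + encode M ds * M

encode-< : ∀ M ds → 0 < M → Below M ds → encode M ds < M ^ length ds
encode-< M [] 0<M h = s≤s z≤n
encode-< M (d ∷ ds) 0<M h = begin-strict
  d + encode M ds * M <⟨ +-monoˡ-< (encode M ds * M) (h d (hereᴸ refl)) ⟩
  M + encode M ds * M ≤⟨ *-monoˡ-≤ M (encode-< M ds 0<M (λ d d∈ → h d (thereᴸ d∈))) ⟩
  M ^ length ds * M ≡⟨ *-comm (M ^ length ds) M ⟩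
  M ^ suc (length ds) ∎
  where open ≤-Reasoning

divmod-val : ∀ B b d q → d < b → q ≤ B → (let Q = floorDiv B b (d + q * b) in
  Q ≡ q × (d + q * b) ∸ sum B (λ j → cond (Q ∸ j) 0 b) ≡ d)
divmod-val B b d q d<b q≤B = e , trans (cong (λ z → (d + q * b) ∸ sum B (λ j → cond (z ∸ j) 0 b)) e)
  (trans (cong ((d + q * b) ∸_) (mul-val B q b q≤B)) (m+n∸n≡m d (q * b)))
  where
  e = div-val B (d + q * b) b q q≤B (m≤n+m (q * b) d) (+-monoˡ-< (q * b) d<b)

takeC : ℕ → Cm
takeC a = a [ 21 ]:= modT (adv ! lit 0) (var 52) ﹔ adv [ 21 ]:= divT (adv ! lit 0) (var 52)

take-ok : ∀ ρ a s d q → a ≢ adv → 0 < ρ 2 → d < ρ 52 → q ≤ ρ 2 → s adv 0 ≡ d + q * ρ 52 →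
  (let s′ = exec (ρ 2) ρ (takeC a) s in s′ a 0 ≡ d × s′ adv 0 ≡ q)
take-ok ρ a s d q ne 0<B d< q≤ e = trans (cong (λ f → f 0) (trans (upd-≢ s₁ {adv} {a} _ (λ z → ne (sym z))) (upd-≡ s a _)))
  (trans (cong (λ z → z ∸ sum B (λ j → cond (floorDiv B (ρ 52) z ∸ j) 0 (ρ 52))) a≡) (proj₂ dm)) ,
    trans (cong (λ z → floorDiv B (ρ 52) z) (trans (cong (λ f → at B f 0) (upd-≢ s {a} {adv} _ ne)) a≡)) (proj₁ dm)
  where
  B = ρ 2
  s₁ : Mem
  s₁ = exec B ρ (a [ 21 ]:= modT (adv ! lit 0) (var 52)) s
  a≡ : at B (s adv) 0 ≡ d + q * ρ 52
  a≡ = trans (at-< B (s adv) 0<B) e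
  dm = divmod-val B (ρ 52) d q d< q≤

-- The set of all numbers congruent modulo m to one of the residues d − 1,
-- for the code m + M (d₁ + M (d₂ + ⋯)) in hC; digits 0 are ignored.

hashStepC hashC : Cm
hashStepC = hd [ 21 ]:= modT (hC ! lit 0) (var 51) ﹔ hC [ 21 ]:= divT (hC ! lit 0) (var 51) ﹔
  HH [ 21 ]:= tm (HH ∋ var 21 ∥ lit 0 ≺ hd ! lit 0 & ∃̇[ 44 ] (var 21 ≐ mulT 40 (var 44) (hm ! lit 0) ⊞ (hd ! lit 0 ⊟ lit 1)))
hashC = hm [ 21 ]:= modT (hC ! lit 0) (var 51) ﹔ hC [ 21 ]:= divT (hC ! lit 0) (var 51) ﹔ HH [ 21 ]:= lit 0 ﹔ for 45 hashStepC

module HashRun (ρ : Env) (0<B : 0 < ρ 2) where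
  B = ρ 2
  M = ρ 51

  Hit : ℕ → ℕ → ℕ → Set
  Hit m d v = 0 < d × ∃[ q ] q < B × v ≡ q * m + (d ∸ 1)

  at0 : ∀ f → at B f 0 ≡ f 0
  at0 f = at-< B f 0<B

  record HashStep (s s′ : Mem) (d q : ℕ) : Set where
    field
      code : s′ hC 0 ≡ q
      modu : s′ hm 0 ≡ s hm 0
      hits→ : ∀ v → v ∈ ⟪ B ⟫ (s′ HH) → v ∈ ⟪ B ⟫ (s HH) ⊎ Hit (s hm 0) d v
      hits← : ∀ v → v < B → v ∈ ⟪ B ⟫ (s HH) ⊎ Hit (s hm 0) d v → v ∈ ⟪ B ⟫ (s′ HH)

  quot : ℕ → ℕ
  quot a = floorDiv B M a

  rem : ℕ → ℕ
  rem a = a ∸ sum B (λ j → cond (quot a ∸ j) 0 M)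

  hash-step : ∀ i s d q → d < M → q ≤ B → s hC 0 ≡ d + q * M → HashStep s (exec B (upd ρ 45 i) hashStepC s) d q
  hash-step i s d q d<M q≤B e = record
    { code = trans (cong quot a≡) (proj₁ dm)
    ; modu = refl
    ; hits→ = λ v (l , h) → [ inj₁ , (λ { (p , q , q<B , z) → inj₂ (subst (0 <_) hd≡ p , q , q<B , trans z (val q q<B)) }) ]′ (sound B hitF {upd (upd ρ 45 i) 21 v} {s₂} h)
    ; hits← = λ v l h → l , complete B hitF {upd (upd ρ 45 i) 21 v} {s₂} ([ inj₁ , (λ { (p , q , q<B , z) → inj₂ (subst (0 <_) (sym hd≡) p , q , q<B , trans z (sym (val q q<B))) }) ]′ h)
    }
    where
    hitF = HH ∋ var 21 ∥ lit 0 ≺ hd ! lit 0 & ∃̇[ 44 ] (var 21 ≐ mulT 40 (var 44) (hm ! lit 0) ⊞ (hd ! lit 0 ⊟ lit 1))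
    s₂ = exec B (upd ρ 45 i) (hd [ 21 ]:= modT (hC ! lit 0) (var 51) ﹔ hC [ 21 ]:= divT (hC ! lit 0) (var 51)) s
    a≡ : at B (s hC) 0 ≡ d + q * M
    a≡ = trans (at0 (s hC)) e
    dm = divmod-val B M d q d<M q≤B
    hd≡ : at B (s₂ hd) 0 ≡ d
    hd≡ = trans (at0 (s₂ hd)) (trans (cong rem a≡) (proj₂ dm))
    val : ∀ q → q < B → sum B (λ j → cond (q ∸ j) 0 (at B (s hm) 0)) + (at B (s₂ hd) 0 ∸ 1) ≡ q * s hm 0 + (d ∸ 1)
    val q q<B = cong₂ _+_ (trans (mul-val B q _ (<⇒≤ q<B)) (cong (q *_) (at0 (s hm)))) (cong (_∸ 1) hd≡)

  hash-loop : ∀ (f : ℕ → Mem → Mem) → (∀ i s d q → d < M → q ≤ B → s hC 0 ≡ d + q * M → HashStep s (f i s) d q) → 0 < M →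
    ∀ ds m j s → length ds ≤ m → Below M ds → encode M ds ≤ B → s hC 0 ≡ encode M ds →
    (let t = iterFrom j m f s in ∀ v → v < B → (v ∈ ⟪ B ⟫ (t HH) → v ∈ ⟪ B ⟫ (s HH) ⊎ ∃[ d ] d ∈ᴸ ds × Hit (s hm 0) d v) ×
                                              (v ∈ ⟪ B ⟫ (s HH) ⊎ (∃[ d ] d ∈ᴸ ds × Hit (s hm 0) d v) → v ∈ ⟪ B ⟫ (t HH)))
  hash-loop f st 0<M [] zero j s _ h b e v v<B = inj₁ , [ id , (λ { (_ , () , _) }) ]′
  hash-loop f st 0<M [] (suc m) j s _ h b e v v<B =
    (λ t → [ (λ t′ → [ inj₁ , (λ { (() , _) }) ]′ (hits→ v t′)) , (λ { (_ , () , _) }) ]′ (proj₁ ih t)) , [ (λ t → proj₂ ih (inj₁ (hits← v v<B (inj₁ t)))) , (λ { (_ , () , _) }) ]′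
    where
    open HashStep (st j s 0 0 0<M z≤n e)
    ih = hash-loop f st 0<M [] m (suc j) (f j s) z≤n (λ _ ()) z≤n code v v<B
  hash-loop f st 0<M (d ∷ ds) (suc m) j s (s≤s l) h b e v v<B =
    (λ t → [ (λ t′ → [ inj₁ , (λ hit → inj₂ (d , hereᴸ refl , hit)) ]′ (hits→ v t′)) , (λ { (d′ , d∈ , hit) → inj₂ (d′ , thereᴸ d∈ , subst (λ m → Hit m d′ v) modu hit) }) ]′ (proj₁ ih t)) ,
    [ (λ t → proj₂ ih (inj₁ (hits← v v<B (inj₁ t)))) , (λ { (_ , hereᴸ refl , hit) → proj₂ ih (inj₁ (hits← v v<B (inj₂ hit)))
      ; (d′ , thereᴸ d∈ , hit) → proj₂ ih (inj₂ (d′ , d∈ , subst (λ m → Hit m d′ v) (sym modu) hit)) }) ]′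
    where
    q≤ : encode M ds ≤ B
    q≤ = ≤-trans (≤-trans (m≤m*n (encode M ds) M {{>-nonZero 0<M}}) (m≤n+m _ d)) b
    open HashStep (st j s d (encode M ds) (h d (hereᴸ refl)) q≤ e)
    ih = hash-loop f st 0<M ds m (suc j) (f j s) l (λ d d∈ → h d (thereᴸ d∈)) q≤ code v v<B

  hash-spec : ∀ s m ds → m < M → length ds ≤ B → Below M ds → encode M (m ∷ ds) ≤ B → s hC 0 ≡ encode M (m ∷ ds) →
    let t = exec B ρ hashC s in
    ∀ v → v < B → (v ∈ ⟪ B ⟫ (t HH) → ∃[ d ] d ∈ᴸ ds × Hit m d v) × ((∃[ d ] d ∈ᴸ ds × Hit m d v) → v ∈ ⟪ B ⟫ (t HH))
  hash-spec s m ds m<M l h b e v v<B =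
    (λ t → [ (λ { (_ , ne) → contradiction refl ne }) , (λ { (d , d∈ , hit) → d , d∈ , subst (λ m → Hit m d v) m≡ hit }) ]′
      (proj₁ main (subst (λ z → v ∈ ⟪ B ⟫ (z HH)) (iter≡iterFrom B f s₁) t))) ,
    (λ { (d , d∈ , hit) → subst (λ z → v ∈ ⟪ B ⟫ (z HH)) (sym (iter≡iterFrom B f s₁)) (proj₂ main (inj₂ (d , d∈ , subst (λ m → Hit m d v) (sym m≡) hit))) })
    where
    f = λ i → exec B (upd ρ 45 i) hashStepC
    s₁ = exec B ρ (hm [ 21 ]:= modT (hC ! lit 0) (var 51) ﹔ hC [ 21 ]:= divT (hC ! lit 0) (var 51) ﹔ HH [ 21 ]:= lit 0) s
    0<M : 0 < M
    0<M = ≤-<-trans z≤n m<M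
    q≤ : encode M ds ≤ B
    q≤ = ≤-trans (≤-trans (m≤m*n (encode M ds) M {{>-nonZero 0<M}}) (m≤n+m _ m)) b
    a≡ : at B (s hC) 0 ≡ m + encode M ds * M
    a≡ = trans (at0 (s hC)) e
    dm = divmod-val B M m (encode M ds) m<M q≤
    m≡ : s₁ hm 0 ≡ m
    m≡ = trans (cong rem a≡) (proj₂ dm)
    main = hash-loop f hash-step 0<M ds B 0 s₁ l h q≤ (trans (cong quot a≡) (proj₁ dm)) v v<B

  hash-ok : ∀ l σ xs qs → Below (2 ^ l) xs → Below (2 ^ l) qs → Apart xs qs →
    length xs * (l * length qs) ≤ σ → 2 * σ + 4 < M → M ^ suc (length xs) ≤ B → length xs ≤ B →
    ∃[ c ] c < M ^ suc (length xs) × (∀ s → s hC 0 ≡ c → let t = exec B ρ hashC s in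
      (∀ x → x ∈ᴸ xs → x < B → x ∈ ⟪ B ⟫ (t HH)) × (∀ q → q ∈ᴸ qs → q ∉ ⟪ B ⟫ (t HH)))
  hash-ok l σ xs qs xs< qs< dis N≤σ σ<M pB lB with separate l σ xs qs xs< qs< dis N≤σ
  ... | m@(suc m-1) , 0<m , m≤ , apart = encode M (m ∷ ds) , c< , λ s e → (λ x x∈ x<B → proj₂ (hash-spec s m ds m<M l≤ ds< c≤ e x x<B) (suc (x % m) , ∈-map⁺ _ x∈ , hit x x<B))
    , (λ q q∈ t → miss q q∈ (proj₁ (hash-spec s m ds m<M l≤ ds< c≤ e q (proj₁ t)) t))
    where
    m<M = ≤-<-trans m≤ σ<M
    ds = map (λ x → suc (x % m)) xs
    ds< : ∀ d → d ∈ᴸ ds → d < M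
    ds< d d∈ with ∈-map⁻ _ d∈
    ... | x , _ , refl = ≤-<-trans (m%n<n x m) m<M
    len : length ds ≡ length xs
    len = length-map _ xs
    l≤ : length ds ≤ B
    l≤ = ≤-trans (≤-reflexive len) lB
    c< : encode M (m ∷ ds) < M ^ suc (length xs)
    c< = <-≤-trans (encode-< M (m ∷ ds) (≤-<-trans z≤n m<M) (λ { _ (hereᴸ refl) → m<M ; d (thereᴸ d∈) → ds< d d∈ })) (≤-reflexive (cong (λ z → M ^ suc z) len))
    c≤ : encode M (m ∷ ds) ≤ B
    c≤ = ≤-trans (<⇒≤ c<) pB
    hit : ∀ x → x < B → Hit m (suc (x % m)) x
    hit x x<B = s≤s z≤n , x / m , ≤-<-trans (m/n≤m x m) x<B , trans (m≡m%n+[m/n]*n x m) (+-comm (x % m) _)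
    miss : ∀ q → q ∈ᴸ qs → ¬ (∃[ d ] d ∈ᴸ ds × Hit m d q)
    miss q q∈ (d , d∈ , _ , a , _ , e) with ∈-map⁻ _ d∈
    ... | x , x∈ , refl = apart x q x∈ q∈ (diff (x / m) a (x % m) (trans (m≡m%n+[m/n]*n x m) (+-comm (x % m) _)) e)
      where
      diff : ∀ a b r → x ≡ a * m + r → q ≡ b * m + r → m ∣ ∣ x - q ∣
      diff a b r ex eq = divides ∣ a - b ∣ (trans (cong₂ ∣_-_∣ ex eq) (trans (cong₂ ∣_-_∣ (+-comm (a * m) r) (+-comm (b * m) r)) (trans (∣m+n-m+o∣≡∣n-o∣ r (a * m) (b * m)) (sym (*-distribʳ-∣-∣ m a b)))))

closeF : Fm
closeF = ∃̇[ 47 ] ∃̇[ 48 ] (var 47 ≺ var 0 & var 48 ≺ var 0 & var 21 ≐ mulN (var 47) ⊞ var 48 &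
  ((gV ∋ var 47 & var 47 ≐ var 48) ∥ (gS ∋ var 47 & ∃̇[ 49 ] (var 49 ≺ var 0 & edgeF 47 49 & MM ∋ (mulN (var 49) ⊞ var 48)))))

-- MM becomes the matrix of all pairs (u , v) joined by a walk that ends in gV
-- and has all its other vertices in gS.
closeC : Cm
closeC = MM [ 21 ]:= lit 0 ﹔ for 46 (MM [ 21 ]:= tm (MM ∋ var 21 ∥ closeF))

module Closure (B n : ℕ) (nn≤B : n * n ≤ B) where
  open Guided B n using (mul; Cell; Cell?) public

  Edge : (ℕ → ℕ) → ℕ → ℕ → Set
  Edge I u v = u < n × v < n × Cell I (n + mul u + v)

  data Walk (V S : DSet) (I : ℕ → ℕ) : ℕ → ℕ → Set where
    stop : ∀ {u} → u ∈ V → Walk V S I u u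
    go : ∀ {u y v} → u ∈ S → Edge I u y → Walk V S I y v → Walk V S I u v

  CloseCond : DSet → DSet → (I M : ℕ → ℕ) → ℕ → Set
  CloseCond V S I M x = ∃[ u ] u < B × ∃[ v ] v < B × u < n × v < n × x ≡ mul u + v ×
    ((u ∈ V × u ≡ v) ⊎ (u ∈ S × ∃[ y ] y < B × y < n × Cell I (n + mul u + y) × Cell M (mul y + v)))

  CloseCond? : ∀ V S I M x → Dec (CloseCond V S I M x)
  CloseCond? V S I M x = any<? B λ u → any<? B λ v → (u <? n) ×-dec (v <? n) ×-dec (x ≟ mul u + v) ×-dec
    ((dec V u ×-dec (u ≟ v)) ⊎-dec (dec S u ×-dec any<? B (λ y → (y <? n) ×-dec Cell? I (n + mul u + y) ×-dec Cell? M (mul y + v))))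

  n≤B : ∀ {u} → u < n → u < B
  n≤B {u} u<n = <-≤-trans u<n (≤-trans (m≤m*n n n {{>-nonZero (≤-<-trans z≤n u<n)}}) nn≤B)

  mul≡ : ∀ {u} → u < n → mul u ≡ u * n
  mul≡ {u} u<n = mul-val B u n (<⇒≤ (n≤B u<n))

  idx< : ∀ {u v} → u < n → v < n → mul u + v < B
  idx< {u} {v} u<n v<n = <-≤-trans (subst (λ z → z + v < n * n) (sym (mul≡ u<n)) (<-≤-trans (+-monoʳ-< (u * n) v<n) (≤-trans (≤-reflexive (+-comm (u * n) n)) (*-monoˡ-≤ n u<n)))) nn≤B

  idx-inj : ∀ {u u′ v v′} → u < n → u′ < n → v < n → v′ < n → mul u + v ≡ mul u′ + v′ → u ≡ u′ × v ≡ v′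
  idx-inj {u} {u′} {v} {v′} l l′ k k′ e = pair-inj n {u} {u′} k k′ (subst₂ (λ a b → a + v ≡ b + v′) (mul≡ l) (mul≡ l′) e)

  module _ (V S : DSet) (I : ℕ → ℕ) (L : ℕ → ℕ → ℕ) (start : ∀ x → L 0 x ≡ 0)
    (grow : ∀ j x → x < B → Cell (L j) x ⊎ CloseCond V S I (L j) x → Cell (L (suc j)) x)
    (only : ∀ j x → x < B → Cell (L (suc j)) x → Cell (L j) x ⊎ CloseCond V S I (L j) x) where

    close-sound : ∀ j u v → u < n → v < n → Cell (L j) (mul u + v) → Walk V S I u v
    close-sound zero u v u<n v<n (_ , ne) = contradiction (start (mul u + v)) ne
    close-sound (suc j) u v u<n v<n c with only j (mul u + v) (proj₁ c) c
    ... | inj₁ c′ = close-sound j u v u<n v<n c′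
    ... | inj₂ (u′ , _ , v′ , _ , u′<n , v′<n , e , h) with idx-inj u<n u′<n v<n v′<n e
    ... | refl , refl with h
    ... | inj₁ (a , refl) = stop a
    ... | inj₂ (a , y , _ , y<n , ed , c′) = go a (u<n , y<n , ed) (close-sound j y v y<n v<n c′)

    close-fixed : ∀ x → x < B → CloseCond V S I (L B) x → Cell (L B) x
    close-fixed = fixpoint B (λ j → Cell (L j)) (λ j → CloseCond V S I (L j)) (λ j → Cell? (L j)) (λ j → CloseCond? V S I (L j)) grow only
      λ { j h x _ (u , u<B , v , v<B , u<n , v<n , e , inj₁ p) → u , u<B , v , v<B , u<n , v<n , e , inj₁ p
        ; j h x _ (u , u<B , v , v<B , u<n , v<n , e , inj₂ (a , y , l , y<n , ed , c)) → u , u<B , v , v<B , u<n , v<n , e , inj₂ (a , y , l , y<n , ed , h _ (proj₁ c) c) }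

    close-complete : ∀ {u v} → u < n → v < n → Walk V S I u v → Cell (L B) (mul u + v)
    close-complete {u} {v} u<n v<n (stop a) = close-fixed _ (idx< u<n v<n) (u , n≤B u<n , v , n≤B v<n , u<n , v<n , refl , inj₁ (a , refl))
    close-complete {u} {v} u<n v<n (go {y = y} a e@(_ , y<n , ed) w) = close-fixed _ (idx< u<n v<n)
      (u , n≤B u<n , v , n≤B v<n , u<n , v<n , refl , inj₂ (a , y , n≤B y<n , y<n , ed , close-complete y<n v<n w))

  close-abs : (f : ℕ → Mem → Mem) (s : Mem) → (∀ i s → f i s gV ≡ s gV × f i s gS ≡ s gS × f i s INP ≡ s INP) →
    (∀ x → s MM x ≡ 0) →
    (∀ i s x → x < B → (Cell (s MM) x ⊎ CloseCond (⟪ B ⟫ (s gV)) (⟪ B ⟫ (s gS)) (s INP) (s MM) x → Cell (f i s MM) x) ×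
      (Cell (f i s MM) x → Cell (s MM) x ⊎ CloseCond (⟪ B ⟫ (s gV)) (⟪ B ⟫ (s gS)) (s INP) (s MM) x)) →
    let t = iter B f s ; V = ⟪ B ⟫ (s gV) ; S = ⟪ B ⟫ (s gS) in
    ∀ u v → u < n → v < n → (Cell (t MM) (mul u + v) → Walk V S (s INP) u v) × (Walk V S (s INP) u v → Cell (t MM) (mul u + v))
  close-abs f s keep s0 st u v u<n v<n = close-sound V S (s INP) L s0 grow only B u v u<n v<n , close-complete V S (s INP) L s0 grow only u<n v<n
    where
    V = ⟪ B ⟫ (s gV)
    S = ⟪ B ⟫ (s gS)
    L : ℕ → ℕ → ℕ
    L j = iter j f s MM
    kept : ∀ j → iter j f s gV ≡ s gV × iter j f s gS ≡ s gS × iter j f s INP ≡ s INP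
    kept zero = refl , refl , refl
    kept (suc j) = let (a , b , c) = keep j (iter j f s) ; (a′ , b′ , c′) = kept j in trans a a′ , trans b b′ , trans c c′
    conv : ∀ {a b c a′ b′ c′ : ℕ → ℕ} m x → a ≡ a′ × b ≡ b′ × c ≡ c′ → CloseCond (⟪ B ⟫ a) (⟪ B ⟫ b) c m x → CloseCond (⟪ B ⟫ a′) (⟪ B ⟫ b′) c′ m x
    conv m x (refl , refl , refl) h = h
    sym³ : ∀ {a b c a′ b′ c′ : ℕ → ℕ} → a ≡ a′ × b ≡ b′ × c ≡ c′ → a′ ≡ a × b′ ≡ b × c′ ≡ c
    sym³ (refl , refl , refl) = refl , refl , refl
    grow : ∀ j x → x < B → Cell (L j) x ⊎ CloseCond V S (s INP) (L j) x → Cell (L (suc j)) x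
    grow j x x<B h = proj₁ (st j (iter j f s) x x<B) ([ inj₁ , (λ c → inj₂ (conv (L j) x (sym³ (kept j)) c)) ]′ h)
    only : ∀ j x → x < B → Cell (L (suc j)) x → Cell (L j) x ⊎ CloseCond V S (s INP) (L j) x
    only j x x<B h = [ inj₁ , (λ c → inj₂ (conv (L j) x (kept j) c)) ]′ (proj₂ (st j (iter j f s) x x<B) h)

module CloseRun (ρ : Env) (nn≤B : ρ 0 * ρ 0 ≤ ρ 2) where
  open Closure (ρ 2) (ρ 0) nn≤B public

  close-ok : ∀ s u v → u < ρ 0 → v < ρ 0 → let t = exec (ρ 2) ρ closeC s ; V = ⟪ ρ 2 ⟫ (s gV) ; S = ⟪ ρ 2 ⟫ (s gS) in
    (Cell (t MM) (mul u + v) → Walk V S (s INP) u v) × (Walk V S (s INP) u v → Cell (t MM) (mul u + v))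
  close-ok s = close-abs (λ i → exec B (upd ρ 46 i) (MM [ 21 ]:= tm (MM ∋ var 21 ∥ closeF))) (upd s MM (λ _ → 0)) (λ _ _ → refl , refl , refl) (λ _ → refl)
    λ i s x x<B → (λ h → x<B , complete B stepF {upd (upd ρ 46 i) 21 x} {s} h) , (λ c → sound B stepF {upd (upd ρ 46 i) 21 x} {s} (proj₂ c))
    where
    B = ρ 2
    stepF = MM ∋ var 21 ∥ closeF

module Graph (B : ℕ) (E : ℕ → ℕ → Set) (E? : ∀ u v → Dec (E u v)) (T : DSet) where

  data Pth (S : ℕ → Set) : ℕ → ℕ → Set where
    here : ∀ {u} → S u → Pth S u u
    step : ∀ {u y v} → S u → E u y → Pth S y v → Pth S u v

  Good : (ℕ → Set) → Set
  Good S = ∀ t t′ → t ∈ T → t′ ∈ T → Pth S t t′ → Pth S t′ t → t ≡ t′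

  module _ {S : ℕ → Set} where

    source∈ : ∀ {u v} → Pth S u v → S u
    source∈ (here s) = s
    source∈ (step s _ _) = s

    target∈ : ∀ {u v} → Pth S u v → S v
    target∈ (here s) = s
    target∈ (step _ _ p) = target∈ p

    _◅◅_ : ∀ {u v w} → Pth S u v → Pth S v w → Pth S u w
    here _ ◅◅ q = q
    step s e p ◅◅ q = step s e (p ◅◅ q)

    pmap : ∀ {S′ : ℕ → Set} {u v} → (∀ y → S y → S′ y) → Pth S u v → Pth S′ u v
    pmap f (here s) = here (f _ s)
    pmap f (step s e p) = step (f _ s) e (pmap f p)

    stays : ∀ {R : ℕ → Set} {u v} → (∀ u y → R u → E u y → S y → R y) → R u → Pth S u v → R v × Pth (λ y → S y × R y) u v
    stays cl r (here s) = r , here (s , r)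
    stays cl r (step s e p) = let (a , b) = stays cl (cl _ _ r e (source∈ p)) p in a , step (s , r) e b

    restrict : ∀ {R : ℕ → Set} {u v} → (∀ y → Pth S u y → R y) → Pth S u v → Pth (λ y → S y × R y) u v
    restrict h (here s) = here (s , h _ (here s))
    restrict h (step s e p) = step (s , h _ (here s)) e (restrict (λ y q → h y (step s e q)) p)

    split : (X : DSet) → ∀ {u v} → Pth S u v → Pth (λ y → S y × y ∉ X) u v ⊎ (∃[ x ] x ∈ X × Pth S u x × Pth S x v)
    split X (here {u} s) with dec X u
    ... | yes x = inj₂ (u , x , here s , here s)
    ... | no ¬x = inj₁ (here (s , ¬x))
    split X (step {u} s e p) with dec X u
    ... | yes x = inj₂ (u , x , here s , step s e p)
    ... | no ¬x with split X p
    ... | inj₁ q = inj₁ (step (s , ¬x) e q)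
    ... | inj₂ (x , x∈ , a , b) = inj₂ (x , x∈ , step s e a , b)

    last-exit : ∀ x {v w} → Pth S v w → w ≢ x →
      Pth (λ y → S y × y ≢ x) v w ⊎ (∃[ y ] E x y × Pth (λ y → S y × y ≢ x) y w)
    last-exit x (here s) ne = inj₁ (here (s , ne))
    last-exit x (step {u} s e p) ne with last-exit x p ne
    ... | inj₂ q = inj₂ q
    ... | inj₁ q with u ≟ x
    ... | yes refl = inj₂ (_ , e , q)
    ... | no u≢x = inj₁ (step (s , u≢x) e q)

  Layer : DSet → ℕ → ℕ → DSet
  El (Layer S u zero) v = v ≡ u × v ∈ S
  dec (Layer S u zero) v = (v ≟ u) ×-dec dec S v
  El (Layer S u (suc j)) v = v ∈ Layer S u j ⊎ (v ∈ S × ∃[ y ] y < B × y ∈ Layer S u j × E y v)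
  dec (Layer S u (suc j)) v = dec (Layer S u j) v ⊎-dec (dec S v ×-dec any<? B (λ y → dec (Layer S u j) y ×-dec E? y v))

  module _ (S : DSet) (S<B : ∀ v → v ∈ S → v < B) where

    layer-sound : ∀ u j v → v ∈ Layer S u j → Pth (El S) u v
    layer-sound u zero v (refl , s) = here s
    layer-sound u (suc j) v (inj₁ l) = layer-sound u j v l
    layer-sound u (suc j) v (inj₂ (s , y , _ , l , e)) = layer-sound u j y l ◅◅ step (target∈ (layer-sound u j y l)) e (here s)

    layer-closed : ∀ u v → v < B → (v ∈ S × ∃[ y ] y < B × y ∈ Layer S u B × E y v) → v ∈ Layer S u B
    layer-closed u = fixpoint B (λ j v → v ∈ Layer S u j) (λ j v → v ∈ S × ∃[ y ] y < B × y ∈ Layer S u j × E y v)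
      (λ j → dec (Layer S u j)) (λ j v → dec S v ×-dec any<? B (λ y → dec (Layer S u j) y ×-dec E? y v))
      (λ _ _ _ → id) (λ _ _ _ → id) (λ { j h v _ (s , y , l , q , e) → s , y , l , h y l q , e })

    layer-complete : ∀ u {y v} → y ∈ Layer S u B → Pth (El S) y v → v ∈ Layer S u B
    layer-complete u l (here s) = l
    layer-complete u l (step s e p) = layer-complete u (layer-closed u _ (S<B _ (source∈ p)) (source∈ p , _ , S<B _ s , l , e)) p

    layer-base : ∀ u → u ∈ S → ∀ j → u ∈ Layer S u j
    layer-base u s zero = refl , s
    layer-base u s (suc j) = inj₁ (layer-base u s j)

    abstract

      reach? : ∀ u v → Dec (Pth (El S) u v)
      reach? u v with dec S u
      ... | no ¬s = no (¬s ∘ source∈)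
      ... | yes s = map′ (layer-sound u B v) (layer-complete u (layer-base u s B)) (dec (Layer S u B) v)

  -- If W meets every bad closed walk, a closed walk through a vertex that
  -- cannot reach W is harmless.
  harmless : ∀ {U S : ℕ → Set} {W : DSet} → Good (λ y → U y × y ∉ W) → (∀ y → S y → U y) →
    ∀ {x t t′} → (∀ w → w ∈ W → ¬ Pth S x w) → t ∈ T → t′ ∈ T → Pth S t x → Pth S x t′ → Pth S t′ t → t ≡ t′
  harmless {U} {S} {W} good S⊆U {x} {t} {t′} noW tT t′T p q r = good t t′ tT t′T (avoid (λ y a → (q ◅◅ r) ◅◅ a) (p ◅◅ q)) (avoid (λ y a → q ◅◅ a) r)
    where
    avoid : ∀ {u v} → (∀ y → Pth S u y → Pth S x y) → Pth S u v → Pth (λ y → U y × y ∉ W) u v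
    avoid h a = pmap (λ { y (s , ∉W) → S⊆U y s , ∉W }) (restrict {R = λ y → y ∉ W} (λ y b w∈ → noW y w∈ (h y b)) a)

  good-through : ∀ {U S : ℕ → Set} {W : DSet} (X : DSet) → Good (λ y → U y × y ∉ W) → (∀ y → S y → U y) →
    Good (λ y → S y × y ∉ X) → (∀ x → x ∈ X → S x → ∀ w → w ∈ W → ¬ Pth S x w) → Good S
  good-through {W = W} X gW S⊆U gX noW t t′ tT t′T p q with split X p
  ... | inj₂ (x , x∈ , a , b) = harmless {W = W} gW S⊆U (noW x x∈ (source∈ b)) tT t′T a b q
  ... | inj₁ p′ with split X q
  ... | inj₂ (x , x∈ , a , b) = sym (harmless {W = W} gW S⊆U (noW x x∈ (source∈ b)) t′T tT a b p)
  ... | inj₁ q′ = gX t t′ tT t′T p′ q′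

  good-⊎ : ∀ {A : ℕ → Set} (Q : DSet) → (∀ u y → u ∈ Q → E u y → A y ⊎ y ∈ Q → y ∈ Q) → Good A →
    (∀ t t′ → t ∈ T → t′ ∈ T → t ∈ Q → t′ ∈ Q → Pth (λ v → A v ⊎ v ∈ Q) t t′ → Pth (λ v → A v ⊎ v ∈ Q) t′ t → t ≡ t′) → Good (λ v → A v ⊎ v ∈ Q)
  good-⊎ {A} Q keep gA both t t′ tT t′T p q with dec Q t | dec Q t′
  ... | yes a | _ = both t t′ tT t′T a (proj₁ (stays {R = El Q} keep a p)) p q
  ... | no na | yes a′ = contradiction (proj₁ (stays {R = El Q} keep a′ q)) na
  ... | no na | no na′ = gA t t′ tT t′T (inside p na′) (inside q na)
    where
    inside : ∀ {a b} → Pth (λ v → A v ⊎ v ∈ Q) a b → b ∉ Q → Pth A a b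
    inside p nb with split Q p
    ... | inj₁ r = pmap (λ { y (inj₁ a , _) → a ; y (inj₂ q , nq) → contradiction q nq }) r
    ... | inj₂ (x , x∈ , _ , r) = contradiction (proj₁ (stays {R = El Q} keep x∈ r)) nb

  -- A table of candidate separators: Sep z b cuts the set Rch z b off from W.
  record Table (U W : DSet) (k K : ℕ) : Set₁ where
    field
      Sep Rch : ℕ → ℕ → DSet
      sep⊆ : ∀ {z} b → z ∈ U ∖ W → ∀ v → v ∈ Sep z b → v ∈ U ∖ W
      rch⊆ : ∀ {z} b → z ∈ U ∖ W → ∀ v → v ∈ Rch z b → v ∈ U ∖ W
      start : ∀ {z} b → z ∈ U ∖ W → z ∉ Sep z b → z ∈ Rch z b
      closed : ∀ {z} b → z ∈ U ∖ W → ∀ u y → u ∈ Rch z b → E u y → y ∈ U → y ∈ Rch z b ⊎ y ∈ Sep z b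
      choose : ∀ z → z ∈ U ∖ W → ∀ R X → z ∈ R → R ⊆ U ∖ W → (∀ u w → u ∈ R → w ∈ W → ¬ E u w) →
        (∀ u y → u ∈ R → E u y → y ∈ U ∖ W → y ∈ R ⊎ y ∈ X) → # B (dec X) ≤ k →
        ∃[ b ] b < K × (∀ v → v ∈ R → v ∉ Sep z b) × # B (dec (Sep z b)) ≤ # B (dec X)

  module Normal (U W : DSet) (U<B : ∀ v → v ∈ U → v < B) (W⊆U : W ⊆ U) (good-W : Good (El (U ∖ W))) {k K : ℕ} (tab : Table U W k K) where
    open Table tab

    record Solution (X : DSet) : Set where
      field
        X⊆ : X ⊆ U ∖ W
        size : # B (dec X) ≤ k
        good : Good (El (U ∖ X))

    bound : ∀ X v → v ∈ U ∖ X → v < B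
    bound X v (u , _) = U<B v u

    ToW : DSet → DSet
    El (ToW X) v = ∃[ w ] w < B × w ∈ W × Pth (El (U ∖ X)) v w
    dec (ToW X) v = any<? B (λ w → dec W w ×-dec reach? (U ∖ X) (bound X) v w)

    toW : ∀ {X v w} → w ∈ W → Pth (El (U ∖ X)) v w → v ∈ ToW X
    toW w∈ p = _ , U<B _ (W⊆U _ w∈) , w∈ , p

    Irredundant : DSet → Set
    Irredundant X = ∀ x → x ∈ X → ∃[ y ] E x y × y ∈ ToW X

    Pushed : DSet → Set
    Pushed X = ∀ z → z ∈ U ∖ X → z ∉ ToW X → ∃[ b ] b < K × z ∉ Sep z b × Sep z b ⊆ X

    separated : ∀ {z} b → z ∈ U ∖ W → ∀ S → (∀ y → S y → y ∈ U × y ∉ Sep z b) → ∀ u → u ∈ Rch z b → ∀ w → w ∈ W → ¬ Pth S u w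
    separated {z} b z∈ S h u u∈ w w∈ p =
      proj₂ (rch⊆ b z∈ w (proj₁ (stays {R = El (Rch z b)} (λ u y r e s → [ id , (λ q → contradiction q (proj₂ (h y s))) ]′ (closed b z∈ u y r e (proj₁ (h y s)))) u∈ p))) w∈

    drop : ∀ X x → Solution X → x ∈ X → (∀ y → E x y → y ∉ ToW X) → Solution (X ∖ ｛ x ｝) × # B (dec (X ∖ ｛ x ｝)) < # B (dec X)
    drop X x sol x∈ none = record
      { X⊆ = λ v v∈ → X⊆ v (proj₁ v∈)
      ; size = ≤-trans (<⇒≤ less) size
      ; good = good-through {W = W} ｛ x ｝ good-W (λ _ → proj₁)
        (λ t t′ a b p q → good t t′ a b (pmap keep p) (pmap keep q))
        (λ { _ refl _ w w∈ p → no-way w w∈ p }) } , less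
      where
      open Solution sol
      less = #-< B (dec (X ∖ ｛ x ｝)) (dec X) (λ _ _ → proj₁) x (U<B x (proj₁ (X⊆ x x∈))) x∈ (λ h → proj₂ h refl)
      keep : ∀ y → (y ∈ U × ¬ (y ∈ X × y ≢ x)) × y ≢ x → y ∈ U × y ∉ X
      keep y ((u , n) , ne) = u , λ h → n (h , ne)
      no-way : ∀ w → w ∈ W → ¬ Pth (El (U ∖ (X ∖ ｛ x ｝))) x w
      no-way w w∈ p with last-exit x p (λ { refl → proj₂ (X⊆ x x∈) w∈ })
      ... | inj₁ q = proj₂ (source∈ q) refl
      ... | inj₂ (y , e , q) = none y e (toW {X} w∈ (pmap keep q))

    push : ∀ X z → Solution X → Irredundant X → z ∈ U ∖ X → z ∉ ToW X → (∀ b → b < K → z ∉ Sep z b → ¬ (Sep z b ⊆ X)) →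
      ∃[ X′ ] Solution X′ × # B (dec X′) ≤ # B (dec X) × # B (dec (ToW X′)) < # B (dec (ToW X))
    push X z sol irr z∈ z∉ nopush = X′ , sol′ , size′ , less
      where
      open Solution sol
      R Xz : DSet
      El R v = Pth (El (U ∖ X)) z v
      dec R v = reach? (U ∖ X) (bound X) z v
      El Xz v = v ∈ U ∖ W × v ∉ R × ∃[ u ] u < B × u ∈ R × E u v
      dec Xz v = dec (U ∖ W) v ×-dec ¬? (dec R v) ×-dec any<? B (λ u → dec R u ×-dec E? u v)
      z∈UW : z ∈ U ∖ W
      z∈UW = proj₁ z∈ , λ w∈ → z∉ (toW {X} w∈ (here z∈))
      R⊆ : R ⊆ U ∖ W
      R⊆ v p = proj₁ (target∈ p) , λ w∈ → z∉ (toW {X} w∈ p)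
      R-W : ∀ u w → u ∈ R → w ∈ W → ¬ E u w
      R-W u w p w∈ e with dec X w
      ... | yes x = proj₂ (X⊆ w x) w∈
      ... | no ¬x = z∉ (toW {X} w∈ (p ◅◅ step (target∈ p) e (here (W⊆U w w∈ , ¬x))))
      Xz⊆X : Xz ⊆ X
      Xz⊆X v (v∈ , ∉R , u , _ , p , e) with dec X v
      ... | yes x = x
      ... | no ¬x = contradiction (p ◅◅ step (target∈ p) e (here (proj₁ v∈ , ¬x))) ∉R
      front : ∀ u y → u ∈ R → E u y → y ∈ U ∖ W → y ∈ R ⊎ y ∈ Xz
      front u y p e y∈ with dec R y
      ... | yes r = inj₁ r
      ... | no ¬r = inj₂ (y∈ , ¬r , u , U<B u (proj₁ (target∈ p)) , p , e)
      choice = choose z z∈UW R Xz (here z∈) R⊆ R-W front (≤-trans (#-mono B (dec Xz) (dec X) (λ v _ → Xz⊆X v)) size)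
      b = proj₁ choice
      S Q : DSet
      S = Sep z b
      Q = Rch z b
      R∩S : ∀ v → v ∈ R → v ∉ S
      R∩S = proj₁ (proj₂ (proj₂ choice))
      S≤ : # B (dec S) ≤ # B (dec Xz)
      S≤ = proj₂ (proj₂ (proj₂ choice))
      z∈Q : z ∈ Q
      z∈Q = start b z∈UW (R∩S z (here z∈))
      R⊆Q : ∀ v → v ∈ R → v ∈ Q
      R⊆Q v p = proj₁ (stays {R = El Q} (λ u y q e (_ , y∈R) → [ id , (λ s → contradiction s (R∩S y y∈R)) ]′ (closed b z∈UW u y q e (proj₁ (target∈ y∈R)))) z∈Q (restrict (λ y p → p) p))
      Xz⊆QS : ∀ v → v ∈ Xz → v ∈ Q ⊎ v ∈ S
      Xz⊆QS v (v∈ , _ , u , _ , p , e) = closed b z∈UW u v (R⊆Q u p) e (proj₁ v∈)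
      X′ : DSet
      X′ = (X ∖ Xz) ∪ S
      avoid : ∀ y → y ∈ U ∖ X′ → y ∈ U × y ∉ S
      avoid y (u , n) = u , n ∘ inj₂
      noW : ∀ u → u ∈ Q → ∀ w → w ∈ W → ¬ Pth (El (U ∖ X′)) u w
      noW = separated b z∈UW (El (U ∖ X′)) avoid
      old : ∀ x → x ∈ X → x ∉ X′ → x ∈ Q
      old x x∈ x∉ with dec Xz x
      ... | no ¬z = contradiction (inj₁ (x∈ , ¬z)) x∉
      ... | yes z = [ id , (λ s → contradiction (inj₂ s) x∉) ]′ (Xz⊆QS x z)
      size′ : # B (dec X′) ≤ # B (dec X)
      size′ = ≤-trans (#-∪ B (dec (X ∖ Xz)) (dec S) (dec X′) (λ _ _ → id)) (≤-trans (+-monoʳ-≤ _ S≤)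
        (#-⊎ B (dec (X ∖ Xz)) (dec Xz) (dec X) (λ _ _ → proj₁) (λ v _ → Xz⊆X v) (λ { _ _ (_ , n) h → n h })))
      sol′ : Solution X′
      sol′ = record
        { X⊆ = λ v → [ (λ h → X⊆ v (proj₁ h)) , sep⊆ b z∈UW v ]′
        ; size = ≤-trans size′ size
        ; good = good-through {W = W} X good-W (λ _ → proj₁)
          (λ t t′ a c p q → good t t′ a c (pmap (λ { y ((u , _) , n) → u , n }) p) (pmap (λ { y ((u , _) , n) → u , n }) q))
          (λ x x∈ s w w∈ → noW x (old x x∈ (proj₂ s)) w w∈) }
      shrink : ∀ v → v ∈ ToW X′ → v ∈ ToW X
      shrink v (w , _ , w∈ , p) with split X p
      ... | inj₁ q = toW {X} w∈ (pmap (λ { y ((u , _) , n) → u , n }) q)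
      ... | inj₂ (x , x∈ , _ , q) = contradiction q (noW x (old x x∈ (proj₂ (source∈ q))) w w∈)
      -- S is no larger than Xz and not contained in X, so some x of Xz lies in Q
      some : ∃[ x ] x ∈ X × x ∉ X′
      some with any<? B (λ x → dec X x ×-dec ¬? (dec X′ x))
      ... | yes (x , _ , h) = x , h
      ... | no none with any<? B (λ s → dec S s ×-dec ¬? (dec X s))
      ...   | no sub = contradiction (λ v v∈ → case dec X v of λ
                { (yes x) → x ; (no ¬x) → contradiction (v , U<B v (proj₁ (sep⊆ b z∈UW v v∈)) , v∈ , ¬x) sub }) (nopush b (proj₁ (proj₂ choice)) (R∩S z (here z∈)))
      ...   | yes (s , s<B , s∈ , s∉) = contradiction (≤-<-trans S≤ (#-< B (dec Xz) (dec S) (λ v v<B v∈ → case dec X′ v of λ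
                { (yes (inj₁ (_ , n))) → contradiction v∈ n ; (yes (inj₂ q)) → q ; (no ¬q) → contradiction (v , v<B , Xz⊆X v v∈ , ¬q) none })
                s s<B s∈ (λ h → s∉ (Xz⊆X s h)))) (<-irrefl refl)
      less : # B (dec (ToW X′)) < # B (dec (ToW X))
      less = let (x , x∈ , x∉) = some ; (y , e , y∈) = irr x x∈ ; (w , _ , w∈ , p) = y∈ in
        #-< B (dec (ToW X′)) (dec (ToW X)) (λ v _ → shrink v) y (U<B y (proj₁ (source∈ p))) y∈
          λ { (w′ , _ , w′∈ , p′) → [ (λ q → noW y q w′ w′∈ p′) , (λ q → proj₂ (source∈ p′) (inj₂ q)) ]′ (closed b z∈UW x y (old x x∈ x∉) e (proj₁ (source∈ p))) }

    impl : ∀ {P Q : Set} → Dec P → Dec Q → Dec (P → Q)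
    impl (no ¬p) _ = yes (λ p → contradiction p ¬p)
    impl (yes p) (yes q) = yes (λ _ → q)
    impl (yes p) (no ¬q) = no (λ f → ¬q (f p))

    sub? : ∀ z X → z ∈ U ∖ W → ∀ b → Dec (Sep z b ⊆ X)
    sub? z X z∈ b = map′ (λ h v v∈ → h v (U<B v (proj₁ (sep⊆ b z∈ v v∈))) v∈) (λ h v _ → h v)
      (all<? B (λ v → impl (dec (Sep z b) v) (dec X v)))

    irredundant? : ∀ X → Solution X → (∃[ x ] x ∈ X × (∀ y → E x y → y ∉ ToW X)) ⊎ Irredundant X
    irredundant? X sol with any<? B (λ x → dec X x ×-dec all<? B (λ y → ¬? (E? x y ×-dec dec (ToW X) y)))
    ... | yes (x , _ , x∈ , none) = inj₁ (x , x∈ , λ { y e y∈@(_ , _ , _ , p) → none y (U<B y (proj₁ (source∈ p))) (e , y∈) })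
    ... | no nope = inj₂ irr
      where
      irr : Irredundant X
      irr x x∈ with any<? B (λ y → E? x y ×-dec dec (ToW X) y)
      ... | yes (y , _ , h) = y , h
      ... | no ¬h = contradiction (x , U<B x (proj₁ (Solution.X⊆ sol x x∈)) , x∈ , λ y l h → ¬h (y , l , h)) nope

    pushed? : ∀ X → (∃[ z ] z ∈ U ∖ X × z ∉ ToW X × (∀ b → b < K → z ∉ Sep z b → ¬ (Sep z b ⊆ X))) ⊎ Pushed X
    pushed? X with any<? B (λ z → bad? z)
      where
      bad? : ∀ z → Dec (z ∈ U ∖ X × z ∉ ToW X × (∀ b → b < K → z ∉ Sep z b → ¬ (Sep z b ⊆ X)))
      bad? z with dec (U ∖ X) z | dec (ToW X) z
      ... | no n | _ = no (n ∘ proj₁)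
      ... | yes _ | yes t = no (λ h → proj₁ (proj₂ h) t)
      ... | yes u | no t = map′ (λ h → u , t , λ b l n s → h b l (n , s)) (λ h b l q → proj₂ (proj₂ h) b l (proj₁ q) (proj₂ q))
        (all<? K (λ b → ¬? (¬? (dec (Sep z b) z) ×-dec sub? z X (proj₁ u , λ w∈ → t (toW {X} w∈ (here u))) b)))
    ... | yes (z , _ , h) = inj₁ (z , h)
    ... | no nope = inj₂ ok
      where
      ok : Pushed X
      ok z u t with any<? K (λ b → ¬? (dec (Sep z b) z) ×-dec sub? z X (proj₁ u , λ w∈ → t (toW {X} w∈ (here u))) b)
      ... | yes (b , h) = b , h
      ... | no n = contradiction (z , U<B z (proj₁ u) , u , t , λ b l m s → n (b , l , m , s)) nope

    abstract
      drop′ : ∀ X x → Solution X → x ∈ X → (∀ y → E x y → y ∉ ToW X) → Solution (X ∖ ｛ x ｝) × # B (dec (X ∖ ｛ x ｝)) < # B (dec X)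
      drop′ = drop

      push′ : ∀ X z → Solution X → Irredundant X → z ∈ U ∖ X → z ∉ ToW X → (∀ b → b < K → z ∉ Sep z b → ¬ (Sep z b ⊆ X)) →
        ∃[ X′ ] Solution X′ × # B (dec X′) ≤ # B (dec X) × # B (dec (ToW X′)) < # B (dec (ToW X))
      push′ = push

    weight : DSet → ℕ
    weight X = # B (dec X) * suc B + # B (dec (ToW X))

    normalise : ∀ fuel X → weight X < fuel → Solution X → ∃[ X′ ] Solution X′ × # B (dec X′) ≤ # B (dec X) × Irredundant X′ × Pushed X′
    normalise (suc fuel) X (s≤s h) sol with irredundant? X sol
    ... | inj₁ (x , x∈ , none) =
      let (sol′ , less) = drop′ X x sol x∈ none
          (X″ , s , l , r) = normalise fuel (X ∖ ｛ x ｝) (<-≤-trans (lighter (X ∖ ｛ x ｝) less) h) sol′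
      in X″ , s , ≤-trans l (<⇒≤ less) , r
      where
      lighter : ∀ X′ → # B (dec X′) < # B (dec X) → weight X′ < weight X
      lighter X′ l = <-≤-trans (+-monoʳ-< (# B (dec X′) * suc B) (s≤s (#-≤ B (dec (ToW X′)))))
        (≤-trans (≤-reflexive (+-comm (# B (dec X′) * suc B) (suc B))) (≤-trans (*-monoˡ-≤ (suc B) l) (m≤m+n _ _)))
    ... | inj₂ irr with pushed? X
    ... | inj₂ p = X , sol , ≤-refl , irr , p
    ... | inj₁ (z , z∈ , z∉ , none) =
      let (X′ , sol′ , l , less) = push′ X z sol irr z∈ z∉ none
          (X″ , s , l′ , r) = normalise fuel X′ (<-≤-trans (+-mono-≤-< (*-monoˡ-≤ (suc B) l) less) h) sol′
      in X″ , s , ≤-trans l′ l , r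

beforeF : ℕ → Fm → Fm
beforeF u φ = ∃̇[ 60 ] (var 60 ≺ var 0 & var u ≺ var 0 & (WW ∋ var 60 & φ) & edgeF u 60)

-- Cuts between the vertex var 56 and WW, in the graph on UU; the choices of
-- the search are the bits of var 57.
zSetC zGuideC zMarkC zC : Cm
zSetC = gV [ 21 ]:= tm (UU ∋ var 21 & ~ (WW ∋ var 21)) ﹔ gS [ 21 ]:= tm (var 21 ≐ var 56) ﹔
  gF [ 21 ]:= tm (beforeF 21 (var 0 ≐ var 0)) ﹔ gB [ 21 ]:= var 57
zGuideC = zSetC ﹔ guideC
zMarkC = ZZ [ 21 ]:= tm (ZZ ∋ var 21 ∥ var 21 ≐ var 56 & var 57 ≺ var 50 & (UU ∋ var 21 & ~ (WW ∋ var 21)) & ~ (gD ∋ var 21) &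
  ~ (∃̇[ 61 ] (gD ∋ var 61 & ~ (PP ∋ var 61))))
zC = ZZ [ 21 ]:= lit 0 ﹔ for 56 (for 57 (zGuideC ﹔ zMarkC))

accumulate : ∀ B (f : ℕ → ℕ → Mem → Mem) (K : Mem → Set) (Hit : ℕ → ℕ → ℕ → Set) → (∀ z b s → K s → K (f z b s)) →
  (∀ z b s → z < B → b < B → K s → ∀ v → v < B → (v ∈ ⟪ B ⟫ (f z b s ZZ) → v ∈ ⟪ B ⟫ (s ZZ) ⊎ Hit z b v) × (v ∈ ⟪ B ⟫ (s ZZ) ⊎ Hit z b v → v ∈ ⟪ B ⟫ (f z b s ZZ))) →
  ∀ s → K s → (∀ v → v ∉ ⟪ B ⟫ (s ZZ)) → let t = iter B (λ z → iter B (f z)) s in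
  K t × (∀ v → v < B → (v ∈ ⟪ B ⟫ (t ZZ) → ∃[ z ] ∃[ b ] z < B × b < B × Hit z b v) × (∀ z b → z < B → b < B → Hit z b v → v ∈ ⟪ B ⟫ (t ZZ)))
accumulate B f K Hit keep st s ks none = let (kt , h) = outer B ≤-refl in
    kt , λ v v<B → (λ t → proj₁ (h v v<B) t) , λ z b z<B b<B hit → proj₂ (h v v<B) z b z<B b<B hit
  where
  inner : ∀ z s → z < B → K s → ∀ c → c ≤ B → K (iter c (f z) s) × (∀ v → v < B →
    (v ∈ ⟪ B ⟫ (iter c (f z) s ZZ) → v ∈ ⟪ B ⟫ (s ZZ) ⊎ ∃[ b ] b < c × Hit z b v) × (v ∈ ⟪ B ⟫ (s ZZ) ⊎ (∃[ b ] b < c × Hit z b v) → v ∈ ⟪ B ⟫ (iter c (f z) s ZZ)))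
  inner z s z<B ks zero c≤ = ks , λ v v<B → inj₁ , [ id , (λ { (_ , () , _) }) ]′
  inner z s z<B ks (suc c) c<B = let (kc , h) = inner z s z<B ks c (<⇒≤ c<B) in keep z c _ kc , λ v v<B → let (to , from) = st z c _ z<B c<B kc v v<B in
    (λ t → [ (λ t′ → [ inj₁ , (λ { (b , b<c , q) → inj₂ (b , m<n⇒m<1+n b<c , q) }) ]′ (proj₁ (h v v<B) t′)) , (λ q → inj₂ (c , ≤-refl , q)) ]′ (to t)) ,
    [ (λ t → from (inj₁ (proj₂ (h v v<B) (inj₁ t)))) , (λ { (b , b<1+c , q) → [ (λ b<c → from (inj₁ (proj₂ (h v v<B) (inj₂ (b , b<c , q))))) , (λ { refl → from (inj₂ q) }) ]′ (m<1+n⇒m<n∨m≡n b<1+c) }) ]′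
  outer : ∀ c → c ≤ B → K (iter c (λ z → iter B (f z)) s) × (∀ v → v < B →
    (v ∈ ⟪ B ⟫ (iter c (λ z → iter B (f z)) s ZZ) → ∃[ z ] ∃[ b ] z < c × b < B × Hit z b v) × (∀ z b → z < c → b < B → Hit z b v → v ∈ ⟪ B ⟫ (iter c (λ z → iter B (f z)) s ZZ)))
  outer zero _ = ks , λ v v<B → (λ t → contradiction t (none v)) , λ { _ _ () }
  outer (suc c) c<B = let (kc , h) = outer c (<⇒≤ c<B) ; (kd , g) = inner c _ c<B kc B ≤-refl in kd , λ v v<B →
    (λ t → [ (λ t′ → let (z , b , z<c , r) = proj₁ (h v v<B) t′ in z , b , m<n⇒m<1+n z<c , r) , (λ { (b , b<B , q) → c , b , ≤-refl , b<B , q }) ]′ (proj₁ (g v v<B) t)) ,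
    λ z b z<1+c b<B q → proj₂ (g v v<B) ([ (λ z<c → inj₁ (proj₂ (h v v<B) z b z<c b<B q)) , (λ { refl → inj₂ (b , b<B , q) }) ]′ (m<1+n⇒m<n∨m≡n z<1+c))

among₀ : List ℕ
among₀ = INP ∷ TT ∷ MM ∷ UU ∷ WW ∷ []

by-contradiction : ∀ P v → ¬ (v ∉ P) → v ∈ P
by-contradiction P v h with dec P v
... | yes p = p
... | no ¬p = contradiction ¬p h

one-of : ∀ P Q v → (v ∉ P → v ∉ Q → ⊥) → v ∈ P ⊎ v ∈ Q
one-of P Q v h with dec P v
... | yes p = inj₁ p
... | no ¬p = inj₂ (by-contradiction Q v (h ¬p))

module ZRun (ρ : Env) (0<B : 0 < ρ 2) (nn≤B : ρ 0 * ρ 0 ≤ ρ 2) where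
  B = ρ 2
  n = ρ 0
  open Closure B n nn≤B public

  Edge? : ∀ I u v → Dec (Edge I u v)
  Edge? I u v = (u <? n) ×-dec (v <? n) ×-dec Cell? I _

  ⟨_⟩ : (ℕ → ℕ) → DSet
  ⟨ f ⟩ = ⟪ B ⟫ f

  env : ℕ → ℕ → Env
  env z b = upd (upd ρ 56 z) 57 b

  set : ℕ → ℕ → Mem → Mem
  set z b = exec B (env z b) zSetC

  cutAt : ℕ → ℕ → Mem → Mem
  cutAt z b s = exec B (env z b) guideC (set z b s)

  Sep Rch : Mem → ℕ → ℕ → DSet
  Sep s z b = ⟨ cutAt z b s gD ⟩
  Rch s z b = ⟨ cutAt z b s gQ ⟩

  module _ (s : Mem) (U<n : ∀ v → v ∈ ⟨ s UU ⟩ → v < n) where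
    U W : DSet
    U = ⟨ s UU ⟩
    W = ⟨ s WW ⟩
    E = Edge (s INP)
    open Graph B E (Edge? (s INP)) ⟨ s TT ⟩

    module _ (z b : ℕ) where
      open GuideRun (env z b) 0<B using (netOf; guide-sound; Sound; sound-end)
      N = netOf (set z b s)

      V→ : ∀ v → v ∈ Net.V N → v ∈ U ∖ W
      V→ v (l , h) = sound B (UU ∋ var 21 & ~ (WW ∋ var 21)) {upd (env z b) 21 v} {s} h

      V← : ∀ v → v ∈ U ∖ W → v ∈ Net.V N
      V← v h = proj₁ (proj₁ h) , complete B (UU ∋ var 21 & ~ (WW ∋ var 21)) {upd (env z b) 21 v} {s} h

      S→ : ∀ v → v ∈ Net.S N → v ≡ z
      S→ v (l , h) = sound B (var 21 ≐ var 56) {upd (env z b) 21 v} {s} h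

      S← : ∀ v → v < B → v ≡ z → v ∈ Net.S N
      S← v l h = l , complete B (var 21 ≐ var 56) {upd (env z b) 21 v} {s} h

      F→ : ∀ v → v ∈ Net.F N → ∃[ w ] w ∈ W × E v w
      F→ v (l , h) = let (w , _ , w<n , v<n , (w∈ , _) , e) = sound B (beforeF 21 (var 0 ≐ var 0)) {upd (env z b) 21 v} {s} h in w , w∈ , v<n , w<n , e

      F← : ∀ v w → w ∈ W → E v w → v ∈ Net.F N
      F← v w w∈ (v<n , w<n , e) = n≤B v<n , complete B (beforeF 21 (var 0 ≐ var 0)) {upd (env z b) 21 v} {s} (w , n≤B w<n , w<n , v<n , (w∈ , refl) , e)

      so = guide-sound (set z b s)

      validR : ∀ v → v ∈ Rch s z b → v ∈ U ∖ W × v ∉ Net.F N × v ∉ Sep s z b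
      validR v v∈ = let (a , c , d) = Sound.valid so v v∈ in V→ v a , c , d

      V∌ : ∀ v → v ∈ U ∖ W → v ∉ Rch s z b → v ∉ Sep s z b → v ∉ Cut.Entered N (Rch s z b)
      V∌ v v∈ nr ns e = sound-end so v (((V← v v∈ , ns) , nr) , e)

      sepV : ∀ v → v ∈ Sep s z b → v ∈ U ∖ W
      sepV v v∈ = V→ v (Sound.D⊆V so v v∈)

      starts : z ∈ U ∖ W → z ∉ Sep s z b → z ∈ Rch s z b
      starts z∈ nz = by-contradiction (Rch s z b) z λ nr → V∌ z z∈ nr nz (inj₁ (S← z (proj₁ (proj₁ z∈)) refl))

      closes : ∀ u y → u ∈ Rch s z b → E u y → y ∈ U → y ∈ Rch s z b ⊎ y ∈ Sep s z b
      closes u y u∈ e y∈ = one-of (Rch s z b) (Sep s z b) y λ nr nd → V∌ y (y∈ , λ w → proj₁ (proj₂ (validR u u∈)) (F← u y w e)) nr nd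
        (inj₂ (u , n≤B (proj₁ e) , u∈ , proj₁ e , inj₁ (proj₂ e)))

    table-choose : ∀ {k K} → 2 ^ (2 * k) ≤ K → 2 ^ (2 * k) ≤ B → 2 * k < B → ∀ z → z ∈ U ∖ W → ∀ R X → z ∈ R → R ⊆ U ∖ W →
      (∀ u w → u ∈ R → w ∈ W → ¬ E u w) → (∀ u y → u ∈ R → E u y → y ∈ U ∖ W → y ∈ R ⊎ y ∈ X) → # B (dec X) ≤ k →
      ∃[ b ] b < K × (∀ v → v ∈ R → v ∉ Sep s z b) × # B (dec (Sep s z b)) ≤ # B (dec X)
    table-choose {k} {K} kK kB lB z z∈ R X z∈R R⊆ noW front X≤ =
      b , <-≤-trans (proj₁ (proj₂ main)) (≤-trans c≤k kK) , (λ v v∈ d → proj₁ res v v∈ (back v d)) , ≤-trans (#-mono B (dec (Sep s z b)) (dec ⟨ t gD ⟩) (λ v _ → back v)) (proj₂ res)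
      where
      c = # B (dec X)
      c≤k : 2 ^ (2 * c) ≤ 2 ^ (2 * k)
      c≤k = ^-monoʳ-≤ 2 (*-monoʳ-≤ 2 X≤)
      N₀ = N z 0
      main = GuideRun.guide-complete (env z 0) 0<B (set z 0 s) R c
        (λ v v∈ → V← z 0 v (R⊆ v v∈) , (λ f → let (w , w∈ , e) = F→ z 0 v f in noW v w v∈ w∈ e) , λ { (_ , ne) → ne refl })
        (#-mono B (dec (Cut.frontier N₀ R (⟪ B ⟫ (λ _ → 0)))) (dec X) λ r _ → inX r)
        (≤-trans c≤k kB) (≤-<-trans (*-monoʳ-≤ 2 X≤) lB)
        where
        inX : ∀ r → r ∈ Cut.frontier N₀ R (⟪ B ⟫ (λ _ → 0)) → r ∈ X
        inX r (((r∈V , _) , r∉R) , inj₁ r∈S) = contradiction (subst (_∈ R) (sym (S→ z 0 r r∈S)) z∈R) r∉R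
        inX r (((r∈V , _) , r∉R) , inj₂ (u , _ , u∈R , u<n , inj₁ (r<n , e))) = [ (λ r∈R → contradiction r∈R r∉R) , id ]′ (front u r u∈R (u<n , r<n , e) (V→ z 0 r r∈V))
        inX r (((r∈V , _) , r∉R) , inj₂ (u , _ , u∈R , u<n , inj₂ (n≤r , _))) = contradiction (U<n r (proj₁ (V→ z 0 r r∈V))) n≤r
      b = proj₁ main
      t = exec B (env z 0) guideC (set z b s)
      res : (∀ v → v ∈ R → v ∉ ⟨ t gD ⟩) × # B (dec ⟨ t gD ⟩) ≤ c
      res = proj₂ (proj₂ main) (set z b s) (same-cons B {gV} {gS ∷ gF ∷ INP ∷ TT ∷ MM ∷ []} {set z 0 s} {set z b s} (λ _ _ → refl)
        (same-cons B {gS} {gF ∷ INP ∷ TT ∷ MM ∷ []} {set z 0 s} {set z b s} (λ _ _ → refl) (same-cons B {gF} {INP ∷ TT ∷ MM ∷ []} {set z 0 s} {set z b s} (λ _ _ → refl)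
        (same-cons B {INP} {TT ∷ MM ∷ []} {set z 0 s} {set z b s} (λ _ _ → refl) (same-cons B {TT} {MM ∷ []} {set z 0 s} {set z b s} (λ _ _ → refl)
        (same-cons B {MM} {[]} {set z 0 s} {set z b s} (λ _ _ → refl) (same-nil B {set z 0 s} {set z b s}))))))) refl
      outs : Same B _ t (cutAt z b s)
      outs = exec-same B guideC {among (0 ∷ 2 ∷ [])} {among (gB ∷ gV ∷ gS ∷ gF ∷ INP ∷ TT ∷ MM ∷ [])} {_} {env z 0} {env z b} {set z b s} {set z b s} refl refl agree (λ _ _ _ _ → refl)
        where
        agree : ∀ x → among (0 ∷ 2 ∷ []) x ≡ true → env z 0 x ≡ env z b x
        agree 0 _ = refl
        agree 2 _ = refl
        agree (suc (suc (suc x))) ()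
      back : ∀ v → v ∈ Sep s z b → v ∈ ⟨ t gD ⟩
      back v (l , h) = l , λ e → h (trans (sym (outs gD refl v l)) e)

    table : ∀ {k K} → 2 ^ (2 * k) ≤ K → 2 ^ (2 * k) ≤ B → 2 * k < B → Table U W k K
    table {k} {K} kK kB lB = record
      { Sep = Sep s ; Rch = Rch s
      ; sep⊆ = λ {z} b _ v v∈ → sepV z b v v∈
      ; rch⊆ = λ {z} b _ v v∈ → proj₁ (validR z b v v∈)
      ; start = λ {z} b z∈ nz → starts z b z∈ nz
      ; closed = λ {z} b z∈ u y u∈ e y∈ → closes z b u y u∈ e y∈
      ; choose = table-choose {k} {K} kK kB lB }

  el-same : ∀ {K σ σ′} a v → Same B K σ σ′ → K a ≡ true → v ∈ ⟨ σ a ⟩ → v ∈ ⟨ σ′ a ⟩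
  el-same a v S k (l , h) = l , λ e → h (trans (S a k v l) e)

  Marked : (U W D P : DSet) → ℕ → ℕ → ℕ → Set
  Marked U W D P z b v = v ≡ z × b < ρ 50 × v ∈ U ∖ W × v ∉ D × ¬ (∃[ x ] x < B × x ∈ D × x ∉ P)

  mark-ok : ∀ z b s v → v < B → (v ∈ ⟨ exec B (env z b) zMarkC s ZZ ⟩ → v ∈ ⟨ s ZZ ⟩ ⊎ Marked ⟨ s UU ⟩ ⟨ s WW ⟩ ⟨ s gD ⟩ ⟨ s PP ⟩ z b v) ×
    (v ∈ ⟨ s ZZ ⟩ ⊎ Marked ⟨ s UU ⟩ ⟨ s WW ⟩ ⟨ s gD ⟩ ⟨ s PP ⟩ z b v → v ∈ ⟨ exec B (env z b) zMarkC s ZZ ⟩)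
  mark-ok z b s v v<B = (λ t → sound B markF {upd (env z b) 21 v} {s} (proj₂ t)) , (λ h → v<B , complete B markF {upd (env z b) 21 v} {s} h)
    where
    markF = ZZ ∋ var 21 ∥ var 21 ≐ var 56 & var 57 ≺ var 50 & (UU ∋ var 21 & ~ (WW ∋ var 21)) & ~ (gD ∋ var 21) & ~ (∃̇[ 61 ] (gD ∋ var 61 & ~ (PP ∋ var 61)))

  Marked-≈ : ∀ {U W D P U′ W′ D′ P′ z b v} → U ⊆ U′ → W′ ⊆ W → D′ ⊆ D → P ⊆ P′ → Marked U W D P z b v → Marked U′ W′ D′ P′ z b v
  Marked-≈ u w d p (e , l , (a , na) , nd , nx) = e , l , (u _ a , na ∘ w _) , nd ∘ d _ , λ { (x , x<B , x∈ , x∉) → nx (x , x<B , d x x∈ , x∉ ∘ p x) }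

  zz-abs : ∀ (cg : Cm) {Kout} s s₁ →
    disjoint (among (PP ∷ ZZ ∷ among₀)) cg ≡ true →
    okCm (among (0 ∷ 2 ∷ 50 ∷ 56 ∷ 57 ∷ [])) cg ≡ true → flow (among among₀) cg ≡ just Kout → Kout gD ≡ true →
    Same B (among among₀) s s₁ → let t = exec B ρ (ZZ [ 21 ]:= lit 0 ﹔ for 56 (for 57 (cg ﹔ zMarkC))) s₁ in
    ∀ v → v < B → (v ∈ ⟨ t ZZ ⟩ → ∃[ b ] b < B × Marked ⟨ s UU ⟩ ⟨ s WW ⟩ ⟨ exec B (env v b) cg s gD ⟩ ⟨ s₁ PP ⟩ v b v) ×
      (∀ b → b < B → Marked ⟨ s UU ⟩ ⟨ s WW ⟩ ⟨ exec B (env v b) cg s gD ⟩ ⟨ s₁ PP ⟩ v b v → v ∈ ⟨ t ZZ ⟩)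
  zz-abs cg {Kout} s s₁ dis ok fl kg S v v<B =
    (λ t → let (z , b , _ , b<B , h) = proj₁ main t in b , b<B , subst (λ z → Marked ⟨ s UU ⟩ ⟨ s WW ⟩ ⟨ exec B (env z b) cg s gD ⟩ ⟨ s₁ PP ⟩ z b v) (sym (proj₁ h)) h) ,
    (λ b b<B h → proj₂ main v b v<B b<B h)
    where
    K₁ : Names
    K₁ = among (PP ∷ among₀)
    Hit : ℕ → ℕ → ℕ → Set
    Hit z b = Marked ⟨ s UU ⟩ ⟨ s WW ⟩ ⟨ exec B (env z b) cg s gD ⟩ ⟨ s₁ PP ⟩ z b
    Kp : Mem → Set
    Kp s′ = Same B K₁ s₁ s′
    disj : ∀ s′ z b → Same B (among (PP ∷ ZZ ∷ among₀)) s′ (exec B (env z b) cg s′)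
    disj s′ z b = keepSame B {among (PP ∷ ZZ ∷ among₀)} (env z b) cg s′ dis
    low : ∀ s′ z b → Same B K₁ s′ (exec B (env z b) cg s′)
    low s′ z b = same-⊆ B {PP ∷ among₀} {among (PP ∷ ZZ ∷ among₀)} {s′} {exec B (env z b) cg s′} refl (disj s′ z b)
    keep : ∀ z b s′ → Kp s′ → Kp (exec B (env z b) (cg ﹔ zMarkC) s′)
    keep z b s′ k = same-trans B {K₁} {s₁} {s′} {exec B (env z b) (cg ﹔ zMarkC) s′} k
      (same-trans B {K₁} {s′} {exec B (env z b) cg s′} {exec B (env z b) (cg ﹔ zMarkC) s′} (low s′ z b) (keepSame B {K₁} (env z b) zMarkC (exec B (env z b) cg s′) refl))
    out : ∀ z b s′ → Kp s′ → ∀ v → v < B → exec B (env z b) cg s gD v ≡ exec B (env z b) cg s′ gD v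
    out z b s′ k = exec-same B cg {among (0 ∷ 2 ∷ 50 ∷ 56 ∷ 57 ∷ [])} {among among₀} {Kout} {env z b} {env z b} {s} {s′} ok fl (λ _ _ → refl)
      (same-trans B {among among₀} {s} {s₁} {s′} S (same-⊆ B {among₀} {K₁} {s₁} {s′} refl k)) gD kg
    ss : ∀ a s′ → among among₀ a ≡ true → K₁ a ≡ true → Kp s′ → ∀ z b v → (v ∈ ⟨ s a ⟩ → v ∈ ⟨ exec B (env z b) cg s′ a ⟩) × (v ∈ ⟨ exec B (env z b) cg s′ a ⟩ → v ∈ ⟨ s a ⟩)
    ss a s′ ka ka′ k z b v = (λ m → el-same {K₁} {s′} {s″} a v (low s′ z b) ka′ (el-same {K₁} {s₁} {s′} a v k ka′ (el-same {among among₀} {s} {s₁} a v S ka m))) ,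
      (λ m → el-same {among among₀} {s₁} {s} a v (same-sym B {among among₀} {s} {s₁} S) ka (el-same {K₁} {s′} {s₁} a v (same-sym B {K₁} {s₁} {s′} k) ka′ (el-same {K₁} {s″} {s′} a v (same-sym B {K₁} {s′} {s″} (low s′ z b)) ka′ m)))
      where s″ = exec B (env z b) cg s′
    pp : ∀ s′ → Kp s′ → ∀ z b v → (v ∈ ⟨ s₁ PP ⟩ → v ∈ ⟨ exec B (env z b) cg s′ PP ⟩) × (v ∈ ⟨ exec B (env z b) cg s′ PP ⟩ → v ∈ ⟨ s₁ PP ⟩)
    pp s′ k z b v = (λ m → el-same {K₁} {s′} {s″} PP v (low s′ z b) refl (el-same {K₁} {s₁} {s′} PP v k refl m)) ,
      (λ m → el-same {K₁} {s′} {s₁} PP v (same-sym B {K₁} {s₁} {s′} k) refl (el-same {K₁} {s″} {s′} PP v (same-sym B {K₁} {s′} {s″} (low s′ z b)) refl m))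
      where s″ = exec B (env z b) cg s′
    st : ∀ z b s′ → z < B → b < B → Kp s′ → ∀ v → v < B →
      (v ∈ ⟨ exec B (env z b) (cg ﹔ zMarkC) s′ ZZ ⟩ → v ∈ ⟨ s′ ZZ ⟩ ⊎ Hit z b v) × (v ∈ ⟨ s′ ZZ ⟩ ⊎ Hit z b v → v ∈ ⟨ exec B (env z b) (cg ﹔ zMarkC) s′ ZZ ⟩)
    st z b s′ _ _ k v v<B =
      (λ t → [ (λ m → inj₁ (el-same {K₂} {s″} {s′} ZZ v (same-sym B {K₂} {s′} {s″} (disj s′ z b)) refl m)) ,
        (λ h → inj₂ (Marked-≈ {⟨ s″ UU ⟩} {⟨ s″ WW ⟩} {⟨ s″ gD ⟩} {⟨ s″ PP ⟩} {⟨ s UU ⟩} {⟨ s WW ⟩} {⟨ exec B (env z b) cg s gD ⟩} {⟨ s₁ PP ⟩} (λ v → proj₂ (ss UU s′ refl refl k z b v)) (λ v → proj₁ (ss WW s′ refl refl k z b v)) (λ v m → proj₁ m , λ e → proj₂ m (trans (out z b s′ k v (proj₁ m)) e)) (λ v → proj₂ (pp s′ k z b v)) h)) ]′ (proj₁ mk t)) ,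
      [ (λ m → proj₂ mk (inj₁ (el-same {K₂} {s′} {s″} ZZ v (disj s′ z b) refl m))) ,
        (λ h → proj₂ mk (inj₂ (Marked-≈ {⟨ s UU ⟩} {⟨ s WW ⟩} {⟨ exec B (env z b) cg s gD ⟩} {⟨ s₁ PP ⟩} {⟨ s″ UU ⟩} {⟨ s″ WW ⟩} {⟨ s″ gD ⟩} {⟨ s″ PP ⟩} (λ v → proj₁ (ss UU s′ refl refl k z b v)) (λ v → proj₂ (ss WW s′ refl refl k z b v)) (λ v m → proj₁ m , λ e → proj₂ m (trans (sym (out z b s′ k v (proj₁ m))) e)) (λ v → proj₁ (pp s′ k z b v)) h))) ]′
      where
      K₂ : Names
      K₂ = among (PP ∷ ZZ ∷ among₀)
      s″ = exec B (env z b) cg s′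
      mk = mark-ok z b s″ v v<B
    s₀ = exec B ρ (ZZ [ 21 ]:= lit 0) s₁
    main = proj₂ (accumulate B (λ z b → exec B (env z b) (cg ﹔ zMarkC)) Kp Hit keep st s₀ (keepSame B {K₁} ρ (ZZ [ 21 ]:= lit 0) s₁ refl) (λ { v (_ , ne) → ne refl })) v v<B

  zz-ok : ∀ s s₁ → Same B (among among₀) s s₁ → let t = exec B ρ zC s₁ in
    ∀ v → v < B → (v ∈ ⟨ t ZZ ⟩ → ∃[ b ] b < B × Marked ⟨ s UU ⟩ ⟨ s WW ⟩ (Sep s v b) ⟨ s₁ PP ⟩ v b v) ×
      (∀ b → b < B → Marked ⟨ s UU ⟩ ⟨ s WW ⟩ (Sep s v b) ⟨ s₁ PP ⟩ v b v → v ∈ ⟨ t ZZ ⟩)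
  zz-ok s s₁ S = zz-abs zGuideC s s₁ refl refl refl refl S

elems : ℕ → DSet → List ℕ
elems zero P = []
elems (suc b) P with dec P b
... | yes _ = b ∷ elems b P
... | no _ = elems b P

elems-# : ∀ b P → length (elems b P) ≡ # b (dec P)
elems-# zero P = refl
elems-# (suc b) P with dec P b
... | yes _ = trans (cong suc (elems-# b P)) (+-comm 1 _)
... | no _ = trans (elems-# b P) (sym (+-identityʳ _))

elems-∈ : ∀ b P v → v ∈ᴸ elems b P → v ∈ P
elems-∈ (suc b) P v v∈ with dec P b
elems-∈ (suc b) P v (hereᴸ refl) | yes p = p
elems-∈ (suc b) P v (thereᴸ v∈) | yes p = elems-∈ b P v v∈
elems-∈ (suc b) P v v∈ | no _ = elems-∈ b P v v∈

∈-elems : ∀ b P v → v < b → v ∈ P → v ∈ᴸ elems b P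
∈-elems (suc b) P v l p with dec P b | m<1+n⇒m<n∨m≡n l
... | yes _ | inj₁ v<b = thereᴸ (∈-elems b P v v<b p)
... | yes _ | inj₂ refl = hereᴸ refl
... | no _ | inj₁ v<b = ∈-elems b P v v<b p
... | no ¬p | inj₂ refl = contradiction p ¬p

first : ℕ → DSet → List ℕ
first B P with any<? B (dec P)
... | yes (v , _) = v ∷ []
... | no _ = []

first-≤ : ∀ B P → length (first B P) ≤ 1
first-≤ B P with any<? B (dec P)
... | yes _ = ≤-refl
... | no _ = z≤n

first-∈ : ∀ B P v → v ∈ᴸ first B P → v ∈ P
first-∈ B P v v∈ with any<? B (dec P)
first-∈ B P v (hereᴸ refl) | yes (_ , _ , p) = p

∈-first : ∀ B P v → v < B → v ∈ P → ∃[ u ] u ∈ᴸ first B P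
∈-first B P v l p with any<? B (dec P)
... | yes (u , _) = u , hereᴸ refl
... | no none = contradiction (v , l , p) none

gather : (f : ℕ → List ℕ) → List ℕ → List ℕ
gather f [] = []
gather f (x ∷ xs) = f x ++ gather f xs

gather-length : ∀ f c xs → (∀ x → length (f x) ≤ c) → length (gather f xs) ≤ length xs * c
gather-length f c [] h = z≤n
gather-length f c (x ∷ xs) h = ≤-trans (≤-reflexive (length-++ (f x))) (+-mono-≤ (h x) (gather-length f c xs h))

∈-gather : ∀ f xs {x v} → x ∈ᴸ xs → v ∈ᴸ f x → v ∈ᴸ gather f xs
∈-gather f (x ∷ xs) (hereᴸ refl) v∈ = ∈-++⁺ˡ v∈
∈-gather f (x ∷ xs) (thereᴸ x∈) v∈ = ∈-++⁺ʳ (f x) (∈-gather f xs x∈ v∈)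

gather-∈ : ∀ f xs {v} → v ∈ᴸ gather f xs → ∃[ x ] x ∈ᴸ xs × v ∈ᴸ f x
gather-∈ f (x ∷ xs) v∈ with ∈-++⁻ (f x) v∈
... | inj₁ a = x , hereᴸ refl , a
... | inj₂ a = let (y , y∈ , b) = gather-∈ f xs a in y , thereᴸ y∈ , b

module RoundMath (B n : ℕ) (nn≤B : n * n ≤ B) (I : ℕ → ℕ) (T U W : DSet)
  (E? : ∀ u v → Dec (Closure.Edge B n nn≤B I u v)) (U<n : ∀ v → v ∈ U → v < n) (W⊆U : W ⊆ U)
  (good-W : Graph.Good B (Closure.Edge B n nn≤B I) E? T (El (U ∖ W))) {k K : ℕ} (tab : Graph.Table B (Closure.Edge B n nn≤B I) E? T U W k K) where

  open Closure B n nn≤B using (n≤B; Walk; stop; go)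
  E = Closure.Edge B n nn≤B I
  open Graph B E E? T hiding (Table)
  open Graph.Table tab

  U<B : ∀ v → v ∈ U → v < B
  U<B v u = n≤B (U<n v u)

  open Normal U W U<B W⊆U good-W tab public

  module Chosen (X : DSet) (sol : Solution X) (irr : Irredundant X) (pushed : Pushed X) (w₁ : ℕ) (w₁∈ : w₁ ∈ W) where
    open Solution sol

    P₀ : ℕ → ℕ → Set
    P₀ = Pth (El (U ∖ X))

    reachD : ℕ → DSet
    El (reachD u) v = P₀ u v
    dec (reachD u) v = reach? (U ∖ X) (bound X) u v

    w∈UX : ∀ {w} → w ∈ W → w ∈ U ∖ X
    w∈UX w∈ = W⊆U _ w∈ , λ x → proj₂ (X⊆ _ x) w∈

    sink : ∀ fuel w → # B (λ v → dec W v ×-dec dec (reachD w) v) < fuel → w ∈ W → ∃[ w₀ ] w₀ ∈ W × (∀ w → w ∈ W → P₀ w₀ w → P₀ w w₀)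
    sink (suc fuel) w (s≤s h) w∈ with any<? B (λ v → (dec W v ×-dec dec (reachD w) v) ×-dec ¬? (dec (reachD v) w))
    ... | no none = w , w∈ , λ v v∈ p → by-contradiction (rev v) w (λ np → none (v , U<B v (W⊆U v v∈) , (v∈ , p) , np))
      where
      rev : ℕ → DSet
      rev = reachD
    ... | yes (v , v<B , (v∈ , p) , np) = sink fuel v (<-≤-trans (#-< B (λ u → dec W u ×-dec dec (reachD v) u) (λ u → dec W u ×-dec dec (reachD w) u)
      (λ { u _ (u∈ , q) → u∈ , p ◅◅ q }) w (U<B w (W⊆U w w∈)) (w∈ , here (w∈UX w∈)) (λ q → np (proj₂ q))) h) v∈

    sunk = sink (suc (# B (λ v → dec W v ×-dec dec (reachD w₁) v))) w₁ ≤-refl w₁∈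
    w₀ = proj₁ sunk
    w₀∈ : w₀ ∈ W
    w₀∈ = proj₁ (proj₂ sunk)

    R W₀ Tl : DSet
    R = reachD w₀
    El W₀ v = v ∈ W × v ∈ R
    dec W₀ v = dec W v ×-dec dec R v
    El Tl v = v ∈ R × v ∈ T × v ∈ ToW X
    dec Tl v = dec R v ×-dec dec T v ×-dec dec (ToW X) v

    back : ∀ {v} → v ∈ R → v ∈ ToW X → P₀ v w₀
    back r (w , _ , w∈ , p) = p ◅◅ proj₂ (proj₂ sunk) w w∈ (r ◅◅ p)

    Tl-unique : ∀ {t t′} → t ∈ Tl → t′ ∈ Tl → t ≡ t′
    Tl-unique {t} {t′} (r , tT , q) (r′ , tT′ , q′) = good t t′ tT tT′ (back r q ◅◅ r′) (back r′ q′ ◅◅ r)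

    Tl-size : # B (dec Tl) ≤ 1
    Tl-size = #-unique B (dec Tl) Tl-unique

    Exempt : DSet
    Exempt = X ∪ (Tl ∖ W)

    xs qs : List ℕ
    xs = elems B (X ∪ W₀)
    qs = elems B (W ∖ W₀) ++ (elems B (Tl ∖ W) ++ gather (λ x → gather (λ b → first B (Sep x b ∖ X)) (elems K (dset (λ b → b < K) (λ b → b <? K)))) (elems B Exempt))

    exempt⊆ : ∀ {x} → x ∈ Exempt → x ∈ U ∖ W
    exempt⊆ (inj₁ x) = X⊆ _ x
    exempt⊆ (inj₂ ((r , _) , nw)) = proj₁ (target∈ r) , nw

    xs-length : length xs ≤ # B (dec X) + # B (dec W)
    xs-length = ≤-trans (≤-reflexive (elems-# B (X ∪ W₀))) (≤-trans (#-∪ B (dec X) (dec W₀) (dec (X ∪ W₀)) (λ _ _ → id)) (+-monoʳ-≤ (# B (dec X)) (#-mono B (dec W₀) (dec W) (λ _ _ → proj₁))))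

    qs-length : length qs ≤ # B (dec W) + (1 + (# B (dec X) + 1) * K)
    qs-length = ≤-trans (≤-reflexive (trans (length-++ (elems B (W ∖ W₀))) (cong (length (elems B (W ∖ W₀)) +_) (length-++ (elems B (Tl ∖ W))))))
      (+-mono-≤ (≤-trans (≤-reflexive (elems-# B (W ∖ W₀))) (#-mono B (dec (W ∖ W₀)) (dec W) (λ _ _ → proj₁)))
        (+-mono-≤ (≤-trans (≤-reflexive (elems-# B (Tl ∖ W))) (≤-trans (#-mono B (dec (Tl ∖ W)) (dec Tl) (λ _ _ → proj₁)) Tl-size))
          (≤-trans (gather-length _ K (elems B Exempt) inner)
            (*-monoˡ-≤ K (≤-trans (≤-reflexive (elems-# B Exempt)) (≤-trans (#-∪ B (dec X) (dec (Tl ∖ W)) (dec Exempt) (λ _ _ → id))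
              (+-monoʳ-≤ (# B (dec X)) (≤-trans (#-mono B (dec (Tl ∖ W)) (dec Tl) (λ _ _ → proj₁)) Tl-size))))))))
      where
      inner : ∀ x → length (gather (λ b → first B (Sep x b ∖ X)) (elems K (dset (λ b → b < K) (λ b → b <? K)))) ≤ K
      inner x = ≤-trans (gather-length _ 1 (elems K (dset (λ b → b < K) (λ b → b <? K))) (λ b → first-≤ B (Sep x b ∖ X)))
        (≤-trans (≤-reflexive (*-identityʳ _)) (≤-trans (≤-reflexive (elems-# K (dset (λ b → b < K) (λ b → b <? K)))) (#-≤ K (λ b → b <? K))))

    xs< : Below n xs
    xs< x x∈ = [ (λ a → U<n x (proj₁ (X⊆ x a))) , (λ a → U<n x (W⊆U x (proj₁ a))) ]′ (elems-∈ B (X ∪ W₀) x x∈)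

    qs-∈ : ∀ q → q ∈ᴸ qs → q ∈ U × q ∉ X × q ∉ W₀
    qs-∈ q q∈ = [ (λ a → let (w , nw) = elems-∈ B (W ∖ W₀) q a in W⊆U q w , (λ x → proj₂ (X⊆ q x) w) , nw) ,
      [ (λ a → let ((r , _) , nw) = elems-∈ B (Tl ∖ W) q a in proj₁ (target∈ r) , proj₂ (target∈ r) , nw ∘ proj₁) ,
        (λ c → let (x , x∈ , d) = gather-∈ _ (elems B Exempt) c
                   (b , b∈ , e) = gather-∈ _ (elems K (dset (λ b → b < K) (λ b → b <? K))) d
                   (s , nx) = first-∈ B (Sep x b ∖ X) q e
                   (u , nw) = sep⊆ b (exempt⊆ (elems-∈ B Exempt x x∈)) q s
               in u , nx , nw ∘ proj₁) ]′ ∘ ∈-++⁻ (elems B (Tl ∖ W)) ]′ (∈-++⁻ (elems B (W ∖ W₀)) q∈)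

    apart : Apart xs qs
    apart x q x∈ q∈ refl = [ proj₁ (proj₂ (qs-∈ q q∈)) , proj₂ (proj₂ (qs-∈ q q∈)) ]′ (elems-∈ B (X ∪ W₀) x x∈)

    module WithP (P : DSet) (P⊇ : ∀ x → x ∈ᴸ xs → x ∈ P) (P∌ : ∀ q → q ∈ᴸ qs → q ∉ P) (Z : DSet)
      (Z→ : ∀ v → v ∈ Z → v ∈ U ∖ W × ∃[ b ] b < K × v ∉ Sep v b × (∀ x → x ∈ Sep v b → x ∈ P))
      (Z← : ∀ v b → v ∈ U ∖ W → b < K → v ∉ Sep v b → (∀ x → x ∈ Sep v b → x ∈ P) → v ∈ Z) where

      X⊆P : ∀ v → v ∈ X → v ∈ P
      X⊆P v x = P⊇ v (∈-elems B (X ∪ W₀) v (U<B v (proj₁ (X⊆ v x))) (inj₁ x))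

      W₀→P : ∀ v → v ∈ W₀ → v ∈ P
      W₀→P v w = P⊇ v (∈-elems B (X ∪ W₀) v (U<B v (W⊆U v (proj₁ w))) (inj₂ w))

      P→W₀ : ∀ v → v ∈ W → v ∈ P → v ∈ R
      P→W₀ v w p = by-contradiction R v λ nr → P∌ v (∈-++⁺ˡ (∈-elems B (W ∖ W₀) v (U<B v (W⊆U v w)) (w , nr ∘ proj₂))) p

      Tl∌P : ∀ v → v ∈ Tl → v ∉ W → v ∉ P
      Tl∌P v t nw = P∌ v (∈-++⁺ʳ (elems B (W ∖ W₀)) (∈-++⁺ˡ (∈-elems B (Tl ∖ W) v (U<B v (proj₁ (target∈ (proj₁ t)))) (t , nw))))

      exempt∉Z : ∀ v → v ∈ Exempt → v ∉ Z
      exempt∉Z v v∈ z = let (vUW , b , b<K , nsep , sub) = Z→ v z in case any<? B (dec (Sep v b ∖ X)) of λ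
          { (yes (q , q<B , h)) → let (u , u∈) = ∈-first B (Sep v b ∖ X) q q<B h in
              P∌ u (∈-++⁺ʳ (elems B (W ∖ W₀)) (∈-++⁺ʳ (elems B (Tl ∖ W)) (∈-gather _ (elems B Exempt) (∈-elems B Exempt v (U<B v (proj₁ vUW)) v∈)
                (∈-gather _ (elems K (dset (λ b → b < K) (λ b → b <? K))) (∈-elems K _ b b<K b<K) u∈)))) (sub u (proj₁ (first-∈ B (Sep v b ∖ X) u u∈)))
          ; (no none) → inside-X v b v∈ vUW nsep (λ y h → proj₁ h , λ s → none (y , U<B y (proj₁ h) , s , proj₂ h)) }
        where
        inside-X : ∀ v b → v ∈ Exempt → v ∈ U ∖ W → v ∉ Sep v b → (∀ y → y ∈ U ∖ X → y ∈ U × y ∉ Sep v b) → ⊥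
        inside-X v b (inj₁ x) vUW nsep sub = let (y , e , (w , _ , w∈ , p)) = irr v x in
          [ (λ r → separated b vUW (El (U ∖ X)) sub y r w w∈ p) , proj₂ (sub y (source∈ p)) ]′ (closed b vUW v y (start b vUW nsep) e (proj₁ (source∈ p)))
        inside-X v b (inj₂ ((_ , _ , (w , _ , w∈ , p)) , _)) vUW nsep sub = separated b vUW (El (U ∖ X)) sub v (start b vUW nsep) w w∈ p

      shadow∈Z : ∀ v → v ∈ U ∖ X → v ∉ ToW X → v ∈ Z
      shadow∈Z v u nt = let (b , b<K , ns , sub) = pushed v u nt in Z← v b (proj₁ u , λ w → nt (toW {X} w (here u))) b<K ns (λ x s → X⊆P x (sub x s))

      Gh : ℕ → ℕ → Set
      Gh = Walk (U ∖ Z) (λ∩ U Z) I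
        where
        λ∩ : DSet → DSet → DSet
        El (λ∩ P Q) v = v ∈ P × v ∈ Q
        dec (λ∩ P Q) v = dec P v ×-dec dec Q v

      gh-shadow : ∀ {u v} → u ∈ U ∖ X → u ∉ ToW X → Gh u v → v ∈ X
      gh-shadow u∈ nt (stop (_ , nz)) = contradiction (shadow∈Z _ u∈ nt) nz
      gh-shadow u∈ nt (go {y = y} _ e w) with dec X y
      gh-shadow u∈ nt (go _ e (stop _)) | yes x = x
      gh-shadow u∈ nt (go _ e (go (_ , z) _ _)) | yes x = contradiction z (exempt∉Z _ (inj₁ x))
      ... | no nx = gh-shadow (src w , nx) (λ { (v , l , v∈ , p) → nt (v , l , v∈ , step u∈ e p) }) w
        where
        src : ∀ {a b} → Gh a b → a ∈ U
        src (stop (u , _)) = u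
        src (go (u , _) _ _) = u

      gh-first : ∀ {S : ℕ → Set} {u w} → (∀ y → S y → y ∈ U) → w ∉ Z → Pth S u w → ∃[ v ] Gh u v × S v
      gh-first {S} {u} S⊆U nz (here s) = u , stop (S⊆U _ s , nz) , s
      gh-first {S} {u} S⊆U nz (step s e p) with dec Z u
      ... | no nu = u , stop (S⊆U _ s , nu) , s
      ... | yes z = let (v , g , sv) = gh-first S⊆U nz p in v , go (S⊆U _ s , z) e g , sv

      W∌Z : ∀ w → w ∈ W → w ∉ Z
      W∌Z w w∈ z = proj₂ (proj₁ (Z→ w z)) w∈

      Tl∉Z : ∀ t → t ∈ Tl → t ∉ Z
      Tl∉Z t t∈ z = exempt∉Z t (inj₂ (t∈ , λ w → W∌Z t w z)) z

      gh-exits : ∀ {t v} → t ∈ R → t ∈ T → Gh t v → v ∈ X ∪ Tl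
      gh-exits {t} r tT g with dec (ToW X) t
      ... | no nt = inj₁ (gh-shadow (target∈ r) nt g)
      gh-exits {t} r tT (stop _) | yes tw = inj₂ (r , tT , tw)
      gh-exits {t} r tT (go (_ , z) _ _) | yes tw = contradiction z (Tl∉Z t (r , tT , tw))

      gh-Tl : ∀ {t} → t ∈ Tl → Gh t t
      gh-Tl t∈ = stop (proj₁ (target∈ (proj₁ t∈)) , Tl∉Z _ t∈)

      module WithBc (Bc : DSet) (Bc⊇ : ∀ t v → t ∈ R → t ∈ T → Gh t v → v ∈ Bc) (H : DSet)
        (H⊇ : ∀ v → v ∈ Bc → v ∈ X ∪ Tl → v ∈ H) (H∌ : ∀ v → v ∈ Bc → v ∉ X ∪ Tl → v ∉ H) (Xb Ex : DSet)
        (Xb→ : ∀ v → v ∈ Xb → v ∈ Bc × v ∈ H × v ∈ P × v ∉ W) (Xb← : ∀ v → v ∈ Bc × v ∈ H × v ∈ P × v ∉ W → v ∈ Xb)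
        (Ex→ : ∀ v → v ∈ Ex → v ∈ Bc × v ∈ H × (v ∉ P ⊎ v ∈ W)) (Ex← : ∀ v → v ∈ Bc × v ∈ H × (v ∉ P ⊎ v ∈ W) → v ∈ Ex) where

        BcH : ∀ v → v ∈ Bc → v ∈ H → v ∈ X ∪ Tl
        BcH v b h = by-contradiction (X ∪ Tl) v λ nx → H∌ v b nx h

        Xb⊆X : ∀ v → v ∈ Xb → v ∈ X
        Xb⊆X v xb = let (b , h , p , nw) = Xb→ v xb in [ id , (λ t → contradiction p (Tl∌P v t nw)) ]′ (BcH v b h)

        Xb⊇ : ∀ v → v ∈ Bc → v ∈ X → v ∈ Xb
        Xb⊇ v b x = Xb← v (b , H⊇ v b (inj₁ x) , X⊆P v x , proj₂ (X⊆ v x))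

        Ex⊆Tl : ∀ v → v ∈ Ex → v ∈ Tl
        Ex⊆Tl v ex = let (b , h , o) = Ex→ v ex in [ (λ x → contradiction o [ (λ np → np (X⊆P v x)) , proj₂ (X⊆ v x) ]′) , id ]′ (BcH v b h)

        Tl⊆Ex : ∀ v → v ∈ Tl → v ∈ Ex
        Tl⊆Ex v t = let b = Bc⊇ v v (proj₁ t) (proj₁ (proj₂ t)) (gh-Tl t) in Ex← v (b , H⊇ v b (inj₂ t) , outside (dec W v))
          where
          outside : Dec (v ∈ W) → v ∉ P ⊎ v ∈ W
          outside (yes w) = inj₂ w
          outside (no nw) = inj₁ (Tl∌P v t nw)

        R-cut : ∀ t w → t ∈ R → t ∈ T → t ∉ Ex → w ∈ W → ¬ Pth (El (U ∖ Xb)) t w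
        R-cut t w r tT nex w∈ p = let (v , g , (_ , nxb)) = gh-first (λ _ → proj₁) (W∌Z w w∈) p in nxb (Xb⊇ v (Bc⊇ t v r tT g) (gh-shadow (target∈ r) (λ tw → nex (Tl⊆Ex t (r , tT , tw))) g))

        module WithCut (Q D : DSet)
          (Q⊆ : ∀ v → v ∈ Q → (v ∈ U × v ∉ Xb × v ∉ W ⊎ v ∈ W × v ∈ P)) (D⊆ : ∀ v → v ∈ D → (v ∈ U × v ∉ Xb × v ∉ W ⊎ v ∈ W × v ∈ P))
          (Q-closed : ∀ u y → u ∈ Q → E u y → (y ∈ U × y ∉ Xb × y ∉ W ⊎ y ∈ W × y ∈ P) → y ∈ Q ⊎ y ∈ D)
          (Q-W : ∀ u w → u ∈ Q → w ∈ W → w ∉ P → ¬ E u w)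
          (Q-T : ∀ t w → t ∈ Q → t ∈ T → t ∉ Ex → w ∈ W → ¬ Pth (El (U ∖ Xb)) t w)
          (Q-start : ∀ w → w ∈ W → w ∈ P → w ∉ D → w ∈ Q) (R∌D : ∀ v → v ∈ R → v ∉ D) (Fr : DSet)
          (Fr-small : # B (dec D) ≤ # B (dec Fr)) (Fr→ : ∀ v → v ∈ Fr → v ∈ X ∖ Xb × v ∉ R × ∃[ u ] u ∈ R × E u v) where

          U′ W′ Y : DSet
          U′ = U ∖ Xb ∖ D ∖ Q
          W′ = W ∖ P
          El Y v = v ∈ X × v ∈ U′
          dec Y v = dec X v ×-dec dec U′ v

          V₃ : ∀ v → v ∈ U ∖ Xb → v ∉ W′ → (v ∈ U × v ∉ Xb × v ∉ W ⊎ v ∈ W × v ∈ P)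
          V₃ v (u , nx) nw = [ (λ w → inj₂ (w , by-contradiction P v λ np → nw (w , np))) , (λ n → inj₁ (u , nx , n)) ]′ (toSum (dec W v))

          R⊆Q : ∀ v → v ∈ R → v ∈ Q
          R⊆Q v r = proj₁ (stays {R = El Q} (λ u y q e (_ , ry) → [ id , (λ d → contradiction d (R∌D y ry)) ]′ (Q-closed u y q e
            (V₃ y (proj₁ (target∈ ry) , λ xb → proj₂ (target∈ ry) (Xb⊆X y xb)) (λ { (w , np) → np (W₀→P y (w , ry)) }))))
            (Q-start w₀ w₀∈ (W₀→P w₀ (w₀∈ , here (w∈UX w₀∈))) (R∌D w₀ (here (w∈UX w₀∈)))) (restrict (λ y p → p) r))

          W′⊆U′ : W′ ⊆ U′
          W′⊆U′ v (w , np) = ((W⊆U v w , λ xb → proj₂ (proj₂ (proj₂ (Xb→ v xb))) w) , (λ d → no-V (D⊆ v d))) , λ q → no-V (Q⊆ v q)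
            where
            no-V : ¬ (v ∈ U × v ∉ Xb × v ∉ W ⊎ v ∈ W × v ∈ P)
            no-V (inj₁ (_ , _ , nw)) = nw w
            no-V (inj₂ (_ , p)) = np p

          W′-smaller : # B (dec W′) < # B (dec W)
          W′-smaller = #-< B (dec W′) (dec W) (λ _ _ → proj₁) w₀ (U<B w₀ (W⊆U w₀ w₀∈)) w₀∈ (λ h → proj₂ h (W₀→P w₀ (w₀∈ , here (w∈UX w₀∈))))

          good-mono : ∀ {S S′ : ℕ → Set} → (∀ y → S′ y → S y) → Good S → Good S′
          good-mono f g t t′ a b p q = g t t′ a b (pmap f p) (pmap f q)

          good-W′ : Good (El (U′ ∖ W′))
          good-W′ = good-mono (λ { y ((((u , nx) , nd) , nq) , nw′) → u , λ w → nw′ (w , λ p → nq (R⊆Q y (P→W₀ y w p))) }) good-W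

          good-Y : Good (El (U′ ∖ Y))
          good-Y = good-mono (λ { y (u′@(((u , _) , _) , _) , ny) → u , λ x → ny (x , u′) }) good

          Y⊆ : Y ⊆ U′ ∖ W′
          Y⊆ v (x , u′) = u′ , λ w′ → proj₂ (X⊆ v x) (proj₁ w′)

          Y-size : # B (dec Y) + (# B (dec Xb) + # B (dec D)) ≤ # B (dec X)
          Y-size = ≤-trans (+-monoʳ-≤ (# B (dec Y)) (≤-trans (+-monoʳ-≤ (# B (dec Xb)) Fr-small)
            (#-⊎ B (dec Xb) (dec Fr) (dec (Xb ∪ Fr)) (λ _ _ → inj₁) (λ _ _ → inj₂) (λ v _ xb fr → proj₂ (proj₁ (Fr→ v fr)) xb))))
            (#-⊎ B (dec Y) (dec (Xb ∪ Fr)) (dec X) (λ _ _ → proj₁) (λ v _ → [ Xb⊆X v , (λ fr → proj₁ (proj₁ (Fr→ v fr))) ]′)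
              (λ v _ (x , (((u , nxb) , nd) , nq)) → [ nxb , (λ fr → let ((_ , _) , _ , a , r , e) = Fr→ v fr in
                [ nq , nd ]′ (Q-closed a v (R⊆Q a r) e (V₃ v (u , nxb) (λ w′ → proj₂ (X⊆ v x) (proj₁ w′))))) ]′))

          Q-stays : ∀ (A : ℕ → Set) → (∀ v → A v → v ∈ U′) → ∀ u y → u ∈ Q → E u y → A y ⊎ y ∈ Q → y ∈ Q
          Q-stays A A⊆ u y u∈ e (inj₂ y∈) = y∈
          Q-stays A A⊆ u y u∈ e (inj₁ ya) = let (((yu , nx) , nd) , nq) = A⊆ y ya in
            [ id , (λ d → contradiction d nd) ]′ (Q-closed u y u∈ e (V₃ y (yu , nx) (λ { (w , np) → Q-W u y u∈ w np e })))

          put-back : ∀ (A : ℕ → Set) → (∀ v → A v → v ∈ U′) → Good A → Good (λ v → A v ⊎ v ∈ Q)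
          put-back A A⊆ gA = good-⊎ Q (Q-stays A A⊆) gA λ t t′ tT t′T a a′ p q →
            [ (λ e → [ (λ e′ → Tl-unique (Ex⊆Tl t e) (Ex⊆Tl t′ e′)) , (λ ne → sym (cut-off t′ t t′T tT a′ ne q p)) ]′ (toSum (dec Ex t′))) , (λ ne → cut-off t t′ tT t′T a ne p q) ]′ (toSum (dec Ex t))
            where
            sub : ∀ y → A y ⊎ y ∈ Q → y ∈ U ∖ Xb
            sub y = [ (λ ya → proj₁ (proj₁ (A⊆ y ya))) , (λ y∈ → [ (λ (u , nx , _) → u , nx) , (λ (w , _) → W⊆U y w , λ xb → proj₂ (proj₂ (proj₂ (Xb→ y xb))) w) ]′ (Q⊆ y y∈)) ]′
            cut-off : ∀ t t′ → t ∈ T → t′ ∈ T → t ∈ Q → t ∉ Ex → Pth (λ v → A v ⊎ v ∈ Q) t t′ → Pth (λ v → A v ⊎ v ∈ Q) t′ t → t ≡ t′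
            cut-off t t′ tT t′T a ne p q = harmless {W = W} good-W (λ y s → proj₁ (sub y s)) (λ w w∈ r → Q-T t w a tT ne w∈ (pmap sub r)) tT t′T (here (inj₂ a)) p q

infix 2 _:≡_
_:≡_ : ℕ → Fm → Cm
a :≡ φ = a [ 21 ]:= tm φ

v̇ : Tm
v̇ = var 21

xbF exF v₁F f₁F v₃F f₃F : Fm
xbF = BC ∋ v̇ & HH ∋ v̇ & PP ∋ v̇ & ~ (WW ∋ v̇)
exF = BC ∋ v̇ & HH ∋ v̇ & (~ (PP ∋ v̇) ∥ WW ∋ v̇)
v₁F = (UU ∋ v̇ & ~ (WW ∋ v̇) ∥ WW ∋ v̇ & PP ∋ v̇) ∥ ~ (v̇ ≺ var 0) & v̇ ≺ var 0 ⊞ var 0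
f₁F = beforeF 21 (~ (PP ∋ var 60)) ∥ ~ (v̇ ≺ var 0)
v₃F = UU ∋ v̇ & ~ xbF & ~ (WW ∋ v̇) ∥ WW ∋ v̇ & PP ∋ v̇
f₃F = beforeF 21 (~ (PP ∋ var 60)) ∥ TT ∋ v̇ & ~ exF & ∃̇[ 60 ] (var 60 ≺ var 0 & v̇ ≺ var 0 & WW ∋ var 60 & MM ∋ (mulN v̇ ⊞ var 60))

closeSetA closeSetC setupA setupC updateC segA segB segC segD roundC : Cm
closeSetA = gV :≡ UU ∋ v̇ & ~ (ZZ ∋ v̇) ﹔ gS :≡ UU ∋ v̇ & ZZ ∋ v̇ ﹔ closeC
closeSetC = gV :≡ UU ∋ v̇ & ~ xbF ﹔ gS :≡ UU ∋ v̇ & ~ xbF ﹔ closeC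
setupA = gV :≡ v₁F ﹔ gS :≡ WW ∋ v̇ & PP ∋ v̇ ﹔ gF :≡ f₁F
setupC = gV :≡ v₃F ﹔ gS :≡ WW ∋ v̇ & PP ∋ v̇ ﹔ gF :≡ f₃F
updateC = XX :≡ XX ∋ v̇ ∥ xbF ∥ gD ∋ v̇ ﹔ UU :≡ ((UU ∋ v̇ & ~ xbF) & ~ (gD ∋ v̇)) & ~ (gQ ∋ v̇) ﹔ WW :≡ WW ∋ v̇ & ~ (PP ∋ v̇)
segA = hashC ﹔ PP :≡ HH ∋ v̇ ﹔ zC ﹔ closeSetA ﹔ setupA
segB = guideC ﹔ BC :≡ v̇ ≺ var 0 & gD ∋ (v̇ ⊞ var 0)
segC = hashC ﹔ closeSetC ﹔ setupC
segD = guideC ﹔ updateC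
roundC = (takeC hC ﹔ segA) ﹔ (takeC gB ﹔ segB) ﹔ (takeC hC ﹔ segC) ﹔ takeC gB ﹔ segD

record Base : Set where
  constructor ⟪I:_T:_U:_W:_X:_⟫
  field bI bT bU bW bX : ℕ → ℕ
open Base

base : Mem → Base
base s = ⟪I: s INP T: s TT U: s UU W: s WW X: s XX ⟫

baseL : List ℕ
baseL = INP ∷ TT ∷ UU ∷ WW ∷ XX ∷ []

frames : ∀ B ρ c as s → disjoint (among as) c ≡ true → ∀ x → among as x ≡ true → exec B ρ c s x ≡ s x
frames B ρ c as s d x e = frame B ρ c s x (silent c d e)
  where
  silent : ∀ c {K : Names} {x} → disjoint K c ≡ true → K x ≡ true → writes c x ≡ false
  silent (a [ y ]:= t) {K} {x} d e with a ≡ᵇ x in eq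
  ... | false = refl
  ... | true = contradiction (trans (cong K (≡ᵇ⇒≡ a x (subst T (sym eq) tt))) e) (λ z → not-true {K a} d z)
  silent (c ﹔ c′) {K} {x} d e rewrite silent c {K} {x} (∧-trueˡ d) e = silent c′ (∧-trueʳ {disjoint K c} d) e
  silent (for y c) d e = silent c d e

base-eq : ∀ t s → (∀ x → among baseL x ≡ true → t x ≡ s x) → base t ≡ base s
base-eq t s h = go (h INP refl) (h TT refl) (h UU refl) (h WW refl) (h XX refl)
  where
  go : ∀ {a b c d e a′ b′ c′ d′ e′} → a ≡ a′ → b ≡ b′ → c ≡ c′ → d ≡ d′ → e ≡ e′ → ⟪I: a T: b U: c W: d X: e ⟫ ≡ ⟪I: a′ T: b′ U: c′ W: d′ X: e′ ⟫
  go refl refl refl refl refl = refl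

module SegRun (ρ : Env) (0<B : 0 < ρ 2) (nn≤B : ρ 0 * ρ 0 ≤ ρ 2) where
  open ZRun ρ 0<B nn≤B public

  infix 4 _≋_
  _≋_ : DSet → (ℕ → Set) → Set
  P ≋ Q = ∀ v → (v ∈ P → Q v) × (v < B → Q v → v ∈ P)

  fm≋ : ∀ a φ s → ⟨ exec B ρ (a :≡ φ) s a ⟩ ≋ (λ v → ⟦ B ⟧ φ (upd ρ 21 v) s)
  fm≋ a φ s v = (λ { (l , h) → sound B φ {upd ρ 21 v} {s} (λ e → h (trans (cong (λ f → f v) (upd-≡ s a _)) e)) }) ,
    (λ l m → l , λ e → complete B φ {upd ρ 21 v} {s} m (trans (sym (cong (λ f → f v) (upd-≡ s a (λ i → eval B (upd ρ 21 i) s (tm φ))))) e))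

  walk-map : ∀ {V V′ S S′ I u v} → V ⊆ V′ → S ⊆ S′ → Walk V S I u v → Walk V′ S′ I u v
  walk-map f g (stop a) = stop (f _ a)
  walk-map f g (go a e w) = go (g _ a) e (walk-map f g w)

  -- Results of a guided cut, for a state a in which the network is set up
  -- and the state t after the search.
  record CutRes (a t : Mem) : Set where
    field
      Q⊆V : ∀ v → v ∈ ⟨ t gQ ⟩ → v ∈ ⟨ a gV ⟩
      Q∌F : ∀ v → v ∈ ⟨ t gQ ⟩ → v ∉ ⟨ a gF ⟩
      D⊆V : ∀ v → v ∈ ⟨ t gD ⟩ → v ∈ ⟨ a gV ⟩
      closed : ∀ u y → u ∈ ⟨ t gQ ⟩ → Guided.Arc B n (a INP) (a TT) (a MM) u y → y ∈ ⟨ a gV ⟩ → y ∈ ⟨ t gQ ⟩ ⊎ y ∈ ⟨ t gD ⟩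
      start : ∀ y → y ∈ ⟨ a gS ⟩ → y ∈ ⟨ a gV ⟩ → y ∈ ⟨ t gQ ⟩ ⊎ y ∈ ⟨ t gD ⟩

  module _ where
    open GuideRun ρ 0<B using (guide-sound; Sound; sound-end)

    cut-res : ∀ a → CutRes a (exec B ρ guideC a)
    cut-res a = record
      { Q⊆V = λ v q → proj₁ (Sound.valid gs v q) ; Q∌F = λ v q → proj₁ (proj₂ (Sound.valid gs v q)) ; D⊆V = Sound.D⊆V gs
      ; closed = λ u y u∈ e y∈ → one-of ⟨ t gQ ⟩ ⟨ t gD ⟩ y λ nq nd → sound-end gs y (((y∈ , nd) , nq) , inj₂ (u , proj₁ u∈ , u∈ , e))
      ; start = λ y s y∈ → one-of ⟨ t gQ ⟩ ⟨ t gD ⟩ y λ nq nd → sound-end gs y (((y∈ , nd) , nq) , inj₁ s) }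
      where
      gs = guide-sound a
      t = exec B ρ guideC a

  module _ (a : Mem) where
    open GuideRun ρ 0<B using (netOf; guide-complete)

    cut-bits : ∀ d → CutRes a (exec B ρ guideC (upd a gB (λ _ → d)))
    cut-bits d = record { Q⊆V = Q⊆V ; Q∌F = Q∌F ; D⊆V = D⊆V ; closed = closed ; start = start }
      where open CutRes (cut-res (upd a gB (λ _ → d)))

    cut-choose : ∀ R₀ (Fr : DSet) → (∀ v → v ∈ R₀ → v ∈ ⟨ a gV ⟩ × v ∉ ⟨ a gF ⟩) →
      (∀ r → r ∈ ⟨ a gV ⟩ → r ∉ R₀ → r ∈ ⟨ a gS ⟩ ⊎ (∃[ u ] u ∈ R₀ × Guided.Arc B n (a INP) (a TT) (a MM) u r) → r ∈ Fr) →
      2 ^ (2 * # B (dec Fr)) ≤ B → 2 * # B (dec Fr) < B →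
      ∃[ d ] d < 2 ^ (2 * # B (dec Fr)) × (let t = exec B ρ guideC (upd a gB (λ _ → d)) in (∀ v → v ∈ R₀ → v ∉ ⟨ t gD ⟩) × # B (dec ⟨ t gD ⟩) ≤ # B (dec Fr))
    cut-choose R₀ Fr valid front pB lB =
      let (d , d< , h) = guide-complete a R₀ (# B (dec Fr)) (λ v v∈ → proj₁ (valid v v∈) , proj₂ (valid v v∈) , λ { (_ , ne) → ne refl })
            (#-mono B (dec (Cut.frontier (netOf a) R₀ (⟪ B ⟫ (λ _ → 0)))) (dec Fr)
              (λ { r _ (((r∈ , _) , nr) , e) → front r r∈ nr ([ inj₁ , (λ { (u , _ , u∈ , ar) → inj₂ (u , u∈ , ar) }) ]′ e) })) pB lB
      in d , d< , h (upd a gB (λ _ → d)) (keepSame B {among (gV ∷ gS ∷ gF ∷ INP ∷ TT ∷ MM ∷ [])} ρ (gB [ 21 ]:= lit d) a refl) refl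


  base-frame : ∀ c s → disjoint (among baseL) c ≡ true → base (exec B ρ c s) ≡ base s
  base-frame c s d = base-eq (exec B ρ c s) s (frames B ρ c baseL s d)

  Iff : Set → Set → Set
  Iff P Q = (P → Q) × (Q → P)

  V₁ S₁ F₁ : Base → DSet → ℕ → Set
  V₁ b P v = (v ∈ ⟨ bU b ⟩ × v ∉ ⟨ bW b ⟩ ⊎ v ∈ ⟨ bW b ⟩ × v ∈ P) ⊎ ¬ (v < n) × v < n + n
  S₁ b P v = v ∈ ⟨ bW b ⟩ × v ∈ P
  F₁ b P v = (∃[ w ] w < B × w < n × v < n × (w ∈ ⟨ bW b ⟩ × w ∉ P) × Cell (bI b) (n + mul v + w)) ⊎ ¬ (v < n)

  Ghost : Base → DSet → ℕ → ℕ → Set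
  Ghost b Z = Walk (⟨ bU b ⟩ ∖ Z) (⟨ bU b ⟩ ∖ (⟨ bU b ⟩ ∖ Z)) (bI b)

  record AfterA (S : ℕ → ℕ → DSet) (s h a : Mem) : Set₁ where
    field
      base≡ : base a ≡ base s
      P≋ : ⟨ a PP ⟩ ≋ (λ v → v ∈ ⟨ h HH ⟩)
      Z : DSet
      Z→ : ∀ v → v ∈ Z → ∃[ b ] b < B × Marked ⟨ s UU ⟩ ⟨ s WW ⟩ (S v b) ⟨ a PP ⟩ v b v
      Z← : ∀ v b → b < B → Marked ⟨ s UU ⟩ ⟨ s WW ⟩ (S v b) ⟨ a PP ⟩ v b v → v ∈ Z
      gh : ∀ u v → u < n → v < n → Iff (Cell (a MM) (mul u + v)) (Ghost (base s) Z u v)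
      V≋ : ⟨ a gV ⟩ ≋ V₁ (base s) ⟨ a PP ⟩
      S≋ : ⟨ a gS ⟩ ≋ S₁ (base s) ⟨ a PP ⟩
      F≋ : ⟨ a gF ⟩ ≋ F₁ (base s) ⟨ a PP ⟩

  closeA : ∀ s u v → u < n → v < n → Iff (Cell (exec B ρ closeSetA s MM) (mul u + v)) (Ghost (base s) ⟨ s ZZ ⟩ u v)
  closeA s u v u<n v<n = (λ c → walk-map (λ y → proj₁ (fm≋ gV inF s y)) (λ y h → let (a , b) = proj₁ (fm≋ gS sF s₁ y) h in a , λ { (_ , nz) → nz b }) (proj₁ cl c)) ,
    (λ w → proj₂ cl (walk-map (λ y h → proj₂ (fm≋ gV inF s y) (proj₁ (proj₁ h)) h) (λ { y (a , b) → proj₂ (fm≋ gS sF s₁ y) (proj₁ a) (a , by-contradiction ⟨ s ZZ ⟩ y (λ nz → b (a , nz))) }) w))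
    where
    inF = UU ∋ v̇ & ~ (ZZ ∋ v̇)
    sF = UU ∋ v̇ & ZZ ∋ v̇
    s₁ = exec B ρ (gV :≡ inF) s
    cl = CloseRun.close-ok ρ nn≤B (exec B ρ (gS :≡ sF) s₁) u v u<n v<n

  SetA : Mem → Base → DSet → Set
  SetA t b P = (⟨ t gV ⟩ ≋ V₁ b P) × (⟨ t gS ⟩ ≋ S₁ b P) × (⟨ t gF ⟩ ≋ F₁ b P)

  setA : ∀ s → SetA (exec B ρ setupA s) (base s) ⟨ s PP ⟩
  setA s = fm≋ gV v₁F s , fm≋ gS (WW ∋ v̇ & PP ∋ v̇) s , fm≋ gF f₁F s

  afterA-abs : ∀ s h s₁ s₂ s₃ a →
    base a ≡ base s₃ → base s₃ ≡ base s₂ → base s₂ ≡ base s₁ → base s₁ ≡ base s → a PP ≡ s₃ PP → s₃ PP ≡ s₂ PP → s₂ PP ≡ s₁ PP →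
    a MM ≡ s₃ MM → ⟨ s₁ PP ⟩ ≋ (λ v → v ∈ ⟨ h HH ⟩) →
    (∀ v → v < B → (v ∈ ⟨ s₂ ZZ ⟩ → ∃[ b ] b < B × Marked ⟨ s UU ⟩ ⟨ s WW ⟩ (Sep s v b) ⟨ s₁ PP ⟩ v b v) ×
      (∀ b → b < B → Marked ⟨ s UU ⟩ ⟨ s WW ⟩ (Sep s v b) ⟨ s₁ PP ⟩ v b v → v ∈ ⟨ s₂ ZZ ⟩)) →
    (∀ u v → u < n → v < n → Iff (Cell (s₃ MM) (mul u + v)) (Ghost (base s₂) ⟨ s₂ ZZ ⟩ u v)) →
    SetA a (base s₃) ⟨ s₃ PP ⟩ → AfterA (Sep s) s h a
  afterA-abs s h s₁ s₂ s₃ a b₃ b₂ b₁ b₀ p₃ p₂ p₁ eM pp zz cl set = record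
    { base≡ = trans b₃ (trans b₂ b₂₀)
    ; P≋ = subst (λ f → ⟨ f ⟩ ≋ (λ v → v ∈ ⟨ h HH ⟩)) (sym aPP) pp
    ; Z = ⟨ s₂ ZZ ⟩
    ; Z→ = λ v z → subst (λ f → ∃[ b ] b < B × Marked ⟨ s UU ⟩ ⟨ s WW ⟩ (Sep s v b) ⟨ f ⟩ v b v) (sym aPP) (proj₁ (zz v (proj₁ z)) z)
    ; Z← = λ v b b<B m → proj₂ (zz v (proj₁ (proj₁ (proj₁ (proj₂ (proj₂ m)))))) b b<B (subst (λ f → Marked ⟨ s UU ⟩ ⟨ s WW ⟩ (Sep s v b) ⟨ f ⟩ v b v) aPP m)
    ; gh = λ u v u<n v<n → subst₂ (λ M b → Iff (Cell M (mul u + v)) (Ghost b ⟨ s₂ ZZ ⟩ u v)) (sym eM) b₂₀ (cl u v u<n v<n)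
    ; V≋ = proj₁ set′ ; S≋ = proj₁ (proj₂ set′) ; F≋ = proj₂ (proj₂ set′) }
    where
    b₂₀ = trans b₁ b₀
    aPP : a PP ≡ s₁ PP
    aPP = trans p₃ (trans p₂ p₁)
    set′ : SetA a (base s) ⟨ a PP ⟩
    set′ = subst₂ (λ b p → SetA a b ⟨ p ⟩) (trans b₂ b₂₀) (sym p₃) set

  segA-ok : ∀ s d → let r = upd s hC (λ _ → d) in AfterA (Sep s) s (exec B ρ hashC r) (exec B ρ segA r)
  segA-ok s d = afterA-abs s h s₁ s₂ s₃ (exec B ρ setupA s₃)
    (base-frame setupA s₃ refl) (base-frame closeSetA s₂ refl) (base-frame zC s₁ refl) (base-frame preC s refl)
    (frame B ρ setupA s₃ PP refl) (frame B ρ closeSetA s₂ PP refl) (frame B ρ zC s₁ PP refl) (frame B ρ setupA s₃ MM refl)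
    (fm≋ PP (HH ∋ v̇) h) (zz-ok s s₁ (keepSame B {among among₀} ρ preC s refl)) (closeA s₂) (setA s₃)
    where
    preC = hC [ 21 ]:= lit d ﹔ hashC ﹔ PP :≡ HH ∋ v̇
    h = exec B ρ hashC (upd s hC (λ _ → d))
    s₁ = exec B ρ (PP :≡ HH ∋ v̇) h
    s₂ = exec B ρ zC s₁
    s₃ = exec B ρ closeSetA s₂

  record AfterB (a g t : Mem) : Set where
    field
      base≡ : base t ≡ base a
      PP≡ : t PP ≡ a PP
      res : CutRes a g
      BC≋ : ⟨ t BC ⟩ ≋ (λ v → v < n × v + n ∈ ⟨ g gD ⟩)

  segB-ok : ∀ s d → let r = upd s gB (λ _ → d) in AfterB s (exec B ρ guideC r) (exec B ρ segB r)
  segB-ok s d = record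
    { base≡ = base-frame (gB [ 21 ]:= lit d ﹔ segB) s refl
    ; PP≡ = frame B ρ segB (upd s gB (λ _ → d)) PP refl
    ; res = cut-bits s d
    ; BC≋ = fm≋ BC (v̇ ≺ var 0 & gD ∋ (v̇ ⊞ var 0)) (exec B ρ guideC (upd s gB (λ _ → d))) }

  xbS exS : (b h p w : ℕ → ℕ) → DSet
  El (xbS b h p w) v = v ∈ ⟨ b ⟩ × v ∈ ⟨ h ⟩ × v ∈ ⟨ p ⟩ × v ∉ ⟨ w ⟩
  dec (xbS b h p w) v = dec ⟨ b ⟩ v ×-dec dec ⟨ h ⟩ v ×-dec dec ⟨ p ⟩ v ×-dec ¬? (dec ⟨ w ⟩ v)
  El (exS b h p w) v = v ∈ ⟨ b ⟩ × v ∈ ⟨ h ⟩ × (v ∉ ⟨ p ⟩ ⊎ v ∈ ⟨ w ⟩)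
  dec (exS b h p w) v = dec ⟨ b ⟩ v ×-dec dec ⟨ h ⟩ v ×-dec (¬? (dec ⟨ p ⟩ v) ⊎-dec dec ⟨ w ⟩ v)

  Clear : Base → (b h p : ℕ → ℕ) → DSet
  Clear s b h p = ⟨ bU s ⟩ ∖ xbS b h p (bW s)

  V₃ F₃ : Base → (b h p : ℕ → ℕ) → ℕ → Set
  V₃ s b h p v = v ∈ ⟨ bU s ⟩ × v ∉ xbS b h p (bW s) × v ∉ ⟨ bW s ⟩ ⊎ v ∈ ⟨ bW s ⟩ × v ∈ ⟨ p ⟩
  F₃ s b h p v = (∃[ w ] w < B × w < n × v < n × (w ∈ ⟨ bW s ⟩ × w ∉ ⟨ p ⟩) × Cell (bI s) (n + mul v + w)) ⊎
    (v ∈ ⟨ bT s ⟩ × v ∉ exS b h p (bW s) × ∃[ w ] w < B × w < n × v < n × w ∈ ⟨ bW s ⟩ × Walk (Clear s b h p) (Clear s b h p) (bI s) v w)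

  closeCl : ∀ s u v → u < n → v < n → Iff (Cell (exec B ρ closeSetC s MM) (mul u + v)) (Walk (Clear (base s) (s BC) (s HH) (s PP)) (Clear (base s) (s BC) (s HH) (s PP)) (s INP) u v)
  closeCl s u v u<n v<n = (λ c → walk-map (λ y → proj₁ (fm≋ gV inF s y)) (λ y → proj₁ (fm≋ gS inF s₁ y)) (proj₁ cl c)) ,
    (λ w → proj₂ cl (walk-map (λ y h → proj₂ (fm≋ gV inF s y) (proj₁ (proj₁ h)) h) (λ y h → proj₂ (fm≋ gS inF s₁ y) (proj₁ (proj₁ h)) h) w))
    where
    inF = UU ∋ v̇ & ~ xbF
    s₁ = exec B ρ (gV :≡ inF) s
    cl = CloseRun.close-ok ρ nn≤B (exec B ρ (gS :≡ inF) s₁) u v u<n v<n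

  record AfterC (s h c : Mem) : Set where
    field
      base≡ : base c ≡ base s
      PP≡ : c PP ≡ s PP
      BC≡ : c BC ≡ s BC
      HH≡ : c HH ≡ h HH
      V≋ : ⟨ c gV ⟩ ≋ V₃ (base c) (c BC) (c HH) (c PP)
      S≋ : ⟨ c gS ⟩ ≋ S₁ (base c) ⟨ c PP ⟩
      F≋ : ⟨ c gF ⟩ ≋ F₃ (base c) (c BC) (c HH) (c PP)

  afterC-abs : ∀ s h s₁ c → base c ≡ base s₁ → base s₁ ≡ base h → base h ≡ base s → c PP ≡ s₁ PP → s₁ PP ≡ h PP → h PP ≡ s PP →
    c BC ≡ s₁ BC → s₁ BC ≡ h BC → h BC ≡ s BC → c HH ≡ s₁ HH → s₁ HH ≡ h HH →
    (∀ u v → u < n → v < n → Iff (Cell (s₁ MM) (mul u + v)) (Walk (Clear (base h) (h BC) (h HH) (h PP)) (Clear (base h) (h BC) (h HH) (h PP)) (h INP) u v)) →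
    ⟨ c gV ⟩ ≋ V₃ (base s₁) (s₁ BC) (s₁ HH) (s₁ PP) → ⟨ c gS ⟩ ≋ S₁ (base s₁) ⟨ s₁ PP ⟩ →
    ⟨ c gF ⟩ ≋ (λ v → (∃[ w ] w < B × w < n × v < n × (w ∈ ⟨ s₁ WW ⟩ × w ∉ ⟨ s₁ PP ⟩) × Cell (s₁ INP) (n + mul v + w)) ⊎
      (v ∈ ⟨ s₁ TT ⟩ × v ∉ exS (s₁ BC) (s₁ HH) (s₁ PP) (s₁ WW) × ∃[ w ] w < B × w < n × v < n × w ∈ ⟨ s₁ WW ⟩ × Cell (s₁ MM) (mul v + w))) → AfterC s h c
  afterC-abs s h s₁ c b₁ b₀ bh p₁ p₀ ph q₁ q₀ qh h₁ h₀ cl v≋ s≋ f≋ = record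
    { base≡ = trans b₁ (trans b₀ bh) ; PP≡ = trans p₁ (trans p₀ ph) ; BC≡ = trans q₁ (trans q₀ qh) ; HH≡ = trans h₁ h₀
    ; V≋ = to (λ s b h p → ⟨ c gV ⟩ ≋ V₃ s b h p) (sym b₁) (sym q₁) (sym h₁) (sym p₁) v≋
    ; S≋ = to (λ s b h p → ⟨ c gS ⟩ ≋ S₁ s ⟨ p ⟩) (sym b₁) (sym q₁) (sym h₁) (sym p₁) s≋
    ; F≋ = to (λ s b h p → ⟨ c gF ⟩ ≋ F₃ s b h p) (sym b₁) (sym q₁) (sym h₁) (sym p₁) λ v →
      (λ m → [ inj₁ , (λ { (t , e , w , w<B , w<n , v<n , w∈ , m) → inj₂ (t , e , w , w<B , w<n , v<n , w∈ , proj₁ (cl₁ v w v<n w<n) m) }) ]′ (proj₁ (f≋ v) m)) ,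
      λ v<B → [ (λ e → proj₂ (f≋ v) v<B (inj₁ e)) , (λ { (t , e , w , w<B , w<n , v<n , w∈ , m) → proj₂ (f≋ v) v<B (inj₂ (t , e , w , w<B , w<n , v<n , w∈ , proj₂ (cl₁ v w v<n w<n) m)) }) ]′ }
    where
    to : ∀ (C : Base → (b h p : ℕ → ℕ) → Set) {s s′ b b′ h h′ p p′} → s ≡ s′ → b ≡ b′ → h ≡ h′ → p ≡ p′ → C s b h p → C s′ b′ h′ p′
    to C refl refl refl refl x = x
    cl₁ : ∀ u v → u < n → v < n → Iff (Cell (s₁ MM) (mul u + v)) (Walk (Clear (base s₁) (s₁ BC) (s₁ HH) (s₁ PP)) (Clear (base s₁) (s₁ BC) (s₁ HH) (s₁ PP)) (s₁ INP) u v)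
    cl₁ u v u<n v<n = to (λ s b h p → Iff (Cell (s₁ MM) (mul u + v)) (Walk (Clear s b h p) (Clear s b h p) (bI s) u v)) (sym b₀) (sym q₀) (sym h₀) (sym p₀) (cl u v u<n v<n)

  segC-ok : ∀ s d → let r = upd s hC (λ _ → d) in AfterC s (exec B ρ hashC r) (exec B ρ segC r)
  segC-ok s d = afterC-abs s h s₁ (exec B ρ setupC s₁)
    (base-frame setupC s₁ refl) (base-frame closeSetC h refl) (base-frame (hC [ 21 ]:= lit d ﹔ hashC) s refl)
    (frame B ρ setupC s₁ PP refl) (frame B ρ closeSetC h PP refl) (frame B ρ hashC r PP refl)
    (frame B ρ setupC s₁ BC refl) (frame B ρ closeSetC h BC refl) (frame B ρ hashC r BC refl)
    (frame B ρ setupC s₁ HH refl) (frame B ρ closeSetC h HH refl)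
    (closeCl h) (fm≋ gV v₃F s₁) (fm≋ gS (WW ∋ v̇ & PP ∋ v̇) s₁) (fm≋ gF f₃F s₁)
    where
    r = upd s hC (λ _ → d)
    h = exec B ρ hashC r
    s₁ = exec B ρ closeSetC h

  record AfterD (c g t : Mem) : Set where
    Xb = xbS (c BC) (c HH) (c PP) (c WW)
    field
      res : CutRes c g
      I≡ : t INP ≡ c INP
      T≡ : t TT ≡ c TT
      X≋ : ⟨ t XX ⟩ ≋ (λ v → v ∈ ⟨ c XX ⟩ ⊎ v ∈ Xb ⊎ v ∈ ⟨ g gD ⟩)
      U≋ : ⟨ t UU ⟩ ≋ (λ v → ((v ∈ ⟨ c UU ⟩ × v ∉ Xb) × v ∉ ⟨ g gD ⟩) × v ∉ ⟨ g gQ ⟩)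
      W≋ : ⟨ t WW ⟩ ≋ (λ v → v ∈ ⟨ c WW ⟩ × v ∉ ⟨ c PP ⟩)

  updates : ∀ g → let t = exec B ρ updateC g ; Xb = xbS (g BC) (g HH) (g PP) (g WW) in
    (⟨ t XX ⟩ ≋ (λ v → v ∈ ⟨ g XX ⟩ ⊎ v ∈ Xb ⊎ v ∈ ⟨ g gD ⟩)) ×
    (⟨ t UU ⟩ ≋ (λ v → ((v ∈ ⟨ g UU ⟩ × v ∉ Xb) × v ∉ ⟨ g gD ⟩) × v ∉ ⟨ g gQ ⟩)) × (⟨ t WW ⟩ ≋ (λ v → v ∈ ⟨ g WW ⟩ × v ∉ ⟨ g PP ⟩))
  updates g = fm≋ XX (XX ∋ v̇ ∥ xbF ∥ gD ∋ v̇) g , fm≋ UU uF g₁ , fm≋ WW (WW ∋ v̇ & ~ (PP ∋ v̇)) (exec B ρ (UU :≡ uF) g₁)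
    where
    uF = ((UU ∋ v̇ & ~ xbF) & ~ (gD ∋ v̇)) & ~ (gQ ∋ v̇)
    g₁ = exec B ρ (XX :≡ XX ∋ v̇ ∥ xbF ∥ gD ∋ v̇) g

  segD-ok : ∀ s d → let r = upd s gB (λ _ → d) in AfterD s (exec B ρ guideC r) (exec B ρ segD r)
  segD-ok s d = let (x≋ , u≋ , w≋) = conv {exec B ρ guideC r} {exec B ρ segD r} {s} (frame B ρ guideC r UU refl) (frame B ρ guideC r WW refl) (frame B ρ guideC r XX refl) (frame B ρ guideC r BC refl) (frame B ρ guideC r HH refl) (frame B ρ guideC r PP refl) (updates (exec B ρ guideC r)) in record
    { res = cut-bits s d ; I≡ = frame B ρ segD r INP refl ; T≡ = frame B ρ segD r TT refl ; X≋ = x≋ ; U≋ = u≋ ; W≋ = w≋ }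
    where
    r = upd s gB (λ _ → d)
    conv : ∀ {g t g′ : Mem} → g UU ≡ g′ UU → g WW ≡ g′ WW → g XX ≡ g′ XX → g BC ≡ g′ BC → g HH ≡ g′ HH → g PP ≡ g′ PP →
      (⟨ t XX ⟩ ≋ (λ v → v ∈ ⟨ g XX ⟩ ⊎ v ∈ xbS (g BC) (g HH) (g PP) (g WW) ⊎ v ∈ ⟨ g gD ⟩)) ×
      (⟨ t UU ⟩ ≋ (λ v → ((v ∈ ⟨ g UU ⟩ × v ∉ xbS (g BC) (g HH) (g PP) (g WW)) × v ∉ ⟨ g gD ⟩) × v ∉ ⟨ g gQ ⟩)) × (⟨ t WW ⟩ ≋ (λ v → v ∈ ⟨ g WW ⟩ × v ∉ ⟨ g PP ⟩)) →
      (⟨ t XX ⟩ ≋ (λ v → v ∈ ⟨ g′ XX ⟩ ⊎ v ∈ xbS (g′ BC) (g′ HH) (g′ PP) (g′ WW) ⊎ v ∈ ⟨ g gD ⟩)) ×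
      (⟨ t UU ⟩ ≋ (λ v → ((v ∈ ⟨ g′ UU ⟩ × v ∉ xbS (g′ BC) (g′ HH) (g′ PP) (g′ WW)) × v ∉ ⟨ g gD ⟩) × v ∉ ⟨ g gQ ⟩)) × (⟨ t WW ⟩ ≋ (λ v → v ∈ ⟨ g′ WW ⟩ × v ∉ ⟨ g′ PP ⟩))
    conv a b c d e f h rewrite a | b | c | d | e | f = h

  GoodIn : (I T : ℕ → ℕ) → (ℕ → Set) → Set
  GoodIn I T = Graph.Good B (Edge I) (Edge? I) ⟨ T ⟩

  good-anti : ∀ {I T} {S S′ : ℕ → Set} → (∀ v → S′ v → S v) → GoodIn I T S → GoodIn I T S′
  good-anti {I} {T} f g t t′ a b p q = g t t′ a b (pmap f p) (pmap f q)
    where open Graph B (Edge I) (Edge? I) ⟨ T ⟩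

aF okF : Fm
aF = v̇ ≺ var 0 & ~ (XX ∋ v̇)
okF = (Σ[ 60 ] ifz (tm (XX ∋ var 60)) (lit 0) (lit 1)) ≺ var 1 ⊞ lit 1 &
  ~ (∃̇[ 60 ] ∃̇[ 61 ] (~ (var 60 ≐ var 61) & TT ∋ var 60 & TT ∋ var 61 & var 60 ≺ var 0 & var 61 ≺ var 0 &
    MM ∋ (mulN (var 60) ⊞ var 61) & MM ∋ (mulN (var 61) ⊞ var 60)))

checkC saveC : Cm
saveC = nsol :≡ found ∋ lit 0 & nsol ∋ v̇ ∥ ~ (found ∋ lit 0) & XX ∋ v̇ ﹔ found :≡ found ∋ lit 0 ∥ okF
checkC = (gV :≡ aF ﹔ gS :≡ aF ﹔ closeC) ﹔ saveC

module CheckRun (ρ : Env) (0<B : 0 < ρ 2) (nn≤B : ρ 0 * ρ 0 ≤ ρ 2) where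
  open SegRun ρ 0<B nn≤B public

  Solves : (I T X : ℕ → ℕ) → Set
  Solves I T X = # B (dec ⟨ X ⟩) ≤ ρ 1 × GoodIn I T (Outside n ⟨ X ⟩)

  saved-≡ : ∀ {I I′ T T′ N N′ F F′ : ℕ → ℕ} → I′ ≡ I → T′ ≡ T → N′ ≡ N → F′ ≡ F → (F 0 ≢ 0 → Solves I T N) → F′ 0 ≢ 0 → Solves I′ T′ N′
  saved-≡ refl refl refl refl h = h

  Saved : Mem → Set
  Saved s = s found 0 ≢ 0 → Solves (s INP) (s TT) (s nsol)

  outside : (ℕ → ℕ) → DSet
  outside X = dset (λ v → v < n) (λ v → v <? n) ∖ ⟨ X ⟩

  JoinedBy : (M X I : ℕ → ℕ) → Set
  JoinedBy M X I = ∀ u v → u < n → v < n → Iff (Cell M (mul u + v)) (Walk (outside X) (outside X) I u v)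

  Joined : Mem → Set
  Joined g = JoinedBy (g MM) (g XX) (g INP)

  close-outside : ∀ s → Joined (exec B ρ (gV :≡ aF ﹔ gS :≡ aF ﹔ closeC) s)
  close-outside s = subst₂ (JoinedBy (g MM)) (sym (frame B ρ c s XX refl)) (sym (frame B ρ c s INP refl)) joined
    where
    c = gV :≡ aF ﹔ gS :≡ aF ﹔ closeC
    g = exec B ρ c s
    joined : JoinedBy (g MM) (s XX) (s INP)
    joined u v u<n v<n = (λ c → walk-map (λ y → proj₁ (fm≋ gV aF s y)) (λ y → proj₁ (fm≋ gS aF s₁ y)) (proj₁ cl c)) ,
      (λ w → proj₂ cl (walk-map (λ y h → proj₂ (fm≋ gV aF s y) (n≤B (proj₁ h)) h) (λ y h → proj₂ (fm≋ gS aF s₁ y) (n≤B (proj₁ h)) h) w))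
      where
      s₁ = exec B ρ (gV :≡ aF) s
      cl = CloseRun.close-ok ρ nn≤B (exec B ρ (gS :≡ aF) s₁) u v u<n v<n

  count-ok : ∀ (r : Env) s → sum B (λ i → eval B (upd r 60 i) s (ifz (tm (XX ∋ var 60)) (lit 0) (lit 1))) ≡ # B (dec ⟨ s XX ⟩)
  count-ok r s = sum-cong B λ i _ → one i (dec ⟨ s XX ⟩ i)
    where
    one : ∀ i (d : Dec (i ∈ ⟨ s XX ⟩)) → eval B (upd r 60 i) s (ifz (tm (XX ∋ var 60)) (lit 0) (lit 1)) ≡ ind d
    one i (yes m) = if-true B (XX ∋ var 60) {upd r 60 i} {s} 0 1 m
    one i (no nm) = if-false B (XX ∋ var 60) {upd r 60 i} {s} 0 1 nm

  module _ (g : Mem) (joined : Joined g) (v : ℕ) where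
    open Graph B (Edge (g INP)) (Edge? (g INP)) ⟨ g TT ⟩

    walk→pth : ∀ {u v} → Walk (outside (g XX)) (outside (g XX)) (g INP) u v → Pth (El (outside (g XX))) u v
    walk→pth (stop a) = here a
    walk→pth (go a e w) = step a e (walk→pth w)

    pth→walk : ∀ {u v} → Pth (El (outside (g XX))) u v → Walk (outside (g XX)) (outside (g XX)) (g INP) u v
    pth→walk (here a) = stop a
    pth→walk (step a e w) = go a e (pth→walk w)

    ok→ : ⟦ B ⟧ okF (upd ρ 21 v) g → Solves (g INP) (g TT) (g XX)
    ok→ (c , nb) = ≤-pred (subst₂ _<_ (count-ok (upd ρ 21 v) g) (+-comm (ρ 1) 1) c) , good
      where
      good : Good (El (outside (g XX)))
      good t t′ tT t′T p q with t ≟ t′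
      ... | yes e = e
      ... | no ne = contradiction (t , n≤B t<n , t′ , n≤B t′<n , ne , tT , t′T , t<n , t′<n , proj₂ (joined t t′ t<n t′<n) (pth→walk p) , proj₂ (joined t′ t t′<n t<n) (pth→walk q)) nb
        where
        t<n = proj₁ (source∈ p)
        t′<n = proj₁ (target∈ p)

    ok← : Solves (g INP) (g TT) (g XX) → ⟦ B ⟧ okF (upd ρ 21 v) g
    ok← (c , good) = subst₂ _<_ (sym (count-ok (upd ρ 21 v) g)) (+-comm 1 (ρ 1)) (s≤s c) ,
      λ { (t , _ , t′ , _ , ne , tT , t′T , t<n , t′<n , c₁ , c₂) → ne (good t t′ tT t′T (walk→pth (proj₁ (joined t t′ t<n t′<n) c₁)) (walk→pth (proj₁ (joined t′ t t′<n t<n) c₂))) }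

  record Checked (s t : Mem) : Set where
    field
      base≡ : base t ≡ base s
      saved : Saved s → Saved t
      finds : s found 0 ≢ 0 ⊎ Solves (s INP) (s TT) (s XX) → t found 0 ≢ 0

  save-ok : ∀ g → Joined g → Checked g (exec B ρ saveC g)
  save-ok g joined = record { base≡ = base-frame saveC g refl ; saved = saved ; finds = λ h → complete B foundF {upd ρ 21 0} {g₁} ([ (λ f → inj₁ (0<B , f)) , (λ s → inj₂ (ok← g₁ joined 0 s)) ]′ h) }
    where
    nsolF = found ∋ lit 0 & nsol ∋ v̇ ∥ ~ (found ∋ lit 0) & XX ∋ v̇
    foundF = found ∋ lit 0 ∥ okF
    g₁ = exec B ρ (nsol :≡ nsolF) g
    t = exec B ρ saveC g
    solves-≈ : ∀ {X X′} → ⟨ X ⟩ ⊆ ⟨ X′ ⟩ → ⟨ X′ ⟩ ⊆ ⟨ X ⟩ → Solves (g INP) (g TT) X → Solves (g INP) (g TT) X′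
    solves-≈ {X} {X′} f h (c , good) = ≤-trans (#-mono B (dec ⟨ X′ ⟩) (dec ⟨ X ⟩) (λ v _ → h v)) c ,
      good-anti {g INP} {g TT} {Outside n ⟨ X ⟩} {Outside n ⟨ X′ ⟩} (λ { v (a , b) → a , b ∘ f v }) good
    saved : Saved g → Saved t
    saved sv ne = pick (g found 0 ≟ 0)
      where
      n≋ = fm≋ nsol nsolF g
      pick : Dec (g found 0 ≡ 0) → Solves (g INP) (g TT) (g₁ nsol)
      pick (no f) = solves-≈ {g nsol} {g₁ nsol} (λ v m → proj₂ (n≋ v) (proj₁ m) (inj₁ ((0<B , f) , m)))
        (λ v m → [ proj₂ , (λ h → contradiction (0<B , f) (proj₁ h)) ]′ (proj₁ (n≋ v) m)) (sv f)
      pick (yes z) = solves-≈ {g XX} {g₁ nsol} (λ v m → proj₂ (n≋ v) (proj₁ m) (inj₂ ((λ { (_ , f) → f z }) , m)))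
        (λ v m → [ (λ h → contradiction z (proj₂ (proj₁ h))) , proj₂ ]′ (proj₁ (n≋ v) m))
        ([ (λ h → contradiction z (proj₂ h)) , ok→ g₁ joined 0 ]′ (sound B foundF {upd ρ 21 0} {g₁} ne))

  checked-abs : ∀ s g t → g INP ≡ s INP → g TT ≡ s TT → g XX ≡ s XX → g nsol ≡ s nsol → g found ≡ s found → base g ≡ base s → Checked g t → Checked s t
  checked-abs s g t i t≡ x ns f b ch = record
    { base≡ = trans (Checked.base≡ ch) b
    ; saved = λ sv → Checked.saved ch λ ne → same i t≡ ns (sv λ z → ne (trans (cong (λ h → h 0) f) z))
    ; finds = λ h → Checked.finds ch ([ (λ ne → inj₁ λ z → ne (trans (cong (λ h → h 0) (sym f)) z)) , (λ so → inj₂ (same i t≡ x so)) ]′ h) }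
    where
    same : ∀ {I I′ T T′ X X′} → I′ ≡ I → T′ ≡ T → X′ ≡ X → Solves I T X → Solves I′ T′ X′
    same refl refl refl h = h

  check-ok : ∀ s → Checked s (exec B ρ checkC s)
  check-ok s = checked-abs s g (exec B ρ saveC g) (frame B ρ c s INP refl) (frame B ρ c s TT refl) (frame B ρ c s XX refl) (frame B ρ c s nsol refl) (frame B ρ c s found refl)
    (base-frame c s refl) (save-ok g (close-outside s))
    where
    c = gV :≡ aF ﹔ gS :≡ aF ﹔ closeC
    g = exec B ρ c s

record Sizes (ρ : Env) : Set where
  k = ρ 1
  w = suc (k + k)
  field
    l σ : ℕ
    0<B : 0 < ρ 2
    nn≤B : ρ 0 * ρ 0 ≤ ρ 2
    2n≤B : ρ 0 + ρ 0 ≤ ρ 2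
    n≤2^ : ρ 0 ≤ 2 ^ l
    w-ok : 2 * w < ρ 2
    K-ok : 2 ^ (2 * w) ≤ ρ 50
    K≤M₂ : ρ 50 ≤ ρ 52
    M₂≤B : ρ 52 ≤ ρ 2
    σ-ok : w * (l * (suc k + (1 + suc k * ρ 50))) ≤ σ
    σ<M : 2 * σ + 4 < ρ 51
    M-ok : ρ 51 ^ suc w ≤ ρ 52
    cap : ρ 52 ^ suc (suc k * 4) ≤ ρ 2

transport₄ : ∀ {X : Set} (C : X → (b h p : ℕ → ℕ) → Set) {s s′ b b′ h h′ p p′} → s ≡ s′ → b ≡ b′ → h ≡ h′ → p ≡ p′ → C s b h p → C s′ b′ h′ p′
transport₄ C refl refl refl refl x = x

module Rounds (ρ : Env) (sz : Sizes ρ) where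
  open Sizes sz
  open CheckRun ρ 0<B nn≤B public

  qmax : ℕ
  qmax = suc k + (1 + suc k * ρ 50)

  K≤B : ρ 50 ≤ B
  K≤B = ≤-trans K≤M₂ M₂≤B

  k≤w : k ≤ w
  k≤w = ≤-trans (m≤m+n k k) (n≤1+n _)

  small : ∀ {c} → c ≤ w → 2 ^ (2 * c) ≤ ρ 50 × 2 ^ (2 * c) ≤ B × 2 * c < B
  small {c} c≤ = a , ≤-trans a K≤B , ≤-<-trans (*-monoʳ-≤ 2 c≤) w-ok
    where a = ≤-trans (^-monoʳ-≤ 2 (*-monoʳ-≤ 2 c≤)) K-ok

  w≤qmax : w ≤ qmax
  w≤qmax = s≤s (+-monoʳ-≤ k (≤-trans (m≤m*n k (ρ 50) {{>-nonZero 0<K}}) (≤-trans (m≤n+m (k * ρ 50) (ρ 50)) (n≤1+n _))))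
    where
    0<K = <-≤-trans (>-nonZero⁻¹ (2 ^ (2 * w)) {{m^n≢0 2 (2 * w)}}) K-ok

  Separates : ℕ → List ℕ → List ℕ → (ℕ → Mem → Mem) → Set
  Separates c xs qs h = c < ρ 52 × (∀ s → (∀ x → x ∈ᴸ xs → x ∈ ⟨ h c s HH ⟩) × (∀ q → q ∈ᴸ qs → q ∉ ⟨ h c s HH ⟩))

  abstract

    hashed guided runA runB runC runD : ℕ → Mem → Mem
    hashed d s = exec B ρ hashC (upd s hC (λ _ → d))
    guided d s = exec B ρ guideC (upd s gB (λ _ → d))
    runA d s = exec B ρ segA (upd s hC (λ _ → d))
    runB d s = exec B ρ segB (upd s gB (λ _ → d))
    runC d s = exec B ρ segC (upd s hC (λ _ → d))
    runD d s = exec B ρ segD (upd s gB (λ _ → d))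

    hashed≡ : ∀ d s → hashed d s ≡ exec B ρ hashC (upd s hC (λ _ → d))
    hashed≡ d s = refl
    runA≡ : ∀ d s → runA d s ≡ exec B ρ segA (upd s hC (λ _ → d))
    runA≡ d s = refl
    runB≡ : ∀ d s → runB d s ≡ exec B ρ segB (upd s gB (λ _ → d))
    runB≡ d s = refl
    runC≡ : ∀ d s → runC d s ≡ exec B ρ segC (upd s hC (λ _ → d))
    runC≡ d s = refl
    runD≡ : ∀ d s → runD d s ≡ exec B ρ segD (upd s gB (λ _ → d))
    runD≡ d s = refl

    runA-ok : ∀ s d → AfterA (Sep s) s (hashed d s) (runA d s)
    runA-ok = segA-ok
    runB-ok : ∀ s d → AfterB s (guided d s) (runB d s)
    runB-ok = segB-ok
    runC-ok : ∀ s d → AfterC s (hashed d s) (runC d s)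
    runC-ok = segC-ok
    runD-ok : ∀ s d → AfterD s (guided d s) (runD d s)
    runD-ok = segD-ok

    choose-hash : ∀ xs qs → Below n xs → Below n qs → Apart xs qs →
      length xs ≤ w → length qs ≤ qmax → ∃[ c ] Separates c xs qs hashed
    choose-hash xs qs xs<n qs<n apart xs≤ qs≤ =
      let (c , c< , h) = HashRun.hash-ok ρ 0<B l σ xs qs (λ x m → <-≤-trans (xs<n x m) n≤2^) (λ q m → <-≤-trans (qs<n q m) n≤2^) apart
            (≤-trans (*-mono-≤ xs≤ (*-monoʳ-≤ l qs≤)) σ-ok) σ<M (≤-trans M≤ M₂≤B) (≤-trans xs≤ (≤-trans (m≤m+n w (w + 0)) (<⇒≤ w-ok)))
      in c , <-≤-trans c< M≤ , λ s → (λ x m → proj₁ (h (upd s hC (λ _ → c)) refl) x m (n≤B (xs<n x m))) , proj₂ (h (upd s hC (λ _ → c)) refl)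
      where
      M≤ : ρ 51 ^ suc (length xs) ≤ ρ 52
      M≤ = ≤-trans (^-monoʳ-≤ (ρ 51) {{>-nonZero (≤-<-trans z≤n σ<M)}} (s≤s xs≤)) M-ok

    choose-cut : ∀ a R₀ (Fr : DSet) → (∀ v → v ∈ R₀ → v ∈ ⟨ a gV ⟩ × v ∉ ⟨ a gF ⟩) →
      (∀ r → r ∈ ⟨ a gV ⟩ → r ∉ R₀ → r ∈ ⟨ a gS ⟩ ⊎ (∃[ u ] u ∈ R₀ × Guided.Arc B n (a INP) (a TT) (a MM) u r) → r ∈ Fr) →
      2 ^ (2 * # B (dec Fr)) ≤ B → 2 * # B (dec Fr) < B →
      ∃[ d ] d < 2 ^ (2 * # B (dec Fr)) × (∀ v → v ∈ R₀ → v ∉ ⟨ guided d a gD ⟩) × # B (dec ⟨ guided d a gD ⟩) ≤ # B (dec Fr)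
    choose-cut = cut-choose

  record InvAt (b : Base) : Set₁ where
    field
      U<n : ∀ v → v ∈ ⟨ bU b ⟩ → v < n
      W⊆U : ⟨ bW b ⟩ ⊆ ⟨ bU b ⟩
      W-size : # B (dec ⟨ bW b ⟩) ≤ suc k
      good-W : GoodIn (bI b) (bT b) (El (⟨ bU b ⟩ ∖ ⟨ bW b ⟩))
      lift : ∀ A → (∀ v → A v → v ∈ ⟨ bU b ⟩) → GoodIn (bI b) (bT b) A → GoodIn (bI b) (bT b) (λ v → A v ⊎ (v < n × v ∉ ⟨ bX b ⟩ × v ∉ ⟨ bU b ⟩))
      X : DSet
      X⊆ : X ⊆ ⟨ bU b ⟩ ∖ ⟨ bW b ⟩
      good-X : GoodIn (bI b) (bT b) (El (⟨ bU b ⟩ ∖ X))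
      size : # B (dec ⟨ bX b ⟩) + # B (dec X) ≤ k

  Inv : Mem → Set₁
  Inv s = InvAt (base s)

  shift : DSet → DSet
  El (shift P) v = n ≤ v × v ∸ n ∈ P
  dec (shift P) v = (n ≤? v) ×-dec dec P (v ∸ n)

  shift-# : ∀ P → # B (dec (shift P)) ≤ # B (dec P)
  shift-# P = #-inj B B (dec (shift P)) (dec P) (_∸ n) (λ i i<B p → ≤-<-trans (m∸n≤m i n) i<B , proj₂ p)
    (λ i j _ _ p q e → trans (sym (m∸n+n≡m (proj₁ p))) (trans (cong (_+ n) e) (m∸n+n≡m (proj₁ q))))

module Round (ρ : Env) (sz : Sizes ρ) (s : Mem) (inv : Rounds.Inv ρ sz s) (w₁ : ℕ) (w₁∈ : w₁ ∈ ⟪ ρ 2 ⟫ (s WW)) where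
  open Sizes sz
  open Rounds ρ sz
  private module I = InvAt inv
  Uₛ Wₛ Tₛ : DSet
  Uₛ = ⟨ s UU ⟩
  Wₛ = ⟨ s WW ⟩
  Tₛ = ⟨ s TT ⟩
  Es = Edge (s INP)

  tab : Graph.Table B Es (Edge? (s INP)) Tₛ Uₛ Wₛ k (ρ 50)
  tab = let (a , b , c) = small k≤w in table s I.U<n {k} {ρ 50} a b c

  open Graph B Es (Edge? (s INP)) Tₛ
  module RM = RoundMath B n nn≤B (s INP) Tₛ Uₛ Wₛ (Edge? (s INP)) I.U<n I.W⊆U I.good-W tab

  normal = RM.normalise (suc (RM.weight I.X)) I.X ≤-refl record { X⊆ = I.X⊆ ; size = ≤-trans (m≤n+m _ _) I.size ; good = I.good-X }
  X₁ = proj₁ normal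
  module Ch = RM.Chosen X₁ (proj₁ (proj₂ normal)) (proj₁ (proj₂ (proj₂ (proj₂ normal)))) (proj₂ (proj₂ (proj₂ (proj₂ normal)))) w₁ w₁∈
  open Ch
  module So = RM.Solution (proj₁ (proj₂ normal))

  X₁≤ : # B (dec X₁) ≤ # B (dec I.X)
  X₁≤ = proj₁ (proj₂ (proj₂ normal))

  edge-R : ∀ {u v} → u ∈ R → Es u v → v ∈ Uₛ ∖ X₁ → v ∈ R
  edge-R r e v∈ = r ◅◅ step (target∈ r) e (here v∈)

  R<n : ∀ v → v ∈ R → v < n
  R<n v r = I.U<n v (proj₁ (target∈ r))

  w₀∈R : w₀ ∈ R
  w₀∈R = here (w∈UX w₀∈)

  hashA : ∃[ c ] Separates c xs qs hashed
  hashA = choose-hash xs qs xs< (λ q m → I.U<n q (proj₁ (qs-∈ q m))) apart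
    (≤-trans xs-length (≤-trans (+-mono-≤ So.size I.W-size) (≤-reflexive (+-suc k k))))
    (≤-trans qs-length (+-mono-≤ I.W-size (s≤s (*-monoˡ-≤ (ρ 50) (≤-trans (+-monoˡ-≤ 1 So.size) (≤-reflexive (+-comm k 1)))))))

  reached : ∀ {a g} → CutRes a g → base a ≡ base s → (∀ v → v ∈ R → v ∈ ⟨ a gV ⟩) → w₀ ∈ ⟨ a gS ⟩ → (∀ v → v ∈ R → v ∉ ⟨ g gD ⟩) → ∀ v → v ∈ R → v ∈ ⟨ g gQ ⟩
  reached {a} {g} res b R⊆V w₀∈S nD v r = proj₁ (stays {R = El ⟨ g gQ ⟩}
    (λ u y q e (_ , ry) → keep y ry (closed u y q (proj₁ e , inj₁ (proj₁ (proj₂ e) , subst (λ b → Cell (bI b) (n + mul u + y)) (sym b) (proj₂ (proj₂ e)))) (R⊆V y ry)))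
    (keep w₀ w₀∈R (start w₀ w₀∈S (R⊆V w₀ w₀∈R))) (restrict (λ y p → p) r))
    where
    open CutRes res
    keep : ∀ y → y ∈ R → y ∈ ⟨ g gQ ⟩ ⊎ y ∈ ⟨ g gD ⟩ → y ∈ ⟨ g gQ ⟩
    keep y ry = [ id , (λ d → contradiction d (nD y ry)) ]′

  module AfterHash {h a : Mem} (A : AfterA (Sep s) s h a) (h⊇ : ∀ x → x ∈ᴸ xs → x ∈ ⟨ h HH ⟩) (h∌ : ∀ q → q ∈ᴸ qs → q ∉ ⟨ h HH ⟩) where
    open AfterA A

    P : DSet
    P = ⟨ a PP ⟩

    P⊇ : ∀ x → x ∈ᴸ xs → x ∈ P
    P⊇ x m = proj₂ (P≋ x) (proj₁ (h⊇ x m)) (h⊇ x m)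

    P∌ : ∀ q → q ∈ᴸ qs → q ∉ P
    P∌ q m p = h∌ q m (proj₁ (P≋ q) p)

    marked→ : ∀ v → v ∈ Z → v ∈ Uₛ ∖ Wₛ × ∃[ b ] b < ρ 50 × v ∉ Sep s v b × (∀ x → x ∈ Sep s v b → x ∈ P)
    marked→ v z = let (b , _ , _ , b<K , vUW , v∉ , none) = Z→ v z in vUW , b , b<K , v∉ , λ x x∈ → by-contradiction P x λ nx → none (x , proj₁ x∈ , x∈ , nx)

    marked← : ∀ v b → v ∈ Uₛ ∖ Wₛ → b < ρ 50 → v ∉ Sep s v b → (∀ x → x ∈ Sep s v b → x ∈ P) → v ∈ Z
    marked← v b vUW b<K v∉ sub = Z← v b (<-≤-trans b<K K≤B) (refl , b<K , vUW , v∉ , λ { (x , _ , x∈ , nx) → nx (sub x x∈) })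

    open WithP P P⊇ P∌ Z marked→ marked← public

    Gh→ : ∀ {u v} → Gh u v → Ghost (base s) Z u v
    Gh→ = walk-map (λ _ → id) (λ { y (u , z) → u , λ { (_ , nz) → nz z } })

    Gh← : ∀ {u v} → Ghost (base s) Z u v → Gh u v
    Gh← = walk-map (λ _ → id) (λ { y (u , nn) → u , by-contradiction Z y (λ nz → nn (u , nz)) })

    R∌F₁ : ∀ v w → v ∈ R → w ∈ Wₛ → w ∉ P → ¬ Es v w
    R∌F₁ v w r w∈ np e = np (W₀→P w (w∈ , edge-R r e (w∈UX w∈)))

    R⊆V₁ : ∀ v → v ∈ R → v ∈ ⟨ a gV ⟩
    R⊆V₁ v r = proj₂ (V≋ v) (RM.U<B v (proj₁ (target∈ r))) (inj₁ (choice (dec Wₛ v)))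
      where
      choice : Dec (v ∈ Wₛ) → v ∈ Uₛ × v ∉ Wₛ ⊎ v ∈ Wₛ × v ∈ P
      choice (yes w) = inj₂ (w , W₀→P v (w , r))
      choice (no nw) = inj₁ (proj₁ (target∈ r) , nw)

    cellI : ∀ {i} → Cell (a INP) i → Cell (s INP) i
    cellI {i} = subst (λ b → Cell (bI b) i) base≡

    Fr₁ : DSet
    Fr₁ = X₁ ∪ shift (X₁ ∪ Tl)

    Fr₁-size : # B (dec Fr₁) ≤ w
    Fr₁-size = ≤-trans (#-∪ B (dec X₁) (dec (shift (X₁ ∪ Tl))) (dec Fr₁) (λ _ _ → id)) (≤-trans (+-mono-≤ So.size
      (≤-trans (shift-# (X₁ ∪ Tl)) (≤-trans (#-∪ B (dec X₁) (dec Tl) (dec (X₁ ∪ Tl)) (λ _ _ → id)) (+-mono-≤ So.size Tl-size)))) (≤-reflexive (trans (cong (k +_) (+-comm k 1)) (+-suc k k))))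

    front₁ : ∀ r → r ∈ ⟨ a gV ⟩ → r ∉ R → r ∈ ⟨ a gS ⟩ ⊎ (∃[ u ] u ∈ R × Guided.Arc B n (a INP) (a TT) (a MM) u r) → r ∈ Fr₁
    front₁ r r∈ nr (inj₁ s∈) = let (w , p) = proj₁ (S≋ r) s∈ in contradiction (P→W₀ r w p) nr
    front₁ r r∈ nr (inj₂ (u , u∈ , u<n , inj₁ (r<n , c))) = inj₁ (by-contradiction X₁ r λ nx → nr (edge-R u∈ (u<n , r<n , cellI c) (inU (proj₁ (V≋ r) r∈) , nx)))
      where
      inU : V₁ (base s) P r → r ∈ Uₛ
      inU (inj₁ (inj₁ (u , _))) = u
      inU (inj₁ (inj₂ (w , _))) = I.W⊆U r w
      inU (inj₂ (nr , _)) = contradiction r<n nr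
    front₁ r r∈ nr (inj₂ (u , u∈ , u<n , inj₂ (r≮n , r<2n , t , c))) = inj₂ (≮⇒≥ r≮n ,
      gh-exits u∈ (subst (λ b → u ∈ ⟨ bT b ⟩) base≡ t) (Gh← (proj₁ (gh u (r ∸ n) u<n (+-cancelʳ-< n (r ∸ n) n (subst (_< n + n) (sym (m∸n+n≡m (≮⇒≥ r≮n))) r<2n))) c)))

    cutB : ∃[ d ] d < ρ 52 × (∀ v → v ∈ R → v ∉ ⟨ guided d a gD ⟩) × # B (dec ⟨ guided d a gD ⟩) ≤ w
    cutB = let (x , y , z) = small Fr₁-size
               (d , d< , nD , D≤) = choose-cut a R Fr₁ (λ v r → R⊆V₁ v r , R∌F v r) front₁ y z
           in d , <-≤-trans d< (≤-trans x K≤M₂) , nD , ≤-trans D≤ Fr₁-size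
      where
      R∌F : ∀ v → v ∈ R → v ∉ ⟨ a gF ⟩
      R∌F v r f = [ (λ { (w , _ , w<n , v<n , (w∈ , np) , c) → R∌F₁ v w r w∈ np (v<n , w<n , c) }) , (λ nv → nv (R<n v r)) ]′ (proj₁ (F≋ v) f)

    module AfterCut {g b : Mem} (AB : AfterB a g b) (nD : ∀ v → v ∈ R → v ∉ ⟨ g gD ⟩) (D≤ : # B (dec ⟨ g gD ⟩) ≤ w) where
      open AfterB AB using (res; BC≋) renaming (base≡ to base≡₂; PP≡ to PP≡₂)

      Bc : DSet
      Bc = ⟨ b BC ⟩

      R⊆Q₁ : ∀ v → v ∈ R → v ∈ ⟨ g gQ ⟩
      R⊆Q₁ = reached res base≡ R⊆V₁ (proj₂ (S≋ w₀) (RM.U<B w₀ (I.W⊆U w₀ w₀∈)) (w₀∈ , W₀→P w₀ (w₀∈ , w₀∈R))) nD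

      Bc⊇ : ∀ t v → t ∈ R → t ∈ Tₛ → Gh t v → v ∈ Bc
      Bc⊇ t v r tT gw = proj₂ (BC≋ v) (n≤B v<n) (v<n , [ (λ q → contradiction (proj₂ (F≋ (v + n)) v+n<B (inj₂ n≮)) (Q∌F (v + n) q)) , id ]′
        (closed t (v + n) (R⊆Q₁ t r) (R<n t r , inj₂ (n≮ , v+n<2n , subst (λ b → t ∈ ⟨ bT b ⟩) (sym base≡) tT ,
          subst (λ z → Cell (a MM) (mul t + z)) (sym (m+n∸n≡m v n)) (proj₂ (gh t v (R<n t r) v<n) (Gh→ gw)))) (proj₂ (V≋ (v + n)) v+n<B (inj₂ (n≮ , v+n<2n)))))
        where
        open CutRes res
        v<n : v < n
        v<n = [ (λ x → I.U<n v (proj₁ (So.X⊆ v x))) , (λ t → R<n v (proj₁ t)) ]′ (gh-exits r tT gw)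
        v+n<2n : v + n < n + n
        v+n<2n = +-monoˡ-< n v<n
        v+n<B : v + n < B
        v+n<B = <-≤-trans v+n<2n 2n≤B
        n≮ : ¬ (v + n < n)
        n≮ h = <⇒≱ h (m≤n+m n v)

      Bc<n : ∀ v → v ∈ Bc → v < n
      Bc<n v h = proj₁ (proj₁ (BC≋ v) h)

      Bc-size : # B (dec Bc) ≤ w
      Bc-size = ≤-trans (#-inj B B (dec Bc) (dec ⟨ g gD ⟩) (_+ n) (λ v _ h → let d = proj₂ (proj₁ (BC≋ v) h) in proj₁ d , d) (λ i j _ _ _ _ e → +-cancelʳ-≡ n i j e)) D≤

      XT inB outB : DSet
      XT = X₁ ∪ Tl
      El inB v = v ∈ Bc × v ∈ XT
      dec inB v = dec Bc v ×-dec dec XT v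
      outB = Bc ∖ XT

      hashB : ∃[ c ] Separates c (elems B inB) (elems B outB) hashed
      hashB = choose-hash (elems B inB) (elems B outB) (λ x m → Bc<n x (proj₁ (elems-∈ B inB x m))) (λ x m → Bc<n x (proj₁ (elems-∈ B outB x m)))
        (λ x q m m′ e → proj₂ (elems-∈ B outB q m′) (subst (_∈ XT) e (proj₂ (elems-∈ B inB x m))))
        (≤-trans (≤-reflexive (elems-# B inB)) (≤-trans (#-mono B (dec inB) (dec Bc) (λ _ _ → proj₁)) Bc-size))
        (≤-trans (≤-reflexive (elems-# B outB)) (≤-trans (#-mono B (dec outB) (dec Bc) (λ _ _ → proj₁)) (≤-trans Bc-size w≤qmax)))

      module AfterHash₂ {h₂ c : Mem} (AC : AfterC b h₂ c) (H⊇ : ∀ x → x ∈ᴸ elems B inB → x ∈ ⟨ h₂ HH ⟩) (H∌ : ∀ q → q ∈ᴸ elems B outB → q ∉ ⟨ h₂ HH ⟩) where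
        open AfterC AC using (HH≡; BC≡) renaming (base≡ to base≡₃; PP≡ to PP≡₃)

        Xb Ex : DSet
        Xb = xbS (b BC) (h₂ HH) (a PP) (s WW)
        Ex = exS (b BC) (h₂ HH) (a PP) (s WW)

        Bc-in : ∀ v → v ∈ Bc → v ∈ XT → v ∈ ⟨ h₂ HH ⟩
        Bc-in v b x = H⊇ v (∈-elems B inB v (proj₁ b) (b , x))

        Bc-out : ∀ v → v ∈ Bc → v ∉ XT → v ∉ ⟨ h₂ HH ⟩
        Bc-out v b x = H∌ v (∈-elems B outB v (proj₁ b) (b , x))

        open WithBc Bc Bc⊇ ⟨ h₂ HH ⟩ Bc-in Bc-out Xb Ex (λ _ → id) (λ _ → id) (λ _ → id) (λ _ → id) public

        baseC : base c ≡ base s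
        baseC = trans base≡₃ (trans base≡₂ base≡)

        along : (C : Base → (b h p : ℕ → ℕ) → Set) → C (base c) (c BC) (c HH) (c PP) → C (base s) (b BC) (h₂ HH) (a PP)
        along C = transport₄ C baseC BC≡ HH≡ (trans PP≡₃ PP≡₂)

        V≋₃ : ⟨ c gV ⟩ ≋ V₃ (base s) (b BC) (h₂ HH) (a PP)
        V≋₃ = along (λ s b h p → ⟨ c gV ⟩ ≋ V₃ s b h p) (AfterC.V≋ AC)
        S≋₃ : ⟨ c gS ⟩ ≋ S₁ (base s) P
        S≋₃ = along (λ s b h p → ⟨ c gS ⟩ ≋ S₁ s ⟨ p ⟩) (AfterC.S≋ AC)
        F≋₃ : ⟨ c gF ⟩ ≋ F₃ (base s) (b BC) (h₂ HH) (a PP)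
        F≋₃ = along (λ s b h p → ⟨ c gF ⟩ ≋ F₃ s b h p) (AfterC.F≋ AC)

        U₃ : ∀ {v} → V₃ (base s) (b BC) (h₂ HH) (a PP) v → v ∈ Uₛ
        U₃ = [ proj₁ , (λ h → I.W⊆U _ (proj₁ h)) ]′

        R⊆V₃ : ∀ v → v ∈ R → v ∈ ⟨ c gV ⟩
        R⊆V₃ v r = proj₂ (V≋₃ v) (RM.U<B v (proj₁ (target∈ r))) (choice (dec Wₛ v))
          where
          choice : Dec (v ∈ Wₛ) → V₃ (base s) (b BC) (h₂ HH) (a PP) v
          choice (yes w) = inj₂ (w , W₀→P v (w , r))
          choice (no nw) = inj₁ (proj₁ (target∈ r) , (λ x → proj₂ (target∈ r) (Xb⊆X v x)) , nw)

        walk→ : ∀ {u v} → Walk (Uₛ ∖ Xb) (Uₛ ∖ Xb) (s INP) u v → Pth (El (Uₛ ∖ Xb)) u v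
        walk→ (stop a) = here a
        walk→ (go a e w) = step a e (walk→ w)

        walk← : ∀ {u v} → Pth (El (Uₛ ∖ Xb)) u v → Walk (Uₛ ∖ Xb) (Uₛ ∖ Xb) (s INP) u v
        walk← (here a) = stop a
        walk← (step a e w) = go a e (walk← w)

        Fr₃ : DSet
        El Fr₃ v = v ∈ X₁ ∖ Xb × v ∉ R × ∃[ u ] u < B × u ∈ R × Es u v
        dec Fr₃ v = dec (X₁ ∖ Xb) v ×-dec ¬? (dec R v) ×-dec any<? B (λ u → dec R u ×-dec Edge? (s INP) u v)

        Fr₃-size : # B (dec Fr₃) ≤ w
        Fr₃-size = ≤-trans (#-mono B (dec Fr₃) (dec X₁) (λ _ _ h → proj₁ (proj₁ h))) (≤-trans So.size k≤w)

        front₃ : ∀ r → r ∈ ⟨ c gV ⟩ → r ∉ R → r ∈ ⟨ c gS ⟩ ⊎ (∃[ u ] u ∈ R × Guided.Arc B n (c INP) (c TT) (c MM) u r) → r ∈ Fr₃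
        front₃ r r∈ nr (inj₁ s∈) = let (w , p) = proj₁ (S≋₃ r) s∈ in contradiction (P→W₀ r w p) nr
        front₃ r r∈ nr (inj₂ (u , u∈ , u<n , inj₂ (r≮n , _))) = contradiction (I.U<n r (U₃ (proj₁ (V≋₃ r) r∈))) r≮n
        front₃ r r∈ nr (inj₂ (u , u∈ , u<n , inj₁ (r<n , cl))) = (x∈ , nxb (proj₁ (V≋₃ r) r∈)) , nr , u , n≤B u<n , u∈ , e
          where
          e : Es u r
          e = u<n , r<n , subst (λ b → Cell (bI b) (n + mul u + r)) baseC cl
          x∈ : r ∈ X₁
          x∈ = by-contradiction X₁ r λ nx → nr (edge-R u∈ e (U₃ (proj₁ (V≋₃ r) r∈) , nx))
          nxb : V₃ (base s) (b BC) (h₂ HH) (a PP) r → r ∉ Xb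
          nxb (inj₁ (_ , nx , _)) = nx
          nxb (inj₂ (w , _)) xb = proj₂ (So.X⊆ r x∈) w

        cutD : ∃[ d ] d < ρ 52 × (∀ v → v ∈ R → v ∉ ⟨ guided d c gD ⟩) × # B (dec ⟨ guided d c gD ⟩) ≤ # B (dec Fr₃)
        cutD = let (x , y , z) = small Fr₃-size
                   (d , d< , r) = choose-cut c R Fr₃ (λ v r → R⊆V₃ v r , R∌F v r) front₃ y z
               in d , <-≤-trans d< (≤-trans x K≤M₂) , r
          where
          R∌F : ∀ v → v ∈ R → v ∉ ⟨ c gF ⟩
          R∌F v r f = [ (λ { (w , _ , w<n , v<n , (w∈ , np) , cl) → R∌F₁ v w r w∈ np (v<n , w<n , cl) }) ,
            (λ { (tT , nex , w , _ , _ , _ , w∈ , p) → R-cut v w r tT nex w∈ (walk→ p) }) ]′ (proj₁ (F≋₃ v) f)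

        module AfterCut₂ {g₂ t : Mem} (AD : AfterD c g₂ t) (nD₂ : ∀ v → v ∈ R → v ∉ ⟨ g₂ gD ⟩) (D≤₂ : # B (dec ⟨ g₂ gD ⟩) ≤ # B (dec Fr₃)) where
          open AfterD AD using () renaming (res to res₂; I≡ to I≡₄; T≡ to T≡₄)
          private module C₂ = CutRes res₂

          Q D : DSet
          Q = ⟨ g₂ gQ ⟩
          D = ⟨ g₂ gD ⟩

          Q⊆ : ∀ v → v ∈ Q → V₃ (base s) (b BC) (h₂ HH) (a PP) v
          Q⊆ v q = proj₁ (V≋₃ v) (C₂.Q⊆V v q)

          D⊆ : ∀ v → v ∈ D → V₃ (base s) (b BC) (h₂ HH) (a PP) v
          D⊆ v d = proj₁ (V≋₃ v) (C₂.D⊆V v d)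

          Q-closed : ∀ u y → u ∈ Q → Es u y → V₃ (base s) (b BC) (h₂ HH) (a PP) y → y ∈ Q ⊎ y ∈ D
          Q-closed u y q e y∈ = C₂.closed u y q (proj₁ e , inj₁ (proj₁ (proj₂ e) , subst (λ b → Cell (bI b) (n + mul u + y)) (sym baseC) (proj₂ (proj₂ e)))) (proj₂ (V≋₃ y) (n≤B (proj₁ (proj₂ e))) y∈)

          Q-W : ∀ u w → u ∈ Q → w ∈ Wₛ → w ∉ P → ¬ Es u w
          Q-W u w q w∈ np e = C₂.Q∌F u q (proj₂ (F≋₃ u) (n≤B (proj₁ e)) (inj₁ (w , n≤B (proj₁ (proj₂ e)) , proj₁ (proj₂ e) , proj₁ e , (w∈ , np) , proj₂ (proj₂ e))))

          Q-T : ∀ t w → t ∈ Q → t ∈ Tₛ → t ∉ Ex → w ∈ Wₛ → ¬ Pth (El (Uₛ ∖ Xb)) t w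
          Q-T t w q tT nex w∈ p = let w<n = I.U<n w (I.W⊆U w w∈) ; t<n = I.U<n t (proj₁ (source∈ p)) in
            C₂.Q∌F t q (proj₂ (F≋₃ t) (n≤B t<n) (inj₂ (tT , nex , w , n≤B w<n , w<n , t<n , w∈ , walk← p)))

          Q-start : ∀ w → w ∈ Wₛ → w ∈ P → w ∉ D → w ∈ Q
          Q-start w w∈ p nd = let w<B = RM.U<B w (I.W⊆U w w∈) in [ id , (λ d → contradiction d nd) ]′ (C₂.start w (proj₂ (S≋₃ w) w<B (w∈ , p)) (proj₂ (V≋₃ w) w<B (inj₂ (w∈ , p))))

          Fr→ : ∀ v → v ∈ Fr₃ → v ∈ X₁ ∖ Xb × v ∉ R × ∃[ u ] u ∈ R × Es u v
          Fr→ v h = let (a , b , u , _ , r , e) = h in a , b , u , r , e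

          open WithCut Q D Q⊆ D⊆ Q-closed Q-W Q-T Q-start nD₂ Fr₃ D≤₂ Fr→

          X≋ : ⟨ t XX ⟩ ≋ (λ v → v ∈ ⟨ s XX ⟩ ⊎ v ∈ Xb ⊎ v ∈ D)
          X≋ = along (λ s b h p → ⟨ t XX ⟩ ≋ (λ v → v ∈ ⟨ bX s ⟩ ⊎ v ∈ xbS b h p (bW s) ⊎ v ∈ D)) (AfterD.X≋ AD)
          U≋ : ⟨ t UU ⟩ ≋ El U′
          U≋ = along (λ s b h p → ⟨ t UU ⟩ ≋ (λ v → ((v ∈ ⟨ bU s ⟩ × v ∉ xbS b h p (bW s)) × v ∉ D) × v ∉ Q)) (AfterD.U≋ AD)
          W≋ : ⟨ t WW ⟩ ≋ El W′
          W≋ = along (λ s b h p → ⟨ t WW ⟩ ≋ (λ v → v ∈ ⟨ bW s ⟩ × v ∉ ⟨ p ⟩)) (AfterD.W≋ AD)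

          I≡ : t INP ≡ s INP
          I≡ = trans I≡₄ (cong bI baseC)
          T≡ : t TT ≡ s TT
          T≡ = trans T≡₄ (cong bT baseC)

          smaller : # B (dec ⟨ t WW ⟩) < # B (dec Wₛ)
          smaller = ≤-<-trans (#-mono B (dec ⟨ t WW ⟩) (dec W′) (λ v _ → proj₁ (W≋ v))) W′-smaller

          to : ∀ A → GoodIn (s INP) (s TT) A → GoodIn (t INP) (t TT) A
          to A = subst₂ (λ i t → GoodIn i t A) (sym I≡) (sym T≡)
          from : ∀ A → GoodIn (t INP) (t TT) A → GoodIn (s INP) (s TT) A
          from A = subst₂ (λ i t → GoodIn i t A) I≡ T≡

          next-W : GoodIn (t INP) (t TT) (El (⟨ t UU ⟩ ∖ ⟨ t WW ⟩))
          next-W = to (El (⟨ t UU ⟩ ∖ ⟨ t WW ⟩)) (good-anti {s INP} {s TT} {El (U′ ∖ W′)} {El (⟨ t UU ⟩ ∖ ⟨ t WW ⟩)}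
            (λ { v (u , nw) → proj₁ (U≋ v) u , λ w → nw (proj₂ (W≋ v) (proj₁ u) w) }) good-W′)

          rest : ∀ (A : ℕ → Set) v → A v ⊎ (v < n × v ∉ ⟨ t XX ⟩ × v ∉ ⟨ t UU ⟩) → (A v ⊎ v ∈ Q) ⊎ (v < n × v ∉ ⟨ s XX ⟩ × v ∉ Uₛ)
          rest A v (inj₁ a) = inj₁ (inj₁ a)
          rest A v (inj₂ (v<n , nx , nu)) = cases (dec Uₛ v)
            where
            cases : Dec (v ∈ Uₛ) → (A v ⊎ v ∈ Q) ⊎ (v < n × v ∉ ⟨ s XX ⟩ × v ∉ Uₛ)
            cases (no nu′) = inj₂ (v<n , (λ x → nx (proj₂ (X≋ v) (n≤B v<n) (inj₁ x))) , nu′)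
            cases (yes u) = inj₁ (inj₂ (by-contradiction Q v λ nq → nu (proj₂ (U≋ v) (n≤B v<n)
              (((u , λ xb → nx (proj₂ (X≋ v) (n≤B v<n) (inj₂ (inj₁ xb)))) , λ d → nx (proj₂ (X≋ v) (n≤B v<n) (inj₂ (inj₂ d)))) , nq))))

          next-lift : ∀ A → (∀ v → A v → v ∈ ⟨ t UU ⟩) → GoodIn (t INP) (t TT) A → GoodIn (t INP) (t TT) (λ v → A v ⊎ (v < n × v ∉ ⟨ t XX ⟩ × v ∉ ⟨ t UU ⟩))
          next-lift A A⊆ gA = to (λ v → A v ⊎ (v < n × v ∉ ⟨ t XX ⟩ × v ∉ ⟨ t UU ⟩))
            (good-anti {s INP} {s TT} {λ v → (A v ⊎ v ∈ Q) ⊎ (v < n × v ∉ ⟨ s XX ⟩ × v ∉ Uₛ)} {λ v → A v ⊎ (v < n × v ∉ ⟨ t XX ⟩ × v ∉ ⟨ t UU ⟩)} (rest A)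
              (I.lift (λ v → A v ⊎ v ∈ Q) (λ v → [ (λ x → proj₁ (proj₁ (proj₁ (proj₁ (U≋ v) (A⊆ v x))))) , (λ q → U₃ (proj₁ (V≋₃ v) (C₂.Q⊆V v q))) ]′)
                (put-back A (λ v x → proj₁ (U≋ v) (A⊆ v x)) (from A gA))))

          next-abs : ∀ Y → Y ⊆ U′ ∖ W′ → Good (El (U′ ∖ Y)) → # B (dec Y) + (# B (dec Xb) + # B (dec D)) ≤ # B (dec X₁) → Inv t
          next-abs Y Y⊆ good-Y Y-size = record
            { U<n = λ v u → I.U<n v (proj₁ (proj₁ (proj₁ (proj₁ (U≋ v) u))))
            ; W⊆U = λ v w → proj₂ (U≋ v) (proj₁ w) (W′⊆U′ v (proj₁ (W≋ v) w))
            ; W-size = ≤-trans (<⇒≤ smaller) I.W-size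
            ; good-W = next-W ; lift = next-lift ; X = Y
            ; X⊆ = λ v y → let (u , nw) = Y⊆ v y in proj₂ (U≋ v) (RM.U<B v (proj₁ (proj₁ (proj₁ u)))) u , λ w → nw (proj₁ (W≋ v) w)
            ; good-X = to (El (⟨ t UU ⟩ ∖ Y)) (good-anti {s INP} {s TT} {El (U′ ∖ Y)} {El (⟨ t UU ⟩ ∖ Y)} (λ { v (u , ny) → proj₁ (U≋ v) u , ny }) good-Y)
            ; size = begin
              # B (dec ⟨ t XX ⟩) + y ≤⟨ +-monoˡ-≤ y (#-∪ B (dec ⟨ s XX ⟩) (dec (Xb ∪ D)) (dec ⟨ t XX ⟩) (λ v _ → proj₁ (X≋ v))) ⟩
              x + # B (dec (Xb ∪ D)) + y ≤⟨ +-monoˡ-≤ y (+-monoʳ-≤ x (#-∪ B (dec Xb) (dec D) (dec (Xb ∪ D)) (λ _ _ → id))) ⟩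
              x + z + y ≡⟨ trans (+-assoc x z y) (cong (x +_) (+-comm z y)) ⟩
              x + (y + z) ≤⟨ +-monoʳ-≤ x (≤-trans Y-size X₁≤) ⟩
              x + # B (dec I.X) ≤⟨ I.size ⟩
              k ∎ }
            where
            open ≤-Reasoning
            x = # B (dec ⟨ s XX ⟩)
            y = # B (dec Y)
            z = # B (dec Xb) + # B (dec D)

          next : Inv t
          next = next-abs Y Y⊆ good-Y Y-size

trialC : Cm
trialC = checkC ﹔ MM [ 21 ]:= lit 0 ﹔ roundC

names₁ : Names
names₁ = among (0 ∷ 1 ∷ 2 ∷ 50 ∷ 51 ∷ 52 ∷ [])

tseg : ∀ B ρ ρ′ a seg L L′ {K′} → okCm names₁ seg ≡ true → flow (among (a ∷ L)) seg ≡ just K′ → contains K′ L′ ≡ true →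
  disjoint (among L) (takeC a) ≡ true → a ≢ adv → writes seg adv ≡ false →
  (∀ s i → exec B ρ′ (takeC a) s a i ≡ exec B ρ′ (takeC a) s a 0) →
  0 < B → ρ′ 2 ≡ B → ρ′ 52 ≡ ρ 52 → (∀ x → names₁ x ≡ true → ρ x ≡ ρ′ x) →
  ∀ s s′ d q → d < ρ 52 → q ≤ B → Same B (among L) s s′ → s′ adv 0 ≡ d + q * ρ 52 →
  Same B (among L′) (exec B ρ seg (upd s a (λ _ → d))) (exec B ρ′ (takeC a ﹔ seg) s′) ×
  exec B ρ′ (takeC a ﹔ seg) s′ adv 0 ≡ q
tseg B ρ ρ′ a seg L L′ {K′} ok fl co dis ne wr const 0<B e₂ e₅₂ ag s s′ d q d< q≤ S e =
  same-⊆ B {L′} {K′} {exec B ρ seg sd} {exec B ρ′ seg s₁} co (exec-same B seg {names₁} {among (a ∷ L)} {K′} {ρ} {ρ′} {sd} {s₁} ok fl ag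
    (same-cons B {a} {L} {sd} {s₁} (λ i _ → trans (cong (λ f → f i) (upd-≡ s a (λ _ → d))) (sym (trans (const s′ i) (proj₁ tk))))
      (same-trans B {among L} {sd} {s} {s₁} (same-sym B {among L} {s} {sd} (keepSame B {among L} ρ′ (a [ 21 ]:= lit d) s (∧-trueˡ dis)))
        (same-trans B {among L} {s} {s′} {s₁} S (keepSame B {among L} ρ′ (takeC a) s′ dis))))) ,
  trans (cong (λ f → f 0) (frame B ρ′ seg s₁ adv wr)) (proj₂ tk)
  where
  sd = upd s a (λ _ → d)
  s₁ = exec B ρ′ (takeC a) s′
  tk : s₁ a 0 ≡ d × s₁ adv 0 ≡ q
  tk = subst (λ b → let t = exec b ρ′ (takeC a) s′ in t a 0 ≡ d × t adv 0 ≡ q) e₂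
    (take-ok ρ′ a s′ d q ne (subst (0 <_) (sym e₂) 0<B) (subst (d <_) (sym e₅₂) d<) (subst (q ≤_) (sym e₂) q≤) (trans e (cong (λ z → d + q * z) (sym e₅₂))))

agree-fresh : ∀ (Γ : Names) (ρ : Env) (y i : ℕ) → Γ y ≡ false → ∀ x → Γ x ≡ true → ρ x ≡ upd ρ y i x
agree-fresh Γ ρ y i f x g = sym (upd-≢ ρ {y} {x} i λ { refl → contradiction (trans (sym g) f) λ () })

digit< : ∀ M e {d t} → d < M → t < M ^ e → d + t * M < M ^ suc e
digit< M e {d} {t} d< t< = begin-strict
  d + t * M ≡⟨ +-comm d (t * M) ⟩
  t * M + d <⟨ +-monoʳ-< (t * M) d< ⟩
  t * M + M ≡⟨ +-comm (t * M) M ⟩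
  suc t * M ≤⟨ *-monoˡ-≤ M t< ⟩
  M ^ e * M ≡⟨ *-comm (M ^ e) M ⟩
  M ^ suc e ∎
  where open ≤-Reasoning

tail≤ : ∀ M {B d t} → 0 < M → d + t * M ≤ B → t ≤ B
tail≤ M {B} {d} {t} 0<M h = ≤-trans (m≤m*n t M {{>-nonZero 0<M}}) (≤-trans (m≤n+m (t * M) d) h)

iterFrom-keep : ∀ (P : Mem → Set) (f : ℕ → Mem → Mem) → (∀ i s → P s → P (f i s)) → ∀ m j s → P s → P (iterFrom j m f s)
iterFrom-keep P f h zero j s p = p
iterFrom-keep P f h (suc m) j s p = iterFrom-keep P f h m (suc j) (f j s) (h j s p)

baseL₁ baseA baseB baseC : List ℕ
baseL₁ = MM ∷ baseL
baseA = PP ∷ gV ∷ gS ∷ gF ∷ MM ∷ baseL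
baseB = BC ∷ PP ∷ MM ∷ baseL
baseC = BC ∷ HH ∷ PP ∷ gV ∷ gS ∷ gF ∷ MM ∷ baseL

iter-cong : ∀ (f g : ℕ → Mem → Mem) → (∀ i s → f i s ≡ g i s) → ∀ c s → iter c f s ≡ iter c g s
iter-cong f g h zero s = refl
iter-cong f g h (suc c) s = trans (h c (iter c f s)) (cong (g c) (iter-cong f g h c s))

module TrialRun (ρ : Env) (0<B : 0 < ρ 2) (nn≤B : ρ 0 * ρ 0 ≤ ρ 2) where
  private
    B = ρ 2
  open CheckRun ρ 0<B nn≤B using (saved-≡; Solves; Saved)

  abstract

    trial : ℕ → Mem → Mem
    trial j = exec (ρ 2) (upd ρ 55 j) trialC

    trial≡ : ∀ b → b ≡ ρ 2 → ∀ j s → exec b (upd ρ 55 j) trialC s ≡ trial j s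
    trial≡ b e j s = cong (λ b → exec b (upd ρ 55 j) trialC s) e

  trial-kept : ∀ j s x → among (INP ∷ TT ∷ sol ∷ fail ∷ []) x ≡ true → trial j s x ≡ s x
  trial-kept j s x e = trans (cong (λ t → t x) (sym (trial≡ B refl j s))) (frames B (upd ρ 55 j) trialC (INP ∷ TT ∷ sol ∷ fail ∷ []) s refl x e)

  trial-same : ∀ b → b ≡ ρ 2 → ∀ c → c ≡ trialC → ∀ j s K t q → Same b K t (exec b (upd ρ 55 j) c s) × exec b (upd ρ 55 j) c s adv 0 ≡ q →
    Same b K t (trial j s) × trial j s adv 0 ≡ q
  trial-same b e _ refl j s K t q = subst (λ u → Same b K t u × u adv 0 ≡ q) (trial≡ b e j s)

  trial-loop : ∀ b → b ≡ ρ 2 → ∀ c → c ≡ trialC → ∀ s → exec b ρ (for 55 c) s ≡ iterFrom 0 b trial s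
  trial-loop b e _ refl s = trans (iter-cong (λ j → exec b (upd ρ 55 j) trialC) trial (trial≡ b e) b s) (iter≡iterFrom b trial s)

  private
    restC : Cm
    restC = MM [ 21 ]:= lit 0 ﹔ roundC

    later : ∀ r cc d c s x → c ≡ (cc ﹔ d) → writes d x ≡ false → exec B r c s x ≡ exec B r cc s x
    later r cc d _ s x refl e = frame B r d (exec B r cc s) x e

    saved-later : ∀ r cc d c s → c ≡ (cc ﹔ d) → writes d INP ≡ false → writes d TT ≡ false → writes d nsol ≡ false → writes d found ≡ false →
      Saved (exec B r cc s) → Saved (exec B r c s)
    saved-later r cc d c s e i t n f = saved-≡ (later r cc d c s INP e i) (later r cc d c s TT e t) (later r cc d c s nsol e n) (later r cc d c s found e f)

  trial-found : ∀ j s → s found 0 ≢ 0 ⊎ Solves (s INP) (s TT) (s XX) → trial j s found 0 ≢ 0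
  trial-found j s h = subst (λ t → t found 0 ≢ 0) (trial≡ B refl j s) λ z → CheckRun.Checked.finds (CheckRun.check-ok (upd ρ 55 j) 0<B nn≤B s) h
    (trans (cong (λ f → f 0) (sym (later (upd ρ 55 j) checkC restC trialC s found refl refl))) z)

  trial-saved : ∀ j s → Saved s → Saved (trial j s)
  trial-saved j s sv = subst Saved (trial≡ B refl j s) (saved-later (upd ρ 55 j) checkC restC trialC s refl refl refl refl refl
    (CheckRun.Checked.saved (CheckRun.check-ok (upd ρ 55 j) 0<B nn≤B s) sv))

module Trials (ρ : Env) (sz : Sizes ρ) where
  open Sizes sz
  open Rounds ρ sz public

  round-ok : ∀ s → Inv s → ∀ w₁ → w₁ ∈ ⟨ s WW ⟩ → ∃[ d₁ ] ∃[ d₂ ] ∃[ d₃ ] ∃[ d₄ ] d₁ < ρ 52 × d₂ < ρ 52 × d₃ < ρ 52 × d₄ < ρ 52 ×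
    (let t = runD d₄ (runC d₃ (runB d₂ (runA d₁ s))) in Σ (Inv t) λ _ → # B (dec ⟨ t WW ⟩) < # B (dec ⟨ s WW ⟩))
  round-ok s inv w₁ w₁∈ = d₁ , d₂ , d₃ , d₄ , proj₁ (proj₂ hA) , proj₁ (proj₂ cB) , proj₁ (proj₂ hB) , proj₁ (proj₂ cD) , next , smaller
    where
    hA = Round.hashA ρ sz s inv w₁ w₁∈
    d₁ = proj₁ hA
    h₁ = proj₂ (proj₂ hA) s
    a = runA d₁ s
    A = runA-ok s d₁
    cB = Round.AfterHash.cutB ρ sz s inv w₁ w₁∈ {hashed d₁ s} {a} A (proj₁ h₁) (proj₂ h₁)
    d₂ = proj₁ cB
    b = runB d₂ a
    AB = runB-ok a d₂
    nD = proj₁ (proj₂ (proj₂ cB))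
    D≤ = proj₂ (proj₂ (proj₂ cB))
    hB = Round.AfterHash.AfterCut.hashB ρ sz s inv w₁ w₁∈ {hashed d₁ s} {a} A (proj₁ h₁) (proj₂ h₁) {guided d₂ a} {b} AB nD D≤
    d₃ = proj₁ hB
    h₃ = proj₂ (proj₂ hB) b
    c = runC d₃ b
    AC = runC-ok b d₃
    cD = Round.AfterHash.AfterCut.AfterHash₂.cutD ρ sz s inv w₁ w₁∈ {hashed d₁ s} {a} A (proj₁ h₁) (proj₂ h₁) {guided d₂ a} {b} AB nD D≤ {hashed d₃ b} {c} AC (proj₁ h₃) (proj₂ h₃)
    d₄ = proj₁ cD
    AD = runD-ok c d₄
    nD₂ = proj₁ (proj₂ (proj₂ cD))
    D≤₂ = proj₂ (proj₂ (proj₂ cD))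
    t = runD d₄ c
    next : Inv t
    next = Round.AfterHash.AfterCut.AfterHash₂.AfterCut₂.next ρ sz s inv w₁ w₁∈ {hashed d₁ s} {a} A (proj₁ h₁) (proj₂ h₁) {guided d₂ a} {b} AB nD D≤ {hashed d₃ b} {c} AC (proj₁ h₃) (proj₂ h₃) {guided d₄ c} {t} AD nD₂ D≤₂
    smaller : # B (dec ⟨ t WW ⟩) < # B (dec ⟨ s WW ⟩)
    smaller = Round.AfterHash.AfterCut.AfterHash₂.AfterCut₂.smaller ρ sz s inv w₁ w₁∈ {hashed d₁ s} {a} A (proj₁ h₁) (proj₂ h₁) {guided d₂ a} {b} AB nD D≤ {hashed d₃ b} {c} AC (proj₁ h₃) (proj₂ h₃) {guided d₄ c} {t} AD nD₂ D≤₂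

  M₂ : ℕ
  M₂ = ρ 52

  digits : ℕ → ℕ → ℕ → ℕ → ℕ → ℕ
  digits d₁ d₂ d₃ d₄ q = d₁ + (d₂ + (d₃ + (d₄ + q * M₂) * M₂) * M₂) * M₂

  round : ℕ → ℕ → ℕ → ℕ → Mem → Mem
  round d₁ d₂ d₃ d₄ s = runD d₄ (runC d₃ (runB d₂ (runA d₁ s)))

  good-same : ∀ {I I′ T T′ A} → (∀ i → i < B → I i ≡ I′ i) → (∀ i → i < B → T i ≡ T′ i) → GoodIn I T A → GoodIn I′ T′ A
  good-same {I} {I′} {T} {T′} {A} e f g t t′ (t<B , tT) (t′<B , t′T) p q = g t t′ (t<B , λ z → tT (trans (sym (f t t<B)) z)) (t′<B , λ z → t′T (trans (sym (f t′ t′<B)) z)) (back p) (back q)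
    where
    module G = Graph B (Edge I) (Edge? I) ⟨ T ⟩
    module G′ = Graph B (Edge I′) (Edge? I′) ⟨ T′ ⟩
    back : ∀ {u v} → G′.Pth A u v → G.Pth A u v
    back (G′.here a) = G.here a
    back (G′.step a (u<n , v<n , l , ne) p) = G.step a (u<n , v<n , l , λ z → ne (trans (sym (e _ l)) z)) (back p)

  solves-same : ∀ {I I′ T T′ X X′} → (∀ i → i < B → I i ≡ I′ i) → (∀ i → i < B → T i ≡ T′ i) → (∀ i → i < B → X i ≡ X′ i) → Solves I T X → Solves I′ T′ X′
  solves-same {I} {I′} {T} {T′} {X} {X′} e f g (c , good) = ≤-trans (#-mono B (dec ⟨ X′ ⟩) (dec ⟨ X ⟩) (λ v _ (l , h) → l , λ z → h (trans (sym (g v l)) z))) c ,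
    good-anti {I′} {T′} {Outside n ⟨ X ⟩} {Outside n ⟨ X′ ⟩} (λ { v (v<n , nx) → v<n , λ { (l , h) → nx (l , λ z → h (trans (g v l) z)) } })
      (good-same {I} {I′} {T} {T′} e f good)

  record Segment (a : ℕ) (seg : Cm) (L L′ : List ℕ) : Set where
    constructor mkSegment
    field
      {K′} : Names
      ok : okCm names₁ seg ≡ true
      flows : flow (among (a ∷ L)) seg ≡ just K′
      gives : contains K′ L′ ≡ true
      apart : disjoint (among L) (takeC a) ≡ true
      a≢ : a ≢ adv
      quiet : writes seg adv ≡ false
      const : ∀ r s i → exec B r (takeC a) s a i ≡ exec B r (takeC a) s a 0

  segmentA : Segment hC segA baseL₁ baseA
  segmentA = mkSegment refl refl refl refl (λ ()) refl (λ _ _ _ → refl)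
  segmentB : Segment gB segB baseA baseB
  segmentB = mkSegment refl refl refl refl (λ ()) refl (λ _ _ _ → refl)
  segmentC : Segment hC segC baseB baseC
  segmentC = mkSegment refl refl refl refl (λ ()) refl (λ _ _ _ → refl)
  segmentD : Segment gB segD baseC baseL
  segmentD = mkSegment refl refl refl refl (λ ()) refl (λ _ _ _ → refl)

  module _ (r : Env) (r₂ : r 2 ≡ B) (r₅₂ : r 52 ≡ M₂) (agree : ∀ x → names₁ x ≡ true → ρ x ≡ r x) where

    Step : Cm → List ℕ → List ℕ → (ℕ → Mem → Mem) → Set
    Step c L L′ ref = ∀ s s′ d q → d < M₂ → q ≤ B → Same B (among L) s s′ → s′ adv 0 ≡ d + q * M₂ →
      Same B (among L′) (ref d s) (exec B r c s′) × exec B r c s′ adv 0 ≡ q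

    segment : ∀ {a sg L L′} → Segment a sg L L′ → (ref : ℕ → Mem → Mem) → (∀ d s → ref d s ≡ exec B ρ sg (upd s a (λ _ → d))) → Step (takeC a ﹔ sg) L L′ ref
    segment {a} {sg} {L} {L′} S ref run≡ s s′ d q d< q≤ same e =
      subst (λ t → Same B (among L′) t (exec B r (takeC a ﹔ sg) s′) × exec B r (takeC a ﹔ sg) s′ adv 0 ≡ q) (sym (run≡ d s))
        (tseg B ρ r a sg L L′ ok flows gives apart a≢ quiet (const r) 0<B r₂ r₅₂ agree s s′ d q d< q≤ same e)
      where open Segment S

    chain : ∀ {cA cB cC cD rA rB rC rD} → Step cA baseL₁ baseA rA → Step cB baseA baseB rB → Step cC baseB baseC rC → Step cD baseC baseL rD →
      ∀ s s′ d₁ d₂ d₃ d₄ q → d₁ < M₂ → d₂ < M₂ → d₃ < M₂ → d₄ < M₂ → digits d₁ d₂ d₃ d₄ q ≤ B →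
      Same B (among baseL₁) s s′ → s′ adv 0 ≡ digits d₁ d₂ d₃ d₄ q → ∀ c → c ≡ (cA ﹔ cB ﹔ cC ﹔ cD) →
      Same B (among baseL) (rD d₄ (rC d₃ (rB d₂ (rA d₁ s)))) (exec B r c s′) × exec B r c s′ adv 0 ≡ q
    chain {cA} {cB} {cC} {cD} {rA} {rB} {rC} SA SB SC SD s s′ d₁ d₂ d₃ d₄ q l₁ l₂ l₃ l₄ h S e _ refl =
      let (S₁ , e₁) = SA s s′ d₁ q₁ l₁ h₁ S e
          (S₂ , e₂) = SB (rA d₁ s) s₁ d₂ q₂ l₂ h₂ S₁ e₁
          (S₃ , e₃) = SC (rB d₂ (rA d₁ s)) s₂ d₃ q₃ l₃ h₃ S₂ e₂
      in SD (rC d₃ (rB d₂ (rA d₁ s))) s₃ d₄ q l₄ h₄ S₃ e₃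
      where
      s₁ = exec B r cA s′
      s₂ = exec B r cB s₁
      s₃ = exec B r cC s₂
      q₃ = d₄ + q * M₂
      q₂ = d₃ + q₃ * M₂
      q₁ = d₂ + q₂ * M₂
      0<M = ≤-<-trans z≤n l₁
      h₁ = tail≤ M₂ 0<M h
      h₂ = tail≤ M₂ 0<M h₁
      h₃ = tail≤ M₂ 0<M h₂
      h₄ = tail≤ M₂ 0<M h₃

    transferred : ∀ s s′ d₁ d₂ d₃ d₄ q → d₁ < M₂ → d₂ < M₂ → d₃ < M₂ → d₄ < M₂ → digits d₁ d₂ d₃ d₄ q ≤ B →
      Same B (among baseL₁) s s′ → s′ adv 0 ≡ digits d₁ d₂ d₃ d₄ q → ∀ c → c ≡ roundC →
      Same B (among baseL) (round d₁ d₂ d₃ d₄ s) (exec B r c s′) × exec B r c s′ adv 0 ≡ q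
    transferred = chain {takeC hC ﹔ segA} {takeC gB ﹔ segB} {takeC hC ﹔ segC} {takeC gB ﹔ segD} {runA} {runB} {runC} {runD}
      (segment segmentA runA runA≡) (segment segmentB runB runB≡) (segment segmentC runC runC≡) (segment segmentD runD runD≡)

    after-check : ∀ cc cr → disjoint (among (adv ∷ baseL)) cc ≡ true → cr ≡ roundC → ∀ s s′ d₁ d₂ d₃ d₄ q → d₁ < M₂ → d₂ < M₂ → d₃ < M₂ → d₄ < M₂ → digits d₁ d₂ d₃ d₄ q ≤ B →
      Same B (among baseL) s s′ → s′ adv 0 ≡ digits d₁ d₂ d₃ d₄ q → ∀ c → c ≡ (cc ﹔ MM [ 21 ]:= lit 0 ﹔ cr) →
      Same B (among baseL) (round d₁ d₂ d₃ d₄ (upd s MM (λ _ → 0))) (exec B r c s′) × exec B r c s′ adv 0 ≡ q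
    after-check cc cr dis cr≡ s s′ d₁ d₂ d₃ d₄ q l₁ l₂ l₃ l₄ h S e _ refl = transferred s₀ s₂ d₁ d₂ d₃ d₄ q l₁ l₂ l₃ l₄ h
      (same-cons B {MM} {baseL} {s₀} {s₂} (λ _ _ → refl) (same-trans B {among baseL} {s₀} {s} {s₂} (same-sym B {among baseL} {s} {s₀} (keepSame B {among baseL} r (MM [ 21 ]:= lit 0) s refl))
        (same-trans B {among baseL} {s} {s′} {s₂} S (same-⊆ B {baseL} {among (adv ∷ baseL)} {s′} {s₂} refl kept))))
      (trans (sym (kept adv refl 0 0<B)) e) cr cr≡
      where
      s₀ = upd s MM (λ _ → 0)
      s₁ = exec B r cc s′
      s₂ = upd s₁ MM (λ _ → 0)
      kept : Same B (among (adv ∷ baseL)) s′ s₂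
      kept = same-trans B {among (adv ∷ baseL)} {s′} {s₁} {s₂} (keepSame B {among (adv ∷ baseL)} r cc s′ dis) (keepSame B {among (adv ∷ baseL)} r (MM [ 21 ]:= lit 0) s₁ refl)

  open TrialRun ρ 0<B nn≤B public

  trial-round : ∀ j s s′ d₁ d₂ d₃ d₄ q → d₁ < M₂ → d₂ < M₂ → d₃ < M₂ → d₄ < M₂ → digits d₁ d₂ d₃ d₄ q ≤ B →
    Same B (among baseL) s s′ → s′ adv 0 ≡ digits d₁ d₂ d₃ d₄ q →
    Same B (among baseL) (round d₁ d₂ d₃ d₄ (upd s MM (λ _ → 0))) (trial j s′) × trial j s′ adv 0 ≡ q
  trial-round j s s′ d₁ d₂ d₃ d₄ q l₁ l₂ l₃ l₄ h S e =
    use trialC refl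
    where
    use : ∀ c → c ≡ trialC → Same B (among baseL) (round d₁ d₂ d₃ d₄ (upd s MM (λ _ → 0))) (trial j s′) × trial j s′ adv 0 ≡ q
    use c c≡ = trial-same B refl c c≡ j s′ (among baseL) (round d₁ d₂ d₃ d₄ (upd s MM (λ _ → 0))) q
      (after-check (upd ρ 55 j) refl refl (agree-fresh names₁ ρ 55 j refl) checkC roundC refl refl s s′ d₁ d₂ d₃ d₄ q l₁ l₂ l₃ l₄ h S e c c≡)

  search : ∀ fuel s → Inv s → # B (dec ⟨ s WW ⟩) ≤ fuel → M₂ ^ (fuel * 4) ≤ B →
    ∃[ q ] q < M₂ ^ (fuel * 4) × (∀ m j s′ → fuel < m → Same B (among baseL) s s′ → s′ adv 0 ≡ q → iterFrom j m trial s′ found 0 ≢ 0)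
  search fuel s inv W≤ pB with any<? B (dec ⟨ s WW ⟩)
  ... | no none = 0 , >-nonZero⁻¹ (M₂ ^ (fuel * 4)) {{m^n≢0 M₂ (fuel * 4) {{>-nonZero 0<M}}}} ,
    λ { (suc m) j s′ _ S _ → iterFrom-keep (λ t → t found 0 ≢ 0) trial (λ i t f → trial-found i t (inj₁ f)) m (suc j) (trial j s′) (trial-found j s′ (inj₂ (there s′ S))) }
    where
    0<M : 0 < M₂
    0<M = <-≤-trans (>-nonZero⁻¹ (2 ^ (2 * w)) {{m^n≢0 2 (2 * w)}}) (≤-trans K-ok K≤M₂)
    open InvAt inv
    solved : Solves (s INP) (s TT) (s XX)
    solved = m+n≤o⇒m≤o _ size , good-anti {s INP} {s TT} {λ v → v ∈ ⟨ s UU ⟩ ⊎ (v < n × v ∉ ⟨ s XX ⟩ × v ∉ ⟨ s UU ⟩)} {Outside n ⟨ s XX ⟩}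
      (λ { v (v<n , nx) → [ inj₁ , (λ nu → inj₂ (v<n , nx , nu)) ]′ (either v) })
      (lift (El ⟨ s UU ⟩) (λ _ → id) (good-anti {s INP} {s TT} {El (⟨ s UU ⟩ ∖ ⟨ s WW ⟩)} {El ⟨ s UU ⟩} (λ v u → u , λ w → none (v , proj₁ w , w)) good-W))
      where
      either : ∀ v → v ∈ ⟨ s UU ⟩ ⊎ v ∉ ⟨ s UU ⟩
      either v with dec ⟨ s UU ⟩ v
      ... | yes u = inj₁ u
      ... | no nu = inj₂ nu
    there : ∀ s′ → Same B (among baseL) s s′ → Solves (s′ INP) (s′ TT) (s′ XX)
    there s′ S = solves-same {s INP} {s′ INP} {s TT} {s′ TT} {s XX} {s′ XX} (S INP refl) (S TT refl) (S XX refl) solved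
  search zero s inv W≤ pB | yes (w₁ , w₁<B , w₁∈) = contradiction (≤-trans (#-pos B (dec ⟨ s WW ⟩) w₁ w₁<B w₁∈) W≤) λ ()
  search (suc fuel) s inv W≤ pB | yes (w₁ , w₁<B , w₁∈) =
    let (d₁ , d₂ , d₃ , d₄ , l₁ , l₂ , l₃ , l₄ , inv′ , less) = round-ok (upd s MM (λ _ → 0)) inv w₁ w₁∈
        M≤ = ≤-trans (^-monoʳ-≤ M₂ {{>-nonZero (≤-<-trans z≤n l₁)}} (m≤n+m (fuel * 4) 4)) pB
        (q , q< , h) = search fuel _ inv′ (≤-pred (<-≤-trans less W≤)) M≤
        bound = digit< M₂ (3 + fuel * 4) l₁ (digit< M₂ (2 + fuel * 4) l₂ (digit< M₂ (1 + fuel * 4) l₃ (digit< M₂ (fuel * 4) l₄ q<)))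
    in digits d₁ d₂ d₃ d₄ q , bound , λ { (suc m) j s′ (s≤s f<m) S e →
      let (S′ , e′) = trial-round j s s′ d₁ d₂ d₃ d₄ q l₁ l₂ l₃ l₄ (≤-trans (<⇒≤ bound) pB) S e in h m (suc j) (trial j s′) f<m S′ e′ }

termF failF : Fm
termF = INP ∋ v̇ & v̇ ≺ var 0 & v̇ ≺ var 54 ⊞ lit 1
failF = fail ∋ lit 0 ∥ ~ (found ∋ lit 0)

preC segS tryC enterC leaveC stageC mainC : Cm
preC = WW :≡ v̇ ≺ var 0 & (sol ∋ v̇ ∥ v̇ ≐ var 54)
segS = hashC ﹔ XX :≡ WW ∋ v̇ & HH ∋ v̇ ﹔ UU :≡ v̇ ≺ var 0 & ~ (XX ∋ v̇) ﹔ WW :≡ WW ∋ v̇ & ~ (XX ∋ v̇)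
tryC = (adv [ 21 ]:= var 53 ﹔ preC) ﹔ (takeC hC ﹔ segS) ﹔ for 55 trialC
enterC = TT :≡ termF ﹔ found [ 21 ]:= lit 0
leaveC = fail :≡ failF ﹔ sol :≡ nsol ∋ v̇
stageC = enterC ﹔ for 50 (for 51 (for 52 (for 53 tryC))) ﹔ leaveC
mainC = (fail [ 21 ]:= lit 0 ﹔ sol [ 21 ]:= lit 0) ﹔ for 54 stageC

Reaches : ℕ → Env → Mem → ℕ → Set
Reaches B ρ s a = ∀ ρ′ → ρ′ 2 ≡ B → (∀ x → names₁ x ≡ true → ρ x ≡ ρ′ x) → ∀ s′ → Same B (among (WW ∷ INP ∷ TT ∷ [])) s s′ → s′ adv 0 ≡ a →
  ∀ cs → cs ≡ (takeC hC ﹔ segS) → ∀ ct → ct ≡ trialC → exec B ρ′ (cs ﹔ for 55 ct) s′ found 0 ≢ 0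

module Start (ρ : Env) (sz : Sizes ρ) where
  open Sizes sz
  open Trials ρ sz

  record AfterS (s h t : Mem) : Set where
    field
      I≡ : t INP ≡ s INP
      T≡ : t TT ≡ s TT
      X≋ : ⟨ t XX ⟩ ≋ (λ v → v ∈ ⟨ s WW ⟩ × v ∈ ⟨ h HH ⟩)
      U≋ : ⟨ t UU ⟩ ≋ (Outside n ⟨ t XX ⟩)
      W≋ : ⟨ t WW ⟩ ≋ (λ v → v ∈ ⟨ s WW ⟩ × v ∉ ⟨ t XX ⟩)

  afterS-abs : ∀ (s h h₁ h₂ t : Mem) → t INP ≡ s INP → t TT ≡ s TT → h WW ≡ s WW → h₂ WW ≡ h WW → t XX ≡ h₁ XX → h₂ XX ≡ h₁ XX →
    ⟨ h₁ XX ⟩ ≋ (λ v → v ∈ ⟨ h WW ⟩ × v ∈ ⟨ h HH ⟩) → ⟨ t UU ⟩ ≋ (Outside n ⟨ h₁ XX ⟩) → ⟨ t WW ⟩ ≋ (λ v → v ∈ ⟨ h₂ WW ⟩ × v ∉ ⟨ h₂ XX ⟩) → AfterS s h t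
  afterS-abs s h h₁ h₂ t i t≡ w w₂ x x₂ x≋ u≋ w≋ = record
    { I≡ = i ; T≡ = t≡
    ; X≋ = subst₂ (λ f g → ⟨ g ⟩ ≋ (λ v → v ∈ ⟨ f ⟩ × v ∈ ⟨ h HH ⟩)) w (sym x) x≋
    ; U≋ = subst (λ g → ⟨ t UU ⟩ ≋ (Outside n ⟨ g ⟩)) (sym x) u≋
    ; W≋ = subst₂ (λ f g → ⟨ t WW ⟩ ≋ (λ v → v ∈ ⟨ f ⟩ × v ∉ ⟨ g ⟩)) (trans w₂ w) (trans x₂ (sym x)) w≋ }

  segS-ok : ∀ s d → let r = upd s hC (λ _ → d) in AfterS s (exec B ρ hashC r) (exec B ρ segS r)
  segS-ok s d = afterS-abs s h h₁ h₂ (exec B ρ segS r) (frame B ρ segS r INP refl) (frame B ρ segS r TT refl) (frame B ρ hashC r WW refl) refl refl refl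
    (fm≋ XX (WW ∋ v̇ & HH ∋ v̇) h) (fm≋ UU (v̇ ≺ var 0 & ~ (XX ∋ v̇)) h₁) (fm≋ WW (WW ∋ v̇ & ~ (XX ∋ v̇)) h₂)
    where
    r = upd s hC (λ _ → d)
    h = exec B ρ hashC r
    h₁ = exec B ρ (XX :≡ WW ∋ v̇ & HH ∋ v̇) h
    h₂ = exec B ρ (UU :≡ v̇ ≺ var 0 & ~ (XX ∋ v̇)) h₁

  abstract

    runS : ℕ → Mem → Mem
    runS d s = exec B ρ segS (upd s hC (λ _ → d))

    runS≡ : ∀ d s → exec B ρ segS (upd s hC (λ _ → d)) ≡ runS d s
    runS≡ d s = refl

    runS-ok : ∀ s d → AfterS s (hashed d s) (runS d s)
    runS-ok s d = subst (λ h → AfterS s h (runS d s)) (sym (hashed≡ d s)) (segS-ok s d)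

  module Begin (s : Mem) (X : DSet) (W<n : ∀ v → v ∈ ⟨ s WW ⟩ → v < n) (W≤ : # B (dec ⟨ s WW ⟩) ≤ suc k)
    (goodW : GoodIn (s INP) (s TT) (Outside n ⟨ s WW ⟩)) (X<n : ∀ v → v ∈ X → v < n) (X≤ : # B (dec X) ≤ k)
    (goodX : GoodIn (s INP) (s TT) (Outside n X)) where

    Wₛ inX : DSet
    Wₛ = ⟨ s WW ⟩
    El inX v = v ∈ Wₛ × v ∈ X
    dec inX v = dec Wₛ v ×-dec dec X v

    code : ∃[ c ] Separates c (elems B inX) (elems B (Wₛ ∖ X)) hashed
    code = choose-hash (elems B inX) (elems B (Wₛ ∖ X)) (λ x m → W<n x (proj₁ (elems-∈ B inX x m))) (λ x m → W<n x (proj₁ (elems-∈ B (Wₛ ∖ X) x m)))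
      (λ x q m m′ e → proj₂ (elems-∈ B (Wₛ ∖ X) q m′) (subst (_∈ X) e (proj₂ (elems-∈ B inX x m))))
      (≤-trans (≤-reflexive (elems-# B inX)) (≤-trans (#-mono B (dec inX) (dec X) (λ _ _ → proj₂)) (≤-trans X≤ k≤w)))
      (≤-trans (≤-reflexive (elems-# B (Wₛ ∖ X))) (≤-trans (#-mono B (dec (Wₛ ∖ X)) (dec Wₛ) (λ _ _ → proj₁)) (≤-trans W≤ (m≤m+n (suc k) _))))

    module Begun {h t : Mem} (A : AfterS s h t) (h⊇ : ∀ x → x ∈ᴸ elems B inX → x ∈ ⟨ h HH ⟩) (h∌ : ∀ q → q ∈ᴸ elems B (Wₛ ∖ X) → q ∉ ⟨ h HH ⟩) where
      open AfterS A

      X→ : ∀ v → v ∈ ⟨ t XX ⟩ → v ∈ Wₛ × v ∈ X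
      X→ v m = let (w , hh) = proj₁ (X≋ v) m in w , by-contradiction X v λ nx → h∌ v (∈-elems B (Wₛ ∖ X) v (n≤B (W<n v w)) (w , nx)) hh

      X← : ∀ v → v ∈ Wₛ → v ∈ X → v ∈ ⟨ t XX ⟩
      X← v w x = proj₂ (X≋ v) (n≤B (W<n v w)) (w , h⊇ v (∈-elems B inX v (n≤B (W<n v w)) (w , x)))

      to : ∀ {A} → GoodIn (s INP) (s TT) A → GoodIn (t INP) (t TT) A
      to {A} = subst₂ (λ i t → GoodIn i t A) (sym I≡) (sym T≡)

      inv : Inv t
      inv = record
        { U<n = λ v u → proj₁ (proj₁ (U≋ v) u)
        ; W⊆U = λ v w → let (w′ , nx) = proj₁ (W≋ v) w in proj₂ (U≋ v) (proj₁ w) (W<n v w′ , nx)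
        ; W-size = ≤-trans (#-mono B (dec ⟨ t WW ⟩) (dec Wₛ) (λ v _ w → proj₁ (proj₁ (W≋ v) w))) W≤
        ; good-W = to {El (⟨ t UU ⟩ ∖ ⟨ t WW ⟩)} (good-anti {s INP} {s TT} {Outside n Wₛ} {El (⟨ t UU ⟩ ∖ ⟨ t WW ⟩)}
          (λ { v (u , nw) → let (v<n , nx) = proj₁ (U≋ v) u in v<n , λ w → nw (proj₂ (W≋ v) (proj₁ u) (w , nx)) }) goodW)
        ; lift = λ A A⊆ g → good-anti {t INP} {t TT} {A} {λ v → A v ⊎ (v < n × v ∉ ⟨ t XX ⟩ × v ∉ ⟨ t UU ⟩)}
          (λ v → [ id , (λ { (v<n , nx , nu) → contradiction (proj₂ (U≋ v) (n≤B v<n) (v<n , nx)) nu }) ]′) g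
        ; X = X ∖ Wₛ
        ; X⊆ = λ { v (x , nw) → proj₂ (U≋ v) (n≤B (X<n v x)) (X<n v x , λ m → nw (proj₁ (X→ v m))) , λ w → nw (proj₁ (proj₁ (W≋ v) w)) }
        ; good-X = to {El (⟨ t UU ⟩ ∖ (X ∖ Wₛ))} (good-anti {s INP} {s TT} {Outside n X} {El (⟨ t UU ⟩ ∖ (X ∖ Wₛ))}
          (λ { v (u , n∖) → let (v<n , nx) = proj₁ (U≋ v) u in v<n , λ x → nx (X← v (by-contradiction Wₛ v (λ nw → n∖ (x , nw))) x) }) goodX)
        ; size = ≤-trans (#-⊎ B (dec ⟨ t XX ⟩) (dec (X ∖ Wₛ)) (dec X) (λ v _ m → proj₂ (X→ v m)) (λ _ _ → proj₁) (λ v _ m h → proj₂ h (proj₁ (X→ v m)))) X≤ }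

    d = proj₁ code
    sep = proj₂ (proj₂ code) s
    open Begun {hashed d s} {runS d s} (runS-ok s d) (proj₁ sep) (proj₂ sep)

    found-by : ∃[ q ] q < M₂ ^ (suc k * 4) × (∀ m j s′ → suc k < m → Same B (among baseL) (runS d s) s′ → s′ adv 0 ≡ q → iterFrom j m trial s′ found 0 ≢ 0)
    found-by = search (suc k) (runS d s) inv (InvAt.W-size inv) (≤-trans (^-monoʳ-≤ M₂ {{>-nonZero 0<M}} {suc k * 4} {suc (suc k * 4)} (n≤1+n _)) cap)
      where
      0<M : 0 < M₂
      0<M = ≤-<-trans z≤n (proj₁ (proj₂ code))

    hit : ∃[ a ] a < B × Reaches B ρ s a
    hit = a , a<B , reach
      where
      q = proj₁ found-by
      q< = proj₁ (proj₂ found-by)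
      a = d + q * M₂
      a<B : a < B
      a<B = <-≤-trans (digit< M₂ (suc k * 4) (proj₁ (proj₂ code)) q<) cap
      1+k<B : suc k < B
      1+k<B = ≤-<-trans (≤-trans (s≤s (m≤m+n k k)) (m≤m+n w (w + 0))) w-ok
      started : ∀ ρ′ → ρ′ 2 ≡ B → (∀ x → names₁ x ≡ true → ρ x ≡ ρ′ x) → ∀ s′ → Same B (among (WW ∷ INP ∷ TT ∷ [])) s s′ → s′ adv 0 ≡ a →
        ∀ cs → cs ≡ (takeC hC ﹔ segS) → Same B (among baseL) (runS d s) (exec B ρ′ cs s′) × exec B ρ′ cs s′ adv 0 ≡ q
      started ρ′ e₂ ag s′ S e _ refl = subst (λ r → Same B (among baseL) r (exec B ρ′ (takeC hC ﹔ segS) s′) × exec B ρ′ (takeC hC ﹔ segS) s′ adv 0 ≡ q) (runS≡ d s)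
        (tseg B ρ ρ′ hC segS (WW ∷ INP ∷ TT ∷ []) baseL refl refl refl refl (λ ()) refl (λ _ _ → refl) 0<B e₂ (sym (ag 52 refl)) ag s s′ d q (proj₁ (proj₂ code))
          (tail≤ M₂ (≤-<-trans z≤n (proj₁ (proj₂ code))) (<⇒≤ a<B)) S e)
      ok-loop : ∀ ct → ct ≡ trialC → okCm names₁ (for 55 ct) ≡ true × flow (λ _ → true) (for 55 ct) ≡ just (λ _ → true)
      ok-loop _ refl = refl , refl
      reach : Reaches B ρ s a
      reach ρ′ e₂ ag s′ S e cs cs≡ ct ct≡ z = proj₂ (proj₂ found-by) B 0 s₁ 1+k<B (proj₁ st) (proj₂ st)
        (trans (cong (λ t → t found 0) (sym (trial-loop B refl ct ct≡ s₁))) (trans same z))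
        where
        s₁ = exec B ρ′ cs s′
        st = started ρ′ e₂ ag s′ S e cs cs≡
        same : exec B ρ (for 55 ct) s₁ found 0 ≡ exec B ρ′ (for 55 ct) s₁ found 0
        same = exec-same B (for 55 ct) {names₁} {λ _ → true} {λ _ → true} {ρ} {ρ′} {s₁} {s₁} (proj₁ (ok-loop ct ct≡)) (proj₂ (ok-loop ct ct≡)) ag (λ _ _ _ _ → refl) found refl 0 0<B

iter-inv : ∀ (P : Mem → Set) (f : ℕ → Mem → Mem) → (∀ i s → P s → P (f i s)) → ∀ c s → P s → P (iter c f s)
iter-inv P f h zero s p = p
iter-inv P f h (suc c) s p = h c (iter c f s) (iter-inv P f h c s p)

iter-hit : ∀ (P G : Mem → Set) (f : ℕ → Mem → Mem) → (∀ i s → P s → P (f i s)) → (∀ i s → G s → G (f i s)) →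
  ∀ b c → b < c → (∀ s → P s → G (f b s)) → ∀ s → P s → G (iter c f s)
iter-hit P G f h g b (suc c) b<1+c hit s p with m<1+n⇒m<n∨m≡n b<1+c
... | inj₁ b<c = g c (iter c f s) (iter-hit P G f h g b c b<c hit s p)
... | inj₂ refl = hit (iter c f s) (iter-inv P f h c s p)

nest : ℕ → (ℕ → ℕ → ℕ → ℕ → Mem → Mem) → Mem → Mem
nest B F = iter B λ a → iter B λ b → iter B λ c → iter B (F a b c)

nest-cong : ∀ B F G → (∀ a b c d s → F a b c d s ≡ G a b c d s) → ∀ s → nest B F s ≡ nest B G s
nest-cong B F G h = iter-cong _ _ (λ a → iter-cong _ _ (λ b → iter-cong _ _ (λ c → iter-cong _ _ (h a b c) B) B) B) B

module Nest (B : ℕ) (F : ℕ → ℕ → ℕ → ℕ → Mem → Mem) (P G : Mem → Set)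
  (keep : ∀ a b c d s → P s → P (F a b c d s)) (stay : ∀ a b c d s → G s → G (F a b c d s)) where

  nest-keep : ∀ s → P s → P (nest B F s)
  nest-keep = iter-inv P _ (λ a → iter-inv P _ (λ b → iter-inv P _ (λ c → iter-inv P _ (keep a b c) B) B) B) B

  nest-hit : ∀ a b c d → a < B → b < B → c < B → d < B → (∀ s → P s → G (F a b c d s)) → ∀ s → P s → G (nest B F s)
  nest-hit a b c d a< b< c< d< hit =
    iter-hit P G _ (λ a → iter-inv P _ (λ b → iter-inv P _ (λ c → iter-inv P _ (keep a b c) B) B) B) (λ a → iter-inv G _ (λ b → iter-inv G _ (λ c → iter-inv G _ (stay a b c) B) B) B) a B a<
      (iter-hit P G _ (λ b → iter-inv P _ (λ c → iter-inv P _ (keep a b c) B) B) (λ b → iter-inv G _ (λ c → iter-inv G _ (stay a b c) B) B) b B b<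
        (iter-hit P G _ (λ c → iter-inv P _ (keep a b c) B) (λ c → iter-inv G _ (stay a b c) B) c B c<
          (iter-hit P G _ (keep a b c) (stay a b c) d B d< hit)))

module StageRun (ρ : Env) (0<B : 0 < ρ 2) (nn≤B : ρ 0 * ρ 0 ≤ ρ 2) where
  open CheckRun ρ 0<B nn≤B

  env₄ : ℕ → ℕ → ℕ → ℕ → Env
  env₄ i K m m₂ = upd (upd (upd (upd ρ 54 i) 50 K) 51 m) 52 m₂

  env₅ : ℕ → ℕ → ℕ → ℕ → ℕ → Env
  env₅ i K m m₂ a = upd (env₄ i K m m₂) 53 a

  Fits : Set
  Fits = ∃[ K ] ∃[ m ] ∃[ m₂ ] K < B × m < B × m₂ < B × (∀ i → Sizes (env₄ i K m m₂))

  GoodOn : (ℕ → ℕ) → DSet → (ℕ → Set) → Set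
  GoodOn I T = Graph.Good B (Edge I) (Edge? I) T

  good-sub : ∀ {I T T′ A A′} → (∀ v → A′ v → A v) → (∀ v → v ∈ T′ → A′ v → v ∈ T) → GoodOn I T A → GoodOn I T′ A′
  good-sub {I} {T} {T′} {A} {A′} f h g t t′ tT t′T p q = g t t′ (h t tT (G′.source∈ p)) (h t′ t′T (G′.target∈ p)) (conv p) (conv q)
    where
    module G = Graph B (Edge I) (Edge? I) T
    module G′ = Graph B (Edge I) (Edge? I) T′
    conv : ∀ {u v} → G′.Pth A′ u v → G.Pth A u v
    conv (G′.here a) = G.here (f _ a)
    conv (G′.step a e p) = G.step (f _ a) e (conv p)

  Tlt : ℕ → (ℕ → ℕ) → DSet
  El (Tlt c I) v = v ∈ ⟨ I ⟩ × v < n × v < c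
  dec (Tlt c I) v = dec ⟨ I ⟩ v ×-dec (v <? n) ×-dec (v <? c)

  SolvesOn : (ℕ → ℕ) → DSet → (ℕ → ℕ) → Set
  SolvesOn I T X = # B (dec ⟨ X ⟩) ≤ ρ 1 × GoodOn I T (Outside n ⟨ X ⟩)

  record Stage (i : ℕ) (s : Mem) : Set₁ where
    field
      T≋ : ⟨ s TT ⟩ ≋ El (Tlt (suc i) (s INP))
      prior : SolvesOn (s INP) (Tlt i (s INP)) (s sol)
      X : DSet
      X<n : ∀ v → v ∈ X → v < n
      X≤ : # B (dec X) ≤ ρ 1
      goodX : GoodOn (s INP) (Tlt n (s INP)) (Outside n X)

  Kept : Mem → Mem → Set
  Kept s t = t INP ≡ s INP × t TT ≡ s TT × t sol ≡ s sol × t fail ≡ s fail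

  compose : ∀ {s t u} → Kept t u → Kept s t → Kept s u
  compose (a , b , c , d) (a′ , b′ , c′ , d′) = trans a a′ , trans b b′ , trans c c′ , trans d d′

  abstract

    attempt : ℕ → ℕ → ℕ → ℕ → ℕ → Mem → Mem
    attempt i K m m₂ a = exec (ρ 2) (env₅ i K m m₂ a) tryC

    attempt≡ : ∀ b → b ≡ ρ 2 → ∀ c → c ≡ tryC → ∀ i K m m₂ a s → exec b (env₅ i K m m₂ a) c s ≡ attempt i K m m₂ a s
    attempt≡ b e _ refl i K m m₂ a s = cong (λ b → exec b (env₅ i K m m₂ a) tryC s) e

  record Parts (cA cB ct c : Cm) : Set where
    field
      A≡ : cA ≡ (adv [ 21 ]:= var 53 ﹔ preC)
      B≡ : cB ≡ (takeC hC ﹔ segS)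
      t≡ : ct ≡ trialC
      c≡ : c ≡ (cA ﹔ cB ﹔ for 55 ct)

  parts : Parts (adv [ 21 ]:= var 53 ﹔ preC) (takeC hC ﹔ segS) trialC tryC
  parts = record { A≡ = refl ; B≡ = refl ; t≡ = refl ; c≡ = refl }

  quiet : ℕ → Bool
  quiet x = not (writes (adv [ 21 ]:= var 53 ﹔ preC) x ∨ writes (takeC hC ﹔ segS) x)

  head-kept : ∀ {cA cB ct c} → Parts cA cB ct c → ∀ e s x → quiet x ≡ true → exec B e cB (exec B e cA s) x ≡ s x
  head-kept {cA} {cB} p e s x q = trans (frame B e cB (exec B e cA s) x (noB (Parts.B≡ p) q)) (frame B e cA s x (noA (Parts.A≡ p) q))
    where
    noA : ∀ {cA} → cA ≡ (adv [ 21 ]:= var 53 ﹔ preC) → quiet x ≡ true → writes cA x ≡ false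
    noA refl q with writes (adv [ 21 ]:= var 53 ﹔ preC) x
    noA refl () | true
    ... | false = refl
    noB : ∀ {cB} → cB ≡ (takeC hC ﹔ segS) → quiet x ≡ true → writes cB x ≡ false
    noB refl q with writes (adv [ 21 ]:= var 53 ﹔ preC) x | writes (takeC hC ﹔ segS) x
    noB refl () | true | _
    noB refl () | false | true
    ... | false | false = refl

  module _ (i K m m₂ a : ℕ) where
    private
      e = env₅ i K m m₂ a
      module TR = TrialRun e 0<B nn≤B

    attempt-keep : ∀ (P : Mem → Set) → (∀ j s → P s → P (TR.trial j s)) → ∀ {cA cB ct c} → Parts cA cB ct c → ∀ s → P (exec B e cB (exec B e cA s)) → P (attempt i K m m₂ a s)
    attempt-keep P h {cA} {cB} {ct} {c} p s ps = subst P (attempt≡ B refl c (c-try p) i K m m₂ a s) (unfold (Parts.c≡ p))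
      where
      c-try : ∀ {cA cB ct c} → Parts cA cB ct c → c ≡ tryC
      c-try record { A≡ = refl ; B≡ = refl ; t≡ = refl ; c≡ = refl } = refl
      unfold : ∀ {c} → c ≡ (cA ﹔ cB ﹔ for 55 ct) → P (exec B e c s)
      unfold refl = subst P (sym (TR.trial-loop B refl ct (Parts.t≡ p) (exec B e cB (exec B e cA s)))) (iterFrom-keep P TR.trial h B 0 (exec B e cB (exec B e cA s)) ps)

    attempt-kept : ∀ s → Kept s (attempt i K m m₂ a s)
    attempt-kept s = attempt-keep (Kept s) (λ j t k → compose {s} {t} {TR.trial j t} (TR.trial-kept j t INP refl , TR.trial-kept j t TT refl , TR.trial-kept j t sol refl , TR.trial-kept j t fail refl) k) parts s
      (head-kept parts e s INP refl , head-kept parts e s TT refl , head-kept parts e s sol refl , head-kept parts e s fail refl)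

    attempt-found : ∀ s → s found 0 ≢ 0 → attempt i K m m₂ a s found 0 ≢ 0
    attempt-found s f = attempt-keep (λ s → s found 0 ≢ 0) (λ j s f → TR.trial-found j s (inj₁ f)) parts s (λ z → f (trans (cong (λ h → h 0) (sym (head-kept parts e s found refl))) z))

    attempt-saved : ∀ s → Saved s → Saved (attempt i K m m₂ a s)
    attempt-saved s sv = attempt-keep Saved TR.trial-saved parts s (saved-≡ (head-kept parts e s INP refl) (head-kept parts e s TT refl) (head-kept parts e s nsol refl) (head-kept parts e s found refl) sv)

  begin-hit : ∀ i K m m₂ → Sizes (env₄ i K m m₂) → ∀ p X → (∀ v → v ∈ ⟨ p WW ⟩ → v < n) → # B (dec ⟨ p WW ⟩) ≤ suc (ρ 1) →
    GoodIn (p INP) (p TT) (Outside n ⟨ p WW ⟩) → (∀ v → v ∈ X → v < n) → # B (dec X) ≤ ρ 1 → GoodIn (p INP) (p TT) (Outside n X) →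
    ∃[ a ] a < B × Reaches B (env₄ i K m m₂) p a
  begin-hit i K m m₂ sz p X a b c d e f = Start.Begin.hit (env₄ i K m m₂) sz p X a b c d e f

  start-hit : ∀ i K m m₂ → Sizes (env₄ i K m m₂) → ∀ s → Stage i s → ∀ p → p INP ≡ s INP → p TT ≡ s TT → ⟨ p WW ⟩ ≋ (λ v → v < n × (v ∈ ⟨ s sol ⟩ ⊎ v ≡ i)) →
    ∃[ a ] a < B × Reaches B (env₄ i K m m₂) p a
  start-hit i K m m₂ sz s st p pI pT W≋ = begin-hit i K m m₂ sz p X (λ v w → proj₁ (proj₁ (W≋ v) w))
    (≤-trans (#-∪ B (dec ⟨ s sol ⟩) (λ v → v ≟ i) (dec ⟨ p WW ⟩) (λ v _ w → proj₂ (proj₁ (W≋ v) w))) (≤-trans (+-mono-≤ (proj₁ prior) (#-one B i)) (≤-reflexive (+-comm (ρ 1) 1))))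
    (subst₂ (λ I T → GoodIn I T (Outside n ⟨ p WW ⟩)) (sym pI) (sym pT) goodW) X<n X≤ (subst₂ (λ I T → GoodIn I T (Outside n X)) (sym pI) (sym pT) good′)
    where
    open Stage st
    goodW : GoodIn (s INP) (s TT) (Outside n ⟨ p WW ⟩)
    goodW = good-sub {s INP} {Tlt i (s INP)} {⟨ s TT ⟩} {Outside n ⟨ s sol ⟩} {Outside n ⟨ p WW ⟩} (λ { v (v<n , nw) → v<n , λ x → nw (proj₂ (W≋ v) (n≤B v<n) (v<n , inj₁ x)) })
      (λ { v t (v<n , nw) → let (a , b , l) = proj₁ (T≋ v) t in a , b , [ id , (λ { refl → contradiction (proj₂ (W≋ v) (n≤B v<n) (v<n , inj₂ refl)) nw }) ]′ (m<1+n⇒m<n∨m≡n l) }) (proj₂ prior)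
    good′ : GoodIn (s INP) (s TT) (Outside n X)
    good′ = good-sub {s INP} {Tlt n (s INP)} {⟨ s TT ⟩} {Outside n X} {Outside n X} (λ _ → id) (λ v t _ → let (a , b , _) = proj₁ (T≋ v) t in a , b , b) goodX

  pre-same : ∀ i K m m₂ a s s′ → Kept s s′ → ∀ cp → cp ≡ preC → let e = env₄ i K m m₂ ; r = env₅ i K m m₂ a in
    ∀ {cA} → cA ≡ (adv [ 21 ]:= var 53 ﹔ cp) → Same B (among (WW ∷ INP ∷ TT ∷ [])) (exec B e cp s) (exec B r cA s′) × exec B r cA s′ adv 0 ≡ a
  pre-same i K m m₂ a s s′ (i≡ , t≡ , s≡ , _) cp cp≡ refl = same-⊆ B {WW ∷ INP ∷ TT ∷ []} {among (WW ∷ sol ∷ INP ∷ TT ∷ [])} {exec B e cp s} {exec B r cp s″} refl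
    (exec-same B cp {among (0 ∷ 2 ∷ 54 ∷ [])} {among (sol ∷ INP ∷ TT ∷ [])} {among (WW ∷ sol ∷ INP ∷ TT ∷ [])} {e} {r} {s} {s″} (proj₁ (facts cp≡)) (proj₁ (proj₂ (facts cp≡))) (agree-fresh (among (0 ∷ 2 ∷ 54 ∷ [])) e 53 a refl)
      (same-cons B {sol} {INP ∷ TT ∷ []} {s} {s″} (λ v _ → cong (λ f → f v) (sym s≡)) (same-cons B {INP} {TT ∷ []} {s} {s″} (λ v _ → cong (λ f → f v) (sym i≡))
        (same-cons B {TT} {[]} {s} {s″} (λ v _ → cong (λ f → f v) (sym t≡)) (same-nil B {s} {s″}))))) , cong (λ f → f 0) (frame B r cp s″ adv (proj₂ (proj₂ (facts cp≡))))
    where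
    e = env₄ i K m m₂
    r = env₅ i K m m₂ a
    s″ = upd s′ adv (λ _ → a)
    facts : ∀ {cp} → cp ≡ preC → okCm (among (0 ∷ 2 ∷ 54 ∷ [])) cp ≡ true × flow (among (sol ∷ INP ∷ TT ∷ [])) cp ≡ just (among (WW ∷ sol ∷ INP ∷ TT ∷ [])) × writes cp adv ≡ false
    facts refl = refl , refl , refl

  attempt-hit : ∀ i K m m₂ → Sizes (env₄ i K m m₂) → ∀ s → Stage i s → ∃[ a ] a < B × (∀ s′ → Kept s s′ → attempt i K m m₂ a s′ found 0 ≢ 0)
  attempt-hit i K m m₂ sz s st = a , proj₁ (proj₂ h) , λ s′ kept → subst (λ t → t found 0 ≢ 0) (attempt≡ B refl tryC refl i K m m₂ a s′) (via s′ kept preC refl parts)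
    where
    h = start-hit i K m m₂ sz s st (exec B (env₄ i K m m₂) preC s) refl refl (SegRun.fm≋ (env₄ i K m m₂) 0<B nn≤B WW (v̇ ≺ var 0 & (sol ∋ v̇ ∥ v̇ ≐ var 54)) s)
    a = proj₁ h
    reaches : ∀ cp → cp ≡ preC → Reaches B (env₄ i K m m₂) (exec B (env₄ i K m m₂) cp s) a
    reaches _ refl = proj₂ (proj₂ h)
    via : ∀ s′ → Kept s s′ → ∀ cp → cp ≡ preC → ∀ {cA cB ct c} → Parts cA cB ct c → exec B (env₅ i K m m₂ a) c s′ found 0 ≢ 0
    via s′ kept cp cp≡ {cA} {cB} {ct} {c} ps = unfold (Parts.c≡ ps)
      where
      A≡ : ∀ {cA} → cA ≡ (adv [ 21 ]:= var 53 ﹔ preC) → cA ≡ (adv [ 21 ]:= var 53 ﹔ cp)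
      A≡ e = trans e (cong (λ c → adv [ 21 ]:= var 53 ﹔ c) (sym cp≡))
      start = pre-same i K m m₂ a s s′ kept cp cp≡ {cA} (A≡ (Parts.A≡ ps))
      unfold : ∀ {c} → c ≡ (cA ﹔ cB ﹔ for 55 ct) → exec B (env₅ i K m m₂ a) c s′ found 0 ≢ 0
      unfold refl = reaches cp cp≡ (env₅ i K m m₂ a) refl (agree-fresh names₁ (env₄ i K m m₂) 53 a refl) (exec B (env₅ i K m m₂ a) cA s′) (proj₁ start) (proj₂ start) cB (Parts.B≡ ps) ct (Parts.t≡ ps)

  loops : ℕ → Mem → Mem
  loops i = nest B (attempt i)

  loops-kept : ∀ i s → Kept s (loops i s)
  loops-kept i s = Nest.nest-keep B (attempt i) (Kept s) (λ _ → ⊤) (λ a b c d t k → compose {s} {t} {attempt i a b c d t} (attempt-kept i a b c d t) k) (λ _ _ _ _ _ _ → tt) s (refl , refl , refl , refl)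

  loops-saved : ∀ i s → Saved s → Saved (loops i s)
  loops-saved i = Nest.nest-keep B (attempt i) Saved (λ _ → ⊤) (attempt-saved i) (λ _ _ _ _ _ _ → tt)

  loops-found : ∀ i s → Fits → Stage i s → loops i s found 0 ≢ 0
  loops-found i s (K , m , m₂ , K< , m< , m₂< , sz) st =
    let (a , a< , h) = attempt-hit i K m m₂ (sz i) s st in
    Nest.nest-hit B (attempt i) (Kept s) (λ t → t found 0 ≢ 0) (λ a b c d t k → compose {s} {t} {attempt i a b c d t} (attempt-kept i a b c d t) k) (attempt-found i) K m m₂ a K< m< m₂< a< h s (refl , refl , refl , refl)

  Solvable : (ℕ → ℕ) → Set₁
  Solvable I = Σ DSet λ X → (∀ v → v ∈ X → v < n) × # B (dec X) ≤ ρ 1 × GoodOn I (Tlt n I) (Outside n X)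

  record Staged (i : ℕ) (s t : Mem) : Set₁ where
    field
      I≡ : t INP ≡ s INP
      solves : t fail 0 ≡ 0 → SolvesOn (s INP) (Tlt (suc i) (s INP)) (t sol)
      succeeds : Fits → Solvable (s INP) → SolvesOn (s INP) (Tlt i (s INP)) (s sol) → s fail 0 ≡ 0 → t fail 0 ≡ 0

  by-zero : ∀ {a} → ¬ (a ≢ 0) → a ≡ 0
  by-zero {zero} h = refl
  by-zero {suc a} h = contradiction (λ ()) h

  staged-abs : ∀ i s s₁ s₂ t → s₁ INP ≡ s INP → s₁ sol ≡ s sol → s₁ fail ≡ s fail → s₁ found 0 ≡ 0 → ⟨ s₁ TT ⟩ ≋ El (Tlt (suc i) (s INP)) →
    Kept s₁ s₂ → (Saved s₁ → Saved s₂) → (Fits → Stage i s₁ → s₂ found 0 ≢ 0) →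
    t INP ≡ s₂ INP → (s₂ found 0 ≡ 0 → t fail 0 ≢ 0) → (t fail 0 ≢ 0 → s₂ fail 0 ≢ 0 ⊎ s₂ found 0 ≡ 0) → ⟨ t sol ⟩ ≋ (λ v → v ∈ ⟨ s₂ nsol ⟩) → Staged i s t
  staged-abs i s s₁ s₂ t eI eS eF f0 T≋ (kI , kT , kS , kF) saved found-if tI fail← fail→ sol≋ = record
    { I≡ = trans tI (trans kI eI)
    ; solves = λ z → solved (saved (λ ne → contradiction f0 ne) (λ z′ → fail← z′ z))
    ; succeeds = λ fits (X , X<n , X≤ , gX) prior z → by-zero λ ne → [ (λ f → f (trans (cong (λ h → h 0) (trans kF eF)) z)) , (λ nf → found-if fits (record
      { T≋ = subst (λ I → ⟨ s₁ TT ⟩ ≋ El (Tlt (suc i) I)) (sym eI) T≋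
      ; prior = subst₂ (λ I S → SolvesOn I (Tlt i I) S) (sym eI) (sym eS) prior
      ; X = X ; X<n = X<n ; X≤ = X≤ ; goodX = subst (λ I → GoodOn I (Tlt n I) (Outside n X)) (sym eI) gX }) nf) ]′ (fail→ ne) }
    where
    solved : Solves (s₂ INP) (s₂ TT) (s₂ nsol) → SolvesOn (s INP) (Tlt (suc i) (s INP)) (t sol)
    solved so = go₁ (subst₂ (λ I T → Solves I T (s₂ nsol)) (trans kI eI) kT so)
      where
      go₁ : Solves (s INP) (s₁ TT) (s₂ nsol) → SolvesOn (s INP) (Tlt (suc i) (s INP)) (t sol)
      go₁ (c , g) = ≤-trans (#-mono B (dec ⟨ t sol ⟩) (dec ⟨ s₂ nsol ⟩) (λ v _ → proj₁ (sol≋ v))) c ,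
        good-sub {s INP} {⟨ s₁ TT ⟩} {Tlt (suc i) (s INP)} (λ { v (v<n , nx) → v<n , λ m → nx (proj₂ (sol≋ v) (proj₁ m) m) }) (λ v m _ → proj₂ (T≋ v) (proj₁ (proj₁ m)) m) g

  staged-by : ∀ i s cL → (∀ s → exec B (upd ρ 54 i) cL s ≡ loops i s) → ∀ c → c ≡ (enterC ﹔ cL ﹔ leaveC) → Staged i s (exec B (upd ρ 54 i) c s)
  staged-by i s cL L≡ _ refl = staged-abs i s s₁ s₂ (exec B e leaveC s₂) refl refl refl refl T≋
    (subst (Kept s₁) (sym (L≡ s₁)) (loops-kept i s₁)) (λ sv → subst Saved (sym (L≡ s₁)) (loops-saved i s₁ sv)) (λ fits st → subst (λ t → t found 0 ≢ 0) (sym (L≡ s₁)) (loops-found i s₁ fits st)) refl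
    (λ z → complete B failF {upd e 21 0} {s₂} (inj₂ (λ f → proj₂ f z)))
    (λ ne → [ (λ f → inj₁ (proj₂ f)) , (λ nf → inj₂ (by-zero λ f → nf (0<B , f))) ]′ (sound B failF {upd e 21 0} {s₂} ne))
    (SegRun.fm≋ e 0<B nn≤B sol (nsol ∋ v̇) (exec B e (fail :≡ failF) s₂))
    where
    e = upd ρ 54 i
    s₁ = exec B e enterC s
    s₂ = exec B e cL s₁
    T≋ : ⟨ s₁ TT ⟩ ≋ El (Tlt (suc i) (s INP))
    T≋ v = let (f , g) = SegRun.fm≋ e 0<B nn≤B TT termF s v in
      (λ m → let (a , b , c) = f m in a , b , subst (v <_) (+-comm i 1) c) , (λ l h → let (a , b , c) = h in g l (a , b , subst (v <_) (+-comm 1 i) c))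

  loops≡ : ∀ i ct → ct ≡ tryC → ∀ s → exec B (upd ρ 54 i) (for 50 (for 51 (for 52 (for 53 ct)))) s ≡ loops i s
  loops≡ i ct ct≡ = nest-cong B (λ K m m₂ a → exec B (env₅ i K m m₂ a) ct) (attempt i) (attempt≡ B refl ct ct≡ i)

  stage-ok : ∀ c → c ≡ stageC → ∀ i s → Staged i s (exec B (upd ρ 54 i) c s)
  stage-ok c c≡ i s = staged-by i s (for 50 (for 51 (for 52 (for 53 tryC)))) (loops≡ i tryC refl) c c≡

  Correct : (s t : Mem) → Set₁
  Correct s t = (t fail 0 ≡ 0 → SolvesOn (s INP) (Tlt n (s INP)) (t sol)) × (Fits → Solvable (s INP) → t fail 0 ≡ 0)

  main-ok : ∀ cs → cs ≡ stageC → ∀ c → c ≡ ((fail [ 21 ]:= lit 0 ﹔ sol [ 21 ]:= lit 0) ﹔ for 54 cs) → ∀ s → Correct s (exec B ρ c s)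
  main-ok cs cs≡ _ refl s = (λ z → let (_ , h , _) = after B in weaken (h z)) , λ fits so → proj₂ (proj₂ (after B)) fits so
    where
    stage : ℕ → Mem → Mem
    stage i = exec B (upd ρ 54 i) cs
    s₀ = exec B ρ (fail [ 21 ]:= lit 0 ﹔ sol [ 21 ]:= lit 0) s
    weaken : ∀ {X} → SolvesOn (s INP) (Tlt B (s INP)) X → SolvesOn (s INP) (Tlt n (s INP)) X
    weaken {X} (c , g) = c , good-sub {s INP} {Tlt B (s INP)} {Tlt n (s INP)} {Outside n ⟨ X ⟩} {Outside n ⟨ X ⟩} (λ _ → id) (λ { v (a , b , _) _ → a , b , n≤B b }) g
    none : SolvesOn (s INP) (Tlt 0 (s INP)) (s₀ sol)
    none = ≤-trans (≤-reflexive (#-0 B (dec ⟨ s₀ sol ⟩) (λ _ _ m → proj₂ m refl))) z≤n , λ { t t′ (_ , _ , ()) }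
    after : ∀ c → let t = iter c stage s₀ in t INP ≡ s INP × (t fail 0 ≡ 0 → SolvesOn (s INP) (Tlt c (s INP)) (t sol)) × (Fits → Solvable (s INP) → t fail 0 ≡ 0)
    after zero = refl , (λ _ → none) , λ _ _ → refl
    after (suc c) = let (i , h , g) = after c ; st = stage-ok cs cs≡ c (iter c stage s₀) in
      trans (Staged.I≡ st) i ,
      (λ z → subst (λ I → SolvesOn I (Tlt (suc c) I) (stage c (iter c stage s₀) sol)) i (Staged.solves st z)) ,
      (λ fits so → let z = g fits so in Staged.succeeds st fits (subst Solvable (sym i) so) (subst (λ I → SolvesOn I (Tlt c I) (iter c stage s₀ sol)) (sym i) (h z)) z)

n<2^n : ∀ n → n < 2 ^ n
n<2^n zero = s≤s z≤n
n<2^n (suc n) = ≤-trans (+-mono-≤ (>-nonZero⁻¹ (2 ^ n) {{m^n≢0 2 n}}) (n<2^n n)) (≤-reflexive (cong (2 ^ n +_) (sym (+-identityʳ (2 ^ n)))))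

pow-* : ∀ e a b → (a * b) ^ e ≡ a ^ e * b ^ e
pow-* zero a b = refl
pow-* (suc e) a b = trans (cong (a * b *_) (pow-* e a b)) ([m*n]*[o*p]≡[m*o]*[n*p] a b (a ^ e) (b ^ e))

-- x = q E + r gives x ≤ (q + 1) E and (q + 1)^E ≤ 2^(q E) ≤ 2^x.
pow-exp : ∀ x E → 0 < E → x ^ E ≤ E ^ E * 2 ^ x
pow-exp x E@(suc _) _ = begin
  x ^ E ≤⟨ ^-monoˡ-≤ E x≤ ⟩
  (suc q * E) ^ E ≡⟨ pow-* E (suc q) E ⟩
  suc q ^ E * E ^ E ≤⟨ *-monoˡ-≤ (E ^ E) (^-monoˡ-≤ E (n<2^n q)) ⟩
  (2 ^ q) ^ E * E ^ E ≡⟨ cong (_* E ^ E) (^-*-assoc 2 q E) ⟩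
  2 ^ (q * E) * E ^ E ≤⟨ *-monoˡ-≤ (E ^ E) (^-monoʳ-≤ 2 (≤-trans (m≤n+m (q * E) (x % E)) (≤-reflexive (sym (m≡m%n+[m/n]*n x E))))) ⟩
  2 ^ x * E ^ E ≡⟨ *-comm (2 ^ x) (E ^ E) ⟩
  E ^ E * 2 ^ x ∎
  where
  open ≤-Reasoning
  q = x / E
  x≤ : x ≤ suc q * E
  x≤ = ≤-trans (≤-reflexive (m≡m%n+[m/n]*n x E)) (+-monoˡ-≤ (q * E) (<⇒≤ (m%n<n x E)))

2n≤ : ∀ n → n + n ≤ suc (n + suc n)
2n≤ n = ≤-trans (+-monoʳ-≤ n (n≤1+n n)) (n≤1+n _)

log₂ : ∀ n → ∃[ L ] n ≤ 2 ^ L × 2 ^ L ≤ suc (n + n)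
log₂ zero = 0 , z≤n , s≤s z≤n
log₂ (suc n) with log₂ n
... | L , lo , hi with suc n ≤? 2 ^ L
... | yes l = L , l , ≤-trans hi (s≤s (2n≤ n))
... | no ¬l = suc L , ≤-trans (s≤s lo) (≤-trans (+-monoˡ-≤ (2 ^ L) (>-nonZero⁻¹ (2 ^ L) {{m^n≢0 2 L}})) (≤-reflexive (cong (2 ^ L +_) (sym (+-identityʳ _))))) ,
  ≤-trans (+-mono-≤ (≤-pred (≰⇒> ¬l)) (+-monoˡ-≤ 0 (≤-pred (≰⇒> ¬l)))) (≤-trans (≤-reflexive (cong (n +_) (+-identityʳ n))) (≤-trans (2n≤ n) (n≤1+n _)))

bound : ℕ → ℕ → ℕ
bound n k = suc n * (suc n * 2 ^ (162 * (suc k * (suc k * suc k))))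

module Sizing (n k : ℕ) where
  open ≤-Reasoning

  κ w K qmax L N M M₂ E : ℕ
  κ = suc k
  w = suc (k + k)
  K = 2 ^ (2 * w)
  qmax = suc k + (1 + suc k * K)
  L = proj₁ (log₂ n)
  N = 2 ^ (4 + 6 * κ)
  M = N * suc L
  M₂ = M ^ suc w
  E = suc w * suc (suc k * 4)

  2^>0 : ∀ a → 0 < 2 ^ a
  2^>0 a = >-nonZero⁻¹ (2 ^ a) {{m^n≢0 2 a}}

  qmax≤ : qmax ≤ 2 ^ (2 + 5 * κ)
  qmax≤ = begin
    κ + (1 + κ * K) ≤⟨ +-mono-≤ (m≤m*n κ K {{>-nonZero (2^>0 (2 * w))}}) (+-monoˡ-≤ (κ * K) (*-mono-≤ {1} {κ} {1} {K} (s≤s z≤n) (2^>0 (2 * w)))) ⟩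
    κ * K + (κ * K + κ * K) ≤⟨ m≤m+n _ (κ * K) ⟩
    κ * K + (κ * K + κ * K) + κ * K ≡⟨ eq (κ * K) ⟩
    4 * (κ * K) ≤⟨ *-monoʳ-≤ 4 (*-mono-≤ (<⇒≤ (n<2^n κ)) (^-monoʳ-≤ 2 {2 * w} {4 * κ} 2w≤)) ⟩
    2 ^ 2 * (2 ^ κ * 2 ^ (4 * κ)) ≡⟨ cong (2 ^ 2 *_) (sym (^-distribˡ-+-* 2 κ (4 * κ))) ⟩
    2 ^ 2 * 2 ^ (5 * κ) ≡⟨ sym (^-distribˡ-+-* 2 2 (5 * κ)) ⟩
    2 ^ (2 + 5 * κ) ∎
    where
    eq = solve 1 (λ x → x :+ (x :+ x) :+ x := con 4 :* x) refl
    2w≤ : 2 * w ≤ 4 * κ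
    2w≤ = ≤-trans (m≤m+n (2 * w) 2) (≤-reflexive (eq₂ k))
      where
      eq₂ = solve 1 (λ k → con 2 :* (con 1 :+ (k :+ k)) :+ con 2 := con 4 :* (con 1 :+ k)) refl

  w≤ : w ≤ 2 ^ (1 + κ)
  w≤ = begin
    suc (k + k) ≤⟨ ≤-trans (n≤1+n _) (≤-reflexive (eq k)) ⟩
    2 * κ ≤⟨ *-monoʳ-≤ 2 (<⇒≤ (n<2^n κ)) ⟩
    2 ^ (1 + κ) ∎
    where
    eq = solve 1 (λ k → con 1 :+ (con 1 :+ (k :+ k)) := con 2 :* (con 1 :+ k)) refl

  σ<M : 2 * (w * (L * qmax)) + 4 < M
  σ<M = begin-strict
    2 * (w * (L * qmax)) + 4 ≤⟨ +-monoˡ-≤ 4 (*-monoʳ-≤ 2 (*-mono-≤ w≤ (*-monoʳ-≤ L qmax≤))) ⟩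
    2 * (a * (L * b)) + 4 ≡⟨ cong (_+ 4) (trans (eq a L b) (cong (_* L) (trans (cong (2 *_) (sym (^-distribˡ-+-* 2 (1 + κ) (2 + 5 * κ)))) (cong (2 ^_) (eq₂ κ))))) ⟩
    N * L + 4 <⟨ +-monoʳ-< (N * L) (<-≤-trans (s≤s (s≤s (s≤s (s≤s (s≤s z≤n))))) (^-monoʳ-≤ 2 {4} {4 + 6 * κ} (m≤m+n 4 (6 * κ)))) ⟩
    N * L + N ≡⟨ trans (+-comm (N * L) N) (sym (*-suc N L)) ⟩
    M ∎
    where
    a = 2 ^ (1 + κ)
    b = 2 ^ (2 + 5 * κ)
    eq = solve 3 (λ a L b → con 2 :* (a :* (L :* b)) := con 2 :* (a :* b) :* L) refl
    eq₂ = solve 1 (λ κ → con 1 :+ ((con 1 :+ κ) :+ (con 2 :+ con 5 :* κ)) := con 4 :+ con 6 :* κ) refl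

  E≤ : E ≤ 10 * (κ * κ)
  E≤ = ≤-trans (≤-reflexive (eq k)) (≤-trans (+-monoˡ-≤ (8 * (κ * κ)) (*-monoʳ-≤ 2 (m≤m*n κ κ))) (≤-reflexive (eq₂ (κ * κ))))
    where
    eq = solve 1 (λ k → (con 1 :+ (con 1 :+ (k :+ k))) :* (con 1 :+ ((con 1 :+ k) :* con 4)) := con 2 :* (con 1 :+ k) :+ con 8 :* ((con 1 :+ k) :* (con 1 :+ k))) refl
    eq₂ : ∀ x → 2 * x + 8 * x ≡ 10 * x
    eq₂ x = sym (*-distribʳ-+ x 2 8)

  E≤2^ : E ≤ 2 ^ (4 + 2 * κ)
  E≤2^ = begin
    E ≤⟨ E≤ ⟩
    10 * (κ * κ) ≤⟨ *-mono-≤ {10} {16} (m≤m+n 10 6) (*-mono-≤ (<⇒≤ (n<2^n κ)) (<⇒≤ (n<2^n κ))) ⟩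
    2 ^ 4 * (2 ^ κ * 2 ^ κ) ≡⟨ cong (2 ^ 4 *_) (trans (sym (^-distribˡ-+-* 2 κ κ)) (cong (λ z → 2 ^ (κ + z)) (sym (+-identityʳ κ)))) ⟩
    2 ^ 4 * 2 ^ (2 * κ) ≡⟨ sym (^-distribˡ-+-* 2 4 (2 * κ)) ⟩
    2 ^ (4 + 2 * κ) ∎

  c³ : ℕ
  c³ = κ * (κ * κ)

  exps : (4 + 6 * κ) * E + ((4 + 2 * κ) * E + 2) ≤ 162 * c³
  exps = begin
    (4 + 6 * κ) * E + ((4 + 2 * κ) * E + 2) ≡⟨ eq κ E ⟩
    8 * (suc κ * E) + 2 ≤⟨ +-mono-≤ (*-monoʳ-≤ 8 (*-mono-≤ {suc κ} {2 * κ} (≤-trans (≤-reflexive (+-comm 1 κ)) (+-monoʳ-≤ κ (s≤s z≤n))) E≤)) (*-monoʳ-≤ 2 (*-mono-≤ {1} {κ} (s≤s z≤n) (*-mono-≤ {1} {κ} (s≤s z≤n) (s≤s z≤n)))) ⟩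
    8 * (2 * κ * (10 * (κ * κ))) + 2 * (κ * (κ * κ)) ≡⟨ eq₂ κ ⟩
    162 * c³ ∎
    where
    eq = solve 2 (λ κ E → (con 4 :+ con 6 :* κ) :* E :+ ((con 4 :+ con 2 :* κ) :* E :+ con 2) := con 8 :* ((con 1 :+ κ) :* E) :+ con 2) refl
    eq₂ = solve 1 (λ κ → con 8 :* (con 2 :* κ :* (con 10 :* (κ :* κ))) :+ con 2 :* (κ :* (κ :* κ)) := con 162 :* (κ :* (κ :* κ))) refl

  M^E : M ^ E ≤ suc n * 2 ^ (162 * c³)
  M^E = begin
    (N * suc L) ^ E ≡⟨ pow-* E N (suc L) ⟩
    N ^ E * suc L ^ E ≤⟨ *-mono-≤ (≤-reflexive (^-*-assoc 2 (4 + 6 * κ) E)) (≤-trans (pow-exp (suc L) E (s≤s z≤n)) (*-mono-≤ (^-monoˡ-≤ E E≤2^) 2^L)) ⟩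
    2 ^ ((4 + 6 * κ) * E) * ((2 ^ (4 + 2 * κ)) ^ E * (2 ^ 2 * suc n)) ≡⟨ cong (λ z → 2 ^ ((4 + 6 * κ) * E) * (z * (2 ^ 2 * suc n))) (^-*-assoc 2 (4 + 2 * κ) E) ⟩
    2 ^ x * (2 ^ y * (2 ^ 2 * suc n)) ≡⟨ eq (2 ^ x) (2 ^ y) (suc n) ⟩
    suc n * (2 ^ x * (2 ^ y * 2 ^ 2)) ≡⟨ cong (suc n *_) (trans (cong (2 ^ x *_) (sym (^-distribˡ-+-* 2 y 2))) (sym (^-distribˡ-+-* 2 x (y + 2)))) ⟩
    suc n * 2 ^ (x + (y + 2)) ≤⟨ *-monoʳ-≤ (suc n) (^-monoʳ-≤ 2 {x + (y + 2)} {162 * c³} exps) ⟩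
    suc n * 2 ^ (162 * c³) ∎
    where
    x = (4 + 6 * κ) * E
    y = (4 + 2 * κ) * E
    eq = solve 3 (λ a b c → a :* (b :* (con 4 :* c)) := c :* (a :* (b :* con 4))) refl
    2^L : 2 ^ suc L ≤ 2 ^ 2 * suc n
    2^L = ≤-trans (*-monoʳ-≤ 2 (proj₂ (proj₂ (log₂ n)))) (≤-trans (m≤m+n (2 * suc (n + n)) 2) (≤-reflexive (eq₃ n)))
      where
      eq₃ = solve 1 (λ n → con 2 :* (con 1 :+ (n :+ n)) :+ con 2 := con 4 :* (con 1 :+ n)) refl

  B : ℕ
  B = bound n k

  cap : M₂ ^ suc (suc k * 4) ≤ B
  cap = ≤-trans (≤-reflexive (^-*-assoc M (suc w) (suc (suc k * 4)))) (≤-trans M^E (m≤n*m _ (suc n)))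

  4≤M : 4 ≤ M
  4≤M = ≤-trans (m≤n+m 4 _) (<⇒≤ σ<M)

  K≤M₂ : K ≤ M₂
  K≤M₂ = begin
    2 ^ (2 * w) ≡⟨ sym (^-*-assoc 2 2 w) ⟩
    4 ^ w ≤⟨ ^-monoˡ-≤ w 4≤M ⟩
    M ^ w ≤⟨ ^-monoʳ-≤ M {{>-nonZero (≤-trans (s≤s z≤n) 4≤M)}} (n≤1+n w) ⟩
    M ^ suc w ∎

  M≤M₂ : M ≤ M₂
  M≤M₂ = ≤-trans (≤-reflexive (sym (*-identityʳ M))) (^-monoʳ-≤ M {{>-nonZero (≤-trans (s≤s z≤n) 4≤M)}} {1} {suc w} (s≤s z≤n))

  M₂<B : M₂ < B
  M₂<B = begin-strict
    M₂ ≡⟨ sym (*-identityʳ M₂) ⟩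
    M₂ * 1 <⟨ *-monoʳ-< M₂ {{>-nonZero (≤-trans (s≤s z≤n) 4≤M₂)}} (≤-trans (s≤s (s≤s z≤n)) 4≤M₂) ⟩
    M₂ * M₂ ≡⟨ cong (M₂ *_) (sym (*-identityʳ M₂)) ⟩
    M₂ ^ 2 ≤⟨ ^-monoʳ-≤ M₂ {{>-nonZero (≤-trans (s≤s z≤n) 4≤M₂)}} {2} {suc (suc k * 4)} (s≤s (s≤s z≤n)) ⟩
    M₂ ^ suc (suc k * 4) ≤⟨ cap ⟩
    B ∎
    where
    4≤M₂ = ≤-trans 4≤M M≤M₂

  sq≤B : suc n * suc n ≤ B
  sq≤B = *-monoʳ-≤ (suc n) (m≤m*n (suc n) (2 ^ (162 * c³)) {{>-nonZero (2^>0 (162 * c³))}})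

  0<B : 0 < B
  0<B = ≤-trans (s≤s z≤n) sq≤B

  nn≤B : n * n ≤ B
  nn≤B = ≤-trans (*-mono-≤ (n≤1+n n) (n≤1+n n)) sq≤B

  2n≤B : n + n ≤ B
  2n≤B = ≤-trans (≤-trans (m≤m+n (n + n) (suc (n * n))) (≤-reflexive (eq n))) sq≤B
    where
    eq = solve 1 (λ n → n :+ n :+ (con 1 :+ (n :* n)) := (con 1 :+ n) :* (con 1 :+ n)) refl

fits : ∀ n k (ρ : Env) (0<B : 0 < ρ 2) (nn≤B : ρ 0 * ρ 0 ≤ ρ 2) → ρ 0 ≡ n → ρ 1 ≡ k → ρ 2 ≡ bound n k → StageRun.Fits ρ 0<B nn≤B
fits n k ρ 0<B nn≤B refl refl e = subst (λ b → ∃[ K ] ∃[ m ] ∃[ m₂ ] K < b × m < b × m₂ < b × (∀ i → Sizes (upd (upd (upd (upd ρ 54 i) 50 K) 51 m) 52 m₂))) (sym e)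
  (S.K , S.M , S.M₂ , ≤-<-trans S.K≤M₂ S.M₂<B , ≤-<-trans S.M≤M₂ S.M₂<B , S.M₂<B , λ i → record
    { l = S.L ; σ = S.w * (S.L * S.qmax) ; 0<B = 0<B ; nn≤B = nn≤B ; 2n≤B = subst (λ b → ρ 0 + ρ 0 ≤ b) (sym e) S.2n≤B ; n≤2^ = proj₁ (proj₂ (log₂ (ρ 0)))
    ; w-ok = subst (λ b → 2 * S.w < b) (sym e) (<-trans (n<2^n (2 * S.w)) (≤-<-trans S.K≤M₂ S.M₂<B))
    ; K-ok = ≤-refl ; K≤M₂ = S.K≤M₂ ; M₂≤B = subst (λ b → S.M₂ ≤ b) (sym e) (<⇒≤ S.M₂<B) ; σ-ok = ≤-refl ; σ<M = S.σ<M ; M-ok = ≤-refl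
    ; cap = subst (λ b → S.M₂ ^ suc (suc (ρ 1) * 4) ≤ b) (sym e) S.cap })
  where module S = Sizing (ρ 0) (ρ 1)

Γ₀ : Names
Γ₀ = among (0 ∷ 1 ∷ 2 ∷ [])

Acts : ℕ → Names → Program → ℕ → (ℕ → ℕ) → Set
Acts b Γ p c f = ∀ s → reg s (ν 2) ≡ b → ∃[ s′ ] Within p s s′ c × Keeps Γ 0 (reg s) (reg s′) × mem s′ ≡ mem s × reg s′ (τ 0) ≡ f (reg s (τ 0))

doubleP : ℕ → Program
doubleP zero = skip
doubleP (suc c) = τ 0 ≔ τ 0 ⊕ τ 0 ⨾ doubleP c

double-acts : ∀ b Γ c → Acts b Γ (doubleP c) (suc c) (2 ^ c *_)
double-acts b Γ zero s@(⟨ r , m ⟩) e = s , oneW ⇓skip , keeps-refl , refl , sym (*-identityˡ _)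
double-acts b Γ (suc c) ⟨ r , m ⟩ e =
  let (s′ , w , k , m≡ , v) = double-acts b Γ c ⟨ upd r (τ 0) (r (τ 0) + r (τ 0)) , m ⟩ (trans (upd-name r 0 (r (τ 0) + r (τ 0)) 2) e)
  in s′ , seqW (oneW ⇓add) w , keeps-trans (keeps-τ {Γ} {0} r {0} _ z≤n) k , m≡ , trans v (trans (cong (2 ^ c *_) (upd-≡ r (τ 0) _)) (eq (2 ^ c) (r (τ 0))))
  where
  eq = solve 2 (λ a x → a :* (x :+ x) := (a :+ (a :+ con 0)) :* x) refl

for-acts : ∀ b Γ x j p c f → 0 < j → Γ 2 ≡ true → Γ x ≡ false → Acts b (upd Γ x true) p c f → Acts b Γ (forP x j p) (forT b c) (λ v → iter b (λ _ → f) v)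
for-acts b Γ x j p c f 0<j Γ2 Γx act s e =
  let (s′ , w , k , m≡ , v) = for-ok b {Γ} {0} {j} x p c z≤n Inv Γ2 Γx body stable s e (refl , refl) in s′ , w , k , m≡ , v
  where
  Inv : ℕ → State → Set
  Inv i t = mem t ≡ mem s × reg t (τ 0) ≡ iter i (λ _ → f) (reg s (τ 0))
  body : ∀ i t → i < b → reg t (ν 2) ≡ b → reg t (ν x) ≡ i → Inv i t → ∃[ t′ ] Within p t t′ c × Keeps (upd Γ x true) 0 (reg t) (reg t′) × Inv (suc i) t′
  body i t i<b e₂ _ (m≡ , v) = let (t′ , w , k , m≡′ , v′) = act t e₂ in t′ , w , k , trans m≡′ m≡ , trans v′ (cong f v)
  stable : ∀ i r r′ m → Keeps Γ j r r′ → Inv i ⟨ r , m ⟩ → Inv i ⟨ r′ , m ⟩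
  stable i r r′ m k (m≡ , v) = m≡ , trans (temps k 0 0<j) v

iter-mul : ∀ b (f : ℕ → ℕ) a → (∀ v → f v ≡ a * v) → ∀ v → iter b (λ _ → f) v ≡ a ^ b * v
iter-mul zero f a h v = sym (*-identityˡ v)
iter-mul (suc b) f a h v = trans (h _) (trans (cong (a *_) (iter-mul b f a h v)) (sym (*-assoc a (a ^ b) v)))

powerP : ℕ → Program
powerP c = forP 4 1 (forP 5 2 (forP 6 3 (doubleP c)))

boundOf : Program → Program → Program
boundOf p q = (ν 1 ≔ τ 0) ⨾ τ 1 ≔const 1 ⨾ (ν 2 ≔ τ 0 ⊕ τ 1) ⨾ τ 0 ≔const 1 ⨾ p ⨾ (ν 3 ≔ τ 0) ⨾ τ 1 ≔const 1 ⨾ (ν 2 ≔ ν 0 ⊕ τ 1) ⨾ q ⨾ (ν 2 ≔ τ 0)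

boundP copyInP copyOutP : Program
boundP = boundOf (powerP 162) (comp (Σ[ 22 ] Σ[ 23 ] var 3) 0)

-- Downwards, as array 1 lies above the input.
copyInP = forP 4 0 ((τ 2 ≔ ν 2 ⊖ ν 4) ⨾ τ 3 ≔const 1 ⨾ (τ 2 ≔ τ 2 ⊖ τ 3) ⨾ τ 1 ≔load τ 2 ⨾ shiftP 2 1 ⨾ store τ 2 ≔ τ 1)
copyOutP = forP 4 1 ((τ 1 ≔ ν 4) ⨾ shiftP 1 28 ⨾ τ 1 ≔load τ 1 ⨾ store ν 4 ≔ τ 1)

outputC wholeC : Cm
outputC = sol [ 21 ]:= ifz (sol ! v̇) (lit 0) (lit 1) ﹔ fail [ 21 ]:= ifz (fail ! lit 0) (lit 1) (lit 0)
wholeC = mainC ﹔ outputC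

solveP : Cm → Program
solveP c = boundP ⨾ copyInP ⨾ compC c ⨾ τ 0 ≔const 31 ⨾ τ 0 ≔load τ 0 ⨾ copyOutP ⨾ (ν 0 ≔ τ 0)

boundTime : ℕ → ℕ → ℕ
boundTime n κ = 4 + (forT κ (forT κ (forT κ 163)) + (3 + (timeTm (suc n) (Σ[ 22 ] Σ[ 23 ] var 3) + 1)))

power : ℕ → ℕ → ℕ → ℕ
power c κ = iter κ (λ _ → iter κ (λ _ → iter κ (λ _ → 2 ^ c *_)))

power-acts : ∀ c κ → Acts κ Γ₀ (powerP c) (forT κ (forT κ (forT κ (suc c)))) (power c κ)
power-acts c κ = for-acts κ Γ₀ 4 1 _ _ _ (s≤s z≤n) refl refl (for-acts κ _ 5 2 _ _ _ (s≤s z≤n) refl refl (for-acts κ _ 6 3 _ _ _ (s≤s z≤n) refl refl (double-acts κ _ c)))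

power-val : ∀ a κ v → power a κ v ≡ 2 ^ (a * (κ * (κ * κ))) * v
power-val a κ v = trans (iter-mul κ _ (((2 ^ a) ^ κ) ^ κ) (iter-mul κ _ ((2 ^ a) ^ κ) (iter-mul κ _ (2 ^ a) (λ _ → refl))) v)
  (cong (_* v) (trans (cong (_^ κ) (trans (cong (_^ κ) (^-*-assoc 2 a κ)) (^-*-assoc 2 (a * κ) κ))) (trans (^-*-assoc 2 (a * κ * κ) κ) (cong (2 ^_) (trans (*-assoc (a * κ) κ κ) (*-assoc a κ (κ * κ)))))))

settle : ∀ {p r m c} {K V : (ℕ → ℕ) → Set} → ∃[ s′ ] Within p ⟨ r , m ⟩ s′ c × K (reg s′) × mem s′ ≡ m × V (reg s′) → ∃[ r′ ] Within p ⟨ r , m ⟩ ⟨ r′ , m ⟩ c × K r′ × V r′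
settle (⟨ r′ , _ ⟩ , w , k , refl , v) = r′ , w , k , v

power-ok : ∀ c κ r m → r (ν 2) ≡ κ → r (τ 0) ≡ 1 →
  ∃[ r′ ] Within (powerP c) ⟨ r , m ⟩ ⟨ r′ , m ⟩ (forT κ (forT κ (forT κ (suc c)))) × Keeps Γ₀ 0 r r′ × r′ (τ 0) ≡ 2 ^ (c * (κ * (κ * κ)))
power-ok c κ r m e e₁ = let (r′ , w , k , v) = settle {powerP c} {r} {m} {_} {Keeps Γ₀ 0 r} {λ r′ → r′ (τ 0) ≡ power c κ (r (τ 0))} (power-acts c κ ⟨ r , m ⟩ e) in
  r′ , w , k , trans v (trans (power-val c κ (r (τ 0))) (trans (cong (2 ^ (c * (κ * (κ * κ))) *_) e₁) (*-identityʳ _)))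

boundOf-ok : ∀ p q a b n k d r m → r 0 ≡ n → r 1 ≡ k →
  (∀ r → r (ν 2) ≡ suc k → r (τ 0) ≡ 1 → ∃[ r′ ] Within p ⟨ r , m ⟩ ⟨ r′ , m ⟩ a × Keeps Γ₀ 0 r r′ × r′ (τ 0) ≡ d) →
  (∀ r → r (ν 2) ≡ suc n → ∃[ r′ ] Within q ⟨ r , m ⟩ ⟨ r′ , m ⟩ b × Keeps Γ₀ 0 r r′ × r′ (τ 0) ≡ suc n * (suc n * r (ν 3))) →
  ∃[ r′ ] Within (boundOf p q) ⟨ r , m ⟩ ⟨ r′ , m ⟩ (4 + (a + (3 + (b + 1)))) × r′ (ν 0) ≡ n × r′ (ν 1) ≡ k × r′ (ν 2) ≡ suc n * (suc n * d)
boundOf-ok p q a b n k d r m r0 r1 P Q = upd r₉ (ν 2) (r₉ (τ 0)) ,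
  seqW (oneW ⇓copy) (seqW (oneW ⇓const) (seqW (oneW ⇓add) (seqW (oneW ⇓const) (seqW (proj₁ (proj₂ pw)) (seqW (oneW ⇓copy) (seqW (oneW ⇓const) (seqW (oneW ⇓add) (seqW (proj₁ (proj₂ cp)) (oneW ⇓copy))))))))) ,
  trans (names k₉ 0 refl) (trans (names k₅ 0 refl) r0) , trans (names k₉ 1 refl) (trans (names k₅ 1 refl) r1) ,
  trans (proj₂ (proj₂ (proj₂ cp))) (cong (λ x → suc n * (suc n * x)) (proj₂ (proj₂ (proj₂ pw))))
  where
  r₁ = upd r (ν 1) (r (τ 0))
  r₂ = upd r₁ (τ 1) 1
  r₃ = upd r₂ (ν 2) (r₂ (τ 0) + r₂ (τ 1))
  r₄ = upd r₃ (τ 0) 1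
  pw = P r₄ (trans (cong (_+ 1) r1) (+-comm k 1)) refl
  r₅ = proj₁ pw
  k₅ = proj₁ (proj₂ (proj₂ pw))
  r₆ = upd r₅ (ν 3) (r₅ (τ 0))
  r₇ = upd r₆ (τ 1) 1
  r₈ = upd r₇ (ν 2) (r₇ (ν 0) + r₇ (τ 1))
  cp = Q r₈ (trans (+-comm (r₅ 0) 1) (cong suc (trans (names k₅ 0 refl) r0)))
  r₉ = proj₁ cp
  k₉ = proj₁ (proj₂ (proj₂ cp))

square-ok : ∀ n m r → r (ν 2) ≡ suc n → ∃[ r′ ] Within (comp (Σ[ 22 ] Σ[ 23 ] var 3) 0) ⟨ r , m ⟩ ⟨ r′ , m ⟩ (timeTm (suc n) (Σ[ 22 ] Σ[ 23 ] var 3)) × Keeps Γ₀ 0 r r′ × r′ (τ 0) ≡ suc n * (suc n * r (ν 3))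
square-ok n m r e = let (r′ , w , v , k) = comp-ok (suc n) (Σ[ 22 ] Σ[ 23 ] var 3) {among (0 ∷ 1 ∷ 2 ∷ 3 ∷ [])} {λ x → r (ν x)} {λ a i → m (addr a i)} 0 r m refl (refl , e) (λ _ _ → refl) (λ _ _ _ _ _ → refl) in
  r′ , w , keeps (λ { 0 _ → names k 0 refl ; 1 _ → names k 1 refl ; 2 _ → names k 2 refl ; (suc (suc (suc _))) () }) (temps k) ,
  trans v (trans (sum-const (suc n) (sum (suc n) (λ _ → r (ν 3)))) (cong (suc n *_) (sum-const (suc n) (r (ν 3)))))

bound-ok : ∀ n k r m → r 0 ≡ n → r 1 ≡ k → ∃[ r′ ] Within boundP ⟨ r , m ⟩ ⟨ r′ , m ⟩ (boundTime n (suc k)) × r′ (ν 0) ≡ n × r′ (ν 1) ≡ k × r′ (ν 2) ≡ bound n k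
bound-ok n k r m r0 r1 = boundOf-ok (powerP 162) (comp (Σ[ 22 ] Σ[ 23 ] var 3) 0) (forT (suc k) (forT (suc k) (forT (suc k) 163))) (timeTm (suc n) (Σ[ 22 ] Σ[ 23 ] var 3)) n k
  (2 ^ (162 * (suc k * (suc k * suc k)))) r m r0 r1 (λ r → power-ok 162 (suc k) r m) (square-ok n m)

addr≥ : ∀ a i → i ≤ addr a i
addr≥ a i = ≤-trans (≤-trans (d i) (≤-trans (d _) (≤-trans (d _) (≤-trans (d _) (d _))))) (m≤m+n _ a)
  where
  d : ∀ i → i ≤ dbl i
  d i = m≤m+n i i

copyIn-ok : ∀ b r m → r (ν 2) ≡ b → ∃[ s′ ] Within copyInP ⟨ r , m ⟩ s′ (forT b 12) × Keeps Γ₀ 0 r (reg s′) × (∀ j → j < b → mem s′ (addr 1 j) ≡ m j)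
copyIn-ok b r m e =
  let (s′ , w , k , (_ , h)) = for-ok b {Γ₀} {0} {0} 4 _ 12 z≤n Inv refl refl body (λ _ _ _ _ _ h → h) ⟨ r , m ⟩ e ((λ _ _ → refl) , λ j l l′ → contradiction l′ (≤⇒≯ l))
  in s′ , w , k , λ j l → h j (≤-trans (≤-reflexive (n∸n≡0 b)) z≤n) l
  where
  Inv : ℕ → State → Set
  Inv i s = (∀ c → c < b ∸ i → mem s c ≡ m c) × (∀ j → b ∸ i ≤ j → j < b → mem s (addr 1 j) ≡ m j)
  pre₂ pre₃ : (ℕ → ℕ) → ℕ → ℕ
  pre₂ r = upd (upd r (τ 2) (r (ν 2) ∸ r (ν 4))) (τ 3) 1
  pre₃ r = upd (pre₂ r) (τ 2) (pre₂ r (τ 2) ∸ pre₂ r (τ 3))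
  pre₄ : (ℕ → ℕ) → (ℕ → ℕ) → ℕ → ℕ
  pre₄ r m = upd (pre₃ r) (τ 1) (m (pre₃ r (τ 2)))
  body : ∀ i s → i < b → reg s (ν 2) ≡ b → reg s (ν 4) ≡ i → Inv i s → ∃[ s′ ] Within _ s s′ 12 × Keeps (upd Γ₀ 4 true) 0 (reg s) (reg s′) × Inv (suc i) s′
  body i ⟨ r , m′ ⟩ i<b e₂ e₄ (low , high) with shift-ok b {upd Γ₀ 4 true} {0} (pre₄ r m′) m′ 2 1 z≤n
  ... | r₅ , w₅ , v₅ , k₅ , t₅ = ⟨ r₅ , upd m′ (r₅ (τ 2)) (r₅ (τ 1)) ⟩ ,
    seqW (oneW ⇓sub) (seqW (oneW ⇓const) (seqW (oneW ⇓sub) (seqW (oneW ⇓load) (seqW w₅ (oneW ⇓store))))) ,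
    keeps-trans (keeps-τ r {2} _ z≤n) (keeps-trans (keeps-τ (upd r (τ 2) (r (ν 2) ∸ r (ν 4))) {3} 1 z≤n) (keeps-trans (keeps-τ (pre₂ r) {2} _ z≤n) (keeps-trans (keeps-τ (pre₃ r) {1} _ z≤n) k₅))) ,
    (λ c c< → trans (upd-≢ m′ (r₅ (τ 1)) (λ z → <⇒≢ (<-≤-trans c< (≤-trans (≤-reflexive (pred≡ refl)) (≤-trans (n≤1+n _) (≤-trans (addr> j) (≤-reflexive (sym a≡)))))) (sym z))) (low c (<-≤-trans c< (∸-monoʳ-≤ b (n≤1+n i))))) ,
    λ j′ l l′ → case j′ ≟ j of λ
      { (yes refl) → trans (cong (λ x → upd m′ x (r₅ (τ 1)) (addr 1 j)) a≡) (trans (upd-≡ m′ (addr 1 j) _) (trans val (low j (≤-reflexive (sym j≡)))))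
      ; (no ne) → trans (cong (λ x → upd m′ x (r₅ (τ 1)) (addr 1 j′)) a≡) (trans (addr-other m′ {1} {1} {j} {j′} _ (s≤s (s≤s z≤n)) (s≤s (s≤s z≤n)) (inj₂ (ne ∘ sym))) (high j′ (≤-trans (≤-reflexive j≡) (≤∧≢⇒< (≤-trans (≤-reflexive (sym (pred≡ refl))) l) (ne ∘ sym))) l′)) }
    where
    j = b ∸ i ∸ 1
    j≡ : b ∸ i ≡ suc j
    j≡ = sym (trans (+-comm 1 j) (m∸n+n≡m (m<n⇒0<n∸m i<b)))
    pred≡ : ∀ {x} → x ≡ i → b ∸ suc x ≡ j
    pred≡ refl = trans (cong (b ∸_) (+-comm 1 i)) (sym (∸-+-assoc b i 1))
    addr> : ∀ j → suc j ≤ addr 1 j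
    addr> j = ≤-trans (s≤s (≤-trans (addr≥ 0 j) (≤-reflexive (+-identityʳ _)))) (≤-reflexive (+-comm 1 _))
    jr : r (ν 2) ∸ r (ν 4) ∸ 1 ≡ j
    jr = cong₂ (λ x y → x ∸ y ∸ 1) e₂ e₄
    a≡ : r₅ (τ 2) ≡ addr 1 j
    a≡ = trans v₅ (cong (addr 1) jr)
    val : r₅ (τ 1) ≡ m′ j
    val = trans (t₅ 1 ≤-refl) (cong m′ jr)

copyOut-ok : ∀ b r m → r (ν 2) ≡ b → ∃[ s′ ] Within copyOutP ⟨ r , m ⟩ s′ (forT b 10) × reg s′ (τ 0) ≡ r (τ 0) × (∀ j → j < b → mem s′ j ≡ m (addr 28 j))
copyOut-ok b r m e =
  let (s′ , w , k , (h , _ , t)) = for-ok b {Γ₀} {0} {1} 4 _ 10 z≤n Inv refl refl body stable ⟨ r , m ⟩ e ((λ _ ()) , (λ _ _ _ → refl) , refl)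
  in s′ , w , t , h
  where
  Inv : ℕ → State → Set
  Inv i s = (∀ v → v < i → mem s v ≡ m (addr 28 v)) × (∀ u → i ≤ u → u < b → mem s (addr 28 u) ≡ m (addr 28 u)) × reg s (τ 0) ≡ r (τ 0)
  stable : ∀ i r r′ m → Keeps Γ₀ 1 r r′ → Inv i ⟨ r , m ⟩ → Inv i ⟨ r′ , m ⟩
  stable i r r′ m k (a , c , t) = a , c , trans (temps k 0 ≤-refl) t
  body : ∀ i s → i < b → reg s (ν 2) ≡ b → reg s (ν 4) ≡ i → Inv i s → ∃[ s′ ] Within _ s s′ 10 × Keeps (upd Γ₀ 4 true) 0 (reg s) (reg s′) × Inv (suc i) s′
  body i ⟨ r , m′ ⟩ i<b e₂ e₄ (low , high , t) with shift-ok b {upd Γ₀ 4 true} {1} (upd r (τ 1) (r (ν 4))) m′ 1 28 ≤-refl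
  ... | r₂ , w₂ , v₂ , k₂ , t₂ = ⟨ r₃ , upd m′ (r₃ (ν 4)) (r₃ (τ 1)) ⟩ , seqW (oneW ⇓copy) (seqW w₂ (seqW (oneW ⇓load) (oneW ⇓store))) , K ,
    (λ v l → trans (cong (λ x → upd m′ x (r₃ (τ 1)) v) a≡) ([ (λ v<i → trans (upd-≢ m′ _ (λ z → <⇒≢ v<i (sym z))) (low v v<i)) , (λ { refl → trans (upd-≡ m′ v _) (trans val (high v ≤-refl i<b)) }) ]′ (m<1+n⇒m<n∨m≡n l))) ,
    (λ u l l′ → trans (cong (λ x → upd m′ x (r₃ (τ 1)) (addr 28 u)) a≡) (trans (upd-≢ m′ _ (<⇒≢ (<-≤-trans l (addr≥ 28 u)))) (high u (<⇒≤ l) l′))) ,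
    trans (temps K′ 0 ≤-refl) t
    where
    r₁ = upd r (τ 1) (r (ν 4))
    r₃ = upd r₂ (τ 1) (m′ (r₂ (τ 1)))
    K′ : Keeps (upd Γ₀ 4 true) 1 r r₃
    K′ = keeps-trans (keeps-τ r {1} _ ≤-refl) (keeps-trans k₂ (keeps-τ r₂ {1} _ ≤-refl))
    K : Keeps (upd Γ₀ 4 true) 0 r r₃
    K = keeps-weaken z≤n K′
    a≡ : r₃ (ν 4) ≡ i
    a≡ = trans (names K′ 4 refl) e₄
    val : r₃ (τ 1) ≡ m′ (addr 28 i)
    val = trans (upd-≡ r₂ (τ 1) _) (cong m′ (trans v₂ (cong (addr 28) e₄)))

envOf : ℕ → ℕ → ℕ → Env
envOf n k b 0 = n
envOf n k b 1 = k
envOf n k b 2 = b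
envOf n k b _ = 0

solveTime : Cm → ℕ → ℕ → ℕ
solveTime c n k = boundTime n (suc k) + (forT b 12 + (timeCm b c + (1 + (1 + (forT b 10 + 1)))))
  where b = bound n k

solve-ok : ∀ c → okCm Γ₀ c ≡ true → ∀ n k r m → r 0 ≡ n → r 1 ≡ k → let b = bound n k in
  ∃[ σ ] (∀ j → j < b → σ INP j ≡ m j) × (∃[ s ] Within (solveP c) ⟨ r , m ⟩ s (solveTime c n k) ×
    (0 < b → reg s 0 ≡ exec b (envOf n k b) c σ fail 0) × (∀ v → v < b → mem s v ≡ exec b (envOf n k b) c σ sol v))
solve-ok c ok n k r m r0 r1 =
  let b = bound n k
      (r₁ , w₁ , n₁ , k₁ , b₁) = bound-ok n k r m r0 r1
      (s₂ , w₂ , K₂ , inp) = copyIn-ok b r₁ m b₁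
      agrees : Agrees Γ₀ (envOf n k b) (reg s₂)
      agrees = λ { 0 _ → trans (names K₂ 0 refl) n₁ ; 1 _ → trans (names K₂ 1 refl) k₁ ; 2 _ → trans (names K₂ 2 refl) b₁ ; (suc (suc (suc _))) () }
      (s₃ , w₃ , K₃ , H₃) = compC-ok b c {Γ₀} {envOf n k b} {λ a i → mem s₂ (addr a i)} (reg s₂) (mem s₂) ok (refl , refl) agrees (λ _ _ _ _ _ → refl)
      r₄ = upd (reg s₃) (τ 0) 31
      r₅ = upd r₄ (τ 0) (mem s₃ (r₄ (τ 0)))
      (s₆ , w₆ , v₆ , o₆) = copyOut-ok b r₅ (mem s₃) (trans (names K₃ 2 refl) (agrees 2 refl))
  in (λ a i → mem s₂ (addr a i)) , inp ,
    ⟨ upd (reg s₆) (ν 0) (reg s₆ (τ 0)) , mem s₆ ⟩ , seqW w₁ (seqW w₂ (seqW w₃ (seqW (oneW ⇓const) (seqW (oneW ⇓load) (seqW w₆ (oneW ⇓copy)))))) ,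
    (λ 0<b → trans v₆ (H₃ 31 (s≤s z≤n) ≤-refl 0 0<b)) , λ v l → trans (o₆ v l) (H₃ 28 (s≤s z≤n) (m≤m+n 29 3) v l)

solve-at : ∀ c → okCm Γ₀ c ≡ true → ∀ n k r m → r 0 ≡ n → r 1 ≡ k → ∀ b → b ≡ bound n k →
  ∃[ σ ] (∀ j → j < b → σ INP j ≡ m j) × (∃[ s ] Within (solveP c) ⟨ r , m ⟩ s (solveTime c n k) ×
    (0 < b → reg s 0 ≡ exec b (envOf n k b) c σ fail 0) × (∀ v → v < b → mem s v ≡ exec b (envOf n k b) c σ sol v))
solve-at c ok n k r m r0 r1 _ refl = solve-ok c ok n k r m r0 r1

forT-mono : ∀ {b b′ c c′} → b ≤ b′ → c ≤ c′ → forT b c ≤ forT b′ c′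
forT-mono l l′ = +-monoʳ-≤ 3 (*-mono-≤ l (+-monoˡ-≤ 4 l′))

κ≤bound : ∀ n k → suc k ≤ bound n k
κ≤bound n k = begin
  κ ≤⟨ ≤-trans (m≤m*n κ (κ * κ)) (m≤n*m (κ * (κ * κ)) 162) ⟩
  162 * (κ * (κ * κ)) ≤⟨ <⇒≤ (n<2^n (162 * (κ * (κ * κ)))) ⟩
  2 ^ (162 * (κ * (κ * κ))) ≤⟨ m≤n*m _ (suc n) ⟩
  suc n * 2 ^ (162 * (κ * (κ * κ))) ≤⟨ m≤n*m _ (suc n) ⟩
  bound n k ∎
  where
  open ≤-Reasoning
  κ = suc k

time-bound : ∀ c → ∃[ e ] (∀ n k → solveTime c n k ≤ (2 + bound n k) ^ e)
time-bound c = proj₁ P , λ n k → ≤-trans (+-monoˡ-≤ _ (+-monoʳ-≤ 4 (+-mono-≤ (forT-mono (κ≤bound n k) (forT-mono (κ≤bound n k) (forT-mono {c = 163} (κ≤bound n k) ≤-refl)))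
  (+-monoʳ-≤ 3 (+-monoˡ-≤ 1 (+-monoʳ-≤ 1 (forT-mono (n≤bound n k) (+-monoˡ-≤ 1 (+-monoʳ-≤ 1 (forT-mono {c = 2} (n≤bound n k) ≤-refl))))))))))
  (proj₂ P (bound n k))
  where
  n≤bound : ∀ n k → suc n ≤ bound n k
  n≤bound n k = ≤-trans (m≤m*n (suc n) (suc n)) (Sizing.sq≤B n k)
  P : Poly (λ b → (4 + (forT b (forT b (forT b 163)) + (3 + ((1 + forT b ((1 + forT b 2) + 1)) + 1)))) + (forT b 12 + (timeCm b c + (1 + (1 + (forT b 10 + 1))))))
  P = poly-+ (poly-+ (poly-const 4) (poly-+ (poly-for (poly-for (poly-for (poly-const 163)))) (poly-+ (poly-const 3) (poly-+ (poly-+ (poly-const 1) (poly-for (poly-+ (poly-+ (poly-const 1) (poly-for (poly-const 2))) (poly-const 1)))) (poly-const 1)))))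
    (poly-+ (poly-for (poly-const 12)) (poly-+ (poly-timeCm c) (poly-+ (poly-const 1) (poly-+ (poly-const 1) (poly-+ (poly-for (poly-const 10)) (poly-const 1))))))

output-ok : ∀ B ρ s → 0 < B → let t = exec B ρ outputC s in
  (s fail 0 ≡ 0 → t fail 0 ≡ 1) × (s fail 0 ≢ 0 → t fail 0 ≡ 0) × (∀ v → v < B → (v ∈ ⟪ B ⟫ (s sol) → t sol v ≡ 1) × (v ∉ ⟪ B ⟫ (s sol) → t sol v ≡ 0))
output-ok B ρ s 0<B = (λ z → cong (λ x → cond x 1 0) (trans (at-< B (s fail) 0<B) z)) ,
  (λ ne → if-nz (λ z → ne (trans (sym (at-< B (s fail) 0<B)) z))) ,
  λ v l → (λ { (_ , ne) → if-nz (λ z → ne (trans (sym (at-< B (s sol) l)) z)) }) , λ nv → if-z (s sol v) (at-< B (s sol) l) (λ ne → nv (l , ne))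
  where
  if-nz : ∀ {x a b : ℕ} → x ≢ 0 → cond x a b ≡ b
  if-nz {zero} h = contradiction refl h
  if-nz {suc x} h = refl
  if-z : ∀ {x} y → x ≡ y → ¬ (y ≢ 0) → cond x 0 1 ≡ 0
  if-z zero refl h = refl
  if-z (suc y) refl h = contradiction (λ ()) h

contents-++ˡ : ∀ xs ys {i} → i < length xs → contents (xs ++ ys) i ≡ contents xs i
contents-++ˡ (x ∷ xs) ys {zero} l = refl
contents-++ˡ (x ∷ xs) ys {suc i} (s≤s l) = contents-++ˡ xs ys l

contents-++ʳ : ∀ xs ys i → contents (xs ++ ys) (length xs + i) ≡ contents ys i
contents-++ʳ [] ys i = refl
contents-++ʳ (x ∷ xs) ys i = contents-++ʳ xs ys i

contents-vec : ∀ {n} (T : Vec Bool n) v → contents (map bit (toList T)) (toℕ v) ≡ bit (lookup T v)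
contents-vec (x ∷ᵛ T) fzero = refl
contents-vec (x ∷ᵛ T) (fsuc v) = contents-vec T v

contents-tab : ∀ {n} (f : Fin n → Bool) v → contents (map bit (tabulate f)) (toℕ v) ≡ bit (f v)
contents-tab f fzero = refl
contents-tab f (fsuc v) = contents-tab (f ∘ fsuc) v

contents-rows : ∀ {m n} (D : Fin m → Fin n → Bool) {l} (g : Fin l → Fin m) u v →
  contents (map bit (concatMap (λ u → tabulate (D u)) (tabulate g))) (toℕ u * n + toℕ v) ≡ bit (D (g u) v)
contents-rows {n = n} D {suc l} g u v = trans (cong (λ xs → contents xs (toℕ u * n + toℕ v)) (map-++ bit (tabulate (D (g fzero))) _)) (row u)
  where
  first₀ = map bit (tabulate (D (g fzero)))
  others = map bit (concatMap (λ u → tabulate (D u)) (tabulate (g ∘ fsuc)))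
  len : length first₀ ≡ n
  len = trans (length-map bit (tabulate (D (g fzero)))) (length-tabulate (D (g fzero)))
  row : ∀ u → contents (first₀ ++ others) (toℕ u * n + toℕ v) ≡ bit (D (g u) v)
  row fzero = trans (contents-++ˡ first₀ others (subst (toℕ v <_) (sym len) (toℕ<n v))) (contents-tab (D (g fzero)) v)
  row (fsuc u) = trans (cong (contents (first₀ ++ others)) (trans (+-assoc n (toℕ u * n) (toℕ v)) (cong (_+ (toℕ u * n + toℕ v)) (sym len))))
    (trans (contents-++ʳ first₀ others (toℕ u * n + toℕ v)) (contents-rows D (g ∘ fsuc) u v))

module Input (I : Instance) where
  n = order I
  m = mem (input I)

  adj : List Bool
  adj = concatMap (λ u → tabulate (digraph I u)) (allFin n)

  input≡ : ∀ i → m i ≡ contents (map bit (toList (terminals I)) ++ map bit adj) i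
  input≡ i = cong (λ xs → contents xs i) (map-++ bit (toList (terminals I)) adj)

  len : length (map bit (toList (terminals I))) ≡ n
  len = trans (length-map bit (toList (terminals I))) (length-toList (terminals I))

  terminal-cell : ∀ v → m (toℕ v) ≡ bit (lookup (terminals I) v)
  terminal-cell v = trans (input≡ (toℕ v)) (trans (contents-++ˡ (map bit (toList (terminals I))) (map bit adj) (subst (toℕ v <_) (sym len) (toℕ<n v))) (contents-vec (terminals I) v))

  arc-cell : ∀ u v → m (n + (toℕ u * n + toℕ v)) ≡ bit (digraph I u v)
  arc-cell u v = trans (input≡ _) (trans (cong (λ z → contents (map bit (toList (terminals I)) ++ map bit adj) (z + (toℕ u * n + toℕ v))) (sym len))
    (trans (contents-++ʳ (map bit (toList (terminals I))) (map bit adj) (toℕ u * n + toℕ v)) (contents-rows (digraph I) id u v)))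

bit-true : ∀ {b} → bit b ≢ 0 → b ≡ true
bit-true {true} h = refl
bit-true {false} h = contradiction refl h

true-bit : ∀ {b} → b ≡ true → bit b ≢ 0
true-bit refl ()

#-shift : ∀ b {P : ℕ → Set} (P? : ∀ i → Dec (P i)) → # (suc b) P? ≡ ind (P? 0) + # b (λ i → P? (suc i))
#-shift zero P? = +-comm 0 (ind (P? 0))
#-shift (suc b) P? = trans (cong (_+ ind (P? (suc b))) (#-shift b P?)) (+-assoc (ind (P? 0)) _ _)

charac : ∀ {n} → Subset n → ℕ → ℕ
charac X = contents (map bit (toList X))

charac-# : ∀ {n} (X : Subset n) b → # b (λ v → ¬? (charac X v ≟ 0)) ≤ ∣ X ∣
charac-# []ᵛ b = ≤-reflexive (#-0 b (λ v → ¬? (charac []ᵛ v ≟ 0)) (λ _ _ h → h refl))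
charac-# (x ∷ᵛ X) zero = z≤n
charac-# (true ∷ᵛ X) (suc b) = ≤-trans (≤-reflexive (#-shift b (λ v → ¬? (charac (true ∷ᵛ X) v ≟ 0)))) (s≤s (charac-# X b))
charac-# (false ∷ᵛ X) (suc b) = ≤-trans (≤-reflexive (#-shift b (λ v → ¬? (charac (false ∷ᵛ X) v ≟ 0)))) (charac-# X b)

tabulate-# : ∀ n {P : ℕ → Set} (P? : ∀ i → Dec (P i)) → ∣ tabulateᵛ {n = n} (λ v → does (P? (toℕ v))) ∣ ≡ # n P?
tabulate-# zero P? = refl
tabulate-# (suc n) P? with P? 0 | #-shift n P?
... | yes _ | e = trans (cong suc (tabulate-# n (λ i → P? (suc i)))) (sym e)
... | no _ | e = trans (tabulate-# n (λ i → P? (suc i))) (sym e)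

charac-∈ : ∀ {n} (X : Subset n) v → v ∈ˢ X → charac X (toℕ v) ≢ 0
charac-∈ X v h z = true-bit ([]=⇒lookup h) (trans (sym (contents-vec X v)) z)

─-∉ : ∀ {n} (p q : Subset n) {x} → x ∈ˢ p ─ q → x ∉ˢ q
─-∉ (_ ∷ᵛ p) (false ∷ᵛ q) hereᵛ ()
─-∉ (_ ∷ᵛ p) (false ∷ᵛ q) (thereᵛ h) (thereᵛ h′) = ─-∉ p q h h′
─-∉ (_ ∷ᵛ p) (true ∷ᵛ q) (thereᵛ h) (thereᵛ h′) = ─-∉ p q h h′

module Glue (I : Instance) (b : ℕ) (b≡ : b ≡ bound (order I) (budget I)) (σ : Mem) (σ-in : ∀ j → j < b → σ INP j ≡ mem (input I) j) where
  open Input I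
  k : ℕ
  k = budget I
  ρ : Env
  ρ = envOf n k b
  0<b : 0 < b
  0<b = subst (0 <_) (sym b≡) (Sizing.0<B n k)
  nn≤b : n * n ≤ b
  nn≤b = subst (n * n ≤_) (sym b≡) (Sizing.nn≤B n k)

  E : ℕ → ℕ → Set
  E = Closure.Edge b n nn≤b (σ INP)

  E? : ∀ u v → Dec (E u v)
  E? = ZRun.Edge? ρ 0<b nn≤b (σ INP)

  Terms : DSet
  Terms = StageRun.Tlt ρ 0<b nn≤b n (σ INP)

  SolvesBy : (X : ℕ → ℕ) → Set
  SolvesBy X = # b (dec (⟪ b ⟫ X)) ≤ k × Graph.Good b E E? Terms (Outside n (⟪ b ⟫ X))

  n<b : ∀ {v} → v < n → v < b
  n<b = Closure.n≤B b n nn≤b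

  cell : ∀ (u v : Fin n) → σ INP (n + Guided.mul b n (toℕ u) + toℕ v) ≡ bit (digraph I u v) × n + Guided.mul b n (toℕ u) + toℕ v < b
  cell u v = trans (cong (σ INP) idx) (trans (σ-in _ idx<b) (arc-cell u v)) , subst (_< b) (sym idx) idx<b
    where
    idx : n + Guided.mul b n (toℕ u) + toℕ v ≡ n + (toℕ u * n + toℕ v)
    idx = trans (cong (λ z → n + z + toℕ v) (Closure.mul≡ b n nn≤b (toℕ<n u))) (+-assoc n (toℕ u * n) (toℕ v))
    idx<b : n + (toℕ u * n + toℕ v) < b
    idx<b = <-≤-trans (+-monoʳ-< n (<-≤-trans (+-monoʳ-< (toℕ u * n) (toℕ<n v)) (≤-trans (≤-reflexive (+-comm (toℕ u * n) n)) (*-monoˡ-≤ n (toℕ<n u)))))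
      (≤-trans (≤-trans (m≤n+m (n + n * n) (suc n)) (≤-reflexive (eq n))) (subst (suc n * suc n ≤_) (sym b≡) (Sizing.sq≤B n k)))
      where
      eq = solve 1 (λ n → con 1 :+ n :+ (n :+ n :* n) := (con 1 :+ n) :* (con 1 :+ n)) refl

  edge→ : ∀ u v → E (toℕ u) (toℕ v) → digraph I u v ≡ true
  edge→ u v (_ , _ , _ , ne) = bit-true (λ z → ne (trans (proj₁ (cell u v)) z))

  edge← : ∀ u v → digraph I u v ≡ true → E (toℕ u) (toℕ v)
  edge← u v e = toℕ<n u , toℕ<n v , proj₂ (cell u v) , λ z → true-bit e (trans (sym (proj₁ (cell u v))) z)

  terminal→ : ∀ t → t ∈ˢ terminals I → toℕ t ∈ Terms
  terminal→ t h = (n<b (toℕ<n t) , λ z → true-bit ([]=⇒lookup h) (trans (sym (terminal-cell t)) (trans (sym (σ-in (toℕ t) (n<b (toℕ<n t)))) z))) , toℕ<n t , toℕ<n t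

  terminal← : ∀ t → toℕ t ∈ Terms → t ∈ˢ terminals I
  terminal← t ((_ , ne) , _) = lookup⇒[]= t (terminals I) (bit-true (λ z → ne (trans (σ-in (toℕ t) (n<b (toℕ<n t))) (trans (terminal-cell t) z))))

  open Graph b E E? Terms

  star→pth : ∀ {X : Subset n} {A : ℕ → Set} → (∀ v → v ∉ˢ X → A (toℕ v)) → ∀ {u v} → u ∉ˢ X → Star (ArcAvoiding (digraph I) X) u v → Pth A (toℕ u) (toℕ v)
  star→pth h u∉ ε = here (h _ u∉)
  star→pth h u∉ (_◅_ {j = y} (e , _ , y∉) p) = step (h _ u∉) (edge← _ y e) (star→pth h y∉ p)

  pth→star : ∀ {X : Subset n} {A : ℕ → Set} → (∀ v → A (toℕ v) → v ∉ˢ X) → (∀ x → A x → x < n) → ∀ {a c} → Pth A a c → ∀ u v → toℕ u ≡ a → toℕ v ≡ c → Star (ArcAvoiding (digraph I) X) u v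
  pth→star h A<n (here _) u v refl e = subst (Star _ u) (sym (toℕ-injective e)) ε
  pth→star {X} {A} h A<n (step {y = y} s e p) u v refl e′ =
    (edge→ u y′ (subst (E (toℕ u)) (sym y≡) e) , h u s , h y′ (subst A (sym y≡) (source∈ p))) ◅ pth→star h A<n p y′ v y≡ e′
    where
    y′ = fromℕ< (A<n y (source∈ p))
    y≡ = toℕ-fromℕ< (A<n y (source∈ p))

  module _ (S : ℕ → ℕ) where

    chosen : Subset n
    chosen = tabulateᵛ (λ v → does (dec (⟪ b ⟫ S) (toℕ v)))

    chosen← : ∀ v → toℕ v ∈ ⟪ b ⟫ S → v ∈ˢ chosen
    chosen← v h = lookup⇒[]= v chosen (trans (lookup∘tabulate (λ v → does (dec (⟪ b ⟫ S) (toℕ v))) v) (does-true (dec (⟪ b ⟫ S) (toℕ v)) h))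
      where
      does-true : ∀ {P : Set} (d : Dec P) → P → does d ≡ true
      does-true (yes _) _ = refl
      does-true (no np) p = contradiction p np

    solution : SolvesBy S → IsSolution I chosen
    solution (c , good) = ≤-trans (≤-reflexive (tabulate-# n (dec (⟪ b ⟫ S)))) (≤-trans (#-inj n b (dec (⟪ b ⟫ S)) (dec (⟪ b ⟫ S)) id (λ i l p → n<b l , p) (λ _ _ _ _ _ _ e → e)) c) ,
      λ t t′ t∈ t′∈ ne (p , q) → ne (toℕ-injective (good (toℕ t) (toℕ t′) (terminal→ t (p─q⊆p (terminals I) chosen t∈)) (terminal→ t′ (p─q⊆p (terminals I) chosen t′∈))
        (star→pth outside (─-∉ (terminals I) chosen t∈) p) (star→pth outside (─-∉ (terminals I) chosen t′∈) q)))
      where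
      outside : ∀ v → v ∉ˢ chosen → toℕ v < n × toℕ v ∉ ⟪ b ⟫ S
      outside v nv = toℕ<n v , nv ∘ chosen← v

    chosen-bit : ∀ v x → (toℕ v ∈ ⟪ b ⟫ S → x ≡ 1) × (toℕ v ∉ ⟪ b ⟫ S → x ≡ 0) → x ≡ bit (lookup chosen v)
    chosen-bit v x h = trans (value (dec (⟪ b ⟫ S) (toℕ v)) h) (cong bit (sym (lookup∘tabulate (λ v → does (dec (⟪ b ⟫ S) (toℕ v))) v)))
      where
      value : ∀ {P : Set} (d : Dec P) → (P → x ≡ 1) × (¬ P → x ≡ 0) → x ≡ bit (does d)
      value (yes p) h = proj₁ h p
      value (no np) h = proj₂ h np

  solvable : ∃ (IsSolution I) → StageRun.Solvable ρ 0<b nn≤b (σ INP)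
  solvable (X , X≤ , sep) = D , (λ _ → proj₁) , ≤-trans (#-mono b (dec D) (λ v → ¬? (charac X v ≟ 0)) (λ _ _ → proj₂)) (≤-trans (charac-# X b) X≤) , good
    where
    D : DSet
    El D v = v < n × charac X v ≢ 0
    dec D v = (v <? n) ×-dec ¬? (charac X v ≟ 0)
    outside : ∀ v → toℕ v < n × toℕ v ∉ D → v ∉ˢ X
    outside v (_ , nd) h = nd (toℕ<n v , charac-∈ X v h)
    good : Good (Outside n D)
    good t t′ tT t′T p q = case t ≟ t′ of λ { (yes e) → e ; (no ne) → contradiction (pth→star {X} {Outside n D} outside (λ _ → proj₁) p u u′ u≡ u′≡ , pth→star {X} {Outside n D} outside (λ _ → proj₁) q u′ u u′≡ u≡)
        (sep u u′ (x∈p∧x∉q⇒x∈p─q (terminal← u (subst (_∈ Terms) (sym u≡) tT)) (outside u (subst (Outside n D) (sym u≡) (source∈ p))))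
          (x∈p∧x∉q⇒x∈p─q (terminal← u′ (subst (_∈ Terms) (sym u′≡) t′T)) (outside u′ (subst (Outside n D) (sym u′≡) (source∈ q))))
          (λ e → ne (trans (sym u≡) (trans (cong toℕ e) u′≡)))) }
      where
      u = fromℕ< (proj₁ (source∈ p))
      u′ = fromℕ< (proj₁ (source∈ q))
      u≡ = toℕ-fromℕ< (proj₁ (source∈ p))
      u′≡ = toℕ-fromℕ< (proj₁ (source∈ q))

  record Outcome (c : Cm) : Set where
    t = exec b ρ c σ
    field
      solved : t fail 0 ≡ 1 × (∃[ X ] IsSolution I X × (∀ v → t sol (toℕ v) ≡ bit (lookup X v))) ⊎ t fail 0 ≡ 0 × ¬ ∃ (IsSolution I)

  outcome : ∀ cs → cs ≡ stageC → ∀ cm → cm ≡ ((fail [ 21 ]:= lit 0 ﹔ sol [ 21 ]:= lit 0) ﹔ for 54 cs) → ∀ c → c ≡ (cm ﹔ outputC) → Outcome c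
  outcome cs cs≡ cm cm≡ _ refl = record { solved = cases (t fail 0 ≟ 0) }
    where
    t = exec b ρ cm σ
    main = StageRun.main-ok ρ 0<b nn≤b cs cs≡ cm cm≡ σ
    out = output-ok b ρ t 0<b
    cases : Dec (t fail 0 ≡ 0) → _
    cases (yes z) = inj₁ (proj₁ out z , chosen (t sol) , solution (t sol) (proj₁ main z) , λ v → chosen-bit (t sol) v _ (proj₂ (proj₂ out) (toℕ v) (n<b (toℕ<n v))))
    cases (no ne) = inj₂ (proj₁ (proj₂ out) ne , λ so → ne (proj₂ main (fits n k ρ 0<b nn≤b refl refl b≡) (solvable so)))

exponent : ℕ → ℕ → ℕ
exponent e k = (4 + 162 * (suc k * (suc k * suc k))) * e

degree : ℕ → ℕ → ℕ
degree e zero = 0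
degree e (suc n) = 2 * e

bound≤ : ∀ e n k → (2 + bound n k) ^ e ≤ 2 ^ exponent e k * n ^ degree e n
bound≤ e zero k = begin
  (2 + bound 0 k) ^ e ≤⟨ ^-monoˡ-≤ e step₁ ⟩
  (2 ^ (4 + a)) ^ e ≡⟨ ^-*-assoc 2 (4 + a) e ⟩
  2 ^ exponent e k ≡⟨ sym (*-identityʳ _) ⟩
  2 ^ exponent e k * 0 ^ 0 ∎
  where
  open ≤-Reasoning
  a = 162 * (suc k * (suc k * suc k))
  step₁ : 2 + bound 0 k ≤ 2 ^ (4 + a)
  step₁ = begin
    2 + (1 * (1 * 2 ^ a)) ≡⟨ cong (2 +_) (trans (*-identityˡ _) (*-identityˡ _)) ⟩
    2 + 2 ^ a ≤⟨ +-monoˡ-≤ (2 ^ a) (*-monoʳ-≤ 2 (Sizing.2^>0 0 k a)) ⟩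
    2 * 2 ^ a + 2 ^ a ≤⟨ m≤m+n _ (13 * 2 ^ a) ⟩
    2 * 2 ^ a + 2 ^ a + 13 * 2 ^ a ≡⟨ eq (2 ^ a) ⟩
    16 * 2 ^ a ≡⟨ sym (^-distribˡ-+-* 2 4 a) ⟩
    2 ^ (4 + a) ∎
    where
    eq = solve 1 (λ x → con 2 :* x :+ x :+ con 13 :* x := con 16 :* x) refl
bound≤ e n@(suc n′) k = begin
  (2 + bound n k) ^ e ≤⟨ ^-monoˡ-≤ e step₁ ⟩
  (2 ^ (4 + a) * n ^ 2) ^ e ≡⟨ pow-* e (2 ^ (4 + a)) (n ^ 2) ⟩
  (2 ^ (4 + a)) ^ e * (n ^ 2) ^ e ≡⟨ cong₂ _*_ (^-*-assoc 2 (4 + a) e) (^-*-assoc n 2 e) ⟩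
  2 ^ exponent e k * n ^ (2 * e) ∎
  where
  open ≤-Reasoning
  a = 162 * (suc k * (suc k * suc k))
  x = 2 ^ a
  step₁ : 2 + bound n k ≤ 2 ^ (4 + a) * n ^ 2
  step₁ = begin
    2 + suc n * (suc n * x) ≤⟨ +-mono-≤ (*-monoʳ-≤ 2 (*-mono-≤ {1} {x} {1} {n * n} (Sizing.2^>0 0 k a) (s≤s z≤n))) (*-mono-≤ 1+n≤ (*-monoˡ-≤ x 1+n≤)) ⟩
    2 * (x * (n * n)) + (n + n) * ((n + n) * x) ≤⟨ m≤m+n _ (10 * (x * (n * n))) ⟩
    2 * (x * (n * n)) + (n + n) * ((n + n) * x) + 10 * (x * (n * n)) ≡⟨ eq x n ⟩
    16 * x * (n * n) ≡⟨ cong₂ _*_ (sym (^-distribˡ-+-* 2 4 a)) (cong (n *_) (sym (*-identityʳ n))) ⟩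
    2 ^ (4 + a) * n ^ 2 ∎
    where
    1+n≤ : suc n ≤ n + n
    1+n≤ = +-monoˡ-≤ n (s≤s z≤n)
    eq = solve 2 (λ x n → con 2 :* (x :* (n :* n)) :+ (n :+ n) :* ((n :+ n) :* x) :+ con 10 :* (x :* (n :* n)) := con 16 :* x :* (n :* n)) refl

exponent-O : ∀ e → exponent e ∈O (λ k → k ^ 3)
exponent-O e = (4 + 162 * 8) * e , 1 , λ { k@(suc k′) _ → begin
  (4 + 162 * (suc k * (suc k * suc k))) * e ≤⟨ *-monoˡ-≤ e (+-mono-≤ (*-monoʳ-≤ 4 (cube≥1 k′)) (*-monoʳ-≤ 162 (*-mono-≤ (1+k≤ k′) (*-mono-≤ (1+k≤ k′) (1+k≤ k′))))) ⟩
  (4 * (k * (k * k)) + 162 * ((k + k) * ((k + k) * (k + k)))) * e ≡⟨ eq k e ⟩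
  (4 + 162 * 8) * e * (k * (k * (k * 1))) ∎ }
  where
  open ≤-Reasoning
  cube≥1 : ∀ k′ → 1 ≤ suc k′ * (suc k′ * suc k′)
  cube≥1 k′ = s≤s z≤n
  1+k≤ : ∀ k′ → suc (suc k′) ≤ suc k′ + suc k′
  1+k≤ k′ = +-monoˡ-≤ (suc k′) (s≤s z≤n)
  eq = solve 2 (λ k e → (con 4 :* (k :* (k :* k)) :+ con 162 :* ((k :+ k) :* ((k :+ k) :* (k :+ k)))) :* e := (con 4 :+ con 162 :* con 8) :* e :* (k :* (k :* (k :* con 1)))) refl

degree-O : ∀ e → degree e ∈O (λ _ → 1)
degree-O e = 2 * e , 0 , λ { zero _ → z≤n ; (suc n) _ → ≤-reflexive (sym (*-identityʳ (2 * e))) }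

solves-at : ∀ c → okCm Γ₀ c ≡ true → (∀ I b b≡ σ inp → Glue.Outcome I b b≡ σ inp c) → ∀ I b → b ≡ bound (order I) (budget I) →
  ∃[ s ] Within (solveP c) (input I) s (solveTime c (order I) (budget I)) × CorrectOutput I s
solves-at c ok out I b b≡ =
  let (σ , inp , s , ev , out₀ , outs) = solve-at c ok (order I) (budget I) (reg (input I)) (mem (input I)) refl refl b b≡
      0<b = Glue.0<b I b b≡ σ inp
  in s , ev ,
    [ (λ { (f , X , is , h) → inj₁ (trans (out₀ 0<b) f , X , is , λ v → trans (outs (toℕ v) (Glue.n<b I b b≡ σ inp (toℕ<n v))) (h v)) }) ,
      (λ { (f , none) → inj₂ (trans (out₀ 0<b) f , none) }) ]′ (Glue.Outcome.solved (out I b b≡ σ inp))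

solves : ∀ c → okCm Γ₀ c ≡ true → (∀ I b b≡ σ inp → Glue.Outcome I b b≡ σ inp c) → ∀ e → (∀ n k → solveTime c n k ≤ (2 + bound n k) ^ e) →
  SolvesWithin (solveP c) (λ I → 2 ^ exponent e (budget I) * order I ^ degree e (order I))
solves c ok out e time I = let (s , (t , ev , le) , correct) = solves-at c ok out I (bound (order I) (budget I)) refl in
  s , t , ev , ≤-trans le (≤-trans (time (order I) (budget I)) (bound≤ e (order I) (budget I))) , correct

solver : ∀ c → okCm Γ₀ c ≡ true → (∀ I b b≡ σ inp → Glue.Outcome I b b≡ σ inp c) →
  ∃[ p ] ∃[ f ] ∃[ g ] (f ∈O (λ k → k ^ 3)) × (g ∈O (λ n → 1)) × SolvesWithin p (λ I → 2 ^ f (budget I) * order I ^ g (order I))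
solver c ok out = let (e , h) = time-bound c in solveP c , exponent e , degree e , exponent-O e , degree-O e , solves c ok out e h

whole-ok : okCm Γ₀ wholeC ≡ true
whole-ok = refl

whole-outcome : ∀ I b b≡ σ inp → Glue.Outcome I b b≡ σ inp wholeC
whole-outcome I b b≡ σ inp = Glue.outcome I b b≡ σ inp stageC refl mainC refl wholeC refl

theorem14 :
  ∃[ p ] ∃[ f ] ∃[ g ]
    (f ∈O (λ k → k ^ 3)) × (g ∈O (λ n → 1)) ×
    SolvesWithin p (λ I → 2 ^ f (budget I) * order I ^ g (order I))
theorem14 = solver wholeC whole-ok whole-outcome
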